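{- Let $P\in\mathbb{Z}[X]$ be a nonconstant irreducible polynomial of degree $d=\deg P$, and let $\delta=\gcd_{k\ge 0}P(k)$ be the greatest common divisor of all the integers $P(k)$, $k\in\mathbb{Z}_{\ge 0}$. Let $G$ be the Galois group of $P$ over $\mathbb{Q}$, viewed as a subgroup of $S_d$ via its action on the $d$ roots of $P$, and let $q$ be the proportion of elements of $G$ that fix a given root of $P$. Then there exists a constant $c>0$ such that for every $\varepsilon>0$ there exists $n(\varepsilon)$ such that for all integers $n\ge 2$ with $n>n(\varepsilon)$ and $\gcd(n,\delta)=1$, at least $$c\,n\,(\log\log n)^{ -qd-\varepsilon}$$ of the numbers $P(0),P(1),P(2),\dots,P(n-1)$ are relatively prime to $n$. That is, $\varphi_P(n)\ge c\,n\,(\log\log n)^{ -qd-\varepsilon}$, where $\varphi_P(n)=\#\{k\in\{0,1,\dots,n-1\}:\gcd(P(k),n)=1\}$. The constant $c$ does not depend on $\varepsilon$ or $n$.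
   Context: The Galois group of $P$ over $\mathbb{Q}$ is $\mathrm{Gal}(K/\mathbb{Q})$, where $K$ is the splitting field of $P$ over $\mathbb{Q}$. The proportion $q$ is $|\{\sigma\in G:\sigma(y)=y\}|/|G|$ for a root $y$ of $P$; since $P$ is irreducible, $G$ acts transitively on the roots, so this value does not depend on the choice of $y$. The numbers among $P(0),\dots,P(n-1)$ coprime to $n$ are counted by index, i.e. with repetition if the same value occurs for several $k$. Here $\log$ is the natural logarithm. -}

module Defs where

open import Level using (Level; 0ℓ; _⊔_) renaming (suc to lsuc)
open import Algebra.Bundles using (RawRing; RawSemiring; CommutativeRing)
open import Algebra.Apartness.Bundles using (HeytingField; HeytingCommutativeRing)
import Algebra.Definitions.RawSemiring as RawSemiringDefinitions
open import Algebra.Morphism.Structures using (module RingMorphisms)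
import Algebra.Morphism.Construct.Identity as Identity
open import Data.Fin.Base using (Fin)
open import Data.Integer.Base as ℤ using (ℤ; +_; -[1+_])
import Data.Integer.Divisibility as ℤ
import Data.Integer.Properties as ℤₚ
open import Data.List.Base using (List; []; _∷_; foldr; map; length; filter; upTo)
open import Data.Nat.Base as ℕ using (ℕ; zero; suc)
open import Data.List.Membership.Propositional using (_∈_)
import Data.Nat.Divisibility as ℕ using (_∣_)
import Data.Nat.GCD as ℕ using (gcd)
import Data.Nat.Properties as ℕₚ
open import Data.Product.Base using (Σ-syntax; ∃-syntax; _×_; _,_; proj₁)
open import Data.Rational.Base
  using (ℚ; 0ℚ; 1ℚ; ½; ∣_∣; _/_; 1/_; mkℚ; *≤*; *<*; toℚᵘ)
import Data.Rational.Base as Rat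
import Data.Rational.Properties as Ratₚ
open import Data.Rational.Solver using (module +-*-Solver)
import Data.Rational.Unnormalised.Base as ℚᵘ
import Data.Rational.Unnormalised.Properties as ℚᵘₚ
open import Data.Sum.Base using (inj₁; inj₂)
open import Function.Bundles using (Inverse)
open import Relation.Binary.Bundles using (Setoid)
import Relation.Binary.Construct.On as On
open import Relation.Binary.PropositionalEquality
  using (_≡_; refl; sym; trans; cong; cong₂; subst; subst₂; module ≡-Reasoning)
import Relation.Binary.PropositionalEquality as ≡
open import Relation.Nullary using (¬_; yes; no)
open import Relation.Nullary.Negation using (contradiction)

------------------------------------------------------------------------
-- Cauchy sequences of rationals

module CauchySequences where
  open Rat
  open Ratₚ
  open +-*-Solver
  open ℕₚ using () renaming (m⊔n≤o⇒m≤o to ⊔ˡ; m⊔n≤o⇒n≤o to ⊔ʳ)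

  +-pos : ∀ {p q} → 0ℚ < p → 0ℚ < q → 0ℚ < p + q
  +-pos 0<p 0<q = +-mono-< 0<p 0<q

  *-pos : ∀ {p q} → 0ℚ < p → 0ℚ < q → 0ℚ < p * q
  *-pos {p} {q} 0<p 0<q =
    subst (_< p * q) (*-zeroʳ p) (*-monoʳ-<-pos p {{positive 0<p}} 0<q)

  *-nonNeg : ∀ {p q} → 0ℚ ≤ p → 0ℚ ≤ q → 0ℚ ≤ p * q
  *-nonNeg {p} {q} 0≤p 0≤q =
    subst (_≤ p * q) (*-zeroʳ p) (*-monoˡ-≤-nonNeg p {{nonNegative 0≤p}} 0≤q)

  *-mono : ∀ {p q r s} → 0ℚ ≤ p → 0ℚ ≤ s → p ≤ q → r ≤ s → p * r ≤ q * s
  *-mono {p} {q} {r} {s} 0≤p 0≤s p≤q r≤s = ≤-trans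
    (*-monoˡ-≤-nonNeg p {{nonNegative 0≤p}} r≤s)
    (*-monoʳ-≤-nonNeg s {{nonNegative 0≤s}} p≤q)

  ≤-from-diff : ∀ {p q} r → q ≡ p + r → 0ℚ ≤ r → p ≤ q
  ≤-from-diff {p} {q} r eq 0≤r =
    subst₂ _≤_ (+-identityʳ p) (sym eq) (+-monoʳ-≤ p 0≤r)

  triangle : ∀ p q r → ∣ p - r ∣ ≤ ∣ p - q ∣ + ∣ q - r ∣
  triangle p q r = subst (λ t → ∣ t ∣ ≤ ∣ p - q ∣ + ∣ q - r ∣)
    (solve 3 (λ p q r → (p :- q) :+ (q :- r) := p :- r) refl p q r)
    (∣p+q∣≤∣p∣+∣q∣ (p - q) (q - r))

  0<½ : 0ℚ < ½
  0<½ = *<* (ℤ.+<+ (ℕ.s≤s ℕ.z≤n))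

  0<1 : 0ℚ < 1ℚ
  0<1 = *<* (ℤ.+<+ (ℕ.s≤s ℕ.z≤n))

  0≤1 : 0ℚ ≤ 1ℚ
  0≤1 = <⇒≤ 0<1

  half-pos : ∀ {η} → 0ℚ < η → 0ℚ < ½ * η
  half-pos = *-pos 0<½

  halves : ∀ η → ½ * η + ½ * η ≡ η
  halves η = trans (sym (*-distribʳ-+ η ½ ½)) (*-identityˡ η)

  divide : ∀ {p} q → 0ℚ < p → ∃[ r ] p * r ≡ q
  divide {p} q 0<p = 1/ p * q , (begin
    p * (1/ p * q)  ≡⟨ *-assoc p (1/ p) q ⟨
    p * 1/ p * q    ≡⟨ cong (_* q) (*-inverseʳ p) ⟩
    1ℚ * q          ≡⟨ *-identityˡ q ⟩
    q               ∎)
    where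
    open ≡-Reasoning
    instance _ = >-nonZero 0<p

  cancel-pos : ∀ {p} q → 0ℚ < p → 0ℚ < p * q → 0ℚ < q
  cancel-pos {p} q 0<p 0<pq = *-cancelˡ-<-nonNeg p {{nonNegative (<⇒≤ 0<p)}}
    (subst (_< p * q) (sym (*-zeroʳ p)) 0<pq)

  nat : ℕ → ℚ
  nat n = + n / 1

  nat-suc : ∀ n → nat (suc n) ≡ 1ℚ + nat n
  nat-suc n = toℚᵘ-injective (begin
    toℚᵘ (nat (suc n))               ≈⟨ toℚᵘ-fromℚᵘ (ℚᵘ.mkℚᵘ (+ suc n) 0) ⟩
    ℚᵘ.mkℚᵘ (+ suc n) 0              ≈⟨ ℚᵘ.*≡* (cong (λ m → (+ 1 ℤ.+ m) ℤ.* + 1) (sym (ℤₚ.*-identityʳ (+ n)))) ⟩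
    ℚᵘ.1ℚᵘ ℚᵘ.+ ℚᵘ.mkℚᵘ (+ n) 0      ≈⟨ ℚᵘₚ.+-congʳ ℚᵘ.1ℚᵘ (toℚᵘ-fromℚᵘ (ℚᵘ.mkℚᵘ (+ n) 0)) ⟨
    ℚᵘ.1ℚᵘ ℚᵘ.+ toℚᵘ (nat n)         ≈⟨ toℚᵘ-homo-+ 1ℚ (nat n) ⟨
    toℚᵘ (1ℚ + nat n)                ∎)
    where open ℚᵘₚ.≃-Reasoning

  nat-inverse : ∀ k → nat (suc k) * (+ 1 / suc k) ≡ 1ℚ
  nat-inverse k = toℚᵘ-injective (begin
    toℚᵘ (nat (suc k) * (+ 1 / suc k))
      ≈⟨ toℚᵘ-homo-* (nat (suc k)) (+ 1 / suc k) ⟩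
    toℚᵘ (nat (suc k)) ℚᵘ.* toℚᵘ (+ 1 / suc k)
      ≈⟨ ℚᵘₚ.*-cong (toℚᵘ-fromℚᵘ (ℚᵘ.mkℚᵘ (+ suc k) 0)) (toℚᵘ-fromℚᵘ (ℚᵘ.mkℚᵘ (+ 1) k)) ⟩
    ℚᵘ.mkℚᵘ (+ suc k) 0 ℚᵘ.* ℚᵘ.mkℚᵘ (+ 1) k
      ≈⟨ ℚᵘ.*≡* (cong +_ eq) ⟩
    ℚᵘ.1ℚᵘ ∎)
    where
    open ℚᵘₚ.≃-Reasoning
    eq : suc k ℕ.* 1 ℕ.* 1 ≡ 1 ℕ.* (1 ℕ.* suc k)
    eq = trans (ℕₚ.*-identityʳ (suc k ℕ.* 1)) (trans (ℕₚ.*-identityʳ (suc k)) (sym (trans (ℕₚ.*-identityˡ (1 ℕ.* suc k)) (ℕₚ.*-identityˡ (suc k)))))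

  archimedean : ∀ p → ∃[ n ] p ≤ nat n
  archimedean (mkℚ (+ n) d c) = n , toℚᵘ-cancel-≤
    (ℚᵘₚ.≤-respʳ-≃ (ℚᵘₚ.≃-sym (toℚᵘ-fromℚᵘ (ℚᵘ.mkℚᵘ (+ n) 0)))
      (ℚᵘ.*≤* (ℤₚ.*-monoˡ-≤-nonNeg (+ n) (ℤ.+≤+ (ℕ.s≤s ℕ.z≤n)))))
  archimedean (mkℚ -[1+ n ] d c) = 0 , *≤* ℤ.-≤+

  nat-nonNeg : ∀ n → 0ℚ ≤ nat n
  nat-nonNeg n = nonNegative⁻¹ (nat n) {{normalize-nonNeg n 1}}

  inv : ℚ → ℚ
  inv q with q ≟ 0ℚ
  ... | yes _   = 0ℚ
  ... | no  q≢0 = 1/_ q {{≢-nonZero q≢0}}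

  inv-inverse : ∀ {q} → 0ℚ < q → q * inv q ≡ 1ℚ
  inv-inverse {q} 0<q with q ≟ 0ℚ
  ... | yes q≡0 = contradiction (sym q≡0) (<⇒≢ 0<q)
  ... | no  q≢0 = *-inverseʳ q {{≢-nonZero q≢0}}

  ring₁ : ∀ x y z w → x * (z - w) + w * (x - y) ≡ x * z - y * w
  ring₁ = solve 4 (λ x y z w → x :* (z :- w) :+ w :* (x :- y) := x :* z :- y :* w) refl

  ring₂ : ∀ x y i j → x * y * (i - j) ≡ y * (x * i) - x * (y * j)
  ring₂ = solve 4 (λ x y i j → x :* y :* (i :- j) := y :* (x :* i) :- x :* (y :* j)) refl

  ring₃ : ∀ κ x y → κ * (x + y) + (1ℚ - κ) * y ≡ κ * x + y
  ring₃ = solve 3 (λ κ x y → κ :* (x :+ y) :+ (con 1ℚ :- κ) :* y := κ :* x :+ y) refl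

  ring₄ : ∀ κ x i → x * (1ℚ + i * κ) ≡ (1ℚ - κ) * x * (1ℚ + (1ℚ + i) * κ) + x * ((1ℚ + i) * (κ * κ))
  ring₄ = solve 3 (λ κ x i → x :* (con 1ℚ :+ i :* κ)
                := (con 1ℚ :- κ) :* x :* (con 1ℚ :+ (con 1ℚ :+ i) :* κ)
                   :+ x :* ((con 1ℚ :+ i) :* (κ :* κ))) refl

  ring₅ : ∀ κ η i → η * (1ℚ + i * κ) ≡ κ * η * i + η
  ring₅ = solve 3 (λ κ η i → η :* (con 1ℚ :+ i :* κ) := κ :* η :* i :+ η) refl

  ring₆ : ∀ x y → x + (y + x) ≡ x + x + y
  ring₆ = solve 2 (λ x y → x :+ (y :+ x) := x :+ x :+ y) refl

  ring₇ : ∀ x y z → x - z + y ≡ x + y - z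
  ring₇ = solve 3 (λ x y z → (x :- z) :+ y := (x :+ y) :- z) refl

  ring₈ : ∀ x y z w → (x - y) + (z - w) ≡ (x + z) - (y + w)
  ring₈ = solve 4 (λ x y z w → (x :- y) :+ (z :- w) := (x :+ z) :- (y :+ w)) refl

  ring₉ : ∀ p q → (p - q) + q ≡ p
  ring₉ = solve 2 (λ p q → (p :- q) :+ q := p) refl

  ring₁₀ : ∀ o κ c → o * ((1ℚ - κ) * 1ℚ) * c ≡ (1ℚ - κ) * (o * c)
  ring₁₀ = solve 3 (λ o κ c → o :* ((con 1ℚ :- κ) :* con 1ℚ) :* c := (con 1ℚ :- κ) :* (o :* c)) refl

  ring₁₁ : ∀ s r → s ≡ s + r - r
  ring₁₁ = solve 2 (λ s r → s := s :+ r :- r) refl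

  ring₁₂ : ∀ x i → (x - 1ℚ) * i + (1ℚ * i + 1ℚ * i) ≡ (x + 1ℚ) * i
  ring₁₂ = solve 2 (λ x i → (x :- con 1ℚ) :* i :+ (con 1ℚ :* i :+ con 1ℚ :* i) := (x :+ con 1ℚ) :* i) refl

  ring₁₃ : ∀ x i → - ((x - 1ℚ) * i) + (x * i + x * i) ≡ (x + 1ℚ) * i
  ring₁₃ = solve 2 (λ x i → :- ((x :- con 1ℚ) :* i) :+ (x :* i :+ x :* i) := (x :+ con 1ℚ) :* i) refl

  abs-* : ∀ p q {P Q} → ∣ p ∣ ≤ P → ∣ q ∣ ≤ Q → ∣ p * q ∣ ≤ P * Q
  abs-* p q {P} {Q} p≤P q≤Q = begin
    ∣ p * q ∣     ≡⟨ ∣p*q∣≡∣p∣*∣q∣ p q ⟩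
    ∣ p ∣ * ∣ q ∣ ≤⟨ *-mono (0≤∣p∣ p) (≤-trans (0≤∣p∣ q) q≤Q) p≤P q≤Q ⟩
    P * Q         ∎
    where open ≤-Reasoning

  abs-swap : ∀ p q → ∣ p - q ∣ ≡ ∣ q - p ∣
  abs-swap p q = trans (sym (∣-p∣≡∣p∣ (p - q))) (cong ∣_∣ (neg-diff p q))
    where
    neg-diff : ∀ p q → - (p - q) ≡ q - p
    neg-diff = solve 2 (λ p q → :- (p :- q) := q :- p) refl

  IsCauchy : (ℕ → ℚ) → Set
  IsCauchy a = ∀ η → 0ℚ < η → ∃[ N ] (∀ m n → N ℕ.≤ m → N ℕ.≤ n → ∣ a m - a n ∣ ≤ η)

  cauchy⇒bounded : ∀ {a} → IsCauchy a →
                   ∃[ B ] (0ℚ < B × ∃[ N ] (∀ n → N ℕ.≤ n → ∣ a n ∣ ≤ B))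
  cauchy⇒bounded {a} ca with ca 1ℚ 0<1
  ... | N , h = 1ℚ + ∣ a N ∣ , +-mono-<-≤ 0<1 (0≤∣p∣ (a N)) , N , λ n N≤n →
    ≤-trans (≤-reflexive (cong ∣_∣ (sym (ring₉ (a n) (a N)))))
      (≤-trans (∣p+q∣≤∣p∣+∣q∣ (a n - a N) (a N))
               (+-monoˡ-≤ ∣ a N ∣ (h n N N≤n ℕₚ.≤-refl)))

  const-cauchy : ∀ q → IsCauchy (λ _ → q)
  const-cauchy q η 0<η = 0 , λ _ _ _ _ →
    subst (λ t → ∣ t ∣ ≤ η) (sym (+-inverseʳ q)) (<⇒≤ 0<η)

  neg-cauchy : ∀ {a} → IsCauchy a → IsCauchy (λ n → - a n)
  neg-cauchy {a} ca η 0<η with ca η 0<η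
  ... | N , h = N , λ m n N≤m N≤n → subst (_≤ η)
    (trans (sym (∣-p∣≡∣p∣ (a m - a n)))
      (cong ∣_∣ (neg-distrib-+ (a m) (- a n))))
    (h m n N≤m N≤n)

  +-cauchy : ∀ {a b} → IsCauchy a → IsCauchy b → IsCauchy (λ n → a n + b n)
  +-cauchy {a} {b} ca cb η 0<η with ca (½ * η) (half-pos 0<η) | cb (½ * η) (half-pos 0<η)
  ... | M , h | N , k = M ℕ.⊔ N , λ m n p q → begin
    ∣ (a m + b m) - (a n + b n) ∣
      ≡⟨ cong ∣_∣ (ring₈ (a m) (a n) (b m) (b n)) ⟨
    ∣ (a m - a n) + (b m - b n) ∣
      ≤⟨ ∣p+q∣≤∣p∣+∣q∣ (a m - a n) (b m - b n) ⟩
    ∣ a m - a n ∣ + ∣ b m - b n ∣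
      ≤⟨ +-mono-≤ (h m n (⊔ˡ M N p) (⊔ˡ M N q))
                  (k m n (⊔ʳ M N p) (⊔ʳ M N q)) ⟩
    ½ * η + ½ * η
      ≡⟨ halves η ⟩
    η ∎
    where open ≤-Reasoning

  shrink : ∀ {δ} → 0ℚ < δ → ∃[ δ′ ] (0ℚ < δ′ × δ′ ≤ δ × δ′ ≤ 1ℚ)
  shrink {δ} 0<δ = δ ⊓ 1ℚ , positive-min , p⊓q≤p δ 1ℚ , p⊓q≤q δ 1ℚ
    where
    positive-min : 0ℚ < δ ⊓ 1ℚ
    positive-min with ⊓-sel δ 1ℚ
    ... | inj₁ e = subst (0ℚ <_) (sym e) 0<δ
    ... | inj₂ e = subst (0ℚ <_) (sym e) 0<1

  scale-down : ∀ {A η} → 0ℚ < A → 0ℚ < η → ∃[ θ ] (0ℚ < θ × A * θ ≡ η)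
  scale-down {A} {η} 0<A 0<η =
    let θ , Aθ≡η = divide η 0<A
    in θ , cancel-pos θ 0<A (subst (0ℚ <_) (sym Aθ≡η) 0<η) , Aθ≡η

  *-close : ∀ x y z w {A B θ ζ η} → ∣ x ∣ ≤ A → ∣ w ∣ ≤ B →
            ∣ z - w ∣ ≤ θ → ∣ x - y ∣ ≤ ζ → A * θ ≡ ½ * η → B * ζ ≡ ½ * η →
            ∣ x * z - y * w ∣ ≤ η
  *-close x y z w {A} {B} {θ} {ζ} {η} x≤A w≤B zw xy Aθ Bζ = begin
    ∣ x * z - y * w ∣
      ≡⟨ cong ∣_∣ (ring₁ x y z w) ⟨
    ∣ x * (z - w) + w * (x - y) ∣
      ≤⟨ ∣p+q∣≤∣p∣+∣q∣ (x * (z - w)) (w * (x - y)) ⟩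
    ∣ x * (z - w) ∣ + ∣ w * (x - y) ∣
      ≤⟨ +-mono-≤ (abs-* x (z - w) x≤A zw) (abs-* w (x - y) w≤B xy) ⟩
    A * θ + B * ζ
      ≡⟨ cong₂ _+_ Aθ Bζ ⟩
    ½ * η + ½ * η
      ≡⟨ halves η ⟩
    η ∎
    where open ≤-Reasoning

  *-cauchy : ∀ {a b} → IsCauchy a → IsCauchy b → IsCauchy (λ n → a n * b n)
  *-cauchy {a} {b} ca cb η 0<η =
    let
      A , 0<A , N₁ , ha = cauchy⇒bounded ca
      B , 0<B , N₂ , hb = cauchy⇒bounded cb
      θ , 0<θ , Aθ = scale-down 0<A (half-pos 0<η)
      ζ , 0<ζ , Bζ = scale-down 0<B (half-pos 0<η)
      N₃ , ka = ca ζ 0<ζ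
      N₄ , kb = cb θ 0<θ
      M = N₁ ℕ.⊔ N₂
      N = N₃ ℕ.⊔ N₄
    in M ℕ.⊔ N , λ m n p q →
      *-close (a m) (a n) (b m) (b n)
        (ha m (⊔ˡ N₁ N₂ (⊔ˡ M N p)))
        (hb n (⊔ʳ N₁ N₂ (⊔ˡ M N q)))
        (kb m n (⊔ʳ N₃ N₄ (⊔ʳ M N p)) (⊔ʳ N₃ N₄ (⊔ʳ M N q)))
        (ka m n (⊔ˡ N₃ N₄ (⊔ʳ M N p)) (⊔ˡ N₃ N₄ (⊔ʳ M N q)))
        Aθ Bζ

  inv-cauchy : ∀ {a δ} → IsCauchy a → 0ℚ < δ → ∃[ N ] (∀ n → N ℕ.≤ n → δ ≤ a n) →
               IsCauchy (λ n → inv (a n))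
  inv-cauchy {a} {δ} ca 0<δ (N₁ , δ≤a) η 0<η with ca (δ * δ * η) (*-pos (*-pos 0<δ 0<δ) 0<η)
  ... | N₂ , h = N₁ ℕ.⊔ N₂ , λ m n p q → bound (a m) (a n)
    (δ≤a m (⊔ˡ N₁ N₂ p)) (δ≤a n (⊔ˡ N₁ N₂ q))
    (h n m (⊔ʳ N₁ N₂ q) (⊔ʳ N₁ N₂ p))
    where
    product-eq : ∀ x y → 0ℚ < x → 0ℚ < y → x * y * (inv x - inv y) ≡ y - x
    product-eq x y 0<x 0<y = begin
      x * y * (inv x - inv y)           ≡⟨ ring₂ x y (inv x) (inv y) ⟩
      y * (x * inv x) - x * (y * inv y) ≡⟨ cong₂ (λ u v → y * u - x * v) (inv-inverse 0<x) (inv-inverse 0<y) ⟩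
      y * 1ℚ - x * 1ℚ                   ≡⟨ cong₂ _-_ (*-identityʳ y) (*-identityʳ x) ⟩
      y - x                             ∎
      where open ≡-Reasoning

    abs-product : ∀ p u → 0ℚ < p → p * ∣ u ∣ ≡ ∣ p * u ∣
    abs-product p u 0<p = begin
      p * ∣ u ∣     ≡⟨ cong (_* ∣ u ∣) (0≤p⇒∣p∣≡p (<⇒≤ 0<p)) ⟨
      ∣ p ∣ * ∣ u ∣ ≡⟨ ∣p*q∣≡∣p∣*∣q∣ p u ⟨
      ∣ p * u ∣     ∎
      where open ≡-Reasoning

    bound : ∀ x y → δ ≤ x → δ ≤ y → ∣ y - x ∣ ≤ δ * δ * η → ∣ inv x - inv y ∣ ≤ η
    bound x y δ≤x δ≤y close = *-cancelˡ-≤-pos (δ * δ) {{positive (*-pos 0<δ 0<δ)}} (begin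
      δ * δ * ∣ inv x - inv y ∣
        ≤⟨ *-monoʳ-≤-nonNeg ∣ inv x - inv y ∣ {{nonNegative (0≤∣p∣ (inv x - inv y))}}
             (*-mono (<⇒≤ 0<δ) (<⇒≤ 0<y) δ≤x δ≤y) ⟩
      x * y * ∣ inv x - inv y ∣
        ≡⟨ abs-product (x * y) (inv x - inv y) (*-pos 0<x 0<y) ⟩
      ∣ x * y * (inv x - inv y) ∣
        ≡⟨ cong ∣_∣ (product-eq x y 0<x 0<y) ⟩
      ∣ y - x ∣
        ≤⟨ close ⟩
      δ * δ * η ∎)
      where
      open ≤-Reasoning
      0<x = <-≤-trans 0<δ δ≤x
      0<y = <-≤-trans 0<δ δ≤y

  partial : (ℕ → ℕ → ℚ) → ℕ → ℕ → ℚ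
  partial t zero    n = 0ℚ
  partial t (suc k) n = partial t k n + t k n

  partial-cauchy : ∀ {t} → (∀ k → IsCauchy (t k)) → ∀ k → IsCauchy (partial t k)
  partial-cauchy {t} ct zero    = const-cauchy 0ℚ
  partial-cauchy {t} ct (suc k) =
    +-cauchy {partial t k} {t k} (partial-cauchy {t} ct k) (ct k)

  RatioBound : (ℕ → ℕ → ℚ) → Set
  RatioBound t = ∃[ κ ] (0ℚ < κ × ∃[ K ] ∃[ N ] (∀ k n → K ℕ.≤ k → N ℕ.≤ n →
                 ∣ t (suc k) n ∣ ≤ (1ℚ - κ) * ∣ t k n ∣))

  module Ratio {t : ℕ → ℕ → ℚ} (ct : ∀ k → IsCauchy (t k))
               {κ : ℚ} (0<κ : 0ℚ < κ) {K N : ℕ}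
               (ratio : ∀ k n → K ℕ.≤ k → N ℕ.≤ n → ∣ t (suc k) n ∣ ≤ (1ℚ - κ) * ∣ t k n ∣)
               where

    S : ℕ → ℕ → ℚ
    S = partial t

    tail : ∀ i {k n} → K ℕ.≤ k → N ℕ.≤ n →
           κ * ∣ S (i ℕ.+ k) n - S k n ∣ + ∣ t (i ℕ.+ k) n ∣ ≤ ∣ t k n ∣
    tail zero {k} {n} K≤k N≤n = ≤-reflexive (begin
      κ * ∣ S k n - S k n ∣ + ∣ t k n ∣ ≡⟨ cong (λ p → κ * ∣ p ∣ + ∣ t k n ∣) (+-inverseʳ (S k n)) ⟩
      κ * 0ℚ + ∣ t k n ∣                ≡⟨ cong (_+ ∣ t k n ∣) (*-zeroʳ κ) ⟩
      0ℚ + ∣ t k n ∣                    ≡⟨ +-identityˡ ∣ t k n ∣ ⟩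
      ∣ t k n ∣                         ∎)
      where open ≡-Reasoning
    tail (suc i) {k} {n} K≤k N≤n = begin
      κ * ∣ s + t j n - S k n ∣ + ∣ t (suc j) n ∣
        ≤⟨ +-mono-≤
             (*-monoˡ-≤-nonNeg κ {{nonNegative (<⇒≤ 0<κ)}}
               step)
             (ratio j n (ℕₚ.≤-trans K≤k (ℕₚ.m≤n+m k i)) N≤n) ⟩
      κ * (∣ s - S k n ∣ + ∣ t j n ∣) + (1ℚ - κ) * ∣ t j n ∣
        ≡⟨ ring₃ κ ∣ s - S k n ∣ ∣ t j n ∣ ⟩
      κ * ∣ s - S k n ∣ + ∣ t j n ∣
        ≤⟨ tail i K≤k N≤n ⟩
      ∣ t k n ∣ ∎
      where
      open ≤-Reasoning
      j = i ℕ.+ k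
      s = S j n
      step : ∣ s + t j n - S k n ∣ ≤ ∣ s - S k n ∣ + ∣ t j n ∣
      step = begin
        ∣ s + t j n - S k n ∣     ≡⟨ cong ∣_∣ (ring₇ s (t j n) (S k n)) ⟨
        ∣ s - S k n + t j n ∣     ≤⟨ ∣p+q∣≤∣p∣+∣q∣ (s - S k n) (t j n) ⟩
        ∣ s - S k n ∣ + ∣ t j n ∣ ∎

    decay : ∀ i {n} → N ℕ.≤ n → ∣ t (i ℕ.+ K) n ∣ * (1ℚ + nat i * κ) ≤ ∣ t K n ∣
    decay zero {n} N≤n = ≤-reflexive (begin
      ∣ t K n ∣ * (1ℚ + 0ℚ * κ) ≡⟨ cong (λ p → ∣ t K n ∣ * (1ℚ + p)) (*-zeroˡ κ) ⟩
      ∣ t K n ∣ * 1ℚ            ≡⟨ *-identityʳ ∣ t K n ∣ ⟩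
      ∣ t K n ∣                 ∎)
      where open ≡-Reasoning
    decay (suc i) {n} N≤n = begin
      ∣ t (suc j) n ∣ * (1ℚ + nat (suc i) * κ)
        ≡⟨ cong (λ p → ∣ t (suc j) n ∣ * (1ℚ + p * κ)) (nat-suc i) ⟩
      ∣ t (suc j) n ∣ * (1ℚ + (1ℚ + nat i) * κ)
        ≤⟨ *-monoʳ-≤-nonNeg _ {{nonNegative (+-mono-≤ 0≤1 (*-nonNeg 0≤1+i (<⇒≤ 0<κ)))}}
             (ratio j n (ℕₚ.m≤n+m K i) N≤n) ⟩
      (1ℚ - κ) * ∣ t j n ∣ * (1ℚ + (1ℚ + nat i) * κ)
        ≤⟨ ≤-from-diff (∣ t j n ∣ * ((1ℚ + nat i) * (κ * κ)))
             (ring₄ κ ∣ t j n ∣ (nat i))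
             (*-nonNeg (0≤∣p∣ (t j n)) (*-nonNeg 0≤1+i (<⇒≤ (*-pos 0<κ 0<κ)))) ⟩
      ∣ t j n ∣ * (1ℚ + nat i * κ)
        ≤⟨ decay i N≤n ⟩
      ∣ t K n ∣ ∎
      where
      open ≤-Reasoning
      j = i ℕ.+ K
      0≤1+i : 0ℚ ≤ 1ℚ + nat i
      0≤1+i = +-mono-≤ 0≤1 (nat-nonNeg i)

    small-bound : ∀ i {n p T η} → 0ℚ < η → N ℕ.≤ n → ∣ t K n ∣ ≤ T →
                  κ * η * p ≡ T → p ≤ nat i → ∣ t (i ℕ.+ K) n ∣ ≤ η
    small-bound i {n} {p} {T} {η} 0<η N≤n bound κηp≡T p≤i =
      *-cancelʳ-≤-pos (1ℚ + nat i * κ)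
        {{positive (+-mono-<-≤ 0<1 (*-nonNeg (nat-nonNeg i) (<⇒≤ 0<κ)))}} (begin
      ∣ t (i ℕ.+ K) n ∣ * (1ℚ + nat i * κ)  ≤⟨ decay i N≤n ⟩
      ∣ t K n ∣                             ≤⟨ bound ⟩
      T                                     ≡⟨ κηp≡T ⟨
      κ * η * p                             ≤⟨ *-monoˡ-≤-nonNeg (κ * η) {{nonNegative (<⇒≤ (*-pos 0<κ 0<η))}} p≤i ⟩
      κ * η * nat i                         ≤⟨ ≤-from-diff η (ring₅ κ η (nat i)) (<⇒≤ 0<η) ⟩
      η * (1ℚ + nat i * κ)                  ∎)
      where open ≤-Reasoning

    small : ∀ {η} → 0ℚ < η →
            ∃[ k ] (K ℕ.≤ k × ∃[ M ] (N ℕ.≤ M × (∀ n → M ℕ.≤ n → ∣ t k n ∣ ≤ η)))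
    small {η} 0<η =
      let
        T , _ , M , bound = cauchy⇒bounded (ct K)
        p , κηp≡T = divide T (*-pos 0<κ 0<η)
        i , p≤i = archimedean p
      in i ℕ.+ K , ℕₚ.m≤n+m K i , N ℕ.⊔ M , ℕₚ.m≤m⊔n N M , λ n q →
         small-bound i 0<η (⊔ˡ N M q) (bound n (⊔ʳ N M q)) κηp≡T p≤i

    uniform-bound : ∀ {η k m n} → K ℕ.≤ k → N ℕ.≤ n → k ℕ.≤ m → ∣ t k n ∣ ≤ κ * η →
                    ∣ S m n - S k n ∣ ≤ η
    uniform-bound {η} {k} {m} {n} K≤k N≤n k≤m bound =
      *-cancelˡ-≤-pos κ {{positive 0<κ}} (begin
        κ * ∣ S m n - S k n ∣
          ≡⟨ cong (λ j → κ * ∣ S j n - S k n ∣) (ℕₚ.m∸n+n≡m k≤m) ⟨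
        κ * ∣ S (m ℕ.∸ k ℕ.+ k) n - S k n ∣
          ≤⟨ ≤-from-diff ∣ t (m ℕ.∸ k ℕ.+ k) n ∣ refl (0≤∣p∣ (t (m ℕ.∸ k ℕ.+ k) n)) ⟩
        κ * ∣ S (m ℕ.∸ k ℕ.+ k) n - S k n ∣ + ∣ t (m ℕ.∸ k ℕ.+ k) n ∣
          ≤⟨ tail (m ℕ.∸ k) K≤k N≤n ⟩
        ∣ t k n ∣
          ≤⟨ bound ⟩
        κ * η ∎)
      where open ≤-Reasoning

    uniform : ∀ {η} → 0ℚ < η →
              ∃[ k ] ∃[ M ] (∀ m n → k ℕ.≤ m → M ℕ.≤ n → ∣ S m n - S k n ∣ ≤ η)
    uniform {η} 0<η =
      let k , K≤k , M , N≤M , bound = small (*-pos 0<κ 0<η)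
      in k , M , λ m n k≤m M≤n →
         uniform-bound K≤k (ℕₚ.≤-trans N≤M M≤n) k≤m (bound n M≤n)

    diagonal-bound : ∀ {η} k m n →
      ∣ S m m - S k m ∣ ≤ ½ * (½ * η) → ∣ S n n - S k n ∣ ≤ ½ * (½ * η) →
      ∣ S k m - S k n ∣ ≤ ½ * η → ∣ S m m - S n n ∣ ≤ η
    diagonal-bound {η} k m n hm hn close = begin
      ∣ S m m - S n n ∣
        ≤⟨ triangle (S m m) (S k m) (S n n) ⟩
      ∣ S m m - S k m ∣ + ∣ S k m - S n n ∣
        ≤⟨ +-mono-≤ hm (triangle (S k m) (S k n) (S n n)) ⟩
      ½ * (½ * η) + (∣ S k m - S k n ∣ + ∣ S k n - S n n ∣)
        ≤⟨ +-monoʳ-≤ (½ * (½ * η)) (+-mono-≤ close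
             (≤-trans (≤-reflexive (abs-swap (S k n) (S n n))) hn)) ⟩
      ½ * (½ * η) + (½ * η + ½ * (½ * η))
        ≡⟨ ring₆ (½ * (½ * η)) (½ * η) ⟩
      ½ * (½ * η) + ½ * (½ * η) + ½ * η
        ≡⟨ cong (_+ ½ * η) (halves (½ * η)) ⟩
      ½ * η + ½ * η
        ≡⟨ halves η ⟩
      η ∎
      where open ≤-Reasoning

    diagonal-cauchy : IsCauchy (λ n → S n n)
    diagonal-cauchy η 0<η =
      let
        k , M , h = uniform (half-pos (half-pos 0<η))
        L , g = partial-cauchy {t} ct k (½ * η) (half-pos 0<η)
      in k ℕ.⊔ (M ℕ.⊔ L) , λ m n p q →
        diagonal-bound k m n
          (h m m (⊔ˡ k (M ℕ.⊔ L) p) (⊔ˡ M L (⊔ʳ k (M ℕ.⊔ L) p)))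
          (h n n (⊔ˡ k (M ℕ.⊔ L) q) (⊔ˡ M L (⊔ʳ k (M ℕ.⊔ L) q)))
          (g m n (⊔ʳ M L (⊔ʳ k (M ℕ.⊔ L) p)) (⊔ʳ M L (⊔ʳ k (M ℕ.⊔ L) q)))

  nat-mono : ∀ {m n} → m ℕ.≤ n → nat m ≤ nat n
  nat-mono {n = n} ℕ.z≤n = nat-nonNeg n
  nat-mono (ℕ.s≤s {m} {n} m≤n) =
    subst₂ _≤_ (sym (nat-suc m)) (sym (nat-suc n)) (+-monoʳ-≤ 1ℚ (nat-mono m≤n))

  unit-nonNeg : ∀ k → 0ℚ ≤ + 1 / suc k
  unit-nonNeg k = nonNegative⁻¹ (+ 1 / suc k) {{normalize-nonNeg 1 (suc k)}}

  unit-antitone : ∀ {k m} → k ℕ.≤ m → + 1 / suc m ≤ + 1 / suc k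
  unit-antitone {k} {m} k≤m = toℚᵘ-cancel-≤
    (ℚᵘₚ.≤-respˡ-≃ (ℚᵘₚ.≃-sym (toℚᵘ-fromℚᵘ (ℚᵘ.mkℚᵘ (+ 1) m)))
      (ℚᵘₚ.≤-respʳ-≃ (ℚᵘₚ.≃-sym (toℚᵘ-fromℚᵘ (ℚᵘ.mkℚᵘ (+ 1) k)))
        (ℚᵘ.*≤* (ℤₚ.*-monoˡ-≤-nonNeg (+ 1) (ℤ.+≤+ (ℕ.s≤s k≤m))))))

  exp-ratio : ∀ t x {B k} → ∣ x ∣ ≤ B → B + B ≤ nat k →
              ∣ t * x * (+ 1 / suc k) ∣ ≤ (1ℚ - ½) * ∣ t ∣
  exp-ratio t x {B} {k} x≤B 2B≤k = begin
    ∣ t * x * c ∣        ≡⟨ cong ∣_∣ (*-assoc t x c) ⟩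
    ∣ t * (x * c) ∣      ≤⟨ abs-* t (x * c) ≤-refl xc≤½ ⟩
    ∣ t ∣ * ½            ≡⟨ *-comm ∣ t ∣ ½ ⟩
    (1ℚ - ½) * ∣ t ∣     ∎
    where
    open ≤-Reasoning
    c = + 1 / suc k
    xc≤½ : ∣ x * c ∣ ≤ ½
    xc≤½ = begin
      ∣ x * c ∣                  ≤⟨ abs-* x c x≤B (≤-reflexive (0≤p⇒∣p∣≡p (unit-nonNeg k))) ⟩
      B * c                      ≡⟨ cong (_* c) (trans (sym (halves B)) (sym (*-distribˡ-+ ½ B B))) ⟩
      ½ * (B + B) * c            ≡⟨ *-assoc ½ (B + B) c ⟩
      ½ * ((B + B) * c)          ≤⟨ *-monoˡ-≤-nonNeg ½ (*-monoʳ-≤-nonNeg c {{nonNegative (unit-nonNeg k)}}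
                                      (≤-trans 2B≤k (nat-mono (ℕₚ.n≤1+n k)))) ⟩
      ½ * (nat (suc k) * c)      ≡⟨ cong (½ *_) (nat-inverse k) ⟩
      ½                          ∎

  artanh-ratio : ∀ o z {κ k m} → 0ℚ < κ → ∣ z ∣ ≤ 1ℚ - κ → k ℕ.≤ m →
                 ∣ o * (z * z) * (+ 1 / suc m) ∣ ≤ (1ℚ - κ) * ∣ o * (+ 1 / suc k) ∣
  artanh-ratio o z {κ} {k} {m} 0<κ z≤1-κ k≤m = begin
    ∣ o * (z * z) * d ∣           ≤⟨ abs-* (o * (z * z)) d
                                       (abs-* o (z * z) ≤-refl (abs-* z z z≤1-κ (≤-trans z≤1-κ 1-κ≤1)))
                                       (≤-trans (≤-reflexive (0≤p⇒∣p∣≡p (unit-nonNeg m))) (unit-antitone k≤m)) ⟩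
    ∣ o ∣ * ((1ℚ - κ) * 1ℚ) * c   ≡⟨ ring₁₀ ∣ o ∣ κ c ⟩
    (1ℚ - κ) * (∣ o ∣ * c)        ≡⟨ cong (λ e → (1ℚ - κ) * (∣ o ∣ * e)) (0≤p⇒∣p∣≡p (unit-nonNeg k)) ⟨
    (1ℚ - κ) * (∣ o ∣ * ∣ c ∣)    ≡⟨ cong ((1ℚ - κ) *_) (∣p*q∣≡∣p∣*∣q∣ o c) ⟨
    (1ℚ - κ) * ∣ o * c ∣          ∎
    where
    open ≤-Reasoning
    c = + 1 / suc k
    d = + 1 / suc m
    1-κ≤1 : 1ℚ - κ ≤ 1ℚ
    1-κ≤1 = ≤-from-diff κ (sym (ring₉ 1ℚ κ)) (<⇒≤ 0<κ)

  cayley-bound : ∀ {x δ B κ} → δ ≤ x → ∣ x ∣ ≤ B → 0ℚ < δ → δ ≤ 1ℚ → (1ℚ + B) * κ ≡ δ →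
                 ∣ (x - 1ℚ) * inv (x + 1ℚ) ∣ ≤ 1ℚ - κ
  cayley-bound {x} {δ} {B} {κ} δ≤x x≤B 0<δ δ≤1 eq = abs-≤ lower upper
    where
    open ≤-Reasoning
    i = inv (x + 1ℚ)
    w = (x - 1ℚ) * i
    0<x+1 : 0ℚ < x + 1ℚ
    0<x+1 = +-pos (<-≤-trans 0<δ δ≤x) 0<1
    inverse : (x + 1ℚ) * i ≡ 1ℚ
    inverse = inv-inverse 0<x+1
    0<i : 0ℚ < i
    0<i = cancel-pos i 0<x+1 (subst (0ℚ <_) (sym inverse) 0<1)
    x+1≤1+B : x + 1ℚ ≤ 1ℚ + B
    x+1≤1+B = ≤-trans (≤-reflexive (+-comm x 1ℚ)) (+-monoʳ-≤ 1ℚ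
      (≤-trans (≤-reflexive (sym (0≤p⇒∣p∣≡p (<⇒≤ (<-≤-trans 0<δ δ≤x))))) x≤B))
    κ≤δi : κ ≤ δ * i
    κ≤δi = *-cancelʳ-≤-pos (x + 1ℚ) {{positive 0<x+1}} (begin
      κ * (x + 1ℚ)       ≤⟨ *-monoˡ-≤-nonNeg κ {{nonNegative (<⇒≤ 0<κ)}} x+1≤1+B ⟩
      κ * (1ℚ + B)       ≡⟨ trans (*-comm κ (1ℚ + B)) eq ⟩
      δ                  ≡⟨ *-identityʳ δ ⟨
      δ * 1ℚ             ≡⟨ cong (δ *_) (trans (*-comm i (x + 1ℚ)) inverse) ⟨
      δ * (i * (x + 1ℚ)) ≡⟨ *-assoc δ i (x + 1ℚ) ⟨
      δ * i * (x + 1ℚ)   ∎)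
      where
      0<κ : 0ℚ < κ
      0<κ = cancel-pos κ (<-≤-trans 0<x+1 x+1≤1+B) (subst (0ℚ <_) (sym eq) 0<δ)
    lift : ∀ {r} → δ ≤ r → κ ≤ r * i
    lift δ≤r = ≤-trans κ≤δi (*-monoʳ-≤-nonNeg i {{nonNegative (<⇒≤ 0<i)}} δ≤r)
    double : ∀ {r} → δ ≤ r → κ ≤ r * i + r * i
    double {r} δ≤r = ≤-trans (lift δ≤r) (≤-from-diff (r * i) refl
      (*-nonNeg (≤-trans (<⇒≤ 0<δ) δ≤r) (<⇒≤ 0<i)))
    shift : ∀ {r s} → s + r ≡ 1ℚ → κ ≤ r → s ≤ 1ℚ - κ
    shift {r} {s} s+r≡1 κ≤r = begin
      s            ≡⟨ ring₁₁ s r ⟩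
      s + r - r    ≡⟨ cong (_- r) s+r≡1 ⟩
      1ℚ - r       ≤⟨ +-monoʳ-≤ 1ℚ (neg-antimono-≤ κ≤r) ⟩
      1ℚ - κ       ∎
    upper : w ≤ 1ℚ - κ
    upper = shift (trans (ring₁₂ x i) inverse) (double δ≤1)
    lower : - w ≤ 1ℚ - κ
    lower = shift (trans (ring₁₃ x i) inverse) (double δ≤x)
    abs-≤ : ∀ {p q} → - p ≤ q → p ≤ q → ∣ p ∣ ≤ q
    abs-≤ {p} {q} -p≤q p≤q with ∣p∣≡p∨∣p∣≡-p p
    ... | inj₁ e = ≤-trans (≤-reflexive e) p≤q
    ... | inj₂ e = ≤-trans (≤-reflexive e) -p≤q

open CauchySequences using (IsCauchy; RatioBound; inv)

------------------------------------------------------------------------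
-- Real numbers

-- Distinct sequences may represent the same real number, so _<ℝ_ and
-- _≤ℝ_ compare limits rather than terms.
record ℝ : Set where
  constructor mkℝ
  field
    approx : ℕ → ℚ
    cauchy : IsCauchy approx

open ℝ public

infixl 7 _*ℝ_
infixl 6 _+ℝ_ _-ℝ_
infix  8 -ℝ_
infix  4 _<ℝ_ _≤ℝ_

const : ℚ → ℝ
const q = mkℝ (λ _ → q) (CauchySequences.const-cauchy q)

fromℕ : ℕ → ℝ
fromℕ n = const (+ n / 1)

0ℝ 1ℝ : ℝ
0ℝ = const 0ℚ
1ℝ = const 1ℚ

_+ℝ_ : ℝ → ℝ → ℝ
x +ℝ y = mkℝ (λ n → approx x n Rat.+ approx y n)
             (CauchySequences.+-cauchy {approx x} {approx y} (cauchy x) (cauchy y))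

-ℝ_ : ℝ → ℝ
-ℝ x = mkℝ (λ n → Rat.- approx x n) (CauchySequences.neg-cauchy {approx x} (cauchy x))

_-ℝ_ : ℝ → ℝ → ℝ
x -ℝ y = x +ℝ (-ℝ y)

_*ℝ_ : ℝ → ℝ → ℝ
x *ℝ y = mkℝ (λ n → approx x n Rat.* approx y n)
             (CauchySequences.*-cauchy {approx x} {approx y} (cauchy x) (cauchy y))

_<ℝ_ : ℝ → ℝ → Set
x <ℝ y = ∃[ η ] (0ℚ Rat.< η × ∃[ N ] (∀ n → N ℕ.≤ n → approx x n Rat.+ η Rat.≤ approx y n))

_≤ℝ_ : ℝ → ℝ → Set
x ≤ℝ y = ∀ η → 0ℚ Rat.< η → ∃[ N ] (∀ n → N ℕ.≤ n → approx x n Rat.≤ approx y n Rat.+ η)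

-- inv sends 0ℚ to 0ℚ, which affects only finitely many terms here.
reciprocal : (x : ℝ) → 0ℝ <ℝ x → ℝ
reciprocal x (δ , 0<δ , N , h) = mkℝ (λ n → inv (approx x n))
  (CauchySequences.inv-cauchy {approx x} (cauchy x) 0<δ
    (N , λ n N≤n → Ratₚ.≤-trans (Ratₚ.≤-reflexive (sym (Ratₚ.+-identityˡ δ))) (h n N≤n)))

-- The n-th approximation is the n-th approximation of the n-th partial
-- sum; the ratio bound makes the partial sums converge uniformly in n.
series : (t : ℕ → ℝ) → RatioBound (λ k → approx (t k)) → ℝ
series t (κ , 0<κ , K , N , ratio) =
  mkℝ (λ n → CauchySequences.partial (λ k → approx (t k)) n n)
      (CauchySequences.Ratio.diagonal-cauchy {λ k → approx (t k)}
        (λ k → cauchy (t k)) 0<κ {K} {N} ratio)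

-- xᵏ / k!
expTerm : ℝ → ℕ → ℝ
expTerm x zero    = 1ℝ
expTerm x (suc k) = expTerm x k *ℝ x *ℝ const (+ 1 / suc k)

exp : ℝ → ℝ
exp x = series (expTerm x) ratio
  where
  ratio : RatioBound (λ k → approx (expTerm x k))
  ratio =
    let B , _ , N , bound = CauchySequences.cauchy⇒bounded (cauchy x)
        K , 2B≤K = CauchySequences.archimedean (B Rat.+ B)
    in ½ , CauchySequences.0<½ , K , N , λ k n K≤k N≤n →
       CauchySequences.exp-ratio (approx (expTerm x k) n) (approx x n) {B} {k} (bound n N≤n)
         (Ratₚ.≤-trans 2B≤K (CauchySequences.nat-mono {K} {k} K≤k))

-- ∣ z ∣ < 1
AbsBelowOne : ℝ → Set
AbsBelowOne z =
  ∃[ κ ] (0ℚ Rat.< κ × ∃[ N ] (∀ n → N ℕ.≤ n → ∣ approx z n ∣ Rat.≤ 1ℚ Rat.- κ))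

-- z²ᵏ⁺¹
oddPower : ℝ → ℕ → ℝ
oddPower z zero    = z
oddPower z (suc k) = oddPower z k *ℝ (z *ℝ z)

artanh : (z : ℝ) → AbsBelowOne z → ℝ
artanh z (κ , 0<κ , N , bound) = series term ratio
  where
  term : ℕ → ℝ
  term k = oddPower z k *ℝ const (+ 1 / suc (2 ℕ.* k))

  ratio : RatioBound (λ k → approx (term k))
  ratio = κ , 0<κ , 0 , N , λ k n _ N≤n →
    CauchySequences.artanh-ratio (approx (oddPower z k) n) (approx z n)
      {κ} {2 ℕ.* k} {2 ℕ.* suc k} 0<κ (bound n N≤n)
      (ℕₚ.*-monoʳ-≤ 2 (ℕₚ.n≤1+n k))

-- Natural logarithm: log x = 2 artanh ((x - 1) / (x + 1)).
log : (x : ℝ) → 0ℝ <ℝ x → ℝ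
log x (δ , 0<δ , N , h) = const (+ 2 / 1) *ℝ artanh z z-bound
  where
  positive+1 : 0ℝ <ℝ x +ℝ 1ℝ
  positive+1 = δ , 0<δ , N , λ n N≤n → Ratₚ.≤-trans (h n N≤n)
    (CauchySequences.≤-from-diff 1ℚ refl CauchySequences.0≤1)

  z : ℝ
  z = (x -ℝ 1ℝ) *ℝ reciprocal (x +ℝ 1ℝ) positive+1

  z-bound : AbsBelowOne z
  z-bound =
    let B , 0<B , M , bound = CauchySequences.cauchy⇒bounded (cauchy x)
        0<1+B = CauchySequences.+-pos CauchySequences.0<1 0<B
        δ′ , 0<δ′ , δ′≤δ , δ′≤1 = CauchySequences.shrink 0<δ
        κ , 0<κ , eq = CauchySequences.scale-down 0<1+B 0<δ′
    in κ , 0<κ , N ℕ.⊔ M , λ n q →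
       CauchySequences.cayley-bound
         (Ratₚ.≤-trans δ′≤δ (Ratₚ.≤-trans (Ratₚ.≤-reflexive (sym (Ratₚ.+-identityˡ δ)))
           (h n (ℕₚ.m⊔n≤o⇒m≤o N M q))))
         (bound n (ℕₚ.m⊔n≤o⇒n≤o N M q)) 0<δ′ δ′≤1 eq

power : (x : ℝ) → 0ℝ <ℝ x → ℝ → ℝ
power x 0<x y = exp (y *ℝ log x 0<x)

fromℕ-positive : ∀ n → 1 ℕ.≤ n → 0ℝ <ℝ fromℕ n
fromℕ-positive n 1≤n = 1ℚ , CauchySequences.0<1 , 0 , λ _ _ → CauchySequences.nat-mono {1} {n} 1≤n

------------------------------------------------------------------------
-- Polynomials

-- A polynomial is the list of its coefficients, constant term first;
-- trailing zeros are allowed and ignored by _≈_.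
module Polynomials {c ℓ} (R : RawRing c ℓ) where
  open RawRing R using (Carrier; 0#; 1#)
    renaming (_≈_ to _≈ᶜ_; _+_ to _+ᶜ_; _*_ to _*ᶜ_; -_ to -ᶜ_)

  Poly : Set c
  Poly = List Carrier

  coeff : Poly → ℕ → Carrier
  coeff []      _       = 0#
  coeff (a ∷ p) zero    = a
  coeff (a ∷ p) (suc i) = coeff p i

  infix  4 _≈_
  infixl 6 _+_
  infixl 7 _*_

  _≈_ : Poly → Poly → Set ℓ
  p ≈ q = ∀ i → coeff p i ≈ᶜ coeff q i

  _+_ : Poly → Poly → Poly
  []      + q       = q
  (a ∷ p) + []      = a ∷ p
  (a ∷ p) + (b ∷ q) = (a +ᶜ b) ∷ (p + q)

  scale : Carrier → Poly → Poly
  scale a = map (a *ᶜ_)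

  _*_ : Poly → Poly → Poly
  []      * q = []
  (a ∷ p) * q = scale a q + (0# ∷ p * q)

  rawSemiring : RawSemiring c ℓ
  rawSemiring = record
    { Carrier = Poly ; _≈_ = _≈_ ; _+_ = _+_ ; _*_ = _*_ ; 0# = [] ; 1# = 1# ∷ [] }

  open RawSemiringDefinitions rawSemiring public using (Irreducible)

  HasDegree : Poly → ℕ → Set ℓ
  HasDegree p d = ¬ (coeff p d ≈ᶜ 0#) × (∀ i → d ℕ.< i → coeff p i ≈ᶜ 0#)

  eval : Poly → Carrier → Carrier
  eval []      x = 0#
  eval (a ∷ p) x = a +ᶜ x *ᶜ eval p x

  -- ∏ (X - y) over the listed y
  fromRoots : List Carrier → Poly
  fromRoots = foldr (λ y p → (-ᶜ y ∷ 1# ∷ []) * p) (1# ∷ [])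

open Polynomials ℤ.+-*-rawRing public
  using (Irreducible; HasDegree) renaming (Poly to ℤ[X]; eval to evalℤ)

IsGCDOfValues : ℤ[X] → ℕ → Set
IsGCDOfValues P δ =
  (∀ k → + δ ℤ.∣ evalℤ P (+ k)) ×
  (∀ e → (∀ k → + e ℤ.∣ evalℤ P (+ k)) → e ℕ.∣ δ)

φ : ℤ[X] → ℕ → ℕ
φ P n = length (filter (λ k → ℕ.gcd ℤ.∣ evalℤ P (+ k) ∣ n ℕₚ.≟ 1) (upTo n))

------------------------------------------------------------------------
-- Splitting fields over ℚ and Galois groups

HasCardinality : ∀ {a ℓ} → Setoid a ℓ → ℕ → Set (a ⊔ ℓ)
HasCardinality S n = Inverse S (≡.setoid (Fin n))

module RationalExtension {a ℓ₁ ℓ₂} (K : HeytingField a ℓ₁ ℓ₂) where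
  open HeytingField K

  rawRing : RawRing a ℓ₁
  rawRing = CommutativeRing.rawRing
    (HeytingCommutativeRing.commutativeRing (HeytingField.heytingCommutativeRing K))

  open Polynomials rawRing public
    using () renaming (_≈_ to _≈ₚ_; scale to scaleₚ; fromRoots to fromRootsₚ; eval to evalₚ)

  module _ (ι : ℚ → Carrier) where

    embed : ℤ[X] → List Carrier
    embed = map (λ z → ι (z / 1))

    -- the subfield ℚ(ys)
    data Generated (ys : List Carrier) : Carrier → Set (a ⊔ ℓ₁) where
      rational  : ∀ q → Generated ys (ι q)
      generator : ∀ {y} → y ∈ ys → Generated ys y
      sum       : ∀ {x y} → Generated ys x → Generated ys y → Generated ys (x + y)
      product   : ∀ {x y} → Generated ys x → Generated ys y → Generated ys (x * y)
      negative  : ∀ {x} → Generated ys x → Generated ys (- x)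
      inverse   : ∀ {x y} → x * y ≈ 1# → Generated ys x → Generated ys y
      respects  : ∀ {x y} → x ≈ y → Generated ys x → Generated ys y

record SplittingField (a ℓ₁ ℓ₂ : Level) (P : ℤ[X]) : Set (lsuc (a ⊔ ℓ₁ ⊔ ℓ₂)) where
  field
    K : HeytingField a ℓ₁ ℓ₂

  open HeytingField K public
  open RationalExtension K public

  field
    ι         : ℚ → Carrier
    isHom     : RingMorphisms.IsRingHomomorphism Rat.+-*-rawRing rawRing ι
    lead      : Carrier
    roots     : List Carrier
    splits    : embed ι P ≈ₚ scaleₚ lead (fromRootsₚ roots)
    generated : ∀ x → Generated ι roots x

  IsRoot : Carrier → Set ℓ₁
  IsRoot y = evalₚ (embed ι P) y ≈ 0#

module GaloisGroup {a ℓ₁ ℓ₂ P} (S : SplittingField a ℓ₁ ℓ₂ P) where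
  open SplittingField S using (Carrier; _≈_; rawRing; ι)
  private
    module K = SplittingField S

  record Automorphism : Set (a ⊔ ℓ₁) where
    field
      σ                 : Carrier → Carrier
      isRingIsomorphism : RingMorphisms.IsRingIsomorphism rawRing rawRing σ
      fixesℚ            : ∀ q → σ (ι q) ≈ ι q

  open Automorphism public

  Gal : Setoid (a ⊔ ℓ₁) (a ⊔ ℓ₁)
  Gal = record
    { Carrier       = Automorphism
    ; _≈_           = λ f g → ∀ x → σ f x ≈ σ g x
    ; isEquivalence = record
      { refl  = λ _ → K.refl
      ; sym   = λ f≈g x → K.sym (f≈g x)
      ; trans = λ f≈g g≈h x → K.trans (f≈g x) (g≈h x)
      }
    }

  Fixing : Carrier → Setoid (a ⊔ ℓ₁) (a ⊔ ℓ₁)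
  Fixing y = record
    { Carrier       = Σ[ f ∈ Automorphism ] σ f y ≈ y
    ; _≈_           = λ f g → Setoid._≈_ Gal (proj₁ f) (proj₁ g)
    ; isEquivalence = On.isEquivalence proj₁ (Setoid.isEquivalence Gal)
    }

  identity : Automorphism
  identity = record
    { σ                 = λ x → x
    ; isRingIsomorphism = Identity.isRingIsomorphism rawRing K.refl
    ; fixesℚ            = λ _ → K.refl
    }

  order-nonZero : ∀ {m} → HasCardinality Gal m → ℕ.NonZero m
  order-nonZero {zero}  |G|≡0 with () ← Inverse.to |G|≡0 identity
  order-nonZero {suc m} _ = _

  fixingProportion : ∀ {m s} y → HasCardinality Gal m → HasCardinality (Fixing y) s → ℚ
  fixingProportion {m} {s} _ |G|≡m _ = _/_ (+ s) m {{order-nonZero |G|≡m}}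

{-
Orbit-stabiliser gives q d ≥ 1, so it suffices to bound φ_P(n) from below by n (log log n)^(-1-ε) for large n.  By the
Chinese remainder theorem φ_P(n)/n is the product of 1 - ρ(p)/p over the primes p dividing n, where ρ(p) counts the roots
of P modulo p.  The primes p > z contribute a bounded factor once z exceeds a multiple of log n.

The product of 1 + 1/p over the pairs (p , a) with p ≤ z prime and P(a) ≡ 0 mod p expands into the sum of 1/N(T) over sets
T of such pairs, N(T) being the product of the primes in T.  By pigeonhole some nonzero f of degree < d whose coefficients
have size at most about N(T)^(1/d) vanishes on T.  As P is irreducible, f is coprime to P, and counting values of the
combinations f u + P w shows that the set of all pairs at which f vanishes has norm O(H^d), where H bounds the coefficients
of f.  Hence f determines T up to boundedly many choices, only O(x) sets T have N(T) ≤ x, and the product over p ≤ z is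
O(log z log log z).  No prime ideal theorem is needed, since the extra factor log log z is absorbed by ε.
-}
module Submission where

-- Let R be the product of 1 + 1/p over the pairs. Summing 1/N(T) over N(T) ≤ x costs a factor log
-- x, and N(T) ranges up to the product of all p, whose logarithm may be as large as a multiple of
-- z. Hence R is bounded in terms of itself. Sets with more than K elements contribute at most
-- R²/2^K, because 1 + 2/p ≤ (1 + 1/p)²; with 2^K between 2R and 4R this is at most half of R. The
-- remaining sets have N(T) ≤ z^K, so R = O(K log z) with K about log R, and this is where the
-- factor log log z comes from.
--
-- The norm bound uses counting in place of resultants and ideal norms: a combination f u + P w,
-- corrected by one residue for each pair, is determined by its values at 0, ..., 2d - 2, and there
-- cannot be more combinations than possible values.
--
-- Passing from 1 + 1/p to 1 - ρ(p)/p costs factors 1 - O(1/p²), whose product stays away from 0.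
-- All analytic inequalities are proved for the rational truncations of the series of log and exp,
-- with explicit indices from which they hold.

open import Algebra.Bundles using (CommutativeRing)

-- Root counting over commutative rings

module PolynomialRoots {c ℓ} (R : CommutativeRing c ℓ) where

  open import Defs using (module Polynomials)
  open import Data.List.Base using (List; []; _∷_; length)
  open import Data.List.Relation.Unary.All using (All; []; _∷_)
  open import Data.List.Relation.Unary.AllPairs using (AllPairs; []; _∷_)
  open import Data.Nat.Base as ℕ using (ℕ; zero; suc)
  open import Relation.Binary.PropositionalEquality as ≡ using (_≡_)
  open import Algebra.Solver.Ring.NaturalCoefficients.Default
    (CommutativeRing.commutativeSemiring R) using (solve; _:=_; _:+_; _:*_)
  open CommutativeRing R
  open Polynomials rawRing using (coeff; eval)
  import Relation.Binary.Reasoning.Setoid setoid as ≈-Reasoning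

  -- Cancellable elements. In this form one root count serves the integers, the residues modulo a
  -- prime and the splitting field, where `¬ x ≈ y` does not hand over an inverse of `y - x`.
  Regular : Carrier → Set _
  Regular a = ∀ x → a * x ≈ 0# → x ≈ 0#

  eval-zero : ∀ p x → (∀ i → coeff p i ≈ 0#) → eval p x ≈ 0#
  eval-zero []      x p≈0 = refl
  eval-zero (a ∷ p) x p≈0 = trans
    (+-cong (p≈0 0) (trans (*-congˡ (eval-zero p x (λ i → p≈0 (suc i)))) (zeroʳ x)))
    (+-identityˡ 0#)

  eval-cong : ∀ p {x y} → x ≈ y → eval p x ≈ eval p y
  eval-cong []      x≈y = refl
  eval-cong (a ∷ p) x≈y = +-congˡ (*-cong x≈y (eval-cong p x≈y))

  -- X p(X) - r p(r) = (X - r) (horner r p)(X)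
  horner : Carrier → List Carrier → List Carrier
  horner r []      = []
  horner r (a ∷ p) = eval (a ∷ p) r ∷ horner r p

  length-horner : ∀ r p → length (horner r p) ≡ length p
  length-horner r []      = ≡.refl
  length-horner r (a ∷ p) = ≡.cong suc (length-horner r p)

  -- Evaluating at `r + e` keeps subtraction out of the identity, so that a solver for commutative
  -- semirings can close it. The extra factor `r + e` on the left is the shift by one degree that
  -- `a ∷ p` introduces.
  horner-factor : ∀ p r e → (r + e) * eval p (r + e) ≈ r * eval p r + e * eval (horner r p) (r + e)
  horner-factor [] r e = trans (zeroʳ (r + e))
    (sym (trans (+-cong (zeroʳ r) (zeroʳ e)) (+-identityˡ 0#)))
  horner-factor (a ∷ p) r e = begin
    x * (a + x * eval p x)
      ≈⟨ *-congˡ (+-congˡ (horner-factor p r e)) ⟩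
    x * (a + (r * eval p r + e * eval (horner r p) x))
      ≈⟨ solve 5 (λ r e a v w → (r :+ e) :* (a :+ (r :* v :+ e :* w))
           := r :* (a :+ r :* v) :+ e :* ((a :+ r :* v) :+ (r :+ e) :* w)) refl
           r e a (eval p r) (eval (horner r p) x) ⟩
    r * (a + r * eval p r) + e * (a + r * eval p r + x * eval (horner r p) x) ∎
    where
    open ≈-Reasoning
    x = r + e

  -- The coefficients of `horner r p` arise from those of `p` by a unitriangular map, so vanishing
  -- is recovered from the top coefficient downwards.
  horner-zero : ∀ r p → (∀ i → coeff (horner r p) i ≈ 0#) → ∀ i → coeff p i ≈ 0#
  horner-zero r []      h i       = refl
  horner-zero r (a ∷ p) h (suc i) = horner-zero r p (λ i → h (suc i)) i
  horner-zero r (a ∷ p) h zero    = begin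
    a                ≈⟨ +-identityʳ a ⟨
    a + 0#           ≈⟨ +-congˡ (zeroʳ r) ⟨
    a + r * 0#       ≈⟨ +-congˡ (*-congˡ (eval-zero p r (horner-zero r p (λ i → h (suc i))))) ⟨
    a + r * eval p r ≈⟨ h 0 ⟩
    0#               ∎
    where open ≈-Reasoning

  -- The quotient by X - r has one coefficient fewer and, since each `s - r` can be cancelled, keeps
  -- all remaining roots. Once the quotient vanishes, so does `p`, and the root `r` then kills the
  -- constant term.
  roots⇒zero : ∀ p rs → length p ℕ.≤ length rs → AllPairs (λ r s → Regular (s - r)) rs →
               All (λ r → eval p r ≈ 0#) rs → ∀ i → coeff p i ≈ 0#
  roots⇒zero []      rs       _          _             _            i = refl
  roots⇒zero (a ∷ p) (r ∷ rs) (ℕ.s≤s le) (reg ∷ regs)  (root ∷ roots) = coeffs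
    where
    open ≈-Reasoning
    quotient-root : ∀ s → Regular (s - r) → eval (a ∷ p) s ≈ 0# → eval (horner r p) s ≈ 0#
    quotient-root s regular s-root = regular _ (begin
      (s - r) * eval (horner r p) s
        ≈⟨ *-congˡ (eval-cong (horner r p) (sym r+e≈s)) ⟩
      e * eval (horner r p) (r + e)
        ≈⟨ +-identityˡ _ ⟨
      0# + e * eval (horner r p) (r + e)
        ≈⟨ +-congʳ root ⟨
      (a + r * eval p r) + e * eval (horner r p) (r + e)
        ≈⟨ +-assoc _ _ _ ⟩
      a + (r * eval p r + e * eval (horner r p) (r + e))
        ≈⟨ +-congˡ (horner-factor p r e) ⟨
      a + (r + e) * eval p (r + e)
        ≈⟨ +-congˡ (*-cong r+e≈s (eval-cong p r+e≈s)) ⟩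
      a + s * eval p s
        ≈⟨ s-root ⟩
      0# ∎)
      where
      e = s - r
      r+e≈s : r + e ≈ s
      r+e≈s = trans (+-congˡ (+-comm s (- r))) (trans (sym (+-assoc r (- r) s))
                (trans (+-congʳ (-‿inverseʳ r)) (+-identityˡ s)))
    quotient-roots : ∀ {ss} → All (λ s → Regular (s - r)) ss → All (λ s → eval (a ∷ p) s ≈ 0#) ss →
                     All (λ s → eval (horner r p) s ≈ 0#) ss
    quotient-roots []         []         = []
    quotient-roots (reg ∷ rg) (rt ∷ rts) = quotient-root _ reg rt ∷ quotient-roots rg rts
    tail-zero : ∀ i → coeff p i ≈ 0#
    tail-zero = horner-zero r p (roots⇒zero (horner r p) rs
      (≡.subst (ℕ._≤ length rs) (≡.sym (length-horner r p)) le) regs (quotient-roots reg roots))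
    coeffs : ∀ i → coeff (a ∷ p) i ≈ 0#
    coeffs (suc i) = tail-zero i
    coeffs zero    = begin
      a                ≈⟨ +-identityʳ a ⟨
      a + 0#           ≈⟨ +-congˡ (zeroʳ r) ⟨
      a + r * 0#       ≈⟨ +-congˡ (*-congˡ (eval-zero p r tail-zero)) ⟨
      a + r * eval p r ≈⟨ root ⟩
      0#               ∎

-- Integer polynomials: division, Gauss's lemma, coprimality to an irreducible polynomial

module IntegerPolynomials where

  open import Defs using (module Polynomials; ℤ[X]; Irreducible; HasDegree)
  open import Data.Integer.Base as ℤ using (ℤ; +_; -[1+_]; 0ℤ; 1ℤ)
  import Data.Integer.Properties as ℤₚ
  open import Data.Integer.Solver using (module +-*-Solver)
  open import Data.Integer.Divisibility.Signed as ℤ∣ using (divides) renaming (_∣_ to _∣ₛ_)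
  open import Data.List.Base using (List; []; _∷_; length; _∷ʳ_; map; upTo)
  import Data.List.Properties as List
  open import Data.List.Relation.Unary.All as All using (All; []; _∷_)
  import Data.List.Relation.Unary.All.Properties as All
  open import Data.List.Relation.Unary.AllPairs as AllPairs using (AllPairs; []; _∷_)
  import Data.List.Relation.Unary.AllPairs.Properties as AllPairs
  import Data.List.Relation.Unary.Unique.Propositional.Properties as Unique
  open import Data.Nat.Base as ℕ using (ℕ; zero; suc; z≤n; s≤s)
  import Data.Nat.Properties as ℕₚ
  open import Data.Nat.Primality using (Prime; euclidsLemma; prime⇒nonZero)
  open import Data.Nat.Primality.Factorisation using (factorise)
  import Data.Nat.Divisibility as ℕ∣
  open import Data.Nat.ListAction using (product)
  open import Data.Product.Base using (∃-syntax; _×_; _,_; proj₁; proj₂)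
  open import Data.Sum.Base using (_⊎_; inj₁; inj₂; [_,_]′)
  open import Data.Empty using (⊥-elim)
  open import Relation.Binary.PropositionalEquality
  open import Relation.Nullary using (¬_; yes; no; contradiction)
  open PolynomialRoots ℤₚ.+-*-commutativeRing public using (Regular; roots⇒zero; eval-zero)
  open Polynomials ℤ.+-*-rawRing public using (coeff; scale; eval) renaming (_+_ to _⊕_; _*_ to _⊛_)
  open +-*-Solver
  import Algebra.Definitions.RawMagma as Divisor

  eval-⊕ : ∀ p q x → eval (p ⊕ q) x ≡ eval p x ℤ.+ eval q x
  eval-⊕ []      q       x = sym (ℤₚ.+-identityˡ _)
  eval-⊕ (a ∷ p) []      x = sym (ℤₚ.+-identityʳ _)
  eval-⊕ (a ∷ p) (b ∷ q) x = trans (cong (λ t → a ℤ.+ b ℤ.+ x ℤ.* t) (eval-⊕ p q x))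
    (solve 5 (λ a b x u v → a :+ b :+ x :* (u :+ v) := a :+ x :* u :+ (b :+ x :* v)) refl a b x (eval p x) (eval q x))

  eval-scale : ∀ a p x → eval (scale a p) x ≡ a ℤ.* eval p x
  eval-scale a []      x = sym (ℤₚ.*-zeroʳ a)
  eval-scale a (b ∷ p) x = trans (cong (λ t → a ℤ.* b ℤ.+ x ℤ.* t) (eval-scale a p x))
    (solve 4 (λ a b x u → a :* b :+ x :* (a :* u) := a :* (b :+ x :* u)) refl a b x (eval p x))

  eval-⊛ : ∀ p q x → eval (p ⊛ q) x ≡ eval p x ℤ.* eval q x
  eval-⊛ []      q x = sym (ℤₚ.*-zeroˡ (eval q x))
  eval-⊛ (a ∷ p) q x = trans (eval-⊕ (scale a q) (0ℤ ∷ p ⊛ q) x)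
    (trans (cong₂ (λ s t → s ℤ.+ (0ℤ ℤ.+ x ℤ.* t)) (eval-scale a q x) (eval-⊛ p q x))
      (solve 4 (λ a x u v → a :* v :+ (con 0ℤ :+ x :* (u :* v)) := (a :+ x :* u) :* v) refl a x (eval p x) (eval q x)))

  coeff-⊕ : ∀ p q i → coeff (p ⊕ q) i ≡ coeff p i ℤ.+ coeff q i
  coeff-⊕ []      q       i       = sym (ℤₚ.+-identityˡ _)
  coeff-⊕ (a ∷ p) []      i       = sym (ℤₚ.+-identityʳ _)
  coeff-⊕ (a ∷ p) (b ∷ q) zero    = refl
  coeff-⊕ (a ∷ p) (b ∷ q) (suc i) = coeff-⊕ p q i

  coeff-scale : ∀ a p i → coeff (scale a p) i ≡ a ℤ.* coeff p i
  coeff-scale a []      i       = sym (ℤₚ.*-zeroʳ a)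
  coeff-scale a (b ∷ p) zero    = refl
  coeff-scale a (b ∷ p) (suc i) = coeff-scale a p i

  length-⊕ : ∀ {n} p q → length p ℕ.≤ n → length q ℕ.≤ n → length (p ⊕ q) ℕ.≤ n
  length-⊕ []      q       _         q≤n       = q≤n
  length-⊕ (a ∷ p) []      p≤n       _         = p≤n
  length-⊕ (a ∷ p) (b ∷ q) (s≤s p≤n) (s≤s q≤n) = s≤s (length-⊕ p q p≤n q≤n)

  length-scale : ∀ a p → length (scale a p) ≡ length p
  length-scale a p = List.length-map (a ℤ.*_) p

  coeff-beyond : ∀ p i → length p ℕ.≤ i → coeff p i ≡ 0ℤ
  coeff-beyond []      i       _       = refl
  coeff-beyond (a ∷ p) (suc i) (s≤s h) = coeff-beyond p i h

  regular : ∀ {a} → a ≢ 0ℤ → Regular a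
  regular {a} a≢0 x ax≡0 with ℤₚ.i*j≡0⇒i≡0∨j≡0 a ax≡0
  ... | inj₁ a≡0 = contradiction a≡0 a≢0
  ... | inj₂ x≡0 = x≡0

  points-regular : ∀ n → AllPairs (λ r s → Regular (s ℤ.- r)) (map +_ (upTo n))
  points-regular n = AllPairs.map⁺ (AllPairs.map
    (λ r≢s → regular (λ s-r≡0 → r≢s (sym (ℤₚ.+-injective (ℤₚ.i-j≡0⇒i≡j _ _ s-r≡0)))))
    (Unique.upTo⁺ n))

  vanishes⇒zero : ∀ p {n} → length p ℕ.≤ n → (∀ j → j ℕ.< n → eval p (+ j) ≡ 0ℤ) → ∀ i → coeff p i ≡ 0ℤ
  vanishes⇒zero p {n} p≤n h = roots⇒zero p (map +_ (upTo n))
    (subst (length p ℕ.≤_) (sym (trans (List.length-map +_ (upTo n)) (List.length-upTo n))) p≤n)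
    (points-regular n)
    (All.map⁺ (All.applyUpTo⁺₁ (λ j → j) n (λ j<n → h _ j<n)))

  -- Lets polynomial identities be proved pointwise by the integer ring solver; coefficient lists,
  -- with their trailing zeros, are compared only at the end.
  eval-injective : ∀ p q → (∀ x → eval p x ≡ eval q x) → ∀ i → coeff p i ≡ coeff q i
  eval-injective p q h i = ℤₚ.i-j≡0⇒i≡j _ _ (begin
    coeff p i ℤ.- coeff q i                ≡⟨ cong (λ t → coeff p i ℤ.+ t) (ℤₚ.-1*i≡-i (coeff q i)) ⟨
    coeff p i ℤ.+ ℤ.-1ℤ ℤ.* coeff q i      ≡⟨ cong (λ t → coeff p i ℤ.+ t) (coeff-scale ℤ.-1ℤ q i) ⟨
    coeff p i ℤ.+ coeff (scale ℤ.-1ℤ q) i  ≡⟨ coeff-⊕ p (scale ℤ.-1ℤ q) i ⟨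
    coeff r i                              ≡⟨ vanishes⇒zero r ℕₚ.≤-refl (λ j _ → r≡0 (+ j)) i ⟩
    0ℤ ∎)
    where
    open ≡-Reasoning
    r = p ⊕ scale ℤ.-1ℤ q
    r≡0 : ∀ x → eval r x ≡ 0ℤ
    r≡0 x = begin
      eval r x                              ≡⟨ eval-⊕ p (scale ℤ.-1ℤ q) x ⟩
      eval p x ℤ.+ eval (scale ℤ.-1ℤ q) x   ≡⟨ cong₂ ℤ._+_ (h x) (eval-scale ℤ.-1ℤ q x) ⟩
      eval q x ℤ.+ ℤ.-1ℤ ℤ.* eval q x       ≡⟨ solve 1 (λ a → a :+ con ℤ.-1ℤ :* a := con 0ℤ) refl (eval q x) ⟩
      0ℤ ∎

  zero-coeffs : ∀ p → (∀ x → eval p x ≡ 0ℤ) → ∀ i → coeff p i ≡ 0ℤ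
  zero-coeffs p h = vanishes⇒zero p ℕₚ.≤-refl (λ j _ → h (+ j))

  ⊕-∷ʳ : ∀ p q c → length p ℕ.≤ length q → p ⊕ (q ∷ʳ c) ≡ (p ⊕ q) ∷ʳ c
  ⊕-∷ʳ []      q       c _       = refl
  ⊕-∷ʳ (a ∷ p) (b ∷ q) c (s≤s h) = cong (a ℤ.+ b ∷_) (⊕-∷ʳ p q c h)

  coeff-∷ʳ : ∀ p c → coeff (p ∷ʳ c) (length p) ≡ c
  coeff-∷ʳ []      c = refl
  coeff-∷ʳ (a ∷ p) c = coeff-∷ʳ p c

  length-⊕-longer : ∀ p q → length p ℕ.≤ length q → length (p ⊕ q) ≡ length q
  length-⊕-longer []      q       _       = refl
  length-⊕-longer (a ∷ p) (b ∷ q) (s≤s h) = cong suc (length-⊕-longer p q h)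

  -- The form `p ∷ʳ a` exposes the leading coefficient. Since `length r` is the degree of the
  -- product, this is additivity of degrees together with multiplicativity of leading coefficients.
  ⊛-∷ʳ : ∀ p a q b → ∃[ r ] length r ≡ length p ℕ.+ length q × (p ∷ʳ a) ⊛ (q ∷ʳ b) ≡ r ∷ʳ a ℤ.* b
  ⊛-∷ʳ [] a q b = scale-snoc q
    where
    scale-snoc : ∀ q → ∃[ r ] length r ≡ length q × scale a (q ∷ʳ b) ⊕ (0ℤ ∷ []) ≡ r ∷ʳ a ℤ.* b
    scale-snoc []          = [] , refl , cong (_∷ []) (ℤₚ.+-identityʳ (a ℤ.* b))
    scale-snoc (c ∷ [])    = a ℤ.* c ℤ.+ 0ℤ ∷ [] , refl , refl
    scale-snoc (c ∷ d ∷ q) = a ℤ.* c ℤ.+ 0ℤ ∷ scale a (d ∷ q) , cong suc (length-scale a (d ∷ q)) ,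
      cong (a ℤ.* c ℤ.+ 0ℤ ∷_) (List.map-++ (a ℤ.*_) (d ∷ q) (b ∷ []))
  ⊛-∷ʳ (x ∷ p) a q b with r , |r| , eq ← ⊛-∷ʳ p a q b =
    scale x (q ∷ʳ b) ⊕ (0ℤ ∷ r) ,
    trans (length-⊕-longer (scale x (q ∷ʳ b)) (0ℤ ∷ r) le) (cong suc |r|) ,
    trans (cong (λ t → scale x (q ∷ʳ b) ⊕ (0ℤ ∷ t)) eq) (⊕-∷ʳ (scale x (q ∷ʳ b)) (0ℤ ∷ r) (a ℤ.* b) le)
    where
    le : length (scale x (q ∷ʳ b)) ℕ.≤ suc (length r)
    le = subst₂ ℕ._≤_ (sym (trans (length-scale x (q ∷ʳ b)) (trans (List.length-++ q) (ℕₚ.+-comm (length q) 1))))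
           (cong suc (sym |r|)) (s≤s (ℕₚ.m≤n+m (length q) (length p)))

  -- Trailing zeros are legal, so a degree is available only after this normalisation. The strict
  -- bound on `length q` makes it usable in descents on the length.
  strip : ∀ p → (∀ i → coeff p i ≡ 0ℤ) ⊎
          ∃[ q ] ∃[ c ] (c ≢ 0ℤ × length q ℕ.< length p × (∀ x → eval p x ≡ eval (q ∷ʳ c) x))
  strip [] = inj₁ (λ _ → refl)
  strip (a ∷ p) with strip p
  ... | inj₂ (q , c , c≢0 , q<p , eq) = inj₂ (a ∷ q , c , c≢0 , s≤s q<p , λ x → cong (λ t → a ℤ.+ x ℤ.* t) (eq x))
  ... | inj₁ p≡0 with a ℤₚ.≟ 0ℤ
  ...   | yes a≡0 = inj₁ (λ { zero → a≡0 ; (suc i) → p≡0 i })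
  ...   | no  a≢0 = inj₂ ([] , a , a≢0 , s≤s z≤n , λ x → cong (λ t → a ℤ.+ x ℤ.* t) (eval-zero p x p≡0))

  -- Otherwise the leading coefficient of the product, itself a product of nonzero integers, would
  -- sit at an index beyond the end of `q`.
  multiple-short⇒zero : ∀ p a h q → a ≢ 0ℤ → length q ℕ.≤ length p →
                        (∀ x → eval (p ∷ʳ a) x ℤ.* eval h x ≡ eval q x) → ∀ x → eval q x ≡ 0ℤ
  multiple-short⇒zero p a h q a≢0 q≤p eq x with strip h
  ... | inj₁ h≡0 = trans (sym (eq x)) (trans (cong (eval (p ∷ʳ a) x ℤ.*_) (eval-zero h x h≡0)) (ℤₚ.*-zeroʳ (eval (p ∷ʳ a) x)))
  ... | inj₂ (h₀ , b , b≢0 , _ , h≡) with r , |r| , prod ← ⊛-∷ʳ p a h₀ b =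
    ⊥-elim (b≢0 (regular a≢0 b (begin
      a ℤ.* b                          ≡⟨ coeff-∷ʳ r (a ℤ.* b) ⟨
      coeff (r ∷ʳ a ℤ.* b) (length r)  ≡⟨ eval-injective (r ∷ʳ a ℤ.* b) q evals (length r) ⟩
      coeff q (length r)               ≡⟨ coeff-beyond q (length r) (ℕₚ.≤-trans q≤p (subst (length p ℕ.≤_) (sym |r|) (ℕₚ.m≤m+n _ _))) ⟩
      0ℤ                               ∎)))
    where
    open ≡-Reasoning
    evals : ∀ x → eval (r ∷ʳ a ℤ.* b) x ≡ eval q x
    evals x = begin
      eval (r ∷ʳ a ℤ.* b) x                ≡⟨ cong (λ t → eval t x) prod ⟨
      eval ((p ∷ʳ a) ⊛ (h₀ ∷ʳ b)) x        ≡⟨ eval-⊛ (p ∷ʳ a) (h₀ ∷ʳ b) x ⟩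
      eval (p ∷ʳ a) x ℤ.* eval (h₀ ∷ʳ b) x ≡⟨ cong (eval (p ∷ʳ a) x ℤ.*_) (h≡ x) ⟨
      eval (p ∷ʳ a) x ℤ.* eval h x         ≡⟨ eq x ⟩
      eval q x                             ∎

  -- The combination c s - t f without its top entry: between `s ∷ʳ t` and `f ∷ʳ c` the leading
  -- terms cancel.
  eliminate : ℤ → ℤ → List ℤ → List ℤ → List ℤ
  eliminate c t (x ∷ s) (y ∷ f) = c ℤ.* x ℤ.- t ℤ.* y ∷ eliminate c t s f
  eliminate c t _       _       = []

  length-eliminate : ∀ c t s f → length (eliminate c t s f) ℕ.≤ length f
  length-eliminate c t []      f       = z≤n
  length-eliminate c t (x ∷ s) []      = z≤n
  length-eliminate c t (x ∷ s) (y ∷ f) = s≤s (length-eliminate c t s f)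

  eval-eliminate : ∀ c t s f x → length s ≡ length f →
    c ℤ.* eval (s ∷ʳ t) x ≡ t ℤ.* eval (f ∷ʳ c) x ℤ.+ eval (eliminate c t s f) x
  eval-eliminate c t [] [] x _ =
    solve 3 (λ c t x → c :* (t :+ x :* con 0ℤ) := t :* (c :+ x :* con 0ℤ) :+ con 0ℤ) refl c t x
  eval-eliminate c t (y ∷ s) (z ∷ f) x eq = begin
    c ℤ.* (y ℤ.+ x ℤ.* S)  ≡⟨ solve 4 (λ c y x S → c :* (y :+ x :* S) := c :* y :+ x :* (c :* S)) refl c y x S ⟩
    c ℤ.* y ℤ.+ x ℤ.* (c ℤ.* S)
      ≡⟨ cong (λ u → c ℤ.* y ℤ.+ x ℤ.* u) (eval-eliminate c t s f x (ℕₚ.suc-injective eq)) ⟩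
    c ℤ.* y ℤ.+ x ℤ.* (t ℤ.* F ℤ.+ R)
      ≡⟨ solve 7 (λ c t y z x F R → c :* y :+ x :* (t :* F :+ R)
           := t :* (z :+ x :* F) :+ (c :* y :- t :* z :+ x :* R)) refl c t y z x F R ⟩
    t ℤ.* (z ℤ.+ x ℤ.* F) ℤ.+ (c ℤ.* y ℤ.- t ℤ.* z ℤ.+ x ℤ.* R) ∎
    where
    open ≡-Reasoning
    S = eval (s ∷ʳ t) x
    F = eval (f ∷ʳ c) x
    R = eval (eliminate c t s f) x

  unsnoc : ∀ (p : List ℤ) {n} → length p ≡ suc n → ∃[ q ] ∃[ c ] (p ≡ q ∷ʳ c × length q ≡ n)
  unsnoc (a ∷ [])    refl = [] , a , refl , refl
  unsnoc (a ∷ b ∷ p) refl with q , c , eq , len ← unsnoc (b ∷ p) refl = a ∷ q , c , cong (a ∷_) eq , cong suc len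

  -- Division in the style of Horner, from the top coefficient down. The leading coefficient `c`
  -- need not be a unit, so each elimination multiplies the dividend by `c`, and `k` collects these
  -- factors.
  pseudo-division : ∀ f c p → c ≢ 0ℤ → ∃[ k ] ∃[ g ] ∃[ r ] (k ≢ 0ℤ × length r ℕ.≤ length f ×
    (∀ x → k ℤ.* eval p x ≡ eval (f ∷ʳ c) x ℤ.* eval g x ℤ.+ eval r x))
  pseudo-division f c [] c≢0 = 1ℤ , [] , [] , (λ ()) , z≤n , λ x →
    sym (trans (ℤₚ.+-identityʳ (eval (f ∷ʳ c) x ℤ.* 0ℤ)) (ℤₚ.*-zeroʳ (eval (f ∷ʳ c) x)))
  pseudo-division f c (a ∷ p) c≢0 with pseudo-division f c p c≢0
  ... | k , g , r , k≢0 , r≤f , eq with length r ℕₚ.≟ length f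
  ...   | no  r≢f = k , 0ℤ ∷ g , k ℤ.* a ∷ r , k≢0 , ℕₚ.≤∧≢⇒< r≤f r≢f , λ x → begin
    k ℤ.* (a ℤ.+ x ℤ.* eval p x)
      ≡⟨ solve 4 (λ k a x v → k :* (a :+ x :* v) := k :* a :+ x :* (k :* v)) refl k a x (eval p x) ⟩
    k ℤ.* a ℤ.+ x ℤ.* (k ℤ.* eval p x)
      ≡⟨ cong (λ t → k ℤ.* a ℤ.+ x ℤ.* t) (eq x) ⟩
    k ℤ.* a ℤ.+ x ℤ.* (eval (f ∷ʳ c) x ℤ.* eval g x ℤ.+ eval r x)
      ≡⟨ solve 5 (λ b x F g r → b :+ x :* (F :* g :+ r) := F :* (con 0ℤ :+ x :* g) :+ (b :+ x :* r)) refl (k ℤ.* a) x (eval (f ∷ʳ c) x) (eval g x) (eval r x) ⟩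
    eval (f ∷ʳ c) x ℤ.* (0ℤ ℤ.+ x ℤ.* eval g x) ℤ.+ (k ℤ.* a ℤ.+ x ℤ.* eval r x) ∎
    where open ≡-Reasoning
  -- Here `k a ∷ r` has exactly the length of `f ∷ʳ c`, and a single elimination brings it below
  -- again.
  ...   | yes r≡f with s , t , st , |s| ← unsnoc (k ℤ.* a ∷ r) {length f} (cong suc r≡f) =
    c ℤ.* k , t ∷ scale c g , eliminate c t s f , (λ ck≡0 → k≢0 (regular c≢0 k ck≡0)) , length-eliminate c t s f , λ x → begin
    c ℤ.* k ℤ.* (a ℤ.+ x ℤ.* eval p x)
      ≡⟨ solve 5 (λ c k a x v → c :* k :* (a :+ x :* v) := c :* (k :* a :+ x :* (k :* v))) refl c k a x (eval p x) ⟩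
    c ℤ.* (k ℤ.* a ℤ.+ x ℤ.* (k ℤ.* eval p x))
      ≡⟨ cong (λ u → c ℤ.* (k ℤ.* a ℤ.+ x ℤ.* u)) (eq x) ⟩
    c ℤ.* (k ℤ.* a ℤ.+ x ℤ.* (eval (f ∷ʳ c) x ℤ.* eval g x ℤ.+ eval r x))
      ≡⟨ solve 6 (λ c b x F g r → c :* (b :+ x :* (F :* g :+ r)) := F :* (x :* (c :* g)) :+ c :* (b :+ x :* r)) refl c (k ℤ.* a) x (eval (f ∷ʳ c) x) (eval g x) (eval r x) ⟩
    eval (f ∷ʳ c) x ℤ.* (x ℤ.* (c ℤ.* eval g x)) ℤ.+ c ℤ.* eval (k ℤ.* a ∷ r) x
      ≡⟨ cong (λ l → eval (f ∷ʳ c) x ℤ.* (x ℤ.* (c ℤ.* eval g x)) ℤ.+ c ℤ.* eval l x) st ⟩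
    eval (f ∷ʳ c) x ℤ.* (x ℤ.* (c ℤ.* eval g x)) ℤ.+ c ℤ.* eval (s ∷ʳ t) x
      ≡⟨ cong₂ (λ u v → eval (f ∷ʳ c) x ℤ.* (x ℤ.* u) ℤ.+ v) (sym (eval-scale c g x)) (eval-eliminate c t s f x |s|) ⟩
    eval (f ∷ʳ c) x ℤ.* (x ℤ.* eval (scale c g) x) ℤ.+ (t ℤ.* eval (f ∷ʳ c) x ℤ.+ eval (eliminate c t s f) x)
      ≡⟨ solve 5 (λ F x g t r → F :* (x :* g) :+ (t :* F :+ r) := F :* (t :+ x :* g) :+ r) refl (eval (f ∷ʳ c) x) x (eval (scale c g) x) t (eval (eliminate c t s f) x) ⟩
    eval (f ∷ʳ c) x ℤ.* (t ℤ.+ x ℤ.* eval (scale c g) x) ℤ.+ eval (eliminate c t s f) x ∎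
    where open ≡-Reasoning

  ∣scale⊕⇒∣ : ∀ {p} a s t → p ∣ₛ a → (∀ i → p ∣ₛ coeff (scale a s ⊕ t) i) → ∀ i → p ∣ₛ coeff t i
  ∣scale⊕⇒∣ {p} a s t p∣a h i = ℤ∣.∣m+n∣m⇒∣n {p} {coeff (scale a s) i} {coeff t i}
    (subst (p ∣ₛ_) (coeff-⊕ (scale a s) t i) (h i))
    (subst (p ∣ₛ_) (sym (coeff-scale a s i)) (ℤ∣.∣m⇒∣m*n (coeff s i) p∣a))

  ⊛-unfoldʳ : ∀ f b g i → coeff (f ⊛ (b ∷ g)) i ≡ coeff (scale b f ⊕ (0ℤ ∷ f ⊛ g)) i
  ⊛-unfoldʳ f b g = eval-injective (f ⊛ (b ∷ g)) (scale b f ⊕ (0ℤ ∷ f ⊛ g)) (λ x → begin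
    eval (f ⊛ (b ∷ g)) x
      ≡⟨ eval-⊛ f (b ∷ g) x ⟩
    eval f x ℤ.* (b ℤ.+ x ℤ.* eval g x)
      ≡⟨ solve 4 (λ F b x g → F :* (b :+ x :* g) := b :* F :+ (con 0ℤ :+ x :* (F :* g))) refl (eval f x) b x (eval g x) ⟩
    b ℤ.* eval f x ℤ.+ (0ℤ ℤ.+ x ℤ.* (eval f x ℤ.* eval g x))
      ≡⟨ cong₂ (λ s t → s ℤ.+ (0ℤ ℤ.+ x ℤ.* t)) (eval-scale b f x) (eval-⊛ f g x) ⟨
    eval (scale b f) x ℤ.+ eval (0ℤ ∷ f ⊛ g) x
      ≡⟨ eval-⊕ (scale b f) (0ℤ ∷ f ⊛ g) x ⟨
    eval (scale b f ⊕ (0ℤ ∷ f ⊛ g)) x ∎)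
    where open ≡-Reasoning

  prime∣* : ∀ {p} → Prime p → ∀ a b → + p ∣ₛ a ℤ.* b → + p ∣ₛ a ⊎ + p ∣ₛ b
  prime∣* {p} pr a b h
    with euclidsLemma ℤ.∣ a ∣ ℤ.∣ b ∣ pr (subst (p ℕ∣.∣_) (ℤₚ.abs-* a b) (ℤ∣.∣⇒∣ᵤ h))
  ... | inj₁ p∣a = inj₁ (ℤ∣.∣ᵤ⇒∣ {+ p} {a} p∣a)
  ... | inj₂ p∣b = inj₂ (ℤ∣.∣ᵤ⇒∣ {+ p} {b} p∣b)

  ∷-∣ : ∀ {p} a f → p ∣ₛ a → (∀ i → p ∣ₛ coeff f i) → ∀ i → p ∣ₛ coeff (a ∷ f) i
  ∷-∣ a f p∣a p∣f zero    = p∣a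
  ∷-∣ a f p∣a p∣f (suc i) = p∣f i

  -- Polynomials over ℤ/p have no zero divisors: `p` divides one of the two constant terms, that
  -- term may be dropped from its factor, and the product with the shortened factor is again
  -- divisible.
  prime∣⊛ : ∀ {p} → Prime p → ∀ f g → (∀ i → + p ∣ₛ coeff (f ⊛ g) i) →
            (∀ i → + p ∣ₛ coeff f i) ⊎ (∀ i → + p ∣ₛ coeff g i)
  prime∣⊛ pr []      g       h = inj₁ (λ _ → divides 0ℤ refl)
  prime∣⊛ pr (a ∷ f) []      h = inj₂ (λ _ → divides 0ℤ refl)
  prime∣⊛ {p} pr (a ∷ f) (b ∷ g) h =
    [ (λ p∣a → [ (λ p∣f → inj₁ (∷-∣ a f p∣a p∣f)) , inj₂ ]′
        (prime∣⊛ pr f (b ∷ g) (∣scale⊕⇒∣ a g (f ⊛ (b ∷ g)) p∣a (λ i → h (suc i)))))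
    , (λ p∣b → [ inj₁ , (λ p∣g → inj₂ (∷-∣ b g p∣b p∣g)) ]′
        (prime∣⊛ pr (a ∷ f) g (∣scale⊕⇒∣ b f ((a ∷ f) ⊛ g) p∣b
          (λ i → subst (+ p ∣ₛ_) (⊛-unfoldʳ (a ∷ f) b g (suc i)) (h (suc i))))))
    ]′ (prime∣* pr a b (subst (+ p ∣ₛ_) (ℤₚ.+-identityʳ (a ℤ.* b)) (h 0)))

  divide-out : ∀ p f → (∀ i → p ∣ₛ coeff f i) → ∃[ g ] (∀ x → eval f x ≡ p ℤ.* eval g x)
  divide-out p []      h = [] , λ x → sym (ℤₚ.*-zeroʳ p)
  divide-out p (a ∷ f) h with h 0 | divide-out p f (λ i → h (suc i))
  ... | divides q a≡qp | g , eq = q ∷ g , λ x → trans (cong₂ (λ s t → s ℤ.+ x ℤ.* t) a≡qp (eq x))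
    (solve 4 (λ q p x g → q :* p :+ x :* (p :* g) := p :* (q :+ x :* g)) refl q p x (eval g x))

  -- Gauss's lemma, clearing the prime factors of the constant one at a time.
  clear-content : ∀ ps → All Prime ps → ∀ P f g →
    (∀ x → + product ps ℤ.* eval P x ≡ eval f x ℤ.* eval g x) →
    ∃[ b ] ∃[ f′ ] ∃[ g′ ] (b ≢ 0ℤ × (∀ x → eval f x ≡ b ℤ.* eval f′ x) ×
                            (∀ x → eval P x ≡ eval f′ x ℤ.* eval g′ x))
  clear-content [] [] P f g eq = 1ℤ , f , g , (λ ()) ,
    (λ x → sym (ℤₚ.*-identityˡ (eval f x))) , λ x → trans (sym (ℤₚ.*-identityˡ (eval P x))) (eq x)
  clear-content (p ∷ ps) (pr ∷ prs) P f g eq =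
    [ (λ p∣f → let f₁ , f≡ = divide-out (+ p) f p∣f
                   b , f′ , g′ , b≢0 , f₁≡ , P≡ = clear-content ps prs P f₁ g (λ x → cancel (begin
                     + p ℤ.* (+ c ℤ.* eval P x)            ≡⟨ unfold x ⟩
                     eval f x ℤ.* eval g x                 ≡⟨ cong (ℤ._* eval g x) (f≡ x) ⟩
                     + p ℤ.* eval f₁ x ℤ.* eval g x        ≡⟨ ℤₚ.*-assoc (+ p) (eval f₁ x) (eval g x) ⟩
                     + p ℤ.* (eval f₁ x ℤ.* eval g x)      ∎))
               in + p ℤ.* b , f′ , g′ , (λ e → b≢0 (regular p≢0 b e)) ,
                  (λ x → trans (f≡ x) (trans (cong (+ p ℤ.*_) (f₁≡ x)) (sym (ℤₚ.*-assoc (+ p) b (eval f′ x))))) , P≡)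
    , (λ p∣g → let g₁ , g≡ = divide-out (+ p) g p∣g
               in clear-content ps prs P f g₁ (λ x → cancel (begin
                     + p ℤ.* (+ c ℤ.* eval P x)            ≡⟨ unfold x ⟩
                     eval f x ℤ.* eval g x                 ≡⟨ cong (eval f x ℤ.*_) (g≡ x) ⟩
                     eval f x ℤ.* (+ p ℤ.* eval g₁ x)      ≡⟨ solve 3 (λ f p g → f :* (p :* g) := p :* (f :* g)) refl (eval f x) (+ p) (eval g₁ x) ⟩
                     + p ℤ.* (eval f x ℤ.* eval g₁ x)      ∎)))
    ]′ (prime∣⊛ pr f g (λ i → subst (+ p ∣ₛ_) (coeffs i) (divides (+ c ℤ.* coeff P i) (ℤₚ.*-comm (+ p) (+ c ℤ.* coeff P i)))))
    where
    open ≡-Reasoning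
    c = product ps
    p≢0 : + p ≢ 0ℤ
    p≢0 e = ℕ.≢-nonZero⁻¹ p {{prime⇒nonZero pr}} (ℤₚ.+-injective e)
    cancel : ∀ {a b} → + p ℤ.* a ≡ + p ℤ.* b → a ≡ b
    cancel {a} {b} = ℤₚ.*-cancelˡ-≡ (+ p) a b {{prime⇒nonZero pr}}
    unfold : ∀ x → + p ℤ.* (+ c ℤ.* eval P x) ≡ eval f x ℤ.* eval g x
    unfold x = trans (trans (sym (ℤₚ.*-assoc (+ p) (+ c) (eval P x))) (cong (ℤ._* eval P x) (sym (ℤₚ.pos-* p c)))) (eq x)
    coeffs : ∀ i → + p ℤ.* (+ c ℤ.* coeff P i) ≡ coeff (f ⊛ g) i
    coeffs i = trans (cong (+ p ℤ.*_) (sym (coeff-scale (+ c) P i)))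
      (trans (sym (coeff-scale (+ p) (scale (+ c) P) i)) (eval-injective (scale (+ p) (scale (+ c) P)) (f ⊛ g) (λ x → begin
        eval (scale (+ p) (scale (+ c) P)) x ≡⟨ trans (eval-scale (+ p) (scale (+ c) P) x) (cong (+ p ℤ.*_) (eval-scale (+ c) P x)) ⟩
        + p ℤ.* (+ c ℤ.* eval P x)           ≡⟨ unfold x ⟩
        eval f x ℤ.* eval g x                ≡⟨ eval-⊛ f g x ⟨
        eval (f ⊛ g) x                       ∎) i))

  -- Recording that `f` is a nonzero multiple of `f′` carries the degree of `f` through Gauss's
  -- lemma; a bare factorisation of `P` would not say how large its factors are.
  clear-denominator : ∀ k P f g → k ≢ 0ℤ → (∀ x → k ℤ.* eval P x ≡ eval f x ℤ.* eval g x) →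
    ∃[ b ] ∃[ f′ ] ∃[ g′ ] (b ≢ 0ℤ × (∀ x → eval f x ≡ b ℤ.* eval f′ x) ×
                            (∀ x → eval P x ≡ eval f′ x ℤ.* eval g′ x))
  clear-denominator (+ zero)    P f g k≢0 eq = contradiction refl k≢0
  clear-denominator (+ suc k)   P f g k≢0 eq with factorise (suc k)
  ... | record { factors = ps ; isFactorisation = k≡ ; factorsPrime = prs } =
    clear-content ps prs P f g (λ x → trans (cong (λ t → + t ℤ.* eval P x) (sym k≡)) (eq x))
  clear-denominator -[1+ k ] P f g k≢0 eq with factorise (suc k)
  ... | record { factors = ps ; isFactorisation = k≡ ; factorsPrime = prs } =
    clear-content ps prs P f (scale ℤ.-1ℤ g) (λ x → begin
      + product ps ℤ.* eval P x ≡⟨ cong (λ t → + t ℤ.* eval P x) k≡ ⟨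
      + suc k ℤ.* eval P x                          ≡⟨ solve 2 (λ k P → k :* P := con ℤ.-1ℤ :* (:- k :* P)) refl (+ suc k) (eval P x) ⟩
      ℤ.-1ℤ ℤ.* (-[1+ k ] ℤ.* eval P x)             ≡⟨ cong (ℤ.-1ℤ ℤ.*_) (eq x) ⟩
      ℤ.-1ℤ ℤ.* (eval f x ℤ.* eval g x)             ≡⟨ solve 3 (λ m f g → m :* (f :* g) := f :* (m :* g)) refl ℤ.-1ℤ (eval f x) (eval g x) ⟩
      eval f x ℤ.* (ℤ.-1ℤ ℤ.* eval g x)             ≡⟨ cong (eval f x ℤ.*_) (eval-scale ℤ.-1ℤ g x) ⟨
      eval f x ℤ.* eval (scale ℤ.-1ℤ g) x           ∎)
    where open ≡-Reasoning

  leading-term : ∀ P {d} → HasDegree P d →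
                 ∃[ q ] ∃[ c ] (c ≢ 0ℤ × length q ≡ d × (∀ x → eval P x ≡ eval (q ∷ʳ c) x))
  leading-term P {d} (Pd≢0 , above) with strip P
  ... | inj₁ P≡0 = contradiction (P≡0 d) Pd≢0
  ... | inj₂ (q , c , c≢0 , _ , P≡) = q , c , c≢0 , ℕₚ.≤-antisym
          (ℕₚ.≮⇒≥ (λ d<q → c≢0 (trans (sym (coeff-∷ʳ q c)) (trans (sym (coeffs (length q))) (above (length q) d<q)))))
          (ℕₚ.≮⇒≥ (λ q<d → Pd≢0 (trans (coeffs d) (coeff-beyond (q ∷ʳ c) d
            (subst (ℕ._≤ d) (sym (trans (List.length-++ q) (ℕₚ.+-comm (length q) 1))) q<d))))) , P≡
    where
    coeffs = eval-injective P (q ∷ʳ c) P≡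

  eval-≈1 : ∀ p → (∀ i → coeff p i ≡ coeff (1ℤ ∷ []) i) → ∀ x → eval p x ≡ 1ℤ
  eval-≈1 []      h x with () ← h 0
  eval-≈1 (e ∷ p) h x = trans (cong₂ (λ s t → s ℤ.+ x ℤ.* t) (h 0) (eval-zero p x (λ i → h (suc i))))
    (trans (cong (λ z → 1ℤ ℤ.+ z) (ℤₚ.*-zeroʳ x)) refl)

  module _ {P : ℤ[X]} (irreducible : Irreducible P) {d : ℕ} (deg : HasDegree P d) where
    open ≡-Reasoning
    private
      P₀ = proj₁ (leading-term P deg)
      a  = proj₁ (proj₂ (leading-term P deg))
      a≢0 : a ≢ 0ℤ
      a≢0 = proj₁ (proj₂ (proj₂ (leading-term P deg)))
      |P₀| : length P₀ ≡ d
      |P₀| = proj₁ (proj₂ (proj₂ (proj₂ (leading-term P deg))))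
      P≡ : ∀ x → eval P x ≡ eval (P₀ ∷ʳ a) x
      P≡ = proj₂ (proj₂ (proj₂ (proj₂ (leading-term P deg))))

    short-multiple⇒zero : ∀ h q → length q ℕ.≤ d → (∀ x → eval P x ℤ.* eval h x ≡ eval q x) → ∀ x → eval q x ≡ 0ℤ
    short-multiple⇒zero h q q≤d eq = multiple-short⇒zero P₀ a h q a≢0 (subst (length q ℕ.≤_) (sym |P₀|) q≤d)
      (λ x → trans (cong (ℤ._* eval h x) (sym (P≡ x))) (eq x))

    -- Gauss's lemma moves the factorisation to ℤ, where irreducibility makes `f′` or `g′` a unit.
    -- In the first case `f₀ ∷ʳ c` divides the nonzero constant `b`, in the second `P` divides
    -- `f₀ ∷ʳ c`; both contradict the degrees.
    no-proper-factor : ∀ k f₀ c g → k ≢ 0ℤ → c ≢ 0ℤ → 1 ℕ.≤ length f₀ → length f₀ ℕ.< d →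
                       ¬ (∀ x → k ℤ.* eval P x ≡ eval (f₀ ∷ʳ c) x ℤ.* eval g x)
    no-proper-factor k f₀ c g k≢0 c≢0 1≤f f<d eq
      with b , f′ , g′ , b≢0 , f≡ , P≡f′g′ ← clear-denominator k P (f₀ ∷ʳ c) g k≢0 eq
      with Irreducible.split-∣1 irreducible {f′} {g′}
             (eval-injective P (f′ ⊛ g′) (λ x → trans (P≡f′g′ x) (sym (eval-⊛ f′ g′ x))))
    ... | inj₁ (h Divisor., hf′≈1) = b≢0 (trans (sym (constant 0ℤ)) (multiple-short⇒zero f₀ c h (b ∷ []) c≢0 1≤f (λ x → begin
      eval (f₀ ∷ʳ c) x ℤ.* eval h x    ≡⟨ cong (ℤ._* eval h x) (f≡ x) ⟩
      b ℤ.* eval f′ x ℤ.* eval h x     ≡⟨ solve 3 (λ b f h → b :* f :* h := b :* (h :* f)) refl b (eval f′ x) (eval h x) ⟩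
      b ℤ.* (eval h x ℤ.* eval f′ x)   ≡⟨ cong (b ℤ.*_) (sym (eval-⊛ h f′ x)) ⟩
      b ℤ.* eval (h ⊛ f′) x            ≡⟨ cong (b ℤ.*_) (eval-≈1 (h ⊛ f′) hf′≈1 x) ⟩
      b ℤ.* 1ℤ                         ≡⟨ trans (ℤₚ.*-identityʳ b) (sym (constant x)) ⟩
      eval (b ∷ []) x                  ∎) 0ℤ))
      where
      constant : ∀ x → eval (b ∷ []) x ≡ b
      constant x = trans (cong (λ z → b ℤ.+ z) (ℤₚ.*-zeroʳ x)) (ℤₚ.+-identityʳ b)
    ... | inj₂ (h Divisor., hg′≈1) = c≢0 (trans (sym (coeff-∷ʳ f₀ c)) (zero-coeffs (f₀ ∷ʳ c)
      (short-multiple⇒zero (scale b h) (f₀ ∷ʳ c)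
        (subst (ℕ._≤ d) (sym (trans (List.length-++ f₀) (ℕₚ.+-comm (length f₀) 1))) f<d) (λ x → begin
        eval P x ℤ.* eval (scale b h) x                 ≡⟨ cong₂ ℤ._*_ (P≡f′g′ x) (eval-scale b h x) ⟩
        eval f′ x ℤ.* eval g′ x ℤ.* (b ℤ.* eval h x)
          ≡⟨ solve 4 (λ f g b h → f :* g :* (b :* h) := b :* f :* (h :* g)) refl (eval f′ x) (eval g′ x) b (eval h x) ⟩
        b ℤ.* eval f′ x ℤ.* (eval h x ℤ.* eval g′ x)    ≡⟨ cong₂ ℤ._*_ (sym (f≡ x)) (sym (eval-⊛ h g′ x)) ⟩
        eval (f₀ ∷ʳ c) x ℤ.* eval (h ⊛ g′) x            ≡⟨ cong (eval (f₀ ∷ʳ c) x ℤ.*_) (eval-≈1 (h ⊛ g′) hg′≈1 x) ⟩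
        eval (f₀ ∷ʳ c) x ℤ.* 1ℤ                         ≡⟨ ℤₚ.*-identityʳ (eval (f₀ ∷ʳ c) x) ⟩
        eval (f₀ ∷ʳ c) x                                ∎)) (length f₀)))

    -- Irreducible implies prime, by Euclidean descent: if k P = F g + r, where F is the trimmed f,
    -- then r u is again a multiple of P and r is shorter than f. A zero remainder would make F a
    -- proper factor of P, and a nonzero constant f ends the descent.
    ∣product⇒zero : ∀ n f u w → length f ℕ.≤ n → n ℕ.≤ d → length u ℕ.≤ d →
                    (∀ x → eval f x ℤ.* eval u x ≡ eval P x ℤ.* eval w x) →
                    (∀ x → eval f x ≡ 0ℤ) ⊎ (∀ x → eval u x ≡ 0ℤ)
    ∣product⇒zero zero [] u w _ _ _ _ = inj₁ (λ _ → refl)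
    ∣product⇒zero (suc n) f u w f≤n n≤d u≤d eq =
      [ (λ f≡0 → inj₁ (λ x → eval-zero f x f≡0)) , (λ (f₀ , c , c≢0 , f₀<f , f≡) → go f₀ c c≢0 f₀<f f≡) ]′ (strip f)
      where
      go : ∀ f₀ c → c ≢ 0ℤ → length f₀ ℕ.< length f → (∀ x → eval f x ≡ eval (f₀ ∷ʳ c) x) →
           (∀ x → eval f x ≡ 0ℤ) ⊎ (∀ x → eval u x ≡ 0ℤ)
      go [] c c≢0 _ f≡ = inj₂ (λ x → regular c≢0 (eval u x) (trans (sym (eval-scale c u x))
        (short-multiple⇒zero w (scale c u) (subst (ℕ._≤ d) (sym (length-scale c u)) u≤d) (λ x → begin
          eval P x ℤ.* eval w x            ≡⟨ eq x ⟨
          eval f x ℤ.* eval u x            ≡⟨ cong (ℤ._* eval u x) (trans (f≡ x) (trans (cong (λ z → c ℤ.+ z) (ℤₚ.*-zeroʳ x)) (ℤₚ.+-identityʳ c))) ⟩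
          c ℤ.* eval u x                   ≡⟨ eval-scale c u x ⟨
          eval (scale c u) x               ∎) x)))
      go f₀@(_ ∷ _) c c≢0 f₀<f f≡ =
        let k , g , r , k≢0 , r≤f₀ , div = pseudo-division f₀ c P c≢0
            F = f₀ ∷ʳ c
        in [ (λ r≡0 → ⊥-elim (no-proper-factor k f₀ c g k≢0 c≢0 (s≤s z≤n) (ℕₚ.≤-trans f₀<f (ℕₚ.≤-trans f≤n n≤d))
               (λ x → trans (div x) (trans (cong (λ z → eval F x ℤ.* eval g x ℤ.+ z) (r≡0 x)) (ℤₚ.+-identityʳ (eval F x ℤ.* eval g x))))))
           , inj₂ ]′
           (∣product⇒zero n r u (scale k u ⊕ scale ℤ.-1ℤ (g ⊛ w))
             (ℕₚ.≤-trans r≤f₀ (ℕₚ.≤-pred (ℕₚ.≤-trans f₀<f f≤n))) (ℕₚ.≤-trans (ℕₚ.n≤1+n n) n≤d) u≤d (λ x → begin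
          eval r x ℤ.* eval u x
            ≡⟨ remainder (eval r x) (eval u x) (eval F x) (eval g x) ⟩
          (eval F x ℤ.* eval g x ℤ.+ eval r x) ℤ.* eval u x ℤ.+ ℤ.-1ℤ ℤ.* (eval g x ℤ.* (eval F x ℤ.* eval u x))
            ≡⟨ cong₂ (λ s t → s ℤ.* eval u x ℤ.+ ℤ.-1ℤ ℤ.* (eval g x ℤ.* t)) (sym (div x))
                 (trans (cong (ℤ._* eval u x) (sym (f≡ x))) (eq x)) ⟩
          k ℤ.* eval P x ℤ.* eval u x ℤ.+ ℤ.-1ℤ ℤ.* (eval g x ℤ.* (eval P x ℤ.* eval w x))
            ≡⟨ multiple k (eval P x) (eval u x) (eval g x) (eval w x) ⟩
          eval P x ℤ.* (k ℤ.* eval u x ℤ.+ ℤ.-1ℤ ℤ.* (eval g x ℤ.* eval w x))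
            ≡⟨ cong (eval P x ℤ.*_) (cong₂ ℤ._+_ (sym (eval-scale k u x))
                 (trans (cong (ℤ.-1ℤ ℤ.*_) (sym (eval-⊛ g w x))) (sym (eval-scale ℤ.-1ℤ (g ⊛ w) x)))) ⟩
          eval P x ℤ.* (eval (scale k u) x ℤ.+ eval (scale ℤ.-1ℤ (g ⊛ w)) x)
            ≡⟨ cong (eval P x ℤ.*_) (eval-⊕ (scale k u) (scale ℤ.-1ℤ (g ⊛ w)) x) ⟨
          eval P x ℤ.* eval (scale k u ⊕ scale ℤ.-1ℤ (g ⊛ w)) x ∎))
        where
        remainder : ∀ r u F g → r ℤ.* u ≡ (F ℤ.* g ℤ.+ r) ℤ.* u ℤ.+ ℤ.-1ℤ ℤ.* (g ℤ.* (F ℤ.* u))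
        remainder = solve 4 (λ r u F g → r :* u := (F :* g :+ r) :* u :+ con ℤ.-1ℤ :* (g :* (F :* u))) refl
        multiple : ∀ k P u g w → k ℤ.* P ℤ.* u ℤ.+ ℤ.-1ℤ ℤ.* (g ℤ.* (P ℤ.* w)) ≡ P ℤ.* (k ℤ.* u ℤ.+ ℤ.-1ℤ ℤ.* (g ℤ.* w))
        multiple = solve 5 (λ k P u g w → k :* P :* u :+ con ℤ.-1ℤ :* (g :* (P :* w)) := P :* (k :* u :+ con ℤ.-1ℤ :* (g :* w))) refl

    -- This makes the combinations f u + P w distinct when they are counted later. Primality of P
    -- disposes of u; what is left is P w = 0, settled by leading coefficients.
    coprime-combination : ∀ f u w → length f ℕ.≤ d → length u ℕ.≤ d → ¬ (∀ x → eval f x ≡ 0ℤ) →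
      (∀ x → eval f x ℤ.* eval u x ℤ.+ eval P x ℤ.* eval w x ≡ 0ℤ) →
      (∀ x → eval u x ≡ 0ℤ) × (∀ x → eval w x ≡ 0ℤ)
    coprime-combination f u w f≤d u≤d f≢0 eq
      with ∣product⇒zero d f u (scale ℤ.-1ℤ w) f≤d ℕₚ.≤-refl u≤d (λ x → begin
        eval f x ℤ.* eval u x
          ≡⟨ solve 4 (λ f u P w → f :* u := (f :* u :+ P :* w) :+ P :* (con ℤ.-1ℤ :* w)) refl (eval f x) (eval u x) (eval P x) (eval w x) ⟩
        (eval f x ℤ.* eval u x ℤ.+ eval P x ℤ.* eval w x) ℤ.+ eval P x ℤ.* (ℤ.-1ℤ ℤ.* eval w x)
          ≡⟨ cong₂ (λ s t → s ℤ.+ eval P x ℤ.* t) (eq x) (sym (eval-scale ℤ.-1ℤ w x)) ⟩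
        0ℤ ℤ.+ eval P x ℤ.* eval (scale ℤ.-1ℤ w) x
          ≡⟨ ℤₚ.+-identityˡ (eval P x ℤ.* eval (scale ℤ.-1ℤ w) x) ⟩
        eval P x ℤ.* eval (scale ℤ.-1ℤ w) x ∎)
    ... | inj₁ f≡0 = contradiction f≡0 f≢0
    ... | inj₂ u≡0 with strip w
    ...   | inj₁ w≡0 = u≡0 , λ x → eval-zero w x w≡0
    ...   | inj₂ (w₀ , b , b≢0 , _ , w≡) = ⊥-elim (a≢0 (regular b≢0 a (trans (ℤₚ.*-comm b a)
            (trans (sym (coeff-∷ʳ r (a ℤ.* b))) (zero-coeffs (r ∷ʳ a ℤ.* b) (λ x → begin
              eval (r ∷ʳ a ℤ.* b) x                 ≡⟨ cong (λ t → eval t x) prod ⟨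
              eval ((P₀ ∷ʳ a) ⊛ (w₀ ∷ʳ b)) x        ≡⟨ eval-⊛ (P₀ ∷ʳ a) (w₀ ∷ʳ b) x ⟩
              eval (P₀ ∷ʳ a) x ℤ.* eval (w₀ ∷ʳ b) x ≡⟨ cong₂ ℤ._*_ (sym (P≡ x)) (sym (w≡ x)) ⟩
              eval P x ℤ.* eval w x                 ≡⟨ ℤₚ.+-identityˡ (eval P x ℤ.* eval w x) ⟨
              0ℤ ℤ.+ eval P x ℤ.* eval w x          ≡⟨ cong (ℤ._+ eval P x ℤ.* eval w x) (ℤₚ.*-zeroʳ (eval f x)) ⟨
              eval f x ℤ.* 0ℤ ℤ.+ eval P x ℤ.* eval w x
                                                    ≡⟨ cong (λ t → eval f x ℤ.* t ℤ.+ eval P x ℤ.* eval w x) (u≡0 x) ⟨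
              eval f x ℤ.* eval u x ℤ.+ eval P x ℤ.* eval w x ≡⟨ eq x ⟩
              0ℤ                                    ∎) (length r))))))
            where
            r = proj₁ (⊛-∷ʳ P₀ a w₀ b)
            prod = proj₂ (proj₂ (⊛-∷ʳ P₀ a w₀ b))

-- Mixed radix codes for finite families

module MixedRadix where

  open import Data.Fin.Base as Fin using (Fin; zero; suc; combine; remQuot)
  import Data.Fin.Properties as Finₚ
  open import Data.Nat.Base using (ℕ; zero; suc; _*_; _^_; _≤_; z≤n; s≤s)
  import Data.Nat.Properties as ℕₚ
  open import Data.Product.Base using (proj₁; proj₂)
  open import Function.Base using (_∘_)
  open import Relation.Binary.PropositionalEquality

  ∏ : ∀ {r} → (Fin r → ℕ) → ℕ
  ∏ {zero}  p = 1
  ∏ {suc r} p = p zero * ∏ (p ∘ suc)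

  ∏-const : ∀ r m → ∏ {r} (λ _ → m) ≡ m ^ r
  ∏-const zero    m = refl
  ∏-const (suc r) m = cong (m *_) (∏-const r m)

  ∏-mono : ∀ {r} {p q : Fin r → ℕ} → (∀ i → p i ≤ q i) → ∏ p ≤ ∏ q
  ∏-mono {zero}  h = s≤s z≤n
  ∏-mono {suc r} h = ℕₚ.*-mono-≤ (h zero) (∏-mono (λ i → h (suc i)))

  ∏-pos : ∀ {r} {p : Fin r → ℕ} → (∀ i → 1 ≤ p i) → 1 ≤ ∏ p
  ∏-pos {zero}  h = s≤s z≤n
  ∏-pos {suc r} h = ℕₚ.*-mono-≤ (h zero) (∏-pos (λ i → h (suc i)))

  encode : ∀ {r} (p : Fin r → ℕ) → (∀ i → Fin (p i)) → Fin (∏ p)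
  encode {zero}  p k = zero
  encode {suc r} p k = combine (k zero) (encode (p ∘ suc) (λ i → k (suc i)))

  -- Families are compared pointwise, which avoids function extensionality.
  encode-injective : ∀ {r} (p : Fin r → ℕ) {k l} → encode p k ≡ encode p l → ∀ i → k i ≡ l i
  encode-injective {suc r} p {k} {l} eq zero    = proj₁ (Finₚ.combine-injective (k zero) _ (l zero) _ eq)
  encode-injective {suc r} p {k} {l} eq (suc i) =
    encode-injective (p ∘ suc) (proj₂ (Finₚ.combine-injective (k zero) _ (l zero) _ eq)) i

  decode : ∀ {r} (p : Fin r → ℕ) → Fin (∏ p) → ∀ i → Fin (p i)
  decode {suc r} p x zero    = proj₁ (remQuot {p zero} (∏ (p ∘ suc)) x)
  decode {suc r} p x (suc i) = decode (p ∘ suc) (proj₂ (remQuot {p zero} (∏ (p ∘ suc)) x)) i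

  remQuot-injective : ∀ m n {x y : Fin (m * n)} → proj₁ (remQuot {m} n x) ≡ proj₁ (remQuot {m} n y) →
                      proj₂ (remQuot {m} n x) ≡ proj₂ (remQuot {m} n y) → x ≡ y
  remQuot-injective m n {x} {y} e₁ e₂ = trans (sym (Finₚ.combine-remQuot {m} n x))
    (trans (cong₂ combine e₁ e₂) (Finₚ.combine-remQuot {m} n y))

  decode-injective : ∀ {r} (p : Fin r → ℕ) {x y} → (∀ i → decode p x i ≡ decode p y i) → x ≡ y
  decode-injective {zero}  p {zero} {zero} eq = refl
  decode-injective {suc r} p eq = remQuot-injective (p zero) (∏ (p ∘ suc)) (eq zero)
    (decode-injective (p ∘ suc) (λ i → eq (suc i)))

-- Roots of P modulo a prime

module ModularRoots where

  open import Defs using (ℤ[X]; HasDegree; IsGCDOfValues; module Polynomials)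
  open IntegerPolynomials
  open import Algebra.Bundles using (CommutativeRing)
  open import Data.Integer.Base as ℤ using (ℤ; +_; 0ℤ; 1ℤ)
  import Data.Integer.Properties as ℤₚ
  open import Data.Integer.Solver using (module +-*-Solver)
  open import Data.Integer.Divisibility.Signed as ℤ∣ using (divides) renaming (_∣_ to _∣ₛ_)
  open import Data.List.Base using (List; []; _∷_; length; _∷ʳ_)
  import Data.List.Properties as List
  open import Data.List.Relation.Unary.All as All using (All)
  open import Data.List.Relation.Unary.AllPairs as AllPairs using (AllPairs)
  open import Data.Nat.Base as ℕ using (ℕ; zero; suc)
  import Data.Nat.Properties as ℕₚ
  import Data.Nat.Divisibility as ℕ∣
  open import Data.Nat.Primality using (Prime)
  open import Data.Product.Base using (_,_; proj₂)
  open import Data.Sum.Base using (inj₁; inj₂)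
  open import Relation.Binary.PropositionalEquality
  open import Relation.Nullary using (¬_; yes; no; contradiction)
  open +-*-Solver

  ∣-eval : ∀ {p} f → (∀ i → p ∣ₛ coeff f i) → ∀ x → p ∣ₛ eval f x
  ∣-eval []      h x = divides 0ℤ refl
  ∣-eval (a ∷ f) h x = ℤ∣.∣m∣n⇒∣m+n (h 0) (ℤ∣.∣n⇒∣m*n x (∣-eval f (λ i → h (suc i)) x))

  module Modular (n : ℕ) where
    infix 4 _≈_
    -- A record instead of plain divisibility of `x - y`, so that both sides can be inferred from a
    -- proof.
    record _≈_ (x y : ℤ) : Set where
      constructor congruent
      field difference : + n ∣ₛ x ℤ.- y
    open _≈_ public

    ≡⇒≈ : ∀ {x y} → x ≡ y → x ≈ y
    ≡⇒≈ {x} refl = congruent (divides 0ℤ (ℤₚ.+-inverseʳ x))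

    ≈0 : ∀ {x} → + n ∣ₛ x → x ≈ 0ℤ
    ≈0 {x} h = congruent (subst (+ n ∣ₛ_) (sym (ℤₚ.+-identityʳ x)) h)

    ≈0⁻¹ : ∀ {x} → x ≈ 0ℤ → + n ∣ₛ x
    ≈0⁻¹ {x} (congruent h) = subst (+ n ∣ₛ_) (ℤₚ.+-identityʳ x) h

    private
      combine : ∀ {x y u v} a b z → a ℤ.* (x ℤ.- y) ℤ.+ b ℤ.* (u ℤ.- v) ≡ z → x ≈ y → u ≈ v → + n ∣ₛ z
      combine a b z eq (congruent h) (congruent k) =
        subst (+ n ∣ₛ_) eq (ℤ∣.∣m∣n⇒∣m+n (ℤ∣.∣n⇒∣m*n a h) (ℤ∣.∣n⇒∣m*n b k))

    ring : CommutativeRing _ _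
    ring = record
      { Carrier = ℤ ; _≈_ = _≈_ ; _+_ = ℤ._+_ ; _*_ = ℤ._*_ ; -_ = ℤ.-_ ; 0# = 0ℤ ; 1# = 1ℤ
      ; isCommutativeRing = record
        { isRing = record
          { +-isAbelianGroup = record
            { isGroup = record
              { isMonoid = record
                { isSemigroup = record
                  { isMagma = record
                    { isEquivalence = record
                      { refl  = ≡⇒≈ refl
                      ; sym   = λ {x} {y} h → congruent (combine ℤ.-1ℤ 0ℤ (y ℤ.- x)
                          (solve 2 (λ x y → con ℤ.-1ℤ :* (x :- y) :+ con 0ℤ :* (x :- y) := y :- x) refl x y) h h)
                      ; trans = λ {x} {y} {z} h k → congruent (combine 1ℤ 1ℤ (x ℤ.- z)
                          (solve 3 (λ x y z → con 1ℤ :* (x :- y) :+ con 1ℤ :* (y :- z) := x :- z) refl x y z) h k)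
                      }
                    ; ∙-cong = λ {x} {y} {u} {v} h k → congruent (combine 1ℤ 1ℤ (x ℤ.+ u ℤ.- (y ℤ.+ v))
                          (solve 4 (λ x y u v → con 1ℤ :* (x :- y) :+ con 1ℤ :* (u :- v) := x :+ u :- (y :+ v)) refl x y u v) h k)
                    }
                  ; assoc = λ x y z → ≡⇒≈ (ℤₚ.+-assoc x y z)
                  }
                ; identity = (λ x → ≡⇒≈ (ℤₚ.+-identityˡ x)) , (λ x → ≡⇒≈ (ℤₚ.+-identityʳ x))
                }
              ; inverse = (λ x → ≡⇒≈ (ℤₚ.+-inverseˡ x)) , (λ x → ≡⇒≈ (ℤₚ.+-inverseʳ x))
              ; ⁻¹-cong = λ {x} {y} h → congruent (combine ℤ.-1ℤ 0ℤ (ℤ.- x ℤ.- (ℤ.- y))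
                  (solve 2 (λ x y → con ℤ.-1ℤ :* (x :- y) :+ con 0ℤ :* (x :- y) := :- x :- (:- y)) refl x y) h h)
              }
            ; comm = λ x y → ≡⇒≈ (ℤₚ.+-comm x y)
            }
          ; *-cong = λ {x} {y} {u} {v} h k → congruent (combine u y (x ℤ.* u ℤ.- y ℤ.* v)
              (solve 4 (λ x y u v → u :* (x :- y) :+ y :* (u :- v) := x :* u :- y :* v) refl x y u v) h k)
          ; *-assoc = λ x y z → ≡⇒≈ (ℤₚ.*-assoc x y z)
          ; *-identity = (λ x → ≡⇒≈ (ℤₚ.*-identityˡ x)) , (λ x → ≡⇒≈ (ℤₚ.*-identityʳ x))
          ; distrib = (λ x y z → ≡⇒≈ (ℤₚ.*-distribˡ-+ x y z)) , (λ x y z → ≡⇒≈ (ℤₚ.*-distribʳ-+ x y z))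
          }
        ; *-comm = λ x y → ≡⇒≈ (ℤₚ.*-comm x y)
        }
      }

    module Roots = PolynomialRoots ring

    prime-regular : Prime n → ∀ {a} → ¬ + n ∣ₛ a → Roots.Regular a
    prime-regular pr {a} n∤a x ax≈0 with prime∣* pr a x (≈0⁻¹ ax≈0)
    ... | inj₁ n∣a = contradiction n∣a n∤a
    ... | inj₂ n∣x = ≈0 n∣x

    open Polynomials (CommutativeRing.rawRing ring) using () renaming (eval to evalₘ; coeff to coeffₘ)

    evalₘ≡eval : ∀ p x → evalₘ p x ≡ eval p x
    evalₘ≡eval []      x = refl
    evalₘ≡eval (a ∷ p) x = cong (λ t → a ℤ.+ x ℤ.* t) (evalₘ≡eval p x)

    coeffₘ≡coeff : ∀ p i → coeffₘ p i ≡ coeff p i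
    coeffₘ≡coeff []      i       = refl
    coeffₘ≡coeff (a ∷ p) zero    = refl
    coeffₘ≡coeff (a ∷ p) (suc i) = coeffₘ≡coeff p i

    roots⇒divisible : Prime n → ∀ p rs → length p ℕ.≤ length rs →
      AllPairs (λ r s → ¬ + n ∣ₛ s ℤ.- r) rs → All (λ r → + n ∣ₛ eval p r) rs → ∀ i → + n ∣ₛ coeff p i
    roots⇒divisible pr p rs p≤rs distinct roots i = subst (+ n ∣ₛ_) (coeffₘ≡coeff p i)
      (≈0⁻¹ (Roots.roots⇒zero p rs p≤rs
        (AllPairs.map (λ {r} {s} → prime-regular pr {s ℤ.- r}) distinct)
        (All.map (λ {r} h → ≈0 (subst (+ n ∣ₛ_) (sym (evalₘ≡eval p r)) h)) roots) i))

  module _ {P : ℤ[X]} {d δ : ℕ} (deg : HasDegree P d) (gcd : IsGCDOfValues P δ) where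

    -- More than d incongruent roots would force p to divide every coefficient of P, hence every
    -- value P(k), hence δ.
    number-of-roots : ∀ {p} → Prime p → ¬ p ℕ∣.∣ δ → ∀ rs → AllPairs (λ r s → ¬ + p ∣ₛ s ℤ.- r) rs →
                      All (λ r → + p ∣ₛ eval P r) rs → length rs ℕ.≤ d
    number-of-roots {p} pr p∤δ rs distinct roots with length rs ℕₚ.≤? d
    ... | yes rs≤d = rs≤d
    -- Trimming `P` to `q ∷ʳ c` leaves exactly d + 1 coefficients, as many as d + 1 roots can
    -- control.
    ... | no  rs≰d with q , c , _ , |q| , P≡ ← leading-term P deg = contradiction
      (proj₂ gcd p (λ k → ℤ∣.∣⇒∣ᵤ (subst (+ p ∣ₛ_) (sym (P≡ (+ k))) (∣-eval (q ∷ʳ c)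
        (Modular.roots⇒divisible p pr (q ∷ʳ c) rs
          (subst (ℕ._≤ length rs) (sym (trans (List.length-++ q) (trans (ℕₚ.+-comm (length q) 1) (cong suc |q|)))) (ℕₚ.≰⇒> rs≰d))
          distinct (All.map (λ {r} → subst (+ p ∣ₛ_) (P≡ r)) roots)) (+ k)))))
      p∤δ

-- Separating polynomials for pairs (p , a)

module Separators where

  open import Defs using (ℤ[X]; HasDegree; IsGCDOfValues)
  open IntegerPolynomials
  open MixedRadix
  open ModularRoots
  open import Data.Bool.Base using (Bool; if_then_else_)
  open import Data.Fin.Base as Fin using (Fin; zero; suc; toℕ; fromℕ<)
  import Data.Fin.Properties as Finₚ
  open import Data.Integer.Base as ℤ using (ℤ; +_; 0ℤ; 1ℤ)
  import Data.Integer.Properties as ℤₚ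
  open import Data.Integer.Solver using (module +-*-Solver)
  open import Data.Integer.Divisibility.Signed as ℤ∣ using (divides) renaming (_∣_ to _∣ₛ_)
  open import Data.List.Base using (List; []; _∷_; length; map; filter; tabulate; allFin)
  import Data.List.Properties as List
  open import Data.List.Membership.Propositional using (_∈_)
  open import Data.List.Relation.Unary.Any using (here; there)
  open import Data.List.Relation.Unary.All as All using (All; []; _∷_)
  import Data.List.Relation.Unary.All.Properties as All
  open import Data.List.Relation.Unary.AllPairs as AllPairs using (AllPairs; []; _∷_)
  import Data.List.Relation.Unary.AllPairs.Properties as AllPairs
  import Data.List.Relation.Unary.Unique.Propositional.Properties as Unique
  open import Data.Nat.Base as ℕ using (ℕ; zero; suc; z≤n; s≤s)
  import Data.Nat.Properties as ℕₚ
  import Data.Nat.Divisibility as ℕ∣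
  open import Data.Nat.Primality using (Prime; prime⇒irreducible; ¬prime[1])
  open import Data.Product.Base using (_×_; _,_)
  open import Data.Sum.Base using (inj₁; inj₂; [_,_]′)
  open import Relation.Binary.PropositionalEquality
  open import Relation.Nullary using (¬_; yes; no; contradiction; Dec; ¬?; _×-dec_)
  open +-*-Solver
  open import Algebra.Properties.AbelianGroup ℤₚ.+-0-abelianGroup using () renaming (∙-cancelʳ to +-cancelʳ)

  -- The sum 1 + D + ... + D^(n-1), which bounds the powers of an argument of size at most D.
  geometric : ℕ → ℕ → ℕ
  geometric D zero    = 0
  geometric D (suc n) = 1 ℕ.+ D ℕ.* geometric D n

  ∣eval∣≤ : ∀ f {n D B j} → length f ℕ.≤ n → (∀ i → ℤ.∣ coeff f i ∣ ℕ.≤ B) → j ℕ.≤ D →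
            ℤ.∣ eval f (+ j) ∣ ℕ.≤ B ℕ.* geometric D n
  ∣eval∣≤ []      _         _ _ = z≤n
  ∣eval∣≤ (a ∷ f) {suc n} {D} {B} {j} (s≤s f≤n) h j≤D = begin
    ℤ.∣ a ℤ.+ + j ℤ.* eval f (+ j) ∣            ≤⟨ ℤₚ.∣i+j∣≤∣i∣+∣j∣ a (+ j ℤ.* eval f (+ j)) ⟩
    ℤ.∣ a ∣ ℕ.+ ℤ.∣ + j ℤ.* eval f (+ j) ∣      ≡⟨ cong (ℤ.∣ a ∣ ℕ.+_) (ℤₚ.abs-* (+ j) (eval f (+ j))) ⟩
    ℤ.∣ a ∣ ℕ.+ j ℕ.* ℤ.∣ eval f (+ j) ∣        ≤⟨ ℕₚ.+-mono-≤ (h 0) (ℕₚ.*-mono-≤ j≤D (∣eval∣≤ f f≤n (λ i → h (suc i)) j≤D)) ⟩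
    B ℕ.+ D ℕ.* (B ℕ.* geometric D n)           ≡⟨ cong (B ℕ.+_) (swap D B (geometric D n)) ⟩
    B ℕ.+ B ℕ.* (D ℕ.* geometric D n)           ≡⟨ ℕₚ.*-suc B (D ℕ.* geometric D n) ⟨
    B ℕ.* (1 ℕ.+ D ℕ.* geometric D n)           ∎
    where
    open ℕₚ.≤-Reasoning
    swap : ∀ x y z → x ℕ.* (y ℕ.* z) ≡ y ℕ.* (x ℕ.* z)
    swap x y z = trans (sym (ℕₚ.*-assoc x y z)) (trans (cong (ℕ._* z) (ℕₚ.*-comm x y)) (ℕₚ.*-assoc y x z))

  -- _⊛_ from Defs leaves spurious trailing zeros when its second argument is [].
  mul : List ℤ → List ℤ → List ℤ
  mul p []      = []
  mul p (b ∷ q) = scale b p ⊕ (0ℤ ∷ mul p q)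

  eval-mul : ∀ p q x → eval (mul p q) x ≡ eval p x ℤ.* eval q x
  eval-mul p []      x = sym (ℤₚ.*-zeroʳ (eval p x))
  eval-mul p (b ∷ q) x = trans (eval-⊕ (scale b p) (0ℤ ∷ mul p q) x)
    (trans (cong₂ (λ s t → s ℤ.+ (0ℤ ℤ.+ x ℤ.* t)) (eval-scale b p x) (eval-mul p q x))
      (solve 4 (λ b x u v → b :* u :+ (con 0ℤ :+ x :* (u :* v)) := u :* (b :+ x :* v)) refl b x (eval p x) (eval q x)))

  length-mul : ∀ p q {m n} → length p ℕ.≤ suc m → length q ≡ n → length (mul p q) ℕ.≤ m ℕ.+ n
  length-mul p []      p≤ refl = z≤n
  length-mul p (b ∷ q) {m} p≤ refl = length-⊕ (scale b p) (0ℤ ∷ mul p q)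
    (subst (ℕ._≤ m ℕ.+ suc (length q)) (sym (length-scale b p))
      (ℕₚ.≤-trans p≤ (subst (suc m ℕ.≤_) (sym (ℕₚ.+-suc m (length q))) (s≤s (ℕₚ.m≤m+n m (length q))))))
    (subst (suc (length (mul p q)) ℕ.≤_) (sym (ℕₚ.+-suc m (length q))) (s≤s (length-mul p q p≤ refl)))

  residue-injective : ∀ {p a b} → a ℕ.< p → b ℕ.< p → + p ∣ₛ + b ℤ.- + a → a ≡ b
  residue-injective {p} {a} {b} a<p b<p h with ℕₚ.≤-total a b
  ... | inj₁ a≤b = ℕₚ.≤-antisym a≤b (ℕₚ.m∸n≡0⇒m≤n (small (b ℕ.∸ a) (ℕₚ.≤-<-trans (ℕₚ.m∸n≤m b a) b<p)
          (subst (p ℕ∣.∣_) (cong ℤ.∣_∣ (trans (ℤₚ.m-n≡m⊖n b a) (ℤₚ.⊖-≥ a≤b))) (ℤ∣.∣⇒∣ᵤ h))))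
    where
    small : ∀ m → m ℕ.< p → p ℕ∣.∣ m → m ≡ 0
    small zero    _   _   = refl
    small (suc m) m<p p∣m = contradiction p∣m (ℕ∣.>⇒∤ m<p)
  ... | inj₂ b≤a = sym (ℕₚ.≤-antisym b≤a (ℕₚ.m∸n≡0⇒m≤n (small (a ℕ.∸ b) (ℕₚ.≤-<-trans (ℕₚ.m∸n≤m a b) a<p)
          (subst (p ℕ∣.∣_) (trans (cong ℤ.∣_∣ (trans (ℤₚ.m-n≡m⊖n b a) (ℤₚ.⊖-≤ b≤a))) (ℤₚ.∣-i∣≡∣i∣ (+ (a ℕ.∸ b)))) (ℤ∣.∣⇒∣ᵤ h)))))
    where
    small : ∀ m → m ℕ.< p → p ℕ∣.∣ m → m ≡ 0
    small zero    _   _   = refl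
    small (suc m) m<p p∣m = contradiction p∣m (ℕ∣.>⇒∤ m<p)

  linear : ℕ → List ℤ → List ℤ
  linear b s = (0ℤ ∷ s) ⊕ scale (ℤ.- + b) s

  eval-linear : ∀ b s x → eval (linear b s) x ≡ (x ℤ.- + b) ℤ.* eval s x
  eval-linear b s x = trans (eval-⊕ (0ℤ ∷ s) (scale (ℤ.- + b) s) x)
    (trans (cong (λ t → 0ℤ ℤ.+ x ℤ.* eval s x ℤ.+ t) (eval-scale (ℤ.- + b) s x))
      (solve 3 (λ x b s → con 0ℤ :+ x :* s :+ (:- b) :* s := (x :- b) :* s) refl x (+ b) (eval s x)))

  length-linear : ∀ b s → length (linear b s) ℕ.≤ suc (length s)
  length-linear b s = length-⊕ (0ℤ ∷ s) (scale (ℤ.- + b) s) ℕₚ.≤-refl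
    (subst (ℕ._≤ suc (length s)) (sym (length-scale (ℤ.- + b) s)) (ℕₚ.n≤1+n (length s)))

  ∑ : ∀ {r} → (Fin r → ℤ) → ℤ
  ∑ {zero}  t = 0ℤ
  ∑ {suc r} t = t zero ℤ.+ ∑ (λ i → t (suc i))

  ∑∣ : ∀ {r q} (t : Fin r → ℤ) → (∀ j → q ∣ₛ t j) → q ∣ₛ ∑ t
  ∑∣ {zero}  t h = divides 0ℤ refl
  ∑∣ {suc r} t h = ℤ∣.∣m∣n⇒∣m+n (h zero) (∑∣ (λ i → t (suc i)) (λ i → h (suc i)))

  ∑-single : ∀ {r q} (t : Fin r → ℤ) i → (∀ j → j ≢ i → q ∣ₛ t j) → q ∣ₛ ∑ t ℤ.- t i
  ∑-single {suc r} {q} t zero h = subst (q ∣ₛ_)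
    (solve 2 (λ a b → b := a :+ b :- a) refl (t zero) (∑ (λ i → t (suc i))))
    (∑∣ (λ i → t (suc i)) (λ j → h (suc j) (λ ())))
  ∑-single {suc r} {q} t (suc i) h = subst (q ∣ₛ_)
    (solve 3 (λ a b c → a :+ (b :- c) := a :+ b :- c) refl (t zero) (∑ (λ i → t (suc i))) (t (suc i)))
    (ℤ∣.∣m∣n⇒∣m+n (h zero (λ ())) (∑-single (λ i → t (suc i)) i (λ j j≢i → h (suc j) (λ e → j≢i (Finₚ.suc-injective e)))))

  ∑-cong : ∀ {r} {s t : Fin r → ℤ} → (∀ i → s i ≡ t i) → ∑ s ≡ ∑ t
  ∑-cong {zero}  h = refl
  ∑-cong {suc r} h = cong₂ ℤ._+_ (h zero) (∑-cong (λ i → h (suc i)))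

  ∑ℕ : ∀ {r} → (Fin r → ℕ) → ℕ
  ∑ℕ {zero}  t = 0
  ∑ℕ {suc r} t = t zero ℕ.+ ∑ℕ (λ i → t (suc i))

  ∣∑∣≤ : ∀ {r} (t : Fin r → ℤ) (b : Fin r → ℕ) → (∀ i → ℤ.∣ t i ∣ ℕ.≤ b i) → ℤ.∣ ∑ t ∣ ℕ.≤ ∑ℕ b
  ∣∑∣≤ {zero}  t b h = z≤n
  ∣∑∣≤ {suc r} t b h = ℕₚ.≤-trans (ℤₚ.∣i+j∣≤∣i∣+∣j∣ (t zero) (∑ (λ i → t (suc i))))
    (ℕₚ.+-mono-≤ (h zero) (∣∑∣≤ (λ i → t (suc i)) (λ i → b (suc i)) (λ i → h (suc i))))

  ∑ᵖ : ∀ {r} → (Fin r → List ℤ) → List ℤ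
  ∑ᵖ {zero}  t = []
  ∑ᵖ {suc r} t = t zero ⊕ ∑ᵖ (λ i → t (suc i))

  eval-∑ᵖ : ∀ {r} (t : Fin r → List ℤ) x → eval (∑ᵖ t) x ≡ ∑ (λ i → eval (t i) x)
  eval-∑ᵖ {zero}  t x = refl
  eval-∑ᵖ {suc r} t x = trans (eval-⊕ (t zero) (∑ᵖ (λ i → t (suc i))) x)
    (cong (λ s → eval (t zero) x ℤ.+ s) (eval-∑ᵖ (λ i → t (suc i)) x))

  length-∑ᵖ : ∀ {r n} (t : Fin r → List ℤ) → (∀ i → length (t i) ℕ.≤ n) → length (∑ᵖ t) ℕ.≤ n
  length-∑ᵖ {zero}  t h = z≤n
  length-∑ᵖ {suc r} t h = length-⊕ (t zero) (∑ᵖ (λ i → t (suc i))) (h zero) (length-∑ᵖ (λ i → t (suc i)) (λ i → h (suc i)))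

  -- A sum that serves as a crude maximum of `h 0`, ..., `h n`.
  bound : (ℕ → ℕ) → ℕ → ℕ
  bound h zero    = h 0
  bound h (suc n) = bound h n ℕ.+ h (suc n)

  ≤bound : ∀ h n {j} → j ℕ.≤ n → h j ℕ.≤ bound h n
  ≤bound h zero    z≤n = ℕₚ.≤-refl
  ≤bound h (suc n) {j} j≤ with ℕₚ.m≤n⇒m<n∨m≡n j≤
  ... | inj₁ j<1+n = ℕₚ.≤-trans (≤bound h n (ℕₚ.≤-pred j<1+n)) (ℕₚ.m≤m+n _ _)
  ... | inj₂ refl  = ℕₚ.m≤n+m _ (bound h n)

  fromDigits : ∀ {n m} → (Fin n → Fin m) → List ℤ
  fromDigits u = tabulate (λ i → + toℕ (u i))

  coeff-fromDigits : ∀ {n m} (u : Fin n → Fin m) i → coeff (fromDigits u) (toℕ i) ≡ + toℕ (u i)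
  coeff-fromDigits u zero    = refl
  coeff-fromDigits u (suc i) = coeff-fromDigits (λ i → u (suc i)) i

  ∣coeff-fromDigits∣≤ : ∀ {n m} (u : Fin n → Fin m) i → ℤ.∣ coeff (fromDigits u) i ∣ ℕ.≤ m
  ∣coeff-fromDigits∣≤ {zero}  u i       = z≤n
  ∣coeff-fromDigits∣≤ {suc n} u zero    = ℕₚ.<⇒≤ (Finₚ.toℕ<n (u zero))
  ∣coeff-fromDigits∣≤ {suc n} u (suc i) = ∣coeff-fromDigits∣≤ (λ i → u (suc i)) i

  fromDigits-injective : ∀ {n m} (u v : Fin n → Fin m) → (∀ x → eval (fromDigits u) x ≡ eval (fromDigits v) x) →
                         ∀ i → u i ≡ v i
  fromDigits-injective u v h i = Finₚ.toℕ-injective (ℤₚ.+-injective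
    (trans (sym (coeff-fromDigits u i))
      (trans (eval-injective (fromDigits u) (fromDigits v) h (toℕ i)) (coeff-fromDigits v i))))

  -- Codes an integer of absolute value at most `Y` as `v + Y`. In that range `v + Y` is
  -- nonnegative, so the absolute value loses nothing, and the default `zero` is never reached.
  shift : ∀ Y v → Fin (suc (Y ℕ.+ Y))
  shift Y v with ℤ.∣ v ℤ.+ + Y ∣ ℕₚ.<? suc (Y ℕ.+ Y)
  ... | yes lt = fromℕ< lt
  ... | no  _  = zero

  shift-injective : ∀ Y {v w} → ℤ.∣ v ∣ ℕ.≤ Y → ℤ.∣ w ∣ ℕ.≤ Y → shift Y v ≡ shift Y w → v ≡ w
  shift-injective Y {v} {w} v≤ w≤ eq
    with ℤ.∣ v ℤ.+ + Y ∣ ℕₚ.<? suc (Y ℕ.+ Y) | ℤ.∣ w ℤ.+ + Y ∣ ℕₚ.<? suc (Y ℕ.+ Y)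
  ... | no  ge | _      = contradiction (s≤s (ℕₚ.≤-trans (ℤₚ.∣i+j∣≤∣i∣+∣j∣ v (+ Y)) (ℕₚ.+-monoˡ-≤ Y v≤))) ge
  ... | yes _  | no  ge = contradiction (s≤s (ℕₚ.≤-trans (ℤₚ.∣i+j∣≤∣i∣+∣j∣ w (+ Y)) (ℕₚ.+-monoˡ-≤ Y w≤))) ge
  ... | yes lv | yes lw = +-cancelʳ (+ Y) v w (trans (sym (nonneg v v≤)) (trans
          (cong +_ (trans (sym (Finₚ.toℕ-fromℕ< lv)) (trans (cong toℕ eq) (Finₚ.toℕ-fromℕ< lw)))) (nonneg w w≤)))
    where
    nonneg : ∀ v → ℤ.∣ v ∣ ℕ.≤ Y → + ℤ.∣ v ℤ.+ + Y ∣ ≡ v ℤ.+ + Y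
    nonneg v v≤ = ℤₚ.0≤i⇒+∣i∣≡i (subst (ℤ._≤ v ℤ.+ + Y) (ℤₚ.+-inverseˡ (+ Y)) (ℤₚ.+-monoˡ-≤ (+ Y)
      (ℤₚ.≤-trans (ℤₚ.neg-mono-≤ (ℤ.+≤+ v≤)) (negabs v))))
      where
      negabs : ∀ v → ℤ.- + ℤ.∣ v ∣ ℤ.≤ v
      negabs (+ zero)   = ℤₚ.≤-refl
      negabs (+ suc n)  = ℤ.-≤+
      negabs ℤ.-[1+ n ] = ℤₚ.≤-refl

  cancel : ∀ f P u u′ w w′ s t → f ℤ.* u ℤ.+ (P ℤ.* w ℤ.+ s) ≡ f ℤ.* u′ ℤ.+ (P ℤ.* w′ ℤ.+ t) →
           f ℤ.* (u′ ℤ.- u) ℤ.+ P ℤ.* (w′ ℤ.- w) ≡ s ℤ.- t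
  cancel f P u u′ w w′ s t h = trans
    (solve 8 (λ f P u u′ w w′ s t → f :* (u′ :- u) :+ P :* (w′ :- w) :=
       (f :* u′ :+ (P :* w′ :+ t)) :- (f :* u :+ (P :* w :+ s)) :+ (s :- t)) refl f P u u′ w w′ s t)
    (trans (cong (ℤ._+ (s ℤ.- t)) (ℤₚ.i≡j⇒i-j≡0 (sym h))) (ℤₚ.+-identityˡ (s ℤ.- t)))

  cancel-∣ : ∀ q f P u u′ w w′ s t → f ℤ.* u ℤ.+ (P ℤ.* w ℤ.+ s) ≡ f ℤ.* u′ ℤ.+ (P ℤ.* w′ ℤ.+ t) →
             q ∣ₛ f → q ∣ₛ P → q ∣ₛ s ℤ.- t
  cancel-∣ q f P u u′ w w′ s t h q∣f q∣P = subst (q ∣ₛ_) (cancel f P u u′ w w′ s t h)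
    (ℤ∣.∣m∣n⇒∣m+n {q} {f ℤ.* (u′ ℤ.- u)} {P ℤ.* (w′ ℤ.- w)}
      (ℤ∣.∣m⇒∣m*n {q} {f} (u′ ℤ.- u) q∣f) (ℤ∣.∣m⇒∣m*n {q} {P} (w′ ℤ.- w) q∣P))

  cancel₀ : ∀ f P u u′ w w′ s → f ℤ.* u ℤ.+ (P ℤ.* w ℤ.+ s) ≡ f ℤ.* u′ ℤ.+ (P ℤ.* w′ ℤ.+ s) →
            f ℤ.* (u ℤ.- u′) ℤ.+ P ℤ.* (w ℤ.- w′) ≡ 0ℤ
  cancel₀ f P u u′ w w′ s h = trans
    (solve 7 (λ f P u u′ w w′ s → f :* (u :- u′) :+ P :* (w :- w′) :=
       (f :* u :+ (P :* w :+ s)) :- (f :* u′ :+ (P :* w′ :+ s))) refl f P u u′ w w′ s)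
    (ℤₚ.i≡j⇒i-j≡0 h)

  close : ∀ q s t m n → q ∣ₛ s ℤ.- m → q ∣ₛ t ℤ.- n → q ∣ₛ s ℤ.- t → q ∣ₛ n ℤ.- m
  close q s t m n h₁ h₂ h₃ = subst (q ∣ₛ_)
    (solve 4 (λ s t m n → (s :- m) :- (t :- n) :- (s :- t) := n :- m) refl s t m n)
    (ℤ∣.∣m∣n⇒∣m-n (ℤ∣.∣m∣n⇒∣m-n h₁ h₂) h₃)

  factor : ∀ q m n e → q ∣ₛ n ℤ.* e ℤ.- m ℤ.* e → q ∣ₛ (n ℤ.- m) ℤ.* e
  factor q m n e = subst (q ∣ₛ_) (solve 3 (λ m n e → n :* e :- m :* e := (n :- m) :* e) refl m n e)

  difference : List ℤ → List ℤ → List ℤ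
  difference g h = g ⊕ scale ℤ.-1ℤ h

  eval-difference : ∀ g h x → eval (difference g h) x ≡ eval g x ℤ.- eval h x
  eval-difference g h x = trans (eval-⊕ g (scale ℤ.-1ℤ h) x)
    (cong (λ z → eval g x ℤ.+ z) (trans (eval-scale ℤ.-1ℤ h x) (ℤₚ.-1*i≡-i (eval h x))))

  length-difference : ∀ {n} g h → length g ℕ.≤ n → length h ℕ.≤ n → length (difference g h) ℕ.≤ n
  length-difference {n} g h g≤n h≤n = length-⊕ g (scale ℤ.-1ℤ h) g≤n (subst (ℕ._≤ n) (sym (length-scale ℤ.-1ℤ h)) h≤n)

  difference-zero : ∀ g h x → eval (difference g h) x ≡ 0ℤ → eval g x ≡ eval h x
  difference-zero g h x eq = ℤₚ.i-j≡0⇒i≡j (eval g x) (eval h x) (trans (sym (eval-difference g h x)) eq)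

  agree⇒≡ : ∀ {n} g h → length g ℕ.≤ n → length h ℕ.≤ n → (∀ j → j ℕ.< n → eval g (+ j) ≡ eval h (+ j)) →
            ∀ x → eval g x ≡ eval h x
  agree⇒≡ g h g≤n h≤n agree x = difference-zero g h x (eval-zero (difference g h) x
    (vanishes⇒zero (difference g h) (length-difference g h g≤n h≤n)
      (λ j j<n → trans (eval-difference g h (+ j)) (ℤₚ.i≡j⇒i-j≡0 (agree j j<n)))))

  -- A pair (p , a) stands for the prime ideal (p, X - a) of degree one in ℤ[X]/(P), and `norm` for
  -- the norm of a product of such ideals. A prime may occur with several roots; `p∤δ` caps their
  -- number at d.
  record Points (P : ℤ[X]) (δ r : ℕ) : Set where
    field
      p a      : Fin r → ℕ
      prime    : ∀ i → Prime (p i)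
      p∤δ      : ∀ i → ¬ p i ℕ∣.∣ δ
      a<p      : ∀ i → a i ℕ.< p i
      root     : ∀ i → + p i ∣ₛ eval P (+ a i)
      distinct : ∀ {i j} → p i ≡ p j → a i ≡ a j → i ≡ j

    norm : (Fin r → Bool) → ℕ
    norm T = ∏ (λ i → if T i then p i else 1)

    incongruent : ∀ {i j} → p i ≡ p j → i ≢ j → ¬ + p i ∣ₛ + a j ℤ.- + a i
    incongruent {i} {j} pi≡pj i≢j h = i≢j (distinct pi≡pj
      (residue-injective (a<p i) (subst (a j ℕ.<_) (sym pi≡pj) (a<p j)) h))

    coprime : ∀ {i j} → p j ≢ p i → ¬ + p i ∣ₛ + p j
    coprime {i} {j} pj≢pi h with prime⇒irreducible (prime j) (ℤ∣.∣⇒∣ᵤ h)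
    ... | inj₁ pi≡1  = ¬prime[1] (subst Prime pi≡1 (prime i))
    ... | inj₂ pi≡pj = pj≢pi (sym pi≡pj)

    -- A pair over another prime contributes the constant `p j` and not X - a j. The degree of a
    -- separator thus grows only with the other roots modulo `p i`, of which there are fewer than d,
    -- however many pairs are separated.
    extend : ∀ i j → Dec (p j ≡ p i) → Dec (i ≡ j) → List ℤ → List ℤ
    extend i j _       (yes _) s = s
    extend i j (yes _) (no _)  s = linear (a j) s
    extend i j (no _)  (no _)  s = scale (+ p j) s

    -- Vanishes modulo p j at a j for every j ≠ i in js, but not modulo p i at a i.
    separator : Fin r → List (Fin r) → List ℤ
    separator i []       = 1ℤ ∷ []
    separator i (j ∷ js) = extend i j (p j ℕₚ.≟ p i) (i Finₚ.≟ j) (separator i js)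

    separator-root : ∀ i js {j} → j ∈ js → j ≢ i → + p j ∣ₛ eval (separator i js) (+ a j)
    separator-root i (j ∷ js) j∈ j≢i with p j ℕₚ.≟ p i | i Finₚ.≟ j
    separator-root i (j ∷ js) (here refl) j≢i | _ | yes i≡j = contradiction (sym i≡j) j≢i
    separator-root i (j ∷ js) (there j∈)  j≢i | _ | yes i≡j = separator-root i js j∈ j≢i
    separator-root i (j ∷ js) (here refl) j≢i | yes _ | no _ =
      subst (+ p j ∣ₛ_) (sym (eval-linear (a j) (separator i js) (+ a j)))
        (ℤ∣.∣m⇒∣m*n (eval (separator i js) (+ a j)) (divides 0ℤ (ℤₚ.+-inverseʳ (+ a j))))
    separator-root i (j ∷ js) {k} (there j∈)  j≢i | yes _ | no _ =
      subst (+ p k ∣ₛ_) (sym (eval-linear (a j) (separator i js) (+ a k)))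
        (ℤ∣.∣n⇒∣m*n (+ a k ℤ.- + a j) (separator-root i js j∈ j≢i))
    separator-root i (j ∷ js) (here refl) j≢i | no _ | no _ =
      subst (+ p j ∣ₛ_) (sym (eval-scale (+ p j) (separator i js) (+ a j)))
        (ℤ∣.∣m⇒∣m*n (eval (separator i js) (+ a j)) (ℤ∣.∣-refl {+ p j}))
    separator-root i (j ∷ js) {k} (there j∈)  j≢i | no _ | no _ =
      subst (+ p k ∣ₛ_) (sym (eval-scale (+ p j) (separator i js) (+ a k)))
        (ℤ∣.∣n⇒∣m*n (+ p j) (separator-root i js j∈ j≢i))

    extend-unit : ∀ i j (e : Dec (p j ≡ p i)) (f : Dec (i ≡ j)) s → ¬ + p i ∣ₛ eval s (+ a i) → ¬ + p i ∣ₛ eval (extend i j e f s) (+ a i)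
    extend-unit i j e (yes _) s unit h = unit h
    extend-unit i j (no pj≢pi) (no _) s unit h = [ coprime pj≢pi , unit ]′
      (prime∣* (prime i) (+ p j) (eval s (+ a i)) (subst (+ p i ∣ₛ_) (eval-scale (+ p j) s (+ a i)) h))
    extend-unit i j (yes pj≡pi) (no i≢j) s unit h =
      [ (λ pi∣ → incongruent pj≡pi (≢-sym i≢j) (subst (λ q → + q ∣ₛ + a i ℤ.- + a j) (sym pj≡pi) pi∣)) , unit ]′
      (prime∣* (prime i) (+ a i ℤ.- + a j) (eval s (+ a i)) (subst (+ p i ∣ₛ_) (eval-linear (a j) s (+ a i)) h))

    separator-unit : ∀ i js → ¬ + p i ∣ₛ eval (separator i js) (+ a i)
    separator-unit i [] h = ¬prime[1] (subst Prime (ℕ∣.∣1⇒≡1 (ℤ∣.∣⇒∣ᵤ (subst (+ p i ∣ₛ_)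
      (trans (cong (λ z → 1ℤ ℤ.+ z) (ℤₚ.*-zeroʳ (+ a i))) refl) h))) (prime i))
    separator-unit i (j ∷ js) = extend-unit i j (p j ℕₚ.≟ p i) (i Finₚ.≟ j) (separator i js) (separator-unit i js)

    sibling? : ∀ i j → Dec (p j ≡ p i × i ≢ j)
    sibling? i j = (p j ℕₚ.≟ p i) ×-dec ¬? (i Finₚ.≟ j)

    length-extend : ∀ i j js s (e : Dec (p j ≡ p i)) (f : Dec (i ≡ j)) →
                    length s ℕ.≤ suc (length (filter (sibling? i) js)) →
                    length (extend i j e f s) ℕ.≤ suc (length (filter (sibling? i) (j ∷ js)))
    length-extend i j js s e (yes i≡j) h = subst (λ l → length s ℕ.≤ suc (length l))
      (sym (List.filter-reject (sibling? i) {xs = js} (λ (_ , i≢j) → i≢j i≡j))) h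
    length-extend i j js s (yes e) (no i≢j) h = subst (λ l → length (linear (a j) s) ℕ.≤ suc (length l))
      (sym (List.filter-accept (sibling? i) {xs = js} (e , i≢j))) (ℕₚ.≤-trans (length-linear (a j) s) (s≤s h))
    length-extend i j js s (no ne) (no _) h = subst₂ (λ m l → m ℕ.≤ suc (length l)) (sym (length-scale (+ p j) s))
      (sym (List.filter-reject (sibling? i) {xs = js} (λ (e , _) → ne e))) h

    length-separator : ∀ i js → length (separator i js) ℕ.≤ suc (length (filter (sibling? i) js))
    length-separator i []       = ℕₚ.≤-refl
    length-separator i (j ∷ js) =
      length-extend i j js (separator i js) (p j ℕₚ.≟ p i) (i Finₚ.≟ j) (length-separator i js)

    module _ {d} (deg : HasDegree P d) (gcd : IsGCDOfValues P δ) where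

      -- The pair `i` and its siblings are incongruent roots of P modulo one prime. The bound keeps
      -- the degree of every separator below d.
      siblings≤ : ∀ i → suc (length (filter (sibling? i) (allFin r))) ℕ.≤ d
      siblings≤ i = subst (ℕ._≤ d) (cong suc (List.length-map (λ j → + a j) siblings))
        (number-of-roots {P} {d} {δ} deg gcd (prime i) (p∤δ i) (map (λ j → + a j) (i ∷ siblings))
          (All.map⁺ (All.map (λ { (pj≡pi , i≢j) → incongruent (sym pj≡pi) i≢j }) all-siblings)
           ∷ AllPairs.map⁺ (pairs (AllPairs.filter⁺ (sibling? i) (Unique.allFin⁺ r)) all-siblings))
          (root i ∷ All.map⁺ (All.map (λ { {j} (pj≡pi , _) → subst (λ q → + q ∣ₛ eval P (+ a j)) pj≡pi (root j) }) all-siblings)))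
        where
        siblings = filter (sibling? i) (allFin r)
        all-siblings : All (λ j → p j ≡ p i × i ≢ j) siblings
        all-siblings = All.all-filter (sibling? i) (allFin r)
        pairs : ∀ {js} → AllPairs _≢_ js → All (λ j → p j ≡ p i × i ≢ j) js →
                AllPairs (λ j k → ¬ + p i ∣ₛ + a k ℤ.- + a j) js
        pairs []         []                 = []
        pairs {j ∷ js} (h ∷ hs) ((pj≡pi , _) ∷ ks) =
          All.zipWith (λ { {k} (j≢k , pk≡pi , _) c → incongruent (trans pj≡pi (sym pk≡pi)) j≢k
            (subst (λ q → + q ∣ₛ + a k ℤ.- + a j) (sym pj≡pi) c) }) (h , ks) ∷ pairs hs ks

    separatorᵢ : Fin r → List ℤ
    separatorᵢ i = separator i (allFin r)

-- Norm of the zero set of a polynomial of degree less than d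

module NormBound where

  open import Defs using (ℤ[X]; HasDegree; Irreducible; IsGCDOfValues)
  open IntegerPolynomials
  open MixedRadix
  open ModularRoots
  open Separators
  open import Data.Bool.Base using (Bool; true; false; if_then_else_)
  open import Data.Fin.Base as Fin using (Fin; zero; suc; toℕ; fromℕ<; remQuot)
  import Data.Fin.Properties as Finₚ
  open import Data.Integer.Base as ℤ using (ℤ; +_; 0ℤ)
  import Data.Integer.Properties as ℤₚ
  open import Data.Integer.Solver using (module +-*-Solver)
  open import Data.Integer.Divisibility.Signed as ℤ∣ using () renaming (_∣_ to _∣ₛ_)
  open import Data.List.Base using (List; length; _∷ʳ_; allFin)
  import Data.List.Properties as List
  open import Data.List.Membership.Propositional.Properties using (∈-allFin)
  open import Data.Nat.Base as ℕ using (ℕ; zero; suc; z≤n; s≤s)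
  import Data.Nat.Properties as ℕₚ
  import Data.Nat.Solver as ℕ-Solver
  open import Data.Nat.Primality using (prime⇒nonZero)
  open import Data.Product.Base using (_×_; _,_; proj₁; proj₂)
  open import Data.Sum.Base using ([_,_]′)
  open import Relation.Binary.PropositionalEquality
  open import Relation.Nullary using (¬_; contradiction)

  ^-distrib-* : ∀ m n k → (m ℕ.* n) ℕ.^ k ≡ m ℕ.^ k ℕ.* n ℕ.^ k
  ^-distrib-* m n zero    = refl
  ^-distrib-* m n (suc k) = trans (cong (m ℕ.* n ℕ.*_) (^-distrib-* m n k)) (swap m n (m ℕ.^ k) (n ℕ.^ k))
    where
    open ℕ-Solver.+-*-Solver
    swap : ∀ a b c d → a ℕ.* b ℕ.* (c ℕ.* d) ≡ a ℕ.* c ℕ.* (b ℕ.* d)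
    swap = solve 4 (λ a b c d → a :* b :* (c :* d) := a :* c :* (b :* d)) refl

  module _ {P : ℤ[X]} {d′ δ : ℕ} (irreducible : Irreducible P) (deg : HasDegree P (suc d′)) (gcd : IsGCDOfValues P δ) where
    private
      d D G c : ℕ
      d = suc d′
      D = d ℕ.+ d′
      G = geometric D d
      -- The three summands account for f u, for P w and for the separators, each measured in units
      -- of `W`.
      c = G ℕ.* G ℕ.+ bound (λ j → ℤ.∣ eval P (+ j) ∣) D ℕ.* G ℕ.+ 1
      P′ : List ℤ
      P′ = proj₁ (leading-term P deg) ∷ʳ proj₁ (proj₂ (leading-term P deg))
      length-P′ : length P′ ≡ suc d
      length-P′ = trans (List.length-++ (proj₁ (leading-term P deg)))
        (trans (ℕₚ.+-comm (length (proj₁ (leading-term P deg))) 1)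
          (cong suc (proj₁ (proj₂ (proj₂ (proj₂ (leading-term P deg)))))))
      P≡P′ : ∀ x → eval P x ≡ eval P′ x
      P≡P′ = proj₂ (proj₂ (proj₂ (proj₂ (leading-term P deg))))

    normConstant : ℕ
    normConstant = (3 ℕ.* c) ℕ.^ D

    module _ {r} (points : Points P δ r) (f : List ℤ) (f≤d : length f ℕ.≤ d) (f≢0 : ¬ (∀ x → eval f x ≡ 0ℤ))
             {H} (1≤H : 1 ℕ.≤ H) (height : ∀ i → ℤ.∣ coeff f i ∣ ℕ.≤ H)
             (T : Fin r → Bool) where
      open Points points

      private
        E U W Y : ℕ
        -- `E` dominates the separators, with all their digits, at the sample points. Taking `U`
        -- beyond `E` lets them disappear in `W`, and `W = H U` balances P w against f u.
        E = bound (λ j → ∑ℕ (λ i → p i ℕ.* ℤ.∣ eval (separatorᵢ i) (+ j) ∣)) D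
        U = suc E
        W = H ℕ.* U
        Y = c ℕ.* W
        q : Fin r → ℕ
        q i = if T i then p i else 1

        U≥1 : 1 ℕ.≤ U
        U≥1 = s≤s z≤n
        W≥U : U ℕ.≤ W
        W≥U = subst (ℕ._≤ W) (ℕₚ.*-identityˡ U) (ℕₚ.*-monoˡ-≤ U 1≤H)

        q≤p : ∀ i → q i ℕ.≤ p i
        q≤p i with T i
        ... | true  = ℕₚ.≤-refl
        ... | false = ℕ.>-nonZero⁻¹ (p i) {{prime⇒nonZero (prime i)}}

        -- Coordinates of a combination: digits of the cofactor of f, digits of the cofactor of P,
        -- and for each pair of `T` a residue modulo its prime, carried by the separator of that
        -- pair.
        Digits : Set
        Digits = (Fin d → Fin U) × (Fin d′ → Fin W) × (∀ i → Fin (q i))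

        correction : Digits → List ℤ
        correction (_ , _ , k) = ∑ᵖ (λ i → scale (+ toℕ (k i)) (separatorᵢ i))

        S : Digits → List ℤ
        S (u , w , k) = mul f (fromDigits u) ⊕ (mul P′ (fromDigits w) ⊕ correction (u , w , k))

        separators : Digits → ℤ → ℤ
        separators (_ , _ , k) x = ∑ (λ i → + toℕ (k i) ℤ.* eval (separatorᵢ i) x)

        eval-correction : ∀ s x → eval (correction s) x ≡ separators s x
        eval-correction (u , w , k) x = trans (eval-∑ᵖ (λ i → scale (+ toℕ (k i)) (separatorᵢ i)) x)
          (∑-cong (λ i → eval-scale (+ toℕ (k i)) (separatorᵢ i) x))

        combination : Digits → ℤ → ℤ
        combination (u , w , k) x = eval f x ℤ.* eval (fromDigits u) x ℤ.+
          (eval P x ℤ.* eval (fromDigits w) x ℤ.+ separators (u , w , k) x)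

        eval-S : ∀ s x → eval (S s) x ≡ combination s x
        eval-S s@(u , w , k) x = trans (eval-⊕ (mul f (fromDigits u)) (mul P′ (fromDigits w) ⊕ correction s) x)
          (cong₂ ℤ._+_ (eval-mul f (fromDigits u) x)
            (trans (eval-⊕ (mul P′ (fromDigits w)) (correction s) x)
              (cong₂ ℤ._+_ (trans (eval-mul P′ (fromDigits w) x) (cong (ℤ._* eval (fromDigits w) x) (sym (P≡P′ x))))
                (eval-correction s x))))

        length-S : ∀ s → length (S s) ℕ.≤ D
        length-S s@(u , w , k) = length-⊕ (mul f (fromDigits u)) (mul P′ (fromDigits w) ⊕ correction s)
          (subst (length (mul f (fromDigits u)) ℕ.≤_) (ℕₚ.+-comm d′ d)
            (length-mul f (fromDigits u) f≤d (List.length-tabulate (λ i → + toℕ (u i)))))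
          (length-⊕ (mul P′ (fromDigits w)) (correction s)
            (length-mul P′ (fromDigits w) (ℕₚ.≤-reflexive length-P′) (List.length-tabulate (λ i → + toℕ (w i))))
            (length-∑ᵖ (λ i → scale (+ toℕ (k i)) (separatorᵢ i)) (λ i →
              subst (ℕ._≤ D) (sym (length-scale (+ toℕ (k i)) (separatorᵢ i)))
                (ℕₚ.≤-trans (length-separator i (allFin r)) (ℕₚ.≤-trans (siblings≤ deg gcd i) (ℕₚ.m≤m+n d d′))))))

        digits-bound : ∀ {n m j} (u : Fin n → Fin m) → n ℕ.≤ d → j ℕ.≤ D → ℤ.∣ eval (fromDigits u) (+ j) ∣ ℕ.≤ m ℕ.* G
        digits-bound u n≤d = ∣eval∣≤ (fromDigits u)
          (subst (ℕ._≤ d) (sym (List.length-tabulate (λ i → + toℕ (u i)))) n≤d) (∣coeff-fromDigits∣≤ u)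

        ∣combination∣≤ : ∀ s {j} → j ℕ.≤ D → ℤ.∣ combination s (+ j) ∣ ℕ.≤ Y
        ∣combination∣≤ s@(u , w , k) {j} j≤D = begin
          ℤ.∣ fu ℤ.+ (Pw ℤ.+ e) ∣
            ≤⟨ ℤₚ.∣i+j∣≤∣i∣+∣j∣ fu (Pw ℤ.+ e) ⟩
          ℤ.∣ fu ∣ ℕ.+ ℤ.∣ Pw ℤ.+ e ∣
            ≤⟨ ℕₚ.+-monoʳ-≤ ℤ.∣ fu ∣ (ℤₚ.∣i+j∣≤∣i∣+∣j∣ Pw e) ⟩
          ℤ.∣ fu ∣ ℕ.+ (ℤ.∣ Pw ∣ ℕ.+ ℤ.∣ e ∣)
            ≤⟨ ℕₚ.+-mono-≤ fu≤ (ℕₚ.+-mono-≤ Pw≤ e≤) ⟩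
          (H ℕ.* G) ℕ.* (U ℕ.* G) ℕ.+ (cP ℕ.* (W ℕ.* G) ℕ.+ W)
            ≡⟨ regroup H G U cP ⟩
          Y ∎
          where
          open ℕₚ.≤-Reasoning
          fu = eval f (+ j) ℤ.* eval (fromDigits u) (+ j)
          Pw = eval P (+ j) ℤ.* eval (fromDigits w) (+ j)
          e = separators s (+ j)
          cP = bound (λ j → ℤ.∣ eval P (+ j) ∣) D
          fu≤ : ℤ.∣ fu ∣ ℕ.≤ (H ℕ.* G) ℕ.* (U ℕ.* G)
          fu≤ = ℕₚ.≤-trans (ℕₚ.≤-reflexive (ℤₚ.abs-* (eval f (+ j)) (eval (fromDigits u) (+ j))))
            (ℕₚ.*-mono-≤ (∣eval∣≤ f f≤d height j≤D) (digits-bound u ℕₚ.≤-refl j≤D))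
          Pw≤ : ℤ.∣ Pw ∣ ℕ.≤ cP ℕ.* (W ℕ.* G)
          Pw≤ = ℕₚ.≤-trans (ℕₚ.≤-reflexive (ℤₚ.abs-* (eval P (+ j)) (eval (fromDigits w) (+ j))))
            (ℕₚ.*-mono-≤ (≤bound (λ j → ℤ.∣ eval P (+ j) ∣) D j≤D) (digits-bound w (ℕₚ.n≤1+n d′) j≤D))
          e≤ : ℤ.∣ e ∣ ℕ.≤ W
          e≤ = ℕₚ.≤-trans (∣∑∣≤ (λ i → + toℕ (k i) ℤ.* eval (separatorᵢ i) (+ j))
              (λ i → p i ℕ.* ℤ.∣ eval (separatorᵢ i) (+ j) ∣)
              (λ i → ℕₚ.≤-trans (ℕₚ.≤-reflexive (ℤₚ.abs-* (+ toℕ (k i)) (eval (separatorᵢ i) (+ j))))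
                (ℕₚ.*-monoˡ-≤ ℤ.∣ eval (separatorᵢ i) (+ j) ∣ (ℕₚ.≤-trans (ℕₚ.<⇒≤ (Finₚ.toℕ<n (k i))) (q≤p i)))))
            (ℕₚ.≤-trans (≤bound (λ j → ∑ℕ (λ i → p i ℕ.* ℤ.∣ eval (separatorᵢ i) (+ j) ∣)) D j≤D)
              (ℕₚ.≤-trans (ℕₚ.n≤1+n E) W≥U))
          regroup : ∀ H G U cP → (H ℕ.* G) ℕ.* (U ℕ.* G) ℕ.+ (cP ℕ.* (H ℕ.* U ℕ.* G) ℕ.+ H ℕ.* U)
                               ≡ (G ℕ.* G ℕ.+ cP ℕ.* G ℕ.+ 1) ℕ.* (H ℕ.* U)
          regroup = ℕ-Solver.+-*-Solver.solve 4 (λ H G U cP →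
            (H :* G) :* (U :* G) :+ (cP :* (H :* U :* G) :+ H :* U) := (G :* G :+ cP :* G :+ con 1) :* (H :* U)) refl
            where open ℕ-Solver.+-*-Solver

        digits : Fin (∏ {d} (λ _ → U) ℕ.* (∏ {d′} (λ _ → W) ℕ.* ∏ q)) → Digits
        digits x = let y , z = remQuot {∏ {d} (λ _ → U)} (∏ {d′} (λ _ → W) ℕ.* ∏ q) x
                       v , k = remQuot {∏ {d′} (λ _ → W)} (∏ q) z
                   in decode (λ _ → U) y , decode (λ _ → W) v , decode q k

        _≈_ : Digits → Digits → Set
        (u , w , k) ≈ (u′ , w′ , k′) = (∀ i → u i ≡ u′ i) × (∀ i → w i ≡ w′ i) × (∀ i → k i ≡ k′ i)

        digits-injective : ∀ {x y} → digits x ≈ digits y → x ≡ y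
        digits-injective {x} {y} (hu , hw , hk) = remQuot-injective (∏ {d} (λ _ → U)) _ (decode-injective {d} (λ _ → U) hu)
          (remQuot-injective (∏ {d′} (λ _ → W)) (∏ q) (decode-injective {d′} (λ _ → W) hw) (decode-injective q hk))

        value : Digits → Fin D → Fin (suc (Y ℕ.+ Y))
        value s j = shift Y (combination s (+ toℕ j))

        values : Digits → Fin (∏ {D} (λ _ → suc (Y ℕ.+ Y)))
        values s = encode {D} (λ _ → suc (Y ℕ.+ Y)) (value s)

        module _ (f-root : ∀ i → T i ≡ true → + p i ∣ₛ eval f (+ a i)) where

          module _ (s t : Digits) (eq : ∀ x → combination s x ≡ combination t x) where
            private
              u  = fromDigits (proj₁ s)
              u′ = fromDigits (proj₁ t)
              w  = fromDigits (proj₁ (proj₂ s))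
              w′ = fromDigits (proj₁ (proj₂ t))

            term : Digits → ℤ → Fin r → ℤ
            term s x j = + toℕ (proj₂ (proj₂ s) j) ℤ.* eval (separatorᵢ j) x

            other-terms : ∀ s i j → j ≢ i → + p i ∣ₛ term s (+ a i) j
            other-terms s i j j≢i = ℤ∣.∣n⇒∣m*n (+ toℕ (proj₂ (proj₂ s) j))
              (separator-root j (allFin r) (∈-allFin i) (≢-sym j≢i))

            -- Modulo `p i` both f and P vanish at `a i`, so only the separator parts of two equal
            -- combinations are left to compare.
            separators-close : ∀ i → T i ≡ true → + p i ∣ₛ separators s (+ a i) ℤ.- separators t (+ a i)
            separators-close i Ti = cancel-∣ (+ p i) (eval f x) (eval P x) (eval u x) (eval u′ x) (eval w x) (eval w′ x)
              (separators s x) (separators t x) (eq x) (f-root i Ti) (root i)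
              where
              x = + a i

            -- At the pair `i` every other separator vanishes and its own is a unit, so the
            -- congruence descends to the digits.
            digit-close : ∀ i → T i ≡ true → + p i ∣ₛ + toℕ (proj₂ (proj₂ t) i) ℤ.- + toℕ (proj₂ (proj₂ s) i)
            digit-close i Ti = [ (λ h → h) , (λ h → contradiction h (separator-unit i (allFin r))) ]′
              (prime∣* (prime i) (+ toℕ (proj₂ (proj₂ t) i) ℤ.- + toℕ (proj₂ (proj₂ s) i)) (eval (separatorᵢ i) (+ a i))
              (factor (+ p i) (+ toℕ (proj₂ (proj₂ s) i)) (+ toℕ (proj₂ (proj₂ t) i)) (eval (separatorᵢ i) (+ a i))
                (close (+ p i) (separators s (+ a i)) (separators t (+ a i)) (term s (+ a i) i) (term t (+ a i) i)
                  (∑-single (term s (+ a i)) i (other-terms s i)) (∑-single (term t (+ a i)) i (other-terms t i))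
                  (separators-close i Ti))))

            digit-below : ∀ {b} (s : Digits) i → T i ≡ b → toℕ (proj₂ (proj₂ s) i) ℕ.< (if b then p i else 1)
            digit-below s i Ti = subst (λ b → toℕ (proj₂ (proj₂ s) i) ℕ.< (if b then p i else 1)) Ti (Finₚ.toℕ<n (proj₂ (proj₂ s) i))

            digit-≡ : ∀ i b → T i ≡ b → toℕ (proj₂ (proj₂ s) i) ≡ toℕ (proj₂ (proj₂ t) i)
            -- Outside `T` the digit ranges over a single element.
            digit-≡ i false Ti = trans (ℕₚ.n<1⇒n≡0 (digit-below s i Ti)) (sym (ℕₚ.n<1⇒n≡0 (digit-below t i Ti)))
            digit-≡ i true  Ti = residue-injective (digit-below s i Ti) (digit-below t i Ti) (digit-close i Ti)

            separators-≡ : ∀ x → separators t x ≡ separators s x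
            separators-≡ x = ∑-cong {s = term t x} {t = term s x}
              (λ i → cong (λ m → + m ℤ.* eval (separatorᵢ i) x) (sym (digit-≡ i (T i) refl)))

            differences-zero : (∀ x → eval (difference u u′) x ≡ 0ℤ) × (∀ x → eval (difference w w′) x ≡ 0ℤ)
            differences-zero = coprime-combination irreducible deg f (difference u u′) (difference w w′) f≤d
              (length-difference u u′ (ℕₚ.≤-reflexive (List.length-tabulate (λ i → + toℕ (proj₁ s i))))
                (ℕₚ.≤-reflexive (List.length-tabulate (λ i → + toℕ (proj₁ t i)))))
              f≢0 (λ x → trans (cong₂ (λ y z → eval f x ℤ.* y ℤ.+ eval P x ℤ.* z) (eval-difference u u′ x) (eval-difference w w′ x))
                (cancel₀ (eval f x) (eval P x) (eval u x) (eval u′ x) (eval w x) (eval w′ x) (separators s x)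
                  (trans (eq x) (cong (λ z → eval f x ℤ.* eval u′ x ℤ.+ (eval P x ℤ.* eval w′ x ℤ.+ z)) (separators-≡ x)))))

            combination⇒≈ : s ≈ t
            combination⇒≈ =
              fromDigits-injective (proj₁ s) (proj₁ t) (λ x → difference-zero u u′ x (proj₁ differences-zero x)) ,
              fromDigits-injective (proj₁ (proj₂ s)) (proj₁ (proj₂ t)) (λ x → difference-zero w w′ x (proj₂ differences-zero x)) ,
              (λ i → Finₚ.toℕ-injective (digit-≡ i (T i) refl))

          -- A list of length at most `D` is determined by its values at `D` points, and these
          -- values are small enough for `shift` to be faithful. Equality of combinations then
          -- passes to the digits.
          values-injective : ∀ s t → values s ≡ values t → s ≈ t
          values-injective s t eq = combination⇒≈ s t (λ x → trans (sym (eval-S s x))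
            (trans (agree⇒≡ (S s) (S t) (length-S s) (length-S t) agree x) (eval-S t x)))
            where
            agree : ∀ j → j ℕ.< D → eval (S s) (+ j) ≡ eval (S t) (+ j)
            agree j j<D = trans (eval-S s (+ j)) (trans
              (subst (λ i → combination s (+ i) ≡ combination t (+ i)) (Finₚ.toℕ-fromℕ< j<D)
                (shift-injective Y (∣combination∣≤ s j≤) (∣combination∣≤ t j≤)
                  (encode-injective {D} (λ _ → suc (Y ℕ.+ Y)) {value s} {value t} eq (fromℕ< j<D))))
              (sym (eval-S t (+ j))))
              where
              j≤ : toℕ (fromℕ< j<D) ℕ.≤ D
              j≤ = ℕₚ.<⇒≤ (Finₚ.toℕ<n (fromℕ< j<D))

          count : ∏ {d} (λ _ → U) ℕ.* (∏ {d′} (λ _ → W) ℕ.* ∏ q) ℕ.≤ ∏ {D} (λ _ → suc (Y ℕ.+ Y))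
          count = Finₚ.injective⇒≤ {f = λ x → values (digits x)}
            (λ {x} {y} eq → digits-injective {x} {y} (values-injective (digits x) (digits y) eq))

      -- Counting gives U^d W^d′ N(T) ≤ (3 c W)^D. With W = H U and D = d + d′ the common factor
      -- cancels and takes `U` with it, through which alone the estimate depended on the pairs. The
      -- result plays the role of the bound O(H^d) for the resultant of f and P.
      norm≤ : (∀ i → T i ≡ true → + p i ∣ₛ eval f (+ a i)) → norm T ℕ.≤ normConstant ℕ.* H ℕ.^ d
      norm≤ f-root = ℕₚ.*-cancelˡ-≤ (U ℕ.^ d ℕ.* W ℕ.^ d′) {{ℕ.>-nonZero (ℕₚ.*-mono-≤ (ℕₚ.m^n>0 U d) (ℕₚ.m^n>0 W {{ℕ.>-nonZero (ℕₚ.≤-trans U≥1 W≥U)}} d′))}} (begin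
        U ℕ.^ d ℕ.* W ℕ.^ d′ ℕ.* norm T
          ≡⟨ ℕₚ.*-assoc (U ℕ.^ d) (W ℕ.^ d′) (norm T) ⟩
        U ℕ.^ d ℕ.* (W ℕ.^ d′ ℕ.* norm T)
          ≡⟨ cong₂ (λ m n → m ℕ.* (n ℕ.* norm T)) (∏-const d U) (∏-const d′ W) ⟨
        ∏ {d} (λ _ → U) ℕ.* (∏ {d′} (λ _ → W) ℕ.* norm T)
          ≤⟨ count f-root ⟩
        ∏ {D} (λ _ → suc (Y ℕ.+ Y))
          ≡⟨ ∏-const D (suc (Y ℕ.+ Y)) ⟩
        suc (Y ℕ.+ Y) ℕ.^ D
          ≤⟨ ℕₚ.^-monoˡ-≤ D (begin
               1 ℕ.+ (Y ℕ.+ Y)      ≤⟨ ℕₚ.+-monoˡ-≤ (Y ℕ.+ Y) (ℕₚ.*-mono-≤ {1} {c} (ℕₚ.m≤n+m 1 (G ℕ.* G ℕ.+ bound (λ j → ℤ.∣ eval P (+ j) ∣) D ℕ.* G)) (ℕₚ.≤-trans U≥1 W≥U)) ⟩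
               Y ℕ.+ (Y ℕ.+ Y)      ≡⟨ triple c W ⟩
               3 ℕ.* c ℕ.* W        ∎) ⟩
        (3 ℕ.* c ℕ.* W) ℕ.^ D
          ≡⟨ ^-distrib-* (3 ℕ.* c) W D ⟩
        normConstant ℕ.* W ℕ.^ D
          ≡⟨ cong (normConstant ℕ.*_) (trans (ℕₚ.^-distribˡ-+-* W d d′) (cong (ℕ._* W ℕ.^ d′) (^-distrib-* H U d))) ⟩
        normConstant ℕ.* (H ℕ.^ d ℕ.* U ℕ.^ d ℕ.* W ℕ.^ d′)
          ≡⟨ regroup normConstant (H ℕ.^ d) (U ℕ.^ d) (W ℕ.^ d′) ⟩
        U ℕ.^ d ℕ.* W ℕ.^ d′ ℕ.* (normConstant ℕ.* H ℕ.^ d) ∎)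
        where
        open ℕₚ.≤-Reasoning
        open ℕ-Solver.+-*-Solver
        triple : ∀ c w → c ℕ.* w ℕ.+ (c ℕ.* w ℕ.+ c ℕ.* w) ≡ 3 ℕ.* c ℕ.* w
        triple = solve 2 (λ c w → c :* w :+ (c :* w :+ c :* w) := con 3 :* c :* w) refl
        regroup : ∀ n h u w → n ℕ.* (h ℕ.* u ℕ.* w) ≡ u ℕ.* w ℕ.* (n ℕ.* h)
        regroup = solve 4 (λ n h u w → n :* (h :* u :* w) := u :* w :* (n :* h)) refl

-- Counting sets of pairs by their norm

module SubsetCount where

  open import Defs using (ℤ[X]; HasDegree; Irreducible; IsGCDOfValues)
  open IntegerPolynomials
  open MixedRadix
  open Separators
  open NormBound
  open import Data.Bool.Base using (Bool; true; false; if_then_else_)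
  import Data.Bool.Properties as Boolₚ
  open import Data.Fin.Base as Fin using (Fin; zero; suc; toℕ; fromℕ<; remQuot; combine)
  import Data.Fin.Properties as Finₚ
  open import Data.Integer.Base as ℤ using (ℤ; +_; 0ℤ)
  import Data.Integer.Properties as ℤₚ
  import Data.Integer.DivMod as ℤ
  open import Data.Integer.Solver using (module +-*-Solver)
  open import Data.Integer.Divisibility.Signed as ℤ∣ using (divides) renaming (_∣_ to _∣ₛ_)
  open import Data.List.Base using (List; _∷_; length; lookup)
  import Data.List.Properties as List
  open import Data.List.Membership.Propositional.Properties using (∈-lookup)
  open import Data.List.Relation.Unary.All as All using (All)
  open import Data.List.Relation.Unary.AllPairs using (_∷_)
  open import Data.List.Relation.Unary.Unique.Propositional using (Unique)
  open import Data.Nat.Base as ℕ using (ℕ; zero; suc; z≤n; s≤s)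
  import Data.Nat.Properties as ℕₚ
  import Data.Nat.Solver as ℕ-Solver
  open import Data.Nat.Primality using (prime⇒nonZero)
  open import Data.Product.Base using (∃-syntax; _×_; _,_; proj₁; proj₂)
  open import Data.Sum.Base using ([_,_]′)
  open import Data.Vec.Base as Vec using (Vec)
  import Data.Vec.Properties as Vec
  open import Relation.Binary.PropositionalEquality
  open import Relation.Nullary.Decidable using (dec-true)
  open import Relation.Nullary using (¬_; yes; no; contradiction; Dec; does; _×-dec_)

  lookup-injective : ∀ {A : Set} {xs : List A} → Unique xs → ∀ i j → lookup xs i ≡ lookup xs j → i ≡ j
  lookup-injective (x∉xs ∷ u) zero    zero    eq = refl
  lookup-injective (x∉xs ∷ u) zero    (suc j) eq = contradiction eq (All.lookup x∉xs (∈-lookup j))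
  lookup-injective (x∉xs ∷ u) (suc i) zero    eq = contradiction (sym eq) (All.lookup x∉xs (∈-lookup i))
  lookup-injective (x∉xs ∷ u) (suc i) (suc j) eq = cong suc (lookup-injective u i j eq)

  does-true : ∀ {A : Set} (a? : Dec A) → does a? ≡ true → A
  does-true (yes a) _ = a

  ∏-strict : ∀ {r} (x y : Fin r → ℕ) j m → (∀ i → x i ℕ.≤ y i) → x j ℕ.* m ℕ.≤ y j → ∏ x ℕ.* m ℕ.≤ ∏ y
  ∏-strict {suc r} x y zero m x≤y xjm≤yj = subst (ℕ._≤ ∏ y) (swap (x zero) (∏ (λ i → x (suc i))) m)
    (ℕₚ.*-mono-≤ xjm≤yj (∏-mono (λ i → x≤y (suc i))))
    where
    open ℕ-Solver.+-*-Solver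
    swap : ∀ a b m → a ℕ.* m ℕ.* b ≡ a ℕ.* b ℕ.* m
    swap = solve 3 (λ a b m → a :* m :* b := a :* b :* m) refl
  ∏-strict {suc r} x y (suc j) m x≤y xjm≤yj = subst (ℕ._≤ ∏ y) (sym (ℕₚ.*-assoc (x zero) (∏ (λ i → x (suc i))) m))
    (ℕₚ.*-mono-≤ (x≤y zero) (∏-strict (λ i → x (suc i)) (λ i → y (suc i)) j m (λ i → x≤y (suc i)) xjm≤yj))

  rem≡⇒∣ : ∀ x y p .{{_ : ℕ.NonZero p}} → x ℤ.%ℕ p ≡ y ℤ.%ℕ p → + p ∣ₛ x ℤ.- y
  rem≡⇒∣ x y p eq = divides (x ℤ./ℕ p ℤ.- y ℤ./ℕ p) (trans
    (cong₂ ℤ._-_ (trans (ℤ.a≡a%ℕn+[a/ℕn]*n x p) (cong (λ r → + r ℤ.+ x ℤ./ℕ p ℤ.* + p) eq)) (ℤ.a≡a%ℕn+[a/ℕn]*n y p))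
    (telescope (+ (y ℤ.%ℕ p)) (x ℤ./ℕ p) (y ℤ./ℕ p) (+ p)))
    where
    open +-*-Solver
    telescope : ∀ r a b p → r ℤ.+ a ℤ.* p ℤ.- (r ℤ.+ b ℤ.* p) ≡ (a ℤ.- b) ℤ.* p
    telescope = solve 4 (λ r a b p → r :+ a :* p :- (r :+ b :* p) := (a :- b) :* p) refl

  integer-root : ∀ d n → 1 ℕ.≤ d → 1 ℕ.≤ n → ∃[ H ] (1 ℕ.≤ H × H ℕ.^ d ℕ.≤ n × n ℕ.< suc H ℕ.^ d)
  integer-root d (suc zero) 1≤d _ = 1 , s≤s z≤n , ℕₚ.≤-reflexive (ℕₚ.^-zeroˡ d) ,
    ℕₚ.^-monoʳ-≤ 2 {1} 1≤d
  integer-root d (suc n@(suc _)) 1≤d _ with integer-root d n 1≤d (s≤s z≤n)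
  ... | H , 1≤H , H^d≤n , n<[1+H]^d with suc n ℕₚ.<? suc H ℕ.^ d
  ...   | yes n+1<  = H , 1≤H , ℕₚ.≤-trans H^d≤n (ℕₚ.n≤1+n n) , n+1<
  ...   | no  n+1≮  = suc H , s≤s z≤n , ℕₚ.≮⇒≥ n+1≮ ,
    ℕₚ.≤-<-trans n<[1+H]^d (ℕₚ.^-monoˡ-< d {{ℕ.>-nonZero 1≤d}} ℕₚ.≤-refl)

  digit-difference : ∀ {n m} (c c′ : Fin n → Fin (suc m)) i →
                     ℤ.∣ coeff (difference (fromDigits c) (fromDigits c′)) i ∣ ℕ.≤ m
  digit-difference {zero}  c c′ i       = z≤n
  digit-difference {suc n} {m} c c′ (suc i) = digit-difference (λ i → c (suc i)) (λ i → c′ (suc i)) i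
  digit-difference {suc n} {m} c c′ zero    = subst (ℕ._≤ m)
    (cong ℤ.∣_∣ (trans (sym (ℤₚ.m-n≡m⊖n (toℕ (c zero)) (toℕ (c′ zero))))
      (cong (λ z → + toℕ (c zero) ℤ.+ z) (sym (ℤₚ.-1*i≡-i (+ toℕ (c′ zero)))))))
    (ℕₚ.≤-trans (ℤₚ.∣m⊝n∣≤m⊔n (toℕ (c zero)) (toℕ (c′ zero)))
      (ℕₚ.⊔-lub (ℕₚ.≤-pred (Finₚ.toℕ<n (c zero))) (ℕₚ.≤-pred (Finₚ.toℕ<n (c′ zero)))))

  -- a + (m ∸ b) encodes a - b for 0 ≤ a, b ≤ m.
  offset : ∀ {m} → Fin (suc m) → Fin (suc m) → Fin (suc (m ℕ.+ m))
  offset {m} a b = fromℕ< {toℕ a ℕ.+ (m ℕ.∸ toℕ b)}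
    (s≤s (ℕₚ.+-mono-≤ (ℕₚ.≤-pred (Finₚ.toℕ<n a)) (ℕₚ.m∸n≤m m (toℕ b))))

  offset-difference : ∀ {m} (a b c d : Fin (suc m)) → offset a b ≡ offset c d →
                      toℕ a ℕ.+ toℕ d ≡ toℕ c ℕ.+ toℕ b
  offset-difference {m} a b c d eq = ℕₚ.+-cancelʳ-≡ m (toℕ a ℕ.+ toℕ d) (toℕ c ℕ.+ toℕ b) (begin
    toℕ a ℕ.+ toℕ d ℕ.+ m
      ≡⟨ cong (toℕ a ℕ.+ toℕ d ℕ.+_) (ℕₚ.m∸n+n≡m (ℕₚ.≤-pred (Finₚ.toℕ<n b))) ⟨
    toℕ a ℕ.+ toℕ d ℕ.+ (m ℕ.∸ toℕ b ℕ.+ toℕ b)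
      ≡⟨ shuffle (toℕ a) (toℕ d) (m ℕ.∸ toℕ b) (toℕ b) ⟩
    toℕ a ℕ.+ (m ℕ.∸ toℕ b) ℕ.+ (toℕ d ℕ.+ toℕ b)
      ≡⟨ cong (ℕ._+ (toℕ d ℕ.+ toℕ b)) (trans (sym (Finₚ.toℕ-fromℕ< _)) (trans (cong toℕ eq) (Finₚ.toℕ-fromℕ< _))) ⟩
    toℕ c ℕ.+ (m ℕ.∸ toℕ d) ℕ.+ (toℕ d ℕ.+ toℕ b)
      ≡⟨ shuffle′ (toℕ c) (m ℕ.∸ toℕ d) (toℕ d) (toℕ b) ⟩
    toℕ c ℕ.+ toℕ b ℕ.+ (m ℕ.∸ toℕ d ℕ.+ toℕ d)
      ≡⟨ cong (toℕ c ℕ.+ toℕ b ℕ.+_) (ℕₚ.m∸n+n≡m (ℕₚ.≤-pred (Finₚ.toℕ<n d))) ⟩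
    toℕ c ℕ.+ toℕ b ℕ.+ m ∎)
    where
    open ≡-Reasoning
    open ℕ-Solver.+-*-Solver
    shuffle : ∀ a d m b → a ℕ.+ d ℕ.+ (m ℕ.+ b) ≡ a ℕ.+ m ℕ.+ (d ℕ.+ b)
    shuffle = solve 4 (λ a d m b → a :+ d :+ (m :+ b) := a :+ m :+ (d :+ b)) refl
    shuffle′ : ∀ c m d b → c ℕ.+ m ℕ.+ (d ℕ.+ b) ≡ c ℕ.+ b ℕ.+ (m ℕ.+ d)
    shuffle′ = solve 4 (λ c m d b → c :+ m :+ (d :+ b) := c :+ b :+ (m :+ d)) refl

  offsets-eval : ∀ {n m} (a b c d : Fin n → Fin (suc m)) → (∀ i → offset (a i) (b i) ≡ offset (c i) (d i)) →
    ∀ x → eval (fromDigits a) x ℤ.+ eval (fromDigits d) x ≡ eval (fromDigits c) x ℤ.+ eval (fromDigits b) x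
  offsets-eval {zero}  a b c d h x = refl
  offsets-eval {suc n} a b c d h x = trans (regroup (+ toℕ (a zero)) (+ toℕ (d zero)) x (eval (fromDigits (λ i → a (suc i))) x) (eval (fromDigits (λ i → d (suc i))) x))
    (trans (cong₂ (λ s t → s ℤ.+ x ℤ.* t)
        (trans (sym (ℤₚ.pos-+ (toℕ (a zero)) (toℕ (d zero)))) (trans (cong +_ (offset-difference (a zero) (b zero) (c zero) (d zero) (h zero))) (ℤₚ.pos-+ (toℕ (c zero)) (toℕ (b zero)))))
        (offsets-eval (λ i → a (suc i)) (λ i → b (suc i)) (λ i → c (suc i)) (λ i → d (suc i)) (λ i → h (suc i)) x))
      (sym (regroup (+ toℕ (c zero)) (+ toℕ (b zero)) x (eval (fromDigits (λ i → c (suc i))) x) (eval (fromDigits (λ i → b (suc i))) x))))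
    where
    open +-*-Solver
    regroup : ∀ a d x s t → a ℤ.+ x ℤ.* s ℤ.+ (d ℤ.+ x ℤ.* t) ≡ a ℤ.+ d ℤ.+ x ℤ.* (s ℤ.+ t)
    regroup = solve 5 (λ a d x s t → a :+ x :* s :+ (d :+ x :* t) := a :+ d :+ x :* (s :+ t)) refl

  swap-difference : ∀ s t u v → s ℤ.+ v ≡ u ℤ.+ t → s ℤ.- t ≡ u ℤ.- v
  swap-difference s t u v h = trans (solve 3 (λ s t v → s :- t := (s :+ v) :- (t :+ v)) refl s t v)
    (trans (cong (ℤ._- (t ℤ.+ v)) h) (solve 3 (λ u t v → (u :+ t) :- (t :+ v) := u :- v) refl u t v))
    where open +-*-Solver

  module _ {P : ℤ[X]} {δ r} (points : Points P δ r) where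
    open Points points

    residue : ∀ b i → ℤ → Fin (if b then p i else 1)
    residue true  i x = fromℕ< (ℤ.n%ℕd<d x (p i) {{prime⇒nonZero (prime i)}})
    residue false i x = zero

    residue-≡ : ∀ b i x y → residue b i x ≡ residue b i y → b ≡ true → + p i ∣ₛ x ℤ.- y
    residue-≡ true i x y eq refl = rem≡⇒∣ x y (p i) {{prime⇒nonZero (prime i)}}
      (trans (sym (Finₚ.toℕ-fromℕ< _)) (trans (cong toℕ eq) (Finₚ.toℕ-fromℕ< _)))

    module _ (d H : ℕ) (T : Fin r → Bool) where

      -- Both digit vectors are kept, not just their difference: `offset` codes the difference from
      -- them inside a finite type.
      record Annihilator : Set where
        field
          c c′ : Fin d → Fin (suc H)
        poly : List ℤ
        poly = difference (fromDigits c) (fromDigits c′)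
        field
          nonzero    : ¬ (∀ x → eval poly x ≡ 0ℤ)
          annihilates : ∀ i → T i ≡ true → + p i ∣ₛ eval poly (+ a i)

      -- There are (H + 1)^d digit vectors but only N(T) systems of residues at the pairs of `T`.
      -- Two vectors collide, and their difference vanishes on `T`.
      annihilator : norm T ℕ.< ∏ {d} (λ _ → suc H) → Annihilator
      annihilator small with Finₚ.pigeonhole small (λ x → encode (λ i → if T i then p i else 1)
                               (λ i → residue (T i) i (eval (fromDigits (decode {d} (λ _ → suc H) x)) (+ a i))))
      ... | x , y , x<y , eq = record
        { c = c ; c′ = c′
        ; nonzero = λ f≡0 → Finₚ.<⇒≢ x<y (decode-injective {d} (λ _ → suc H)
            (fromDigits-injective c c′ (λ x → difference-zero (fromDigits c) (fromDigits c′) x (f≡0 x))))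
        ; annihilates = λ i Ti → subst (+ p i ∣ₛ_) (sym (eval-difference (fromDigits c) (fromDigits c′) (+ a i)))
            (residue-≡ (T i) i (eval (fromDigits c) (+ a i)) (eval (fromDigits c′) (+ a i))
              (encode-injective (λ i → if T i then p i else 1)
                {λ i → residue (T i) i (eval (fromDigits c) (+ a i))} {λ i → residue (T i) i (eval (fromDigits c′) (+ a i))} eq i) Ti)
        }
        where
        c  = decode {d} (λ _ → suc H) x
        c′ = decode {d} (λ _ → suc H) y

    norm-⊂ : ∀ T Z j → (∀ i → T i ≡ true → Z i ≡ true) → T j ≡ false → Z j ≡ true → norm T ℕ.* p j ℕ.≤ norm Z
    norm-⊂ T Z j T⊆Z Tj Zj = ∏-strict (λ i → if T i then p i else 1) (λ i → if Z i then p i else 1) j (p j)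
      (λ i → weight-mono i (T i) (Z i) (T⊆Z i))
      (subst₂ (λ s t → (if s then p j else 1) ℕ.* p j ℕ.≤ (if t then p j else 1)) (sym Tj) (sym Zj) (ℕₚ.≤-reflexive (ℕₚ.*-identityˡ (p j))))
      where
      weight-mono : ∀ i s t → (s ≡ true → t ≡ true) → (if s then p i else 1) ℕ.≤ (if t then p i else 1)
      weight-mono i true  t     h rewrite h refl = ℕₚ.≤-refl
      weight-mono i false true  h = ℕ.>-nonZero⁻¹ (p i) {{prime⇒nonZero (prime i)}}
      weight-mono i false false h = ℕₚ.≤-refl

    Member : (Fin r → Bool) → ℕ → ℕ → Set
    Member T x y = ∃[ i ] (p i ≡ x × a i ≡ y × T i ≡ true)

    member? : ∀ T x y → Dec (Member T x y)
    member? T x y = Finₚ.any? (λ i → (p i ℕₚ.≟ x) ×-dec (a i ℕₚ.≟ y) ×-dec (T i Boolₚ.≟ true))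

    bit : ∀ {A : Set} → Dec A → Fin 2
    bit (yes _) = suc zero
    bit (no _)  = zero

    bit-≡ : ∀ {A B : Set} (a? : Dec A) (b? : Dec B) → bit a? ≡ bit b? → A → B
    bit-≡ (yes _) (yes b) _ _ = b
    bit-≡ (no ¬a) _       _ a = contradiction a ¬a

    -- Records which pairs with prime below `B` belong to `T`. The grid is indexed by the pair
    -- itself and not by its position in `Fin r`, so its size does not depend on the number of
    -- pairs.
    trace : ∀ B → (Fin r → Bool) → Fin (B ℕ.* B) → Fin 2
    trace B T z = bit (member? T (toℕ (proj₁ (remQuot {B} B z))) (toℕ (proj₂ (remQuot {B} B z))))

    trace-⊆ : ∀ B T T′ → (∀ z → trace B T z ≡ trace B T′ z) → ∀ i → p i ℕ.< B → T i ≡ true → T′ i ≡ true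
    trace-⊆ B T T′ eq i p<B Ti = transfer (bit-≡ (member? T x y) (member? T′ x y) (eq z) (i , sym px , sym ay , Ti))
      where
      z = combine (fromℕ< p<B) (fromℕ< (ℕₚ.<-trans (a<p i) p<B))
      x = toℕ (proj₁ (remQuot {B} B z))
      y = toℕ (proj₂ (remQuot {B} B z))
      px : x ≡ p i
      px = trans (cong (λ xy → toℕ (proj₁ xy)) (Finₚ.remQuot-combine (fromℕ< p<B) (fromℕ< (ℕₚ.<-trans (a<p i) p<B)))) (Finₚ.toℕ-fromℕ< p<B)
      ay : y ≡ a i
      ay = trans (cong (λ xy → toℕ (proj₂ xy)) (Finₚ.remQuot-combine (fromℕ< p<B) (fromℕ< (ℕₚ.<-trans (a<p i) p<B)))) (Finₚ.toℕ-fromℕ< _)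
      transfer : Member T′ x y → T′ i ≡ true
      transfer (j , pj , aj , T′j) = subst (λ k → T′ k ≡ true) (distinct (trans pj px) (trans aj ay)) T′j

  module _ {P : ℤ[X]} {d′ δ : ℕ} (irreducible : Irreducible P) (deg : HasDegree P (suc d′)) (gcd : IsGCDOfValues P δ) where
    private
      d C B : ℕ
      d = suc d′
      C = normConstant {P} {d′} {δ} irreducible deg gcd
      B = suc (C ℕ.* 2)

    -- The factor 3^d · 2 counts coded annihilators in units of X, from (2H + 1)^d ≤ 3^d H^d and H^d
    -- ≤ 2X; the last factor counts traces.
    countConstant : ℕ
    countConstant = 3 ℕ.^ d ℕ.* 2 ℕ.* 2 ℕ.^ (B ℕ.* B)

    module _ {r} (points : Points P δ r) where
      open Points points

      module _ (X H : ℕ) (1≤X : 1 ℕ.≤ X) (1≤H : 1 ℕ.≤ H) (H^d≤2X : H ℕ.^ d ℕ.≤ 2 ℕ.* X) where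

        private
          Ann : (Fin r → Bool) → Set
          Ann = Annihilator points d H

        zeros : ∀ {T} → Ann T → Fin r → Bool
        zeros f i = does (+ p i ℤ∣.∣? eval (Annihilator.poly f) (+ a i))

        zeros-sound : ∀ {T} (f : Ann T) i → zeros f i ≡ true → + p i ∣ₛ eval (Annihilator.poly f) (+ a i)
        zeros-sound f i = does-true (+ p i ℤ∣.∣? eval (Annihilator.poly f) (+ a i))

        zeros-complete : ∀ {T} (f : Ann T) i → + p i ∣ₛ eval (Annihilator.poly f) (+ a i) → zeros f i ≡ true
        zeros-complete f i h = dec-true (+ p i ℤ∣.∣? eval (Annihilator.poly f) (+ a i)) h

        -- If such a pair with prime p lay outside `T`, the zero set of f would have norm at least X
        -- p, whereas the norm bound allows only C H^d ≤ 2 C X. Its prime would then be below `B`.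
        large-zero : ∀ T (f : Ann T) → X ℕ.≤ norm T → ∀ j → B ℕ.≤ p j → zeros f j ≡ true → T j ≡ true
        large-zero T f X≤ j B≤p Zj = by-cases (T j) refl
          where
          open ℕₚ.≤-Reasoning
          bounded : T j ≡ false → p j ℕ.≤ C ℕ.* 2
          bounded Tj = ℕₚ.*-cancelˡ-≤ X {{ℕ.>-nonZero 1≤X}} (begin
            X ℕ.* p j             ≤⟨ ℕₚ.*-monoˡ-≤ (p j) X≤ ⟩
            norm T ℕ.* p j        ≤⟨ norm-⊂ points T (zeros f) j (λ i Ti → zeros-complete f i (Annihilator.annihilates f i Ti)) Tj Zj ⟩
            norm (zeros f)        ≤⟨ norm≤ irreducible deg gcd points (Annihilator.poly f)
                                       (length-difference (fromDigits (Annihilator.c f)) (fromDigits (Annihilator.c′ f))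
                                         (ℕₚ.≤-reflexive (List.length-tabulate (λ i → + toℕ (Annihilator.c f i))))
                                         (ℕₚ.≤-reflexive (List.length-tabulate (λ i → + toℕ (Annihilator.c′ f i)))))
                                       (Annihilator.nonzero f) 1≤H
                                       (digit-difference (Annihilator.c f) (Annihilator.c′ f)) (zeros f) (zeros-sound f) ⟩
            C ℕ.* H ℕ.^ d         ≤⟨ ℕₚ.*-monoʳ-≤ C H^d≤2X ⟩
            C ℕ.* (2 ℕ.* X)       ≡⟨ trans (sym (ℕₚ.*-assoc C 2 X)) (ℕₚ.*-comm (C ℕ.* 2) X) ⟩
            X ℕ.* (C ℕ.* 2)       ∎)
          by-cases : ∀ b → T j ≡ b → T j ≡ true
          by-cases true  Tj = Tj
          by-cases false Tj = contradiction B≤p (ℕₚ.<⇒≱ (s≤s (bounded Tj)))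

        code : ∀ T → Ann T → Fin (∏ {d} (λ _ → suc (H ℕ.+ H)) ℕ.* ∏ {B ℕ.* B} (λ _ → 2))
        code T f = combine (encode {d} (λ _ → suc (H ℕ.+ H)) (λ i → offset (Annihilator.c f i) (Annihilator.c′ f i)))
                           (encode {B ℕ.* B} (λ _ → 2) (trace points B T))

        -- Small primes are read off from the trace. For a large prime the two annihilators take
        -- equal values, so a pair of `T` is a zero of the annihilator of `T′` and therefore belongs
        -- to `T′`.
        code-⊆ : ∀ T T′ (f : Ann T) (f′ : Ann T′) → X ℕ.≤ norm T′ → code T f ≡ code T′ f′ → ∀ i → T i ≡ true → T′ i ≡ true
        code-⊆ T T′ f f′ X≤ eq i Ti = [ (λ p<B → trace-⊆ points B T T′ traces i p<B Ti) , (λ B≤p → large-zero T′ f′ X≤ i B≤p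
            (zeros-complete f′ i (subst (+ p i ∣ₛ_) same (Annihilator.annihilates f i Ti)))) ]′ (ℕₚ.<-≤-connex (p i) B)
          where
          open Annihilator
          codes = Finₚ.combine-injective
            (encode {d} (λ _ → suc (H ℕ.+ H)) (λ i → offset (c f i) (c′ f i))) (encode {B ℕ.* B} (λ _ → 2) (trace points B T))
            (encode {d} (λ _ → suc (H ℕ.+ H)) (λ i → offset (c f′ i) (c′ f′ i))) (encode {B ℕ.* B} (λ _ → 2) (trace points B T′)) eq
          traces = encode-injective {B ℕ.* B} (λ _ → 2) {trace points B T} {trace points B T′} (proj₂ codes)
          same : eval (poly f) (+ a i) ≡ eval (poly f′) (+ a i)
          same = trans (eval-difference (fromDigits (c f)) (fromDigits (c′ f)) (+ a i)) (trans
            (swap-difference (eval (fromDigits (c f)) (+ a i)) (eval (fromDigits (c′ f)) (+ a i))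
              (eval (fromDigits (c f′)) (+ a i)) (eval (fromDigits (c′ f′)) (+ a i))
              (offsets-eval (c f) (c′ f) (c f′) (c′ f′)
                (encode-injective {d} (λ _ → suc (H ℕ.+ H)) {λ i → offset (c f i) (c′ f i)} {λ i → offset (c f′ i) (c′ f′ i)}
                  (proj₁ codes)) (+ a i)))
            (sym (eval-difference (fromDigits (c f′)) (fromDigits (c′ f′)) (+ a i))))

      count≤ : ∀ X → 1 ℕ.≤ X → (Ts : List (Vec Bool r)) → Unique Ts →
               All (λ T → X ℕ.≤ norm (Vec.lookup T) × norm (Vec.lookup T) ℕ.< 2 ℕ.* X) Ts →
               length Ts ℕ.≤ countConstant ℕ.* X
      count≤ X 1≤X Ts unique sizes
        -- `H` is the integer part of the d-th root of 2X: the bound 2X < (H + 1)^d feeds the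
        -- pigeonhole, and H^d ≤ 2X the norm bound and the number of codes.
        with H , 1≤H , H^d≤2X , 2X<[1+H]^d ← integer-root d (2 ℕ.* X) (s≤s z≤n) (ℕₚ.≤-trans 1≤X (ℕₚ.m≤m+n X (X ℕ.+ 0))) = begin
          length Ts
            ≤⟨ Finₚ.injective⇒≤ {f = λ i → code X H 1≤X 1≤H H^d≤2X (T i) (ann H 2X<[1+H]^d i)} (λ {i} {j} → code-injective H 1≤H H^d≤2X 2X<[1+H]^d i j) ⟩
          ∏ {d} (λ _ → suc (H ℕ.+ H)) ℕ.* ∏ {B ℕ.* B} (λ _ → 2)
            ≡⟨ cong₂ ℕ._*_ (∏-const d (suc (H ℕ.+ H))) (∏-const (B ℕ.* B) 2) ⟩
          suc (H ℕ.+ H) ℕ.^ d ℕ.* 2 ℕ.^ (B ℕ.* B)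
            ≤⟨ ℕₚ.*-monoˡ-≤ (2 ℕ.^ (B ℕ.* B)) (ℕₚ.^-monoˡ-≤ d (ℕₚ.≤-trans (ℕₚ.+-monoˡ-≤ (H ℕ.+ H) 1≤H) (ℕₚ.≤-reflexive (cong (H ℕ.+_) (cong (H ℕ.+_) (sym (ℕₚ.+-identityʳ H))))))) ⟩
          (3 ℕ.* H) ℕ.^ d ℕ.* 2 ℕ.^ (B ℕ.* B)
            ≡⟨ cong (ℕ._* 2 ℕ.^ (B ℕ.* B)) (^-distrib-* 3 H d) ⟩
          3 ℕ.^ d ℕ.* H ℕ.^ d ℕ.* 2 ℕ.^ (B ℕ.* B)
            ≤⟨ ℕₚ.*-monoˡ-≤ (2 ℕ.^ (B ℕ.* B)) (ℕₚ.*-monoʳ-≤ (3 ℕ.^ d) H^d≤2X) ⟩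
          3 ℕ.^ d ℕ.* (2 ℕ.* X) ℕ.* 2 ℕ.^ (B ℕ.* B)
            ≡⟨ regroup (3 ℕ.^ d) X (2 ℕ.^ (B ℕ.* B)) ⟩
          countConstant ℕ.* X ∎
        where
        open ℕₚ.≤-Reasoning
        regroup : ∀ a x b → a ℕ.* (2 ℕ.* x) ℕ.* b ≡ a ℕ.* 2 ℕ.* b ℕ.* x
        regroup = solve 3 (λ a x b → a :* (con 2 :* x) :* b := a :* con 2 :* b :* x) refl
          where open ℕ-Solver.+-*-Solver
        T : Fin (length Ts) → Fin r → Bool
        T i = Vec.lookup (lookup Ts i)
        size : ∀ i → X ℕ.≤ norm (T i) × norm (T i) ℕ.< 2 ℕ.* X
        size i = All.lookup sizes (∈-lookup {xs = Ts} i)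
        ann : ∀ H → 2 ℕ.* X ℕ.< suc H ℕ.^ d → ∀ i → Annihilator points d H (T i)
        ann H lt i = annihilator points d H (T i) (ℕₚ.<-trans (proj₂ (size i)) (subst (2 ℕ.* X ℕ.<_) (sym (∏-const d (suc H))) lt))
        iff : ∀ {s t} → (s ≡ true → t ≡ true) → (t ≡ true → s ≡ true) → s ≡ t
        iff {true}  {t}     h k = sym (h refl)
        iff {false} {true}  h k = k refl
        iff {false} {false} h k = refl
        code-injective : ∀ H 1≤H H^d≤2X lt i j →
          code X H 1≤X 1≤H H^d≤2X (T i) (ann H lt i) ≡ code X H 1≤X 1≤H H^d≤2X (T j) (ann H lt j) → i ≡ j
        code-injective H 1≤H H^d≤2X lt i j eq = lookup-injective unique i j
          (trans (sym (Vec.tabulate∘lookup (lookup Ts i))) (trans (Vec.tabulate-cong (λ k → iff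
            (code-⊆ X H 1≤X 1≤H H^d≤2X (T i) (T j) (ann H lt i) (ann H lt j) (proj₁ (size j)) eq k)
            (code-⊆ X H 1≤X 1≤H H^d≤2X (T j) (T i) (ann H lt j) (ann H lt i) (proj₁ (size i)) (sym eq) k)))
          (Vec.tabulate∘lookup (lookup Ts j))))

-- Bounding the product of 1 + 1/p over the pairs

module ProductBound where

  open MixedRadix
  open import Data.Bool.Base using (Bool; true; false; if_then_else_)
  open import Data.Fin.Base using (Fin; zero; suc)
  open import Data.List.Base using (List; []; _∷_; _++_; length; map; filter)
  open import Data.List.Membership.Propositional using (_∈_)
  open import Data.List.Membership.Propositional.Properties using (∈-map⁻)
  open import Data.List.Relation.Unary.All as All using (All; []; _∷_)
  import Data.List.Relation.Unary.All.Properties as All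
  open import Data.List.Relation.Unary.AllPairs using ([]; _∷_)
  open import Data.List.Relation.Unary.Unique.Propositional using (Unique)
  import Data.List.Relation.Unary.Unique.Propositional.Properties as Unique
  open import Data.Nat.Base
  open import Data.Nat.Properties
  open import Data.Nat.Solver using (module +-*-Solver)
  open import Data.Product.Base using (∃-syntax; _×_; _,_)
  open import Data.Sum.Base using (_⊎_; inj₁; inj₂)
  open import Data.Vec.Base using (Vec; []; _∷_; lookup)
  import Data.Vec.Properties as Vec
  open import Function.Base using (_∘_)
  open import Level using (0ℓ)
  open import Relation.Binary.PropositionalEquality
  open import Relation.Nullary using (¬_; yes; no; contradiction; ¬?)
  open import Relation.Unary using (Pred; Decidable)

  ∑ₗ : ∀ {A : Set} → (A → ℕ) → List A → ℕ
  ∑ₗ g []       = 0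
  ∑ₗ g (x ∷ xs) = g x + ∑ₗ g xs

  ∑ₗ-++ : ∀ {A : Set} (g : A → ℕ) xs ys → ∑ₗ g (xs ++ ys) ≡ ∑ₗ g xs + ∑ₗ g ys
  ∑ₗ-++ g []       ys = refl
  ∑ₗ-++ g (x ∷ xs) ys = trans (cong (g x +_) (∑ₗ-++ g xs ys)) (sym (+-assoc (g x) (∑ₗ g xs) (∑ₗ g ys)))

  ∑ₗ-map : ∀ {A B : Set} (g : B → ℕ) (h : A → B) xs → ∑ₗ g (map h xs) ≡ ∑ₗ (g ∘ h) xs
  ∑ₗ-map g h []       = refl
  ∑ₗ-map g h (x ∷ xs) = cong (g (h x) +_) (∑ₗ-map g h xs)

  ∑ₗ-*ˡ : ∀ {A : Set} c (g : A → ℕ) xs → ∑ₗ (λ x → c * g x) xs ≡ c * ∑ₗ g xs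
  ∑ₗ-*ˡ c g []       = sym (*-zeroʳ c)
  ∑ₗ-*ˡ c g (x ∷ xs) = trans (cong (c * g x +_) (∑ₗ-*ˡ c g xs)) (sym (*-distribˡ-+ c (g x) (∑ₗ g xs)))

  ∑ₗ-mono : ∀ {A : Set} {g h : A → ℕ} {xs} → All (λ x → g x ≤ h x) xs → ∑ₗ g xs ≤ ∑ₗ h xs
  ∑ₗ-mono []       = z≤n
  ∑ₗ-mono (h ∷ hs) = +-mono-≤ h (∑ₗ-mono hs)

  ∑ₗ-const : ∀ {A : Set} m (xs : List A) → ∑ₗ (λ _ → m) xs ≡ length xs * m
  ∑ₗ-const m []       = refl
  ∑ₗ-const m (x ∷ xs) = cong (m +_) (∑ₗ-const m xs)

  module _ {A : Set} {Q : Pred A 0ℓ} (Q? : Decidable Q) (g : A → ℕ) where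
    ∑ₗ-split : ∀ xs → ∑ₗ g xs ≡ ∑ₗ g (filter Q? xs) + ∑ₗ g (filter (¬? ∘ Q?) xs)
    ∑ₗ-split [] = refl
    ∑ₗ-split (x ∷ xs) with Q? x
    ... | yes _ = trans (cong (g x +_) (∑ₗ-split xs)) (sym (+-assoc (g x) _ _))
    ... | no  _ = trans (cong (g x +_) (∑ₗ-split xs))
      (solve 3 (λ a b c → a :+ (b :+ c) := b :+ (a :+ c)) refl (g x) (∑ₗ g (filter Q? xs)) (∑ₗ g (filter (¬? ∘ Q?) xs)))
      where open +-*-Solver

    ∑ₗ-filter≤ : ∀ xs → ∑ₗ g (filter Q? xs) ≤ ∑ₗ g xs
    ∑ₗ-filter≤ xs = ≤-trans (m≤m+n _ _) (≤-reflexive (sym (∑ₗ-split xs)))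

  subsets : ∀ r → List (Vec Bool r)
  subsets zero    = [] ∷ []
  subsets (suc r) = map (true ∷_) (subsets r) ++ map (false ∷_) (subsets r)

  subsets-unique : ∀ r → Unique (subsets r)
  subsets-unique zero    = [] ∷ []
  subsets-unique (suc r) = Unique.++⁺ (Unique.map⁺ Vec.∷-injectiveʳ (subsets-unique r))
    (Unique.map⁺ Vec.∷-injectiveʳ (subsets-unique r)) disjoint
    where
    disjoint : ∀ {v} → ¬ (v ∈ map (true ∷_) (subsets r) × v ∈ map (false ∷_) (subsets r))
    disjoint (v∈₁ , v∈₂) with ∈-map⁻ (true ∷_) v∈₁ | ∈-map⁻ (false ∷_) v∈₂
    ... | _ , _ , refl | _ , _ , ()

  -- One term of an expanded product of sums. Denominators are cleared throughout: with M the
  -- product of all p, the reciprocal 1/N(T) appears below as `coN T`, which is M/N(T).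
  weigh : ∀ {r} → (x y : Fin r → ℕ) → Vec Bool r → ℕ
  weigh x y T = ∏ (λ i → if lookup T i then x i else y i)

  weigh-* : ∀ {r} (x y x′ y′ : Fin r → ℕ) T → weigh x y T * weigh x′ y′ T ≡ weigh (λ i → x i * x′ i) (λ i → y i * y′ i) T
  weigh-* x y x′ y′ []      = refl
  weigh-* x y x′ y′ (b ∷ T) = trans (interchange (if b then x zero else y zero) (weigh (x ∘ suc) (y ∘ suc) T) (if b then x′ zero else y′ zero) (weigh (x′ ∘ suc) (y′ ∘ suc) T))
    (cong₂ _*_ (if-* b) (weigh-* (x ∘ suc) (y ∘ suc) (x′ ∘ suc) (y′ ∘ suc) T))
    where
    interchange : ∀ a b c d → a * b * (c * d) ≡ a * c * (b * d)
    interchange = solve 4 (λ a b c d → a :* b :* (c :* d) := a :* c :* (b :* d)) refl where open +-*-Solver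
    if-* : ∀ b → (if b then x zero else y zero) * (if b then x′ zero else y′ zero) ≡ (if b then x zero * x′ zero else y zero * y′ zero)
    if-* true  = refl
    if-* false = refl

  weigh-mono : ∀ {r} {x y x′ y′ : Fin r → ℕ} → (∀ i → x i ≤ x′ i) → (∀ i → y i ≤ y′ i) → ∀ T → weigh x y T ≤ weigh x′ y′ T
  weigh-mono hx hy T = ∏-mono (λ i → pick (lookup T i) i)
    where
    pick : ∀ b i → (if b then _ else _) ≤ (if b then _ else _)
    pick true  i = hx i
    pick false i = hy i

  weigh-diag : ∀ {r} (x : Fin r → ℕ) T → weigh x x T ≡ ∏ x
  weigh-diag x []          = refl
  weigh-diag x (true ∷ T)  = cong (x zero *_) (weigh-diag (x ∘ suc) T)
  weigh-diag x (false ∷ T) = cong (x zero *_) (weigh-diag (x ∘ suc) T)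

  weigh-cong : ∀ {r} {x y x′ y′ : Fin r → ℕ} → (∀ i → x i ≡ x′ i) → (∀ i → y i ≡ y′ i) → ∀ T → weigh x y T ≡ weigh x′ y′ T
  weigh-cong hx hy T = ≤-antisym (weigh-mono (≤-reflexive ∘ hx) (≤-reflexive ∘ hy) T)
                                 (weigh-mono (≤-reflexive ∘ sym ∘ hx) (≤-reflexive ∘ sym ∘ hy) T)

  ∑-weigh : ∀ {r} (x y : Fin r → ℕ) → ∑ₗ (weigh x y) (subsets r) ≡ ∏ (λ i → x i + y i)
  ∑-weigh {zero}  x y = refl
  ∑-weigh {suc r} x y = begin
    ∑ₗ (weigh x y) (map (true ∷_) (subsets r) ++ map (false ∷_) (subsets r))
      ≡⟨ ∑ₗ-++ (weigh x y) (map (true ∷_) (subsets r)) _ ⟩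
    ∑ₗ (weigh x y) (map (true ∷_) (subsets r)) + ∑ₗ (weigh x y) (map (false ∷_) (subsets r))
      ≡⟨ cong₂ _+_ (trans (∑ₗ-map (weigh x y) (true ∷_) (subsets r)) (∑ₗ-*ˡ (x zero) w (subsets r)))
                   (trans (∑ₗ-map (weigh x y) (false ∷_) (subsets r)) (∑ₗ-*ˡ (y zero) w (subsets r))) ⟩
    x zero * ∑ₗ w (subsets r) + y zero * ∑ₗ w (subsets r)
      ≡⟨ *-distribʳ-+ (∑ₗ w (subsets r)) (x zero) (y zero) ⟨
    (x zero + y zero) * ∑ₗ w (subsets r)
      ≡⟨ cong ((x zero + y zero) *_) (∑-weigh (x ∘ suc) (y ∘ suc)) ⟩
    ∏ (λ i → x i + y i) ∎
    where
    open ≡-Reasoning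
    w = weigh (x ∘ suc) (y ∘ suc)

  ∏-* : ∀ {r} (x y : Fin r → ℕ) → ∏ (λ i → x i * y i) ≡ ∏ x * ∏ y
  ∏-* x y = trans (sym (weigh-diag _ full)) (trans (sym (weigh-* x x y y full)) (cong₂ _*_ (weigh-diag x full) (weigh-diag y full)))
    where
    full = Data.Vec.Base.replicate _ true

  -- Fixes the dyadic size of A/M without a division; `k` merely starts the downward search.
  minimal-exponent : ∀ A M k → A ≤ 2 ^ k * M → A ≤ M ⊎ ∃[ j ] (2 ^ j * M < A × A ≤ 2 ^ suc j * M)
  minimal-exponent A M zero    A≤ = inj₁ (subst (A ≤_) (+-identityʳ M) A≤)
  minimal-exponent A M (suc k) A≤ with A ≤? 2 ^ k * M
  ... | yes A≤′ = minimal-exponent A M k A≤′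
  ... | no  A≰  = inj₂ (k , ≰⇒> A≰ , A≤)

  n<2^n : ∀ n → n < 2 ^ n
  n<2^n zero    = s≤s z≤n
  n<2^n (suc n) = ≤-trans (+-mono-≤ (m^n>0 2 n) (n<2^n n)) (≤-reflexive (cong (2 ^ n +_) (sym (+-identityʳ (2 ^ n)))))

  [k+3]²≤16*2^k : ∀ k → (k + 3) * (k + 3) ≤ 16 * 2 ^ k
  [k+3]²≤16*2^k zero    = m≤m+n 9 7
  [k+3]²≤16*2^k (suc k) = begin
    (suc k + 3) * (suc k + 3)           ≤⟨ m≤m+n _ (k * k + 4 * k + 2) ⟩
    (suc k + 3) * (suc k + 3) + (k * k + 4 * k + 2)
      ≡⟨ solve 1 (λ k → (con 1 :+ k :+ con 3) :* (con 1 :+ k :+ con 3) :+ (k :* k :+ con 4 :* k :+ con 2)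
                     := con 2 :* ((k :+ con 3) :* (k :+ con 3))) refl k ⟩
    2 * ((k + 3) * (k + 3))             ≤⟨ *-monoʳ-≤ 2 ([k+3]²≤16*2^k k) ⟩
    2 * (16 * 2 ^ k)                    ≡⟨ solve 1 (λ x → con 2 :* (con 16 :* x) := con 16 :* (con 2 :* x)) refl (2 ^ k) ⟩
    16 * (2 * 2 ^ k)                    ∎
    where
    open ≤-Reasoning
    open +-*-Solver

  -- Squaring puts 4^k on the left, and (k + 3)² ≤ 16 · 2^k on the right leaves one power 2^k to
  -- cancel. The linear factor k + 3 thus costs only a doubling of e.
  exponent-bound : ∀ c k e → 2 ^ k ≤ c * (k + 3) * 2 ^ e → k ≤ c * c * 16 + 2 * e
  exponent-bound c k e h = ≮⇒≥ (λ n≤k → <⇒≱ (<-≤-trans small (^-monoʳ-≤ 2 n≤k)) bound)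
    where
    open ≤-Reasoning
    open +-*-Solver
    n = suc (c * c * 16 + 2 * e)
    bound : 2 ^ k ≤ c * c * 16 * 2 ^ (2 * e)
    bound = *-cancelʳ-≤ (2 ^ k) _ (2 ^ k) {{m^n≢0 2 k}} (begin
      2 ^ k * 2 ^ k
        ≤⟨ *-mono-≤ h h ⟩
      c * (k + 3) * 2 ^ e * (c * (k + 3) * 2 ^ e)
        ≡⟨ solve 3 (λ c k e → c :* (k :+ con 3) :* e :* (c :* (k :+ con 3) :* e) := c :* c :* (e :* e) :* ((k :+ con 3) :* (k :+ con 3))) refl c k (2 ^ e) ⟩
      c * c * (2 ^ e * 2 ^ e) * ((k + 3) * (k + 3))
        ≤⟨ *-monoʳ-≤ (c * c * (2 ^ e * 2 ^ e)) ([k+3]²≤16*2^k k) ⟩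
      c * c * (2 ^ e * 2 ^ e) * (16 * 2 ^ k)
        ≡⟨ solve 3 (λ c x y → c :* c :* x :* (con 16 :* y) := c :* c :* con 16 :* x :* y) refl c (2 ^ e * 2 ^ e) (2 ^ k) ⟩
      c * c * 16 * (2 ^ e * 2 ^ e) * 2 ^ k
        ≡⟨ cong (λ t → c * c * 16 * t * 2 ^ k) (trans (sym (^-distribˡ-+-* 2 e e)) (cong (λ t → 2 ^ (e + t)) (sym (+-identityʳ e)))) ⟩
      c * c * 16 * 2 ^ (2 * e) * 2 ^ k ∎)
    small : c * c * 16 * 2 ^ (2 * e) < 2 ^ n
    small = begin-strict
      c * c * 16 * 2 ^ (2 * e)              <⟨ *-monoˡ-< (2 ^ (2 * e)) {{m^n≢0 2 (2 * e)}} (n<2^n (c * c * 16)) ⟩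
      2 ^ (c * c * 16) * 2 ^ (2 * e)        ≡⟨ ^-distribˡ-+-* 2 (c * c * 16) (2 * e) ⟨
      2 ^ (c * c * 16 + 2 * e)              ≤⟨ ^-monoʳ-≤ 2 (n≤1+n (c * c * 16 + 2 * e)) ⟩
      2 ^ n                                 ∎

  -- The factor 2C stems from `self-bound`, the bracket from `exponent-bound`. The successor keeps
  -- the constant positive for C = 0, which the case A ≤ M of `product≤` relies on.
  productConstant : ℕ → ℕ
  productConstant C = suc (2 * C * (2 * C * (2 * C) * 16 + 3))

  module _ {r} (p : Fin r → ℕ) (p≥1 : ∀ i → 1 ≤ p i) (C : ℕ)
    (count : ∀ X → 1 ≤ X → (Ts : List (Vec Bool r)) → Unique Ts →
             All (λ T → X ≤ weigh p (λ _ → 1) T × weigh p (λ _ → 1) T < 2 * X) Ts → length Ts ≤ C * X) where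
    private
      open ≤-Reasoning
      N coN pow : Vec Bool r → ℕ
      N   = weigh p (λ _ → 1)
      coN = weigh (λ _ → 1) p
      pow = weigh (λ _ → 2) (λ _ → 1)
      M : ℕ
      M = ∏ p

      N*coN : ∀ T → N T * coN T ≡ M
      N*coN T = trans (weigh-* p (λ _ → 1) (λ _ → 1) p T)
        (trans (weigh-cong (λ i → *-identityʳ (p i)) (λ i → *-identityˡ (p i)) T) (weigh-diag p T))

      -- There are at most C · 2^j such sets, each contributing at most M/2^j.
      bucket : ∀ j Ts → Unique Ts → All (λ T → 2 ^ j ≤ N T × N T < 2 * 2 ^ j) Ts → ∑ₗ coN Ts ≤ C * M
      bucket j Ts unique sizes = *-cancelˡ-≤ (2 ^ j) {{m^n≢0 2 j}} (begin
        2 ^ j * ∑ₗ coN Ts             ≡⟨ ∑ₗ-*ˡ (2 ^ j) coN Ts ⟨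
        ∑ₗ (λ T → 2 ^ j * coN T) Ts   ≤⟨ ∑ₗ-mono (All.map (λ {T} (h , _) → ≤-trans (*-monoˡ-≤ (coN T) h) (≤-reflexive (N*coN T))) sizes) ⟩
        ∑ₗ (λ _ → M) Ts               ≡⟨ ∑ₗ-const M Ts ⟩
        length Ts * M                 ≤⟨ *-monoˡ-≤ M (count (2 ^ j) (m^n>0 2 j) Ts unique sizes) ⟩
        C * 2 ^ j * M                 ≡⟨ solve 3 (λ c x m → c :* x :* m := x :* (c :* m)) refl C (2 ^ j) M ⟩
        2 ^ j * (C * M)               ∎)
        where open +-*-Solver

      -- Every dyadic block of norms costs C M. Norms are at least 1, so nothing remains for
      -- `J = 0`.
      dyadic : ∀ J Ts → Unique Ts → All (λ T → N T < 2 ^ J) Ts → ∑ₗ coN Ts ≤ J * (C * M)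
      dyadic zero []       unique sizes      = z≤n
      dyadic zero (T ∷ Ts) unique (s ∷ _) = contradiction (∏-pos (λ i → pick (lookup T i) i)) (<⇒≱ s)
        where
        pick : ∀ b i → 1 ≤ (if b then p i else 1)
        pick true  i = p≥1 i
        pick false i = ≤-refl
      dyadic (suc J) Ts unique sizes = begin
        ∑ₗ coN Ts
          ≡⟨ ∑ₗ-split (λ T → N T <? 2 ^ J) coN Ts ⟩
        ∑ₗ coN small + ∑ₗ coN large
          ≤⟨ +-mono-≤ (dyadic J small (Unique.filter⁺ _ unique) (All.all-filter _ Ts))
               (bucket J large (Unique.filter⁺ _ unique) (All.zipWith (λ (a , b) → ≮⇒≥ a , b) (All.all-filter _ Ts , All.filter⁺ _ sizes))) ⟩
        J * (C * M) + C * M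
          ≡⟨ +-comm (J * (C * M)) (C * M) ⟩
        suc J * (C * M) ∎
        where
        small = filter (λ T → N T <? 2 ^ J) Ts
        large = filter (¬? ∘ (λ T → N T <? 2 ^ J)) Ts

      A : ℕ
      A = ∏ (λ i → 1 + p i)

      -- Rankin's trick: a set with more than K elements has 2^|T|/2^K ≥ 1 and may be given that
      -- extra weight. The weighted sum over all sets is the product of 2 + p, and (2 + p) p ≤ (1 +
      -- p)².
      tail : ∀ K → 2 ^ K * ∑ₗ coN (filter (¬? ∘ (λ T → pow T ≤? 2 ^ K)) (subsets r)) * M ≤ A * A
      tail K = begin
        2 ^ K * ∑ₗ coN large * M
          ≡⟨ cong (_* M) (∑ₗ-*ˡ (2 ^ K) coN large) ⟨
        ∑ₗ (λ T → 2 ^ K * coN T) large * M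
          ≤⟨ *-monoˡ-≤ M (≤-trans (∑ₗ-mono (All.map (λ {T} h → ≤-trans (*-monoˡ-≤ (coN T) (<⇒≤ (≰⇒> h)))
               (≤-reflexive (trans (weigh-* (λ _ → 2) (λ _ → 1) (λ _ → 1) p T) (weigh-cong (λ _ → refl) (λ i → *-identityˡ (p i)) T))))
               (All.all-filter _ (subsets r))))
               (∑ₗ-filter≤ (¬? ∘ (λ T → pow T ≤? 2 ^ K)) (weigh (λ _ → 2) p) (subsets r))) ⟩
        ∑ₗ (weigh (λ _ → 2) p) (subsets r) * M
          ≡⟨ cong (_* M) (∑-weigh (λ _ → 2) p) ⟩
        ∏ (λ i → 2 + p i) * M
          ≡⟨ ∏-* (λ i → 2 + p i) p ⟨
        ∏ (λ i → (2 + p i) * p i)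
          ≤⟨ ∏-mono (λ i → ≤-trans (m≤m+n ((2 + p i) * p i) 1) (≤-reflexive
               (solve 1 (λ p → (con 2 :+ p) :* p :+ con 1 := (con 1 :+ p) :* (con 1 :+ p)) refl (p i)))) ⟩
        ∏ (λ i → (1 + p i) * (1 + p i))
          ≡⟨ ∏-* (λ i → 1 + p i) (λ i → 1 + p i) ⟩
        A * A ∎
        where
        open +-*-Solver
        large = filter (¬? ∘ (λ T → pow T ≤? 2 ^ K)) (subsets r)

    module _ {ℓ} (p≤2^ℓ : ∀ i → p i ≤ 2 ^ ℓ) where
      private
        N≤pow^ℓ : ∀ T → N T ≤ pow T ^ ℓ
        N≤pow^ℓ T = ≤-trans (weigh-mono p≤2^ℓ (λ _ → ≤-refl) T) (≤-reflexive (powers ℓ))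
          where
          powers : ∀ ℓ → weigh (λ _ → 2 ^ ℓ) (λ _ → 1) T ≡ pow T ^ ℓ
          powers zero    = trans (weigh-diag (λ _ → 1) T) (trans (∏-const r 1) (^-zeroˡ r))
          powers (suc ℓ) = trans (sym (weigh-* (λ _ → 2) (λ _ → 1) (λ _ → 2 ^ ℓ) (λ _ → 1) T)) (cong (pow T *_) (powers ℓ))

        -- The threshold 2^(k + 1) is chosen so that the sets beyond it carry at most half of A. The
        -- other half comes from sets of norm at most 2^((k + 1) ℓ), which fill (k + 1) ℓ + 1 dyadic
        -- blocks.
        self-bound : ∀ k → A ≤ 2 ^ k * M → A ≤ 2 * (suc (suc k * ℓ) * (C * M))
        self-bound k A≤ = +-cancelʳ-≤ A A (2 * (suc (suc k * ℓ) * (C * M))) (begin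
          A + A
            ≡⟨ cong (A +_) (+-identityʳ A) ⟨
          2 * A
            ≡⟨ cong (2 *_) (trans (sym (∑-weigh (λ _ → 1) p)) (∑ₗ-split (λ T → pow T ≤? 2 ^ suc k) coN (subsets r))) ⟩
          2 * (∑ₗ coN small + ∑ₗ coN large)
            ≡⟨ *-distribˡ-+ 2 (∑ₗ coN small) (∑ₗ coN large) ⟩
          2 * ∑ₗ coN small + 2 * ∑ₗ coN large
            ≤⟨ +-mono-≤ (*-monoʳ-≤ 2 (dyadic (suc (suc k * ℓ)) small (Unique.filter⁺ _ (subsets-unique r))
                 (All.map (λ {T} h → ≤-<-trans (≤-trans (N≤pow^ℓ T) (≤-trans (^-monoˡ-≤ ℓ h) (≤-reflexive (^-*-assoc 2 (suc k) ℓ))))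
                   (^-monoʳ-< 2 ≤-refl (n<1+n (suc k * ℓ)))) (All.all-filter _ (subsets r))))) large≤ ⟩
          2 * (suc (suc k * ℓ) * (C * M)) + A ∎)
          where
          small = filter (λ T → pow T ≤? 2 ^ suc k) (subsets r)
          large = filter (¬? ∘ (λ T → pow T ≤? 2 ^ suc k)) (subsets r)
          large≤ : 2 * ∑ₗ coN large ≤ A
          large≤ = *-cancelʳ-≤ (2 * ∑ₗ coN large) A (2 ^ k * M) {{>-nonZero (*-mono-≤ (m^n>0 2 k) (∏-pos p≥1))}} (begin
            2 * ∑ₗ coN large * (2 ^ k * M)   ≡⟨ solve 3 (λ s x m → con 2 :* s :* (x :* m) := con 2 :* x :* s :* m) refl (∑ₗ coN large) (2 ^ k) M ⟩
            2 * 2 ^ k * ∑ₗ coN large * M     ≤⟨ tail (suc k) ⟩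
            A * A                            ≤⟨ *-monoʳ-≤ A A≤ ⟩
            A * (2 ^ k * M)                  ∎)
            where open +-*-Solver

      -- With 2^k < A/M ≤ 2^(k + 1), `self-bound` gives A/M = O(k ℓ). Comparing this with 2^k < A/M
      -- and ℓ ≤ 2^e yields k = O(e + 1).
      product≤ : ∀ e → 1 ≤ ℓ → ℓ ≤ 2 ^ e → A ≤ productConstant C * (ℓ * suc e) * M
      product≤ e 1≤ℓ ℓ≤2^e with minimal-exponent A M r (begin
        A                         ≤⟨ ∏-mono (λ i → ≤-trans (+-monoˡ-≤ (p i) (p≥1 i)) (≤-reflexive (cong (p i +_) (sym (+-identityʳ (p i)))))) ⟩
        ∏ (λ i → 2 * p i)         ≡⟨ ∏-* (λ _ → 2) p ⟩
        ∏ {r} (λ _ → 2) * M       ≡⟨ cong (_* M) (∏-const r 2) ⟩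
        2 ^ r * M                 ∎)
      ... | inj₁ A≤M = ≤-trans A≤M (≤-trans (≤-reflexive (sym (+-identityʳ M)))
              (*-monoˡ-≤ M (*-mono-≤ {1} {productConstant C} (s≤s z≤n) (*-mono-≤ {1} {ℓ} 1≤ℓ (s≤s z≤n)))))
      ... | inj₂ (k , 2^kM<A , A≤) = begin
        A
          ≤⟨ A≤′ ⟩
        c * (k + 3) * ℓ * M
          ≤⟨ *-monoˡ-≤ M (*-monoˡ-≤ ℓ (*-monoʳ-≤ c (begin
               k + 3                              ≤⟨ +-monoˡ-≤ 3 (exponent-bound c k e 2^k≤) ⟩
               c * c * 16 + 2 * e + 3             ≤⟨ m≤m+n _ (e * (c * c * 16 + 1)) ⟩
               c * c * 16 + 2 * e + 3 + e * (c * c * 16 + 1)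
                 ≡⟨ solve 2 (λ s e → s :+ con 2 :* e :+ con 3 :+ e :* (s :+ con 1) := (s :+ con 3) :* (con 1 :+ e)) refl (c * c * 16) e ⟩
               (c * c * 16 + 3) * suc e           ∎))) ⟩
        c * ((c * c * 16 + 3) * suc e) * ℓ * M
          ≡⟨ solve 5 (λ c s e l m → c :* (s :* e) :* l :* m := c :* s :* (l :* e) :* m) refl c (c * c * 16 + 3) (suc e) ℓ M ⟩
        c * (c * c * 16 + 3) * (ℓ * suc e) * M
          ≤⟨ *-monoˡ-≤ M (*-monoˡ-≤ (ℓ * suc e) (n≤1+n (c * (c * c * 16 + 3)))) ⟩
        productConstant C * (ℓ * suc e) * M ∎
        where
        open +-*-Solver
        c = 2 * C
        A≤′ : A ≤ c * (k + 3) * ℓ * M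
        A≤′ = begin
          A
            ≤⟨ self-bound (suc k) A≤ ⟩
          2 * (suc (suc (suc k) * ℓ) * (C * M))
            ≤⟨ *-monoʳ-≤ 2 (*-monoˡ-≤ (C * M) (+-monoˡ-≤ (suc (suc k) * ℓ) 1≤ℓ)) ⟩
          2 * ((ℓ + suc (suc k) * ℓ) * (C * M))
            ≡⟨ solve 4 (λ l k c m → con 2 :* ((l :+ (con 1 :+ (con 1 :+ k)) :* l) :* (c :* m)) := con 2 :* c :* (k :+ con 3) :* l :* m) refl ℓ k C M ⟩
          c * (k + 3) * ℓ * M ∎
        2^k≤ : 2 ^ k ≤ c * (k + 3) * 2 ^ e
        2^k≤ = ≤-trans (*-cancelʳ-≤ _ _ M {{>-nonZero (∏-pos p≥1)}} (≤-trans (<⇒≤ 2^kM<A) A≤′)) (*-monoʳ-≤ (c * (k + 3)) ℓ≤2^e)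

-- Lower bound for `φ P n` as a product over the prime factors of n

module Sieve where

  open import Defs using (ℤ[X]; φ; evalℤ)
  open IntegerPolynomials using (eval)
  open Separators using (residue-injective)
  open import Data.Integer.Base as ℤ using (ℤ; +_; 0ℤ)
  import Data.Integer.Properties as ℤₚ
  open import Data.Integer.Solver using (module +-*-Solver)
  open import Data.Integer.Divisibility.Signed as ℤ∣ using (divides) renaming (_∣_ to _∣ₛ_)
  import Data.Integer.DivMod as ℤ
  open import Data.List.Base using (List; []; _∷_; _∷ʳ_; length; map; filter; upTo)
  import Data.List.Properties as List
  open import Data.List.Relation.Unary.All as All using (All; []; _∷_)
  import Data.List.Relation.Unary.All.Properties as All
  open import Data.List.Relation.Unary.AllPairs using ([]; _∷_)
  open import Data.List.Relation.Unary.Unique.Propositional using (Unique)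
  import Data.List.Relation.Unary.Unique.Propositional.Properties as Unique
  open import Data.Nat.Base
  open import Data.Nat.Properties
  open import Data.Nat.DivMod using (_%_; m%n<n; m≡m%n+[m/n]*n)
  open import Data.Nat.Divisibility as ℕ∣ using (_∣_; _∣?_)
  open import Data.Nat.GCD using (gcd; gcd[m,n]∣m; gcd[m,n]∣n; gcd[m,n]≢0)
  open import Data.Nat.Primality using (Prime; prime?; prime⇒nonZero; euclidsLemma; ¬prime[1]; prime⇒irreducible)
  open import Data.Nat.Primality.Factorisation using (factorise)
  import Data.Nat.Solver as ℕ-Solver
  open import Data.Product.Base using (∃-syntax; _×_; _,_)
  open import Data.Sum.Base using (inj₁; inj₂; [_,_]′)
  open import Relation.Binary.PropositionalEquality
  open import Relation.Nullary using (¬_; yes; no; contradiction; Dec; ¬?; _×-dec_)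
  open import Relation.Unary using (Pred; Decidable)
  open import Level using (0ℓ)
  open ProductBound using (∑ₗ)

  ∑< : (ℕ → ℕ) → ℕ → ℕ
  ∑< f zero    = 0
  ∑< f (suc m) = ∑< f m + f m

  ∏< : (ℕ → ℕ) → ℕ → ℕ
  ∏< f zero    = 1
  ∏< f (suc m) = ∏< f m * f m

  ∑<-+ : ∀ f a b → ∑< f (a + b) ≡ ∑< f a + ∑< (λ j → f (a + j)) b
  ∑<-+ f a zero    = trans (cong (∑< f) (+-identityʳ a)) (sym (+-identityʳ (∑< f a)))
  ∑<-+ f a (suc b) = trans (cong (∑< f) (+-suc a b))
    (trans (cong (_+ f (a + b)) (∑<-+ f a b)) (+-assoc (∑< f a) (∑< (λ j → f (a + j)) b) (f (a + b))))

  ∑<-cong : ∀ {f g} m → (∀ k → k < m → f k ≡ g k) → ∑< f m ≡ ∑< g m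
  ∑<-cong zero    h = refl
  ∑<-cong (suc m) h = cong₂ _+_ (∑<-cong m (λ k k<m → h k (m<n⇒m<1+n k<m))) (h m ≤-refl)

  ∑<-mono : ∀ {f g} m → (∀ k → f k ≤ g k) → ∑< f m ≤ ∑< g m
  ∑<-mono zero    h = z≤n
  ∑<-mono (suc m) h = +-mono-≤ (∑<-mono m h) (h m)

  ∑<-distrib-+ : ∀ f g m → ∑< (λ k → f k + g k) m ≡ ∑< f m + ∑< g m
  ∑<-distrib-+ f g zero    = refl
  ∑<-distrib-+ f g (suc m) = trans (cong (_+ (f m + g m)) (∑<-distrib-+ f g m))
    (solve 4 (λ a b c d → a :+ b :+ (c :+ d) := a :+ c :+ (b :+ d)) refl (∑< f m) (∑< g m) (f m) (g m))
    where open ℕ-Solver.+-*-Solver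

  ∑<-*ˡ : ∀ c f m → ∑< (λ k → c * f k) m ≡ c * ∑< f m
  ∑<-*ˡ c f zero    = sym (*-zeroʳ c)
  ∑<-*ˡ c f (suc m) = trans (cong (_+ c * f m) (∑<-*ˡ c f m)) (sym (*-distribˡ-+ c (∑< f m) (f m)))

  ∑<-const : ∀ c m → ∑< (λ _ → c) m ≡ m * c
  ∑<-const c zero    = refl
  ∑<-const c (suc m) = trans (cong (_+ c) (∑<-const c m)) (+-comm (m * c) c)

  ∑<-exchange : ∀ (F : ℕ → ℕ → ℕ) m n → ∑< (λ s → ∑< (F s) n) m ≡ ∑< (λ t → ∑< (λ s → F s t) m) n
  ∑<-exchange F zero    n = sym (trans (∑<-const 0 n) (*-zeroʳ n))
  ∑<-exchange F (suc m) n = trans (cong (_+ ∑< (F m) n) (∑<-exchange F m n))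
    (sym (∑<-distrib-+ (λ t → ∑< (λ s → F s t) m) (F m) n))

  ∑<-blocks : ∀ f m q → ∑< f (m * q) ≡ ∑< (λ t → ∑< (λ j → f (t * q + j)) q) m
  ∑<-blocks f zero    q = refl
  ∑<-blocks f (suc m) q = trans (cong (∑< f) (+-comm q (m * q)))
    (trans (∑<-+ f (m * q) q) (cong (_+ ∑< (λ j → f (m * q + j)) q) (∑<-blocks f m q)))

  ∏<-* : ∀ f g m → ∏< (λ k → f k * g k) m ≡ ∏< f m * ∏< g m
  ∏<-* f g zero    = refl
  ∏<-* f g (suc m) = trans (cong (_* (f m * g m)) (∏<-* f g m))
    (solve 4 (λ a b c d → a :* b :* (c :* d) := a :* c :* (b :* d)) refl (∏< f m) (∏< g m) (f m) (g m))
    where open ℕ-Solver.+-*-Solver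

  ∏<-mono : ∀ {f g} m → (∀ k → f k ≤ g k) → ∏< f m ≤ ∏< g m
  ∏<-mono zero    h = ≤-refl
  ∏<-mono (suc m) h = *-mono-≤ (∏<-mono m h) (h m)

  ∏<-cong : ∀ {f g} m → (∀ k → k < m → f k ≡ g k) → ∏< f m ≡ ∏< g m
  ∏<-cong zero    h = refl
  ∏<-cong (suc m) h = cong₂ _*_ (∏<-cong m (λ k k<m → h k (m<n⇒m<1+n k<m))) (h m ≤-refl)

  ∏<-pos : ∀ {f} m → (∀ k → 1 ≤ f k) → 1 ≤ ∏< f m
  ∏<-pos zero    h = ≤-refl
  ∏<-pos (suc m) h = *-mono-≤ (∏<-pos m h) (h m)

  ∣∏< : ∀ f {q} m → q < m → f q ∣ ∏< f m
  ∣∏< f {q} (suc m) q<1+m with m≤n⇒m<n∨m≡n (≤-pred q<1+m)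
  ... | inj₁ q<m  = ℕ∣.∣-trans (∣∏< f m q<m) (ℕ∣.m∣m*n (f m))
  ... | inj₂ refl = ℕ∣.n∣m*n (∏< f q)

  ∏<-vanishes : ∀ f {q} m → q < m → f q ≡ 0 → ∏< f m ≡ 0
  ∏<-vanishes f m q<m fq≡0 = ℕ∣.0∣⇒≡0 (subst (_∣ ∏< f m) fq≡0 (∣∏< f m q<m))

  prime∣∏< : ∀ f {q} → Prime q → ∀ m → q ∣ ∏< f m → ∃[ k ] (k < m × q ∣ f k)
  prime∣∏< f {q} pr zero    q∣1 = contradiction (subst Prime (ℕ∣.∣1⇒≡1 q∣1) pr) ¬prime[1]
  prime∣∏< f {q} pr (suc m) q∣ with euclidsLemma (∏< f m) (f m) pr q∣
  ... | inj₁ q∣∏ = let k , k<m , q∣fk = prime∣∏< f pr m q∣∏ in k , m<n⇒m<1+n k<m , q∣fk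
  ... | inj₂ q∣f = m , ≤-refl , q∣f

  remove : ∀ (f : ℕ → ℕ) m xs → Unique xs → ∑ₗ f xs ≤ ∑ₗ f (filter (λ x → ¬? (x ≟ m)) xs) + f m
  remove f m []       _         = z≤n
  remove f m (x ∷ xs) (x∉ ∷ u) = go (x ≟ m)
    where
    go : Dec (x ≡ m) → f x + ∑ₗ f xs ≤ ∑ₗ f (filter (λ x → ¬? (x ≟ m)) (x ∷ xs)) + f m
    go (no x≢m) = subst (λ l → f x + ∑ₗ f xs ≤ ∑ₗ f l + f m)
      (sym (List.filter-accept (λ x → ¬? (x ≟ m)) {xs = xs} x≢m))
      (≤-trans (+-monoʳ-≤ (f x) (remove f m xs u)) (≤-reflexive (sym (+-assoc (f x) _ (f m)))))
    go (yes refl) = subst (λ l → f x + ∑ₗ f xs ≤ ∑ₗ f l + f x)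
      (sym (trans (List.filter-reject (λ y → ¬? (y ≟ x)) {xs = xs} (λ x≢x → x≢x refl))
                  (List.filter-all (λ y → ¬? (y ≟ x)) (All.map ≢-sym x∉))))
      (≤-reflexive (+-comm (f x) (∑ₗ f xs)))

  unique-sum≤ : ∀ f m xs → Unique xs → All (_< m) xs → ∑ₗ f xs ≤ ∑< f m
  unique-sum≤ f zero    []       _ _        = z≤n
  unique-sum≤ f zero    (x ∷ xs) _ (() ∷ _)
  unique-sum≤ f (suc m) xs u below = ≤-trans (remove f m xs u) (+-monoˡ-≤ (f m)
    (unique-sum≤ f m (filter (λ x → ¬? (x ≟ m)) xs) (Unique.filter⁺ _ u)
      (All.zipWith (λ (x≢m , x<1+m) → ≤∧≢⇒< (≤-pred x<1+m) x≢m) (All.all-filter _ xs , All.filter⁺ _ below))))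

  upTo-∷ʳ : ∀ m → upTo (suc m) ≡ upTo m ∷ʳ m
  upTo-∷ʳ m = sym (List.applyUpTo-∷ʳ (λ k → k) m)

  ∑ₗ-∷ʳ : ∀ (f : ℕ → ℕ) xs x → ∑ₗ f (xs ∷ʳ x) ≡ ∑ₗ f xs + f x
  ∑ₗ-∷ʳ f []       x = +-identityʳ (f x)
  ∑ₗ-∷ʳ f (y ∷ xs) x = trans (cong (λ z → f y + z) (∑ₗ-∷ʳ f xs x)) (sym (+-assoc (f y) (∑ₗ f xs) (f x)))

  ∑ₗ-upTo : ∀ f m → ∑ₗ f (upTo m) ≡ ∑< f m
  ∑ₗ-upTo f zero    = refl
  ∑ₗ-upTo f (suc m) = trans (cong (∑ₗ f) (upTo-∷ʳ m)) (trans (∑ₗ-∷ʳ f (upTo m) m) (cong (_+ f m) (∑ₗ-upTo f m)))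

  ∑<-injective : ∀ f (σ : ℕ → ℕ) m → (∀ s → σ s < m) → (∀ s t → s < m → t < m → σ s ≡ σ t → s ≡ t) →
                 ∑< (λ s → f (σ s)) m ≤ ∑< f m
  ∑<-injective f σ m σ<m inj = subst (_≤ ∑< f m) (trans (sum-map (upTo m)) (∑ₗ-upTo (λ s → f (σ s)) m))
    (unique-sum≤ f m (map σ (upTo m)) (unique (upTo m) (Unique.upTo⁺ m) (All.applyUpTo⁺₁ (λ s → s) m (λ s<m → s<m)))
      (All.map⁺ (All.universal σ<m (upTo m))))
    where
    sum-map : ∀ xs → ∑ₗ f (map σ xs) ≡ ∑ₗ (λ s → f (σ s)) xs
    sum-map []       = refl
    sum-map (x ∷ xs) = cong (λ z → f (σ x) + z) (sum-map xs)
    unique : ∀ xs → Unique xs → All (_< m) xs → Unique (map σ xs)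
    unique []       _        _        = []
    unique (x ∷ xs) (x∉ ∷ u) (x< ∷ <s) =
      All.map⁺ (All.zipWith (λ {y} (x≢y , y<) σx≡σy → x≢y (inj x y x< y< σx≡σy)) (x∉ , <s)) ∷ unique xs u <s

  ∑ₗ≤length-filter : ∀ {Q : Pred ℕ 0ℓ} (Q? : Decidable Q) f → (∀ k → f k ≤ 1) → (∀ k → f k ≢ 0 → Q k) →
                     ∀ xs → ∑ₗ f xs ≤ length (filter Q? xs)
  ∑ₗ≤length-filter Q? f f≤1 f⇒Q []       = z≤n
  ∑ₗ≤length-filter Q? f f≤1 f⇒Q (x ∷ xs) with Q? x
  ... | yes _ = +-mono-≤ (f≤1 x) (∑ₗ≤length-filter Q? f f≤1 f⇒Q xs)
  ... | no ¬q with f x ≟ 0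
  ...   | yes fx≡0 = subst (λ s → s + ∑ₗ f xs ≤ length (filter Q? xs)) (sym fx≡0) (∑ₗ≤length-filter Q? f f≤1 f⇒Q xs)
  ...   | no  fx≢0 = contradiction (f⇒Q x fx≢0) ¬q

  -- Takes the decision as an argument, so that a proof can hand it to a helper and match on it
  -- there.
  pick : ∀ {A : Set} → Dec A → ℕ → ℕ → ℕ
  pick (yes _) x y = x
  pick (no _)  x y = y

  pick-yes : ∀ {A : Set} (a? : Dec A) {x y} → A → pick a? x y ≡ x
  pick-yes (yes _) a = refl
  pick-yes (no ¬a) a = contradiction a ¬a

  pick-no : ∀ {A : Set} (a? : Dec A) {x y} → ¬ A → pick a? x y ≡ y
  pick-no (yes a) ¬a = contradiction a ¬a
  pick-no (no _)  ¬a = refl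

  pick-⇔ : ∀ {A B : Set} (a? : Dec A) (b? : Dec B) {x y} → (A → B) → (B → A) → pick a? x y ≡ pick b? x y
  pick-⇔ (yes a) b? f g = sym (pick-yes b? (f a))
  pick-⇔ (no ¬a) b? f g = sym (pick-no b? (λ b → ¬a (g b)))

  eval-congruent : ∀ q p x y → q ∣ₛ x ℤ.- y → q ∣ₛ eval p x ℤ.- eval p y
  eval-congruent q []      x y h = divides 0ℤ refl
  eval-congruent q (a ∷ p) x y h = subst (q ∣ₛ_) (regroup a x y (eval p x) (eval p y))
    (ℤ∣.∣m∣n⇒∣m+n {q} {(x ℤ.- y) ℤ.* eval p x} {y ℤ.* (eval p x ℤ.- eval p y)}
      (ℤ∣.∣m⇒∣m*n {q} {x ℤ.- y} (eval p x) h) (ℤ∣.∣n⇒∣m*n {q} y {eval p x ℤ.- eval p y} (eval-congruent q p x y h)))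
    where
    open +-*-Solver
    regroup : ∀ a x y u v → (x ℤ.- y) ℤ.* u ℤ.+ y ℤ.* (u ℤ.- v) ≡ a ℤ.+ x ℤ.* u ℤ.- (a ℤ.+ y ℤ.* v)
    regroup = solve 5 (λ a x y u v → (x :- y) :* u :+ y :* (u :- v) := a :+ x :* u :- (a :+ y :* v)) refl

  ∣-congruent : ∀ q u v → q ∣ₛ u ℤ.- v → q ∣ₛ v → q ∣ₛ u
  ∣-congruent q u v h k = subst (q ∣ₛ_) (solve 2 (λ u v → u :- v :+ v := u) refl u v)
    (ℤ∣.∣m∣n⇒∣m+n {q} {u ℤ.- v} {v} h k)
    where open +-*-Solver

  negate-∣ : ∀ q u v → q ∣ₛ u ℤ.- v → q ∣ₛ v ℤ.- u
  negate-∣ q u v h = subst (q ∣ₛ_) (solve 2 (λ u v → :- (u :- v) := v :- u) refl u v) (ℤ∣.∣m⇒∣-m {q} {u ℤ.- v} h)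
    where open +-*-Solver

  shift-∣ : ∀ {q} Q t j → q ∣ Q → + q ∣ₛ + (t * Q + j) ℤ.- + j
  shift-∣ {q} Q t j q∣Q = subst (+ q ∣ₛ_)
    (sym (trans (cong (ℤ._- + j) (ℤₚ.pos-+ (t * Q) j)) (solve 2 (λ a b → a :+ b :- b := a) refl (+ (t * Q)) (+ j))))
    (ℤ∣.∣ᵤ⇒∣ {+ q} {+ (t * Q)} (ℕ∣.∣n⇒∣m*n t q∣Q))
    where open +-*-Solver

  module _ (P : ℤ[X]) where

    nonroot : ℕ → ℕ → ℕ
    nonroot q k = pick (+ q ℤ∣.∣? eval P (+ k)) 0 1

    nonroot≤1 : ∀ q k → nonroot q k ≤ 1
    nonroot≤1 q k = go (+ q ℤ∣.∣? eval P (+ k))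
      where
      go : ∀ {A : Set} (a? : Dec A) → pick a? 0 1 ≤ 1
      go (yes _) = z≤n
      go (no _)  = ≤-refl

    nonroots : ℕ → ℕ
    nonroots q = ∑< (nonroot q) q

    nonroot-periodic : ∀ q k k′ → + q ∣ₛ + k ℤ.- + k′ → nonroot q k ≡ nonroot q k′
    nonroot-periodic q k k′ h = pick-⇔ (+ q ℤ∣.∣? eval P (+ k)) (+ q ℤ∣.∣? eval P (+ k′))
      (∣-congruent (+ q) (eval P (+ k′)) (eval P (+ k)) (negate-∣ (+ q) (eval P (+ k)) (eval P (+ k′)) close))
      (∣-congruent (+ q) (eval P (+ k)) (eval P (+ k′)) close)
      where
      close = eval-congruent (+ q) P (+ k) (+ k′) h

    -- The map t ↦ t Q + j modulo q is injective, which bounds the roots along the progression from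
    -- above by all roots. Complementing inside a set of q elements turns this into a lower bound
    -- for the nonroots.
    progression-nonroots : ∀ {q} → Prime q → ∀ Q j → ¬ q ∣ Q → nonroots q ≤ ∑< (λ t → nonroot q (t * Q + j)) q
    progression-nonroots {q} pr Q j q∤Q = +-cancelʳ-≤ roots (nonroots q) _ (begin
      nonroots q + roots
        ≡⟨ trans (sym (∑<-distrib-+ (nonroot q) (λ k → 1 ∸ nonroot q k) q)) (∑<-cong q (λ k _ → m+[n∸m]≡n (nonroot≤1 q k))) ⟩
      ∑< (λ _ → 1) q
        ≡⟨ trans (∑<-cong q (λ t _ → sym (m+[n∸m]≡n (nonroot≤1 q (t * Q + j))))) (∑<-distrib-+ (λ t → nonroot q (t * Q + j)) _ q) ⟩
      ∑< (λ t → nonroot q (t * Q + j)) q + ∑< (λ t → 1 ∸ nonroot q (t * Q + j)) q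
        ≡⟨ cong (λ z → ∑< (λ t → nonroot q (t * Q + j)) q + z) (∑<-cong q (λ t _ → cong (1 ∸_) (nonroot-periodic q _ _ (reduce (t * Q + j))))) ⟩
      ∑< (λ t → nonroot q (t * Q + j)) q + ∑< (λ t → 1 ∸ nonroot q (σ t)) q
        ≤⟨ +-monoʳ-≤ (∑< (λ t → nonroot q (t * Q + j)) q) (∑<-injective (λ k → 1 ∸ nonroot q k) σ q (λ t → m%n<n (t * Q + j) q) σ-injective) ⟩
      ∑< (λ t → nonroot q (t * Q + j)) q + roots ∎)
      where
      open ≤-Reasoning
      instance _ = prime⇒nonZero pr
      roots = ∑< (λ k → 1 ∸ nonroot q k) q
      σ : ℕ → ℕ
      σ t = (t * Q + j) % q
      reduce : ∀ k → + q ∣ₛ + k ℤ.- + (k % q)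
      reduce k = subst (λ x → + q ∣ₛ + x ℤ.- + (k % q))
        (trans (+-comm (k / q * q) (k % q)) (sym (m≡m%n+[m/n]*n k q))) (shift-∣ q (k / q) (k % q) ℕ∣.∣-refl)
      σ-injective : ∀ s t → s < q → t < q → σ s ≡ σ t → s ≡ t
      σ-injective s t s<q t<q eq = residue-injective s<q t<q
        ([ (λ q∣Q → contradiction q∣Q q∤Q) , (λ q∣d → ℤ∣.∣ᵤ⇒∣ {+ q} {+ t ℤ.- + s} q∣d) ]′
          (euclidsLemma Q ℤ.∣ + t ℤ.- + s ∣ pr (subst (q ∣_) (ℤₚ.abs-* (+ Q) (+ t ℤ.- + s)) (ℤ∣.∣⇒∣ᵤ {+ q} product∣))))
        where
        difference∣ : + q ∣ₛ + (t * Q + j) ℤ.- + (s * Q + j)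
        difference∣ = subst (+ q ∣ₛ_) (swap (+ (t * Q + j)) (+ (s * Q + j)) (+ σ t))
          (ℤ∣.∣m∣n⇒∣m-n {+ q} {+ (t * Q + j) ℤ.- + σ t} {+ (s * Q + j) ℤ.- + σ t} (reduce (t * Q + j))
            (subst (λ x → + q ∣ₛ + (s * Q + j) ℤ.- + x) eq (reduce (s * Q + j))))
          where
          open +-*-Solver
          swap : ∀ a b c → a ℤ.- c ℤ.- (b ℤ.- c) ≡ a ℤ.- b
          swap = solve 3 (λ a b c → a :- c :- (b :- c) := a :- b) refl
        product∣ : + q ∣ₛ + Q ℤ.* (+ t ℤ.- + s)
        product∣ = subst (+ q ∣ₛ_) (trans (cong₂ ℤ._-_ (cast t) (cast s)) (expand (+ t) (+ s) (+ Q) (+ j))) difference∣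
          where
          open +-*-Solver
          cast : ∀ t → + (t * Q + j) ≡ + t ℤ.* + Q ℤ.+ + j
          cast t = trans (ℤₚ.pos-+ (t * Q) j) (cong (ℤ._+ + j) (ℤₚ.pos-* t Q))
          expand : ∀ t s Q j → t ℤ.* Q ℤ.+ j ℤ.- (s ℤ.* Q ℤ.+ j) ≡ Q ℤ.* (t ℤ.- s)
          expand = solve 4 (λ t s Q j → t :* Q :+ j :- (s :* Q :+ j) := Q :* (t :- s)) refl

    module _ (n : ℕ) where

      PrimeFactor : ℕ → Set
      PrimeFactor q = Prime q × q ∣ n

      primeFactor? : ∀ q → Dec (PrimeFactor q)
      primeFactor? q = prime? q ×-dec (q ∣? n)

      -- The product of `bot` up to n is the radical of n. At a prime factor q of n the quotient of
      -- `top` by `bot` is the local density 1 - ρ(q)/q.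
      bot top : ℕ → ℕ
      bot q = pick (primeFactor? q) q 1
      top q = pick (primeFactor? q) (nonroots q) 1

      factor′ : ℕ → ℕ → ℕ
      factor′ k q = pick (primeFactor? q) (nonroot q k) 1

      -- Indicator of those k that are roots of P modulo none of the prime factors of n below m.
      sieved : ℕ → ℕ → ℕ
      sieved m k = ∏< (factor′ k) m

      primeFactor∣bot : ∀ {q} m → q < m → PrimeFactor q → q ∣ ∏< bot m
      primeFactor∣bot {q} m q<m pf = subst (_∣ ∏< bot m) (pick-yes (primeFactor? q) pf) (∣∏< bot m q<m)

      prime∣bot : ∀ {q} m → Prime q → q ∣ ∏< bot m → q < m
      prime∣bot {q} m pr q∣ with prime∣∏< bot pr m q∣
      ... | k , k<m , q∣bot = subst (_< m) (sym (go (primeFactor? k) q∣bot)) k<m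
        where
        go : ∀ (a? : Dec (PrimeFactor k)) → q ∣ pick a? k 1 → q ≡ k
        go (no _)          q∣1 = contradiction (subst Prime (ℕ∣.∣1⇒≡1 q∣1) pr) ¬prime[1]
        go (yes (prk , _)) q∣k with prime⇒irreducible prk q∣k
        ... | inj₁ q≡1 = contradiction (subst Prime q≡1 pr) ¬prime[1]
        ... | inj₂ q≡k = q≡k

      -- A prime does not divide the product of the smaller prime factors, so it divides the
      -- cofactor of that product in n.
      bot∣n : ∀ m → ∏< bot m ∣ n
      bot∣n zero    = ℕ∣.1∣ n
      bot∣n (suc m) = go (primeFactor? m)
        where
        go : (a? : Dec (PrimeFactor m)) → ∏< bot m * pick a? m 1 ∣ n
        go (no _)             = subst (_∣ n) (sym (*-identityʳ (∏< bot m))) (bot∣n m)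
        go (yes (pr , m∣n)) with bot∣n m
        ... | ℕ∣.divides k n≡ = [ (λ m∣k → subst (∏< bot m * m ∣_) (trans (*-comm (∏< bot m) k) (sym n≡)) (ℕ∣.*-monoʳ-∣ (∏< bot m) m∣k))
                                , (λ m∣Q → contradiction (prime∣bot m pr m∣Q) (<-irrefl refl)) ]′
                                (euclidsLemma k (∏< bot m) pr (subst (m ∣_) n≡ m∣n))

      sieved-periodic : ∀ m t j → sieved m (t * ∏< bot m + j) ≡ sieved m j
      sieved-periodic m t j = ∏<-cong m (λ q q<m → go q q<m (primeFactor? q))
        where
        go : ∀ q → q < m → (a? : Dec (PrimeFactor q)) → pick a? (nonroot q (t * ∏< bot m + j)) 1 ≡ pick a? (nonroot q j) 1
        go q q<m (no _)   = refl
        go q q<m (yes pf) = nonroot-periodic q _ _ (shift-∣ (∏< bot m) t j (primeFactor∣bot m q<m pf))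

      -- A one-sided Chinese remainder theorem, one prime at a time. Numbers below Q m are written t
      -- Q + j: the earlier conditions depend on j alone, and for fixed j the numbers t Q + j sweep
      -- all residues modulo the new prime.
      top≤sieved : ∀ m → ∏< top m ≤ ∑< (sieved m) (∏< bot m)
      top≤sieved zero    = ≤-refl
      top≤sieved (suc m) = go (primeFactor? m)
        where
        open ≤-Reasoning
        Q = ∏< bot m
        go : (a? : Dec (PrimeFactor m)) →
             ∏< top m * pick a? (nonroots m) 1 ≤ ∑< (λ k → sieved m k * pick a? (nonroot m k) 1) (Q * pick a? m 1)
        go (no _) = begin
          ∏< top m * 1                    ≡⟨ *-identityʳ (∏< top m) ⟩
          ∏< top m                        ≤⟨ top≤sieved m ⟩
          ∑< (sieved m) Q                 ≡⟨ ∑<-cong Q (λ k _ → sym (*-identityʳ (sieved m k))) ⟩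
          ∑< (λ k → sieved m k * 1) Q     ≡⟨ cong (∑< (λ k → sieved m k * 1)) (*-identityʳ Q) ⟨
          ∑< (λ k → sieved m k * 1) (Q * 1) ∎
        go (yes (pr , m∣n)) = begin
          ∏< top m * nonroots m
            ≤⟨ *-monoˡ-≤ (nonroots m) (top≤sieved m) ⟩
          ∑< (sieved m) Q * nonroots m
            ≡⟨ trans (*-comm (∑< (sieved m) Q) (nonroots m)) (trans (sym (∑<-*ˡ (nonroots m) (sieved m) Q)) (∑<-cong Q (λ k _ → *-comm (nonroots m) (sieved m k)))) ⟩
          ∑< (λ j → sieved m j * nonroots m) Q
            ≤⟨ ∑<-mono Q (λ j → *-monoʳ-≤ (sieved m j) (progression-nonroots pr Q j (λ m∣Q → <-irrefl refl (prime∣bot m pr m∣Q)))) ⟩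
          ∑< (λ j → sieved m j * ∑< (λ t → nonroot m (t * Q + j)) m) Q
            ≡⟨ ∑<-cong Q (λ j _ → trans (sym (∑<-*ˡ (sieved m j) (λ t → nonroot m (t * Q + j)) m))
                 (∑<-cong m (λ t _ → cong (_* nonroot m (t * Q + j)) (sym (sieved-periodic m t j))))) ⟩
          ∑< (λ j → ∑< (λ t → sieved m (t * Q + j) * nonroot m (t * Q + j)) m) Q
            ≡⟨ ∑<-exchange (λ t j → sieved m (t * Q + j) * nonroot m (t * Q + j)) m Q ⟨
          ∑< (λ t → ∑< (λ j → sieved m (t * Q + j) * nonroot m (t * Q + j)) Q) m
            ≡⟨ ∑<-blocks (λ k → sieved m k * nonroot m k) m Q ⟨
          ∑< (λ k → sieved m k * nonroot m k) (m * Q)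
            ≡⟨ cong (∑< (λ k → sieved m k * nonroot m k)) (*-comm m Q) ⟩
          ∑< (λ k → sieved m k * nonroot m k) (Q * m) ∎

      module _ .{{_ : NonZero n}} where

        private
          coprime? : ∀ k → Dec (gcd ℤ.∣ evalℤ P (+ k) ∣ n ≡ 1)
          coprime? k = gcd ℤ.∣ evalℤ P (+ k) ∣ n ≟ 1

          -- A gcd above 1 has a prime factor q. It divides n, so q ≤ n lies in the range of the
          -- product, and the factor at q is 0.
          sieved⇒coprime : ∀ k → sieved (suc n) k ≢ 0 → gcd ℤ.∣ evalℤ P (+ k) ∣ n ≡ 1
          sieved⇒coprime k s≢0 with gcd ℤ.∣ evalℤ P (+ k) ∣ n in eq
          ... | zero  = contradiction (gcd[m,n]≢0-contra eq) λ ()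
            where
            gcd[m,n]≢0-contra : gcd ℤ.∣ evalℤ P (+ k) ∣ n ≡ 0 → 1 ≡ 0
            gcd[m,n]≢0-contra e = contradiction e (≢-nonZero⁻¹ _ {{≢-nonZero (gcd[m,n]≢0 ℤ.∣ evalℤ P (+ k) ∣ n (inj₂ (≢-nonZero⁻¹ n)))}})
          ... | suc g with factorise (suc g)
          ...   | record { factors = [] ; isFactorisation = g≡1 } = g≡1
          ...   | record { factors = q ∷ qs ; isFactorisation = g≡ ; factorsPrime = pr ∷ _ } =
            contradiction (∏<-vanishes (factor′ k) (suc n) (s≤s (ℕ∣.∣⇒≤ q∣n))
              (trans (pick-yes (primeFactor? q) (pr , q∣n)) (pick-yes (+ q ℤ∣.∣? eval P (+ k)) (ℤ∣.∣ᵤ⇒∣ {+ q} {eval P (+ k)} q∣P)))) s≢0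
            where
            q∣g : q ∣ gcd ℤ.∣ evalℤ P (+ k) ∣ n
            q∣g = subst (q ∣_) (sym (trans eq g≡)) (ℕ∣.m∣m*n _)
            q∣n = ℕ∣.∣-trans q∣g (gcd[m,n]∣n ℤ.∣ evalℤ P (+ k) ∣ n)
            q∣P = ℕ∣.∣-trans q∣g (gcd[m,n]∣m ℤ.∣ evalℤ P (+ k) ∣ n)

        sieved≤1 : ∀ m k → sieved m k ≤ 1
        sieved≤1 zero    k = ≤-refl
        sieved≤1 (suc m) k = *-mono-≤ (sieved≤1 m k) (go (primeFactor? m))
          where
          go : (a? : Dec (PrimeFactor m)) → pick a? (nonroot m k) 1 ≤ 1
          go (yes _) = nonroot≤1 m k
          go (no _)  = ≤-refl

        ∑sieved≤φ : ∑< (sieved (suc n)) n ≤ φ P n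
        ∑sieved≤φ = subst (_≤ φ P n) (∑ₗ-upTo (sieved (suc n)) n)
          (∑ₗ≤length-filter coprime? (sieved (suc n)) (sieved≤1 (suc n)) sieved⇒coprime (upTo n))

        -- The radical Q divides n, so 0, ..., n - 1 consists of n/Q full periods of the sieve.
        n*top≤φ*bot : n * ∏< top (suc n) ≤ φ P n * ∏< bot (suc n)
        n*top≤φ*bot with bot∣n (suc n)
        ... | ℕ∣.divides M n≡ = begin
          n * ∏< top (suc n)                       ≡⟨ cong (_* ∏< top (suc n)) n≡ ⟩
          M * Q * ∏< top (suc n)                   ≤⟨ *-monoʳ-≤ (M * Q) (top≤sieved (suc n)) ⟩
          M * Q * ∑< (sieved (suc n)) Q            ≡⟨ regroup M Q (∑< (sieved (suc n)) Q) ⟩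
          M * ∑< (sieved (suc n)) Q * Q            ≡⟨ cong (_* Q) (∑<-const (∑< (sieved (suc n)) Q) M) ⟨
          ∑< (λ _ → ∑< (sieved (suc n)) Q) M * Q   ≡⟨ cong (_* Q) (∑<-cong M (λ t _ → ∑<-cong Q (λ j _ → sieved-periodic (suc n) t j))) ⟨
          ∑< (λ t → ∑< (λ j → sieved (suc n) (t * Q + j)) Q) M * Q
                                                   ≡⟨ cong (_* Q) (∑<-blocks (sieved (suc n)) M Q) ⟨
          ∑< (sieved (suc n)) (M * Q) * Q          ≡⟨ cong (λ x → ∑< (sieved (suc n)) x * Q) n≡ ⟨
          ∑< (sieved (suc n)) n * Q                ≤⟨ *-monoˡ-≤ Q ∑sieved≤φ ⟩
          φ P n * Q                                ∎
          where
          open ≤-Reasoning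
          Q = ∏< bot (suc n)
          regroup : ∀ a b c → a * b * c ≡ a * c * b
          regroup = solve 3 (λ a b c → a :* b :* c := a :* c :* b) refl where open ℕ-Solver.+-*-Solver

-- Comparing the sieve product with the product over pairs

module SieveEstimate where

  open import Defs using (ℤ[X]; φ; HasDegree; Irreducible; IsGCDOfValues)
  open IntegerPolynomials using (eval)
  open MixedRadix using (∏)
  open ModularRoots using (number-of-roots)
  open Separators using (residue-injective; Points)
  open SubsetCount using (lookup-injective; count≤; countConstant)
  open ProductBound using (∑ₗ; product≤; productConstant)
  open Sieve
  open import Data.Fin.Base using (zero; suc)
  open import Data.Integer.Base as ℤ using (ℤ; +_)
  open import Data.Integer.Divisibility.Signed as ℤ∣ using () renaming (_∣_ to _∣ₛ_)
  open import Data.List.Base using (List; []; _∷_; _++_; length; map; filter; upTo; lookup)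
  import Data.List.Properties as List
  open import Data.List.Membership.Propositional using (_∈_)
  open import Data.List.Membership.Propositional.Properties using (∈-lookup; ∈-map⁻)
  open import Data.List.Relation.Unary.All as All using (All; []; _∷_)
  import Data.List.Relation.Unary.All.Properties as All
  open import Data.List.Relation.Unary.AllPairs as AllPairs using (AllPairs; []; _∷_)
  import Data.List.Relation.Unary.AllPairs.Properties as AllPairs
  open import Data.List.Relation.Unary.Unique.Propositional using (Unique)
  import Data.List.Relation.Unary.Unique.Propositional.Properties as Unique
  open import Data.Nat.Base
  open import Data.Nat.Properties
  open import Data.Nat.DivMod using (_%_; m%n<n; m≡m%n+[m/n]*n)
  open import Data.Nat.Divisibility as ℕ∣ using (_∣_; _∣?_)
  open import Data.Nat.GCD using (gcd; gcd-greatest)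
  open import Data.Nat.Primality using (Prime; prime?; prime⇒nonZero; prime⇒nonTrivial; ¬prime[1])
  open import Data.Nat.Solver using (module +-*-Solver)
  open import Data.Product.Base using (_×_; _,_; proj₁; proj₂)
  open import Data.Sum.Base using (inj₁; inj₂)
  open import Level using (0ℓ)
  open import Relation.Binary.PropositionalEquality
  open import Relation.Nullary using (¬_; yes; no; contradiction; Dec; ¬?; _×-dec_)
  open import Relation.Unary using (Pred; Decidable)

  length-filter-complement : ∀ {Q : Pred ℕ 0ℓ} (Q? : Decidable Q) xs →
                             ∑ₗ (λ k → pick (Q? k) 0 1) xs + length (filter Q? xs) ≡ length xs
  length-filter-complement Q? [] = refl
  length-filter-complement Q? (x ∷ xs) with Q? x
  ... | yes _ = trans (+-suc _ _) (cong suc (length-filter-complement Q? xs))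
  ... | no  _ = cong suc (length-filter-complement Q? xs)

  ∑<-zero : ∀ f m → ∑< f m ≡ 0 → ∀ k → k < m → f k ≡ 0
  ∑<-zero f (suc m) eq k k<1+m with m≤n⇒m<n∨m≡n (≤-pred k<1+m)
  ... | inj₁ k<m  = ∑<-zero f m (m+n≡0⇒m≡0 (∑< f m) eq) k k<m
  ... | inj₂ refl = m+n≡0⇒n≡0 (∑< f k) eq

  -- Bernoulli's inequality for (1 + 1/q)^r with denominators cleared.
  bernoulli : ∀ q r → q ^ r * (q + r) ≤ q * suc q ^ r
  bernoulli q zero    = ≤-reflexive (solve 1 (λ q → con 1 :* (q :+ con 0) := q :* con 1) refl q) where open +-*-Solver
  bernoulli q (suc r) = begin
    q * q ^ r * (q + suc r)              ≤⟨ m≤m+n _ (q ^ r * r) ⟩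
    q * q ^ r * (q + suc r) + q ^ r * r  ≡⟨ solve 3 (λ q x r → q :* x :* (q :+ (con 1 :+ r)) :+ x :* r := (con 1 :+ q) :* (x :* (q :+ r))) refl q (q ^ r) r ⟩
    suc q * (q ^ r * (q + r))            ≤⟨ *-monoʳ-≤ (suc q) (bernoulli q r) ⟩
    suc q * (q * suc q ^ r)              ≡⟨ solve 3 (λ s q x → s :* (q :* x) := q :* (s :* x)) refl (suc q) q (suc q ^ r) ⟩
    q * (suc q * suc q ^ r)              ∎
    where
    open ≤-Reasoning
    open +-*-Solver

  ∏ₗ : ∀ {A : Set} → (A → ℕ) → List A → ℕ
  ∏ₗ g []       = 1
  ∏ₗ g (x ∷ xs) = g x * ∏ₗ g xs

  ∏ₗ-++ : ∀ {A : Set} (g : A → ℕ) xs ys → ∏ₗ g (xs ++ ys) ≡ ∏ₗ g xs * ∏ₗ g ys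
  ∏ₗ-++ g []       ys = sym (+-identityʳ (∏ₗ g ys))
  ∏ₗ-++ g (x ∷ xs) ys = trans (cong (g x *_) (∏ₗ-++ g xs ys)) (sym (*-assoc (g x) (∏ₗ g xs) (∏ₗ g ys)))

  ∏-lookup : ∀ {A : Set} (g : A → ℕ) xs → ∏ (λ i → g (lookup xs i)) ≡ ∏ₗ g xs
  ∏-lookup g []       = refl
  ∏-lookup g (x ∷ xs) = cong (g x *_) (∏-lookup g xs)

  -- At most `a` of the factors differ from 1.
  capped-product : ∀ a b m → 1 ≤ b → ∏< (λ q → pick (q <? a) b 1) m ≤ b ^ a
  capped-product a b m 1≤b with ≤-total m a
  ... | inj₁ m≤a = ≤-trans (bounded m) (^-monoʳ-≤ b {{>-nonZero 1≤b}} m≤a)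
    where
    bounded : ∀ m → ∏< (λ q → pick (q <? a) b 1) m ≤ b ^ m
    bounded zero    = ≤-refl
    bounded (suc m) = ≤-trans (*-mono-≤ (bounded m) (go (m <? a))) (≤-reflexive (*-comm (b ^ m) b))
      where
      go : (c? : Dec (m < a)) → pick c? b 1 ≤ b
      go (yes _) = ≤-refl
      go (no _)  = 1≤b
  capped-product a b zero    1≤b | inj₂ a≤m = m^n>0 b {{>-nonZero 1≤b}} a
  capped-product a b (suc m) 1≤b | inj₂ a≤1+m with m≤n⇒m<n∨m≡n a≤1+m
  ... | inj₁ a<1+m = ≤-trans (≤-reflexive (trans (cong (∏< (λ q → pick (q <? a) b 1) m *_)
                       (pick-no (m <? a) (≤⇒≯ (≤-pred a<1+m)))) (*-identityʳ _))) (capped-product a b m 1≤b)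
  ... | inj₂ refl  = ≤-trans (*-mono-≤ (bounded m) (go (m <? suc m))) (≤-reflexive (*-comm (b ^ m) b))
    where
    go : (c? : Dec (m < suc m)) → pick c? b 1 ≤ b
    go (yes _) = ≤-refl
    go (no _)  = 1≤b
    bounded : ∀ k → ∏< (λ q → pick (q <? suc m) b 1) k ≤ b ^ k
    bounded zero    = ≤-refl
    bounded (suc k) = ≤-trans (*-mono-≤ (bounded k) (go′ (k <? suc m))) (≤-reflexive (*-comm (b ^ k) b))
      where
      go′ : (c? : Dec (k < suc m)) → pick c? b 1 ≤ b
      go′ (yes _) = ≤-refl
      go′ (no _)  = 1≤b

  module _ {P : ℤ[X]} {d′ δ : ℕ} (irreducible : Irreducible P) (deg : HasDegree P (suc d′)) (gcdδ : IsGCDOfValues P δ) where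
    private
      d D q₀ : ℕ
      d = suc d′
      D = d * d
      -- From here on the losses 1 - D/q² multiply to more than 1/2; the finitely many smaller
      -- primes are treated crudely.
      q₀ = suc (2 * D)

    root? : ∀ q a → Dec (+ q ∣ₛ eval P (+ a))
    root? q a = + q ℤ∣.∣? eval P (+ a)

    rootList : ℕ → List ℕ
    rootList q = filter (root? q) (upTo q)

    ρ : ℕ → ℕ
    ρ q = length (rootList q)

    nonroots+ρ : ∀ q → nonroots P q + ρ q ≡ q
    nonroots+ρ q = trans (cong (λ z → z + ρ q) (sym (∑ₗ-upTo (nonroot P q) q)))
      (trans (length-filter-complement (root? q) (upTo q)) (List.length-upTo q))

    rootList< : ∀ q → All (_< q) (rootList q)
    rootList< q = All.filter⁺ (root? q) (All.applyUpTo⁺₁ (λ a → a) q (λ a<q → a<q))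

    ρ≤d : ∀ {q} → Prime q → ¬ q ∣ δ → ρ q ≤ d
    ρ≤d {q} pr q∤δ = subst (_≤ d) (List.length-map +_ (rootList q))
      (number-of-roots {P} {d} {δ} deg gcdδ pr q∤δ (map +_ (rootList q))
        (AllPairs.map⁺ (incongruent (rootList q) (Unique.filter⁺ (root? q) (Unique.upTo⁺ q)) (rootList< q)))
        (All.map⁺ (All.all-filter (root? q) (upTo q))))
      where
      incongruent : ∀ xs → Unique xs → All (_< q) xs → AllPairs (λ a b → ¬ + q ∣ₛ + b ℤ.- + a) xs
      incongruent []       []       []        = []
      incongruent (a ∷ xs) (a∉ ∷ u) (a<q ∷ h) =
        All.zipWith (λ (a≢b , b<q) q∣ → a≢b (residue-injective a<q b<q q∣)) (a∉ , h) ∷ incongruent xs u h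

    -- If every residue were a root, q would divide all values of P, hence δ. This is how
    -- coprimality of n and δ keeps every factor of the sieve positive.
    nonroots≥1 : ∀ {q} → Prime q → ¬ q ∣ δ → 1 ≤ nonroots P q
    nonroots≥1 {q} pr q∤δ = n≢0⇒n>0 (λ none → q∤δ (proj₂ gcdδ q (λ k →
      ℤ∣.∣⇒∣ᵤ {+ q} {eval P (+ k)} (is-root (root? q k) (trans (nonroot-periodic P q k (k % q) (reduce k))
        (∑<-zero (nonroot P q) q none (k % q) (m%n<n k q)))))))
      where
      instance _ = prime⇒nonZero pr
      reduce : ∀ k → + q ∣ₛ + k ℤ.- + (k % q)
      reduce k = subst (λ x → + q ∣ₛ + x ℤ.- + (k % q))
        (trans (+-comm (k / q * q) (k % q)) (sym (m≡m%n+[m/n]*n k q))) (shift-∣ q (k / q) (k % q) ℕ∣.∣-refl)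
      is-root : ∀ {A : Set} (a? : Dec A) → pick a? 0 1 ≡ 0 → A
      is-root (yes a) _ = a

    module _ (z : ℕ) where

      Good : ℕ → Set
      Good q = Prime q × ¬ q ∣ δ × q ≤ z

      good? : ∀ q → Dec (Good q)
      good? q = prime? q ×-dec ¬? (q ∣? δ) ×-dec (q ≤? z)

      fibre : ∀ q → Dec (Good q) → List (ℕ × ℕ)
      fibre q (yes _) = map (q ,_) (rootList q)
      fibre q (no _)  = []

      pairs : ℕ → List (ℕ × ℕ)
      pairs zero    = []
      pairs (suc m) = pairs m ++ fibre m (good? m)

      Valid : ℕ → ℕ × ℕ → Set
      Valid m (q , a) = Good q × a < q × + q ∣ₛ eval P (+ a) × q < m

      pairs-valid : ∀ m → All (Valid m) (pairs m)
      pairs-valid zero    = []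
      pairs-valid (suc m) = All.++⁺ (All.map (λ (g , a<q , r , q<m) → g , a<q , r , m<n⇒m<1+n q<m) (pairs-valid m)) (go (good? m))
        where
        go : (g? : Dec (Good m)) → All (Valid (suc m)) (fibre m g?)
        go (no _)  = []
        go (yes g) = All.map⁺ (All.zipWith (λ (a<m , r) → g , a<m , r , ≤-refl) (rootList< m , All.all-filter (root? m) (upTo m)))

      pairs-unique : ∀ m → Unique (pairs m)
      pairs-unique zero    = []
      pairs-unique (suc m) = Unique.++⁺ (pairs-unique m) (go (good? m)) (disjoint (good? m))
        where
        go : (g? : Dec (Good m)) → Unique (fibre m g?)
        go (no _)  = []
        go (yes _) = Unique.map⁺ (cong proj₂) (Unique.filter⁺ (root? m) (Unique.upTo⁺ m))
        disjoint : (g? : Dec (Good m)) → ∀ {v} → ¬ (v ∈ pairs m × v ∈ fibre m g?)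
        disjoint (no _)  (_ , ())
        disjoint (yes _) (v∈ , v∈′) with ∈-map⁻ (m ,_) v∈′
        ... | a , _ , refl = <-irrefl refl (proj₂ (proj₂ (proj₂ (All.lookup (pairs-valid m) v∈))))

      points : ∀ m → Points P δ (length (pairs m))
      points m = record
        { p = λ i → proj₁ (lookup (pairs m) i)
        ; a = λ i → proj₂ (lookup (pairs m) i)
        ; prime = λ i → proj₁ (proj₁ (valid i))
        ; p∤δ = λ i → proj₁ (proj₂ (proj₁ (valid i)))
        ; a<p = λ i → proj₁ (proj₂ (valid i))
        ; root = λ i → proj₁ (proj₂ (proj₂ (valid i)))
        ; distinct = λ {i} {j} e e′ → lookup-injective (pairs-unique m) i j (cong₂ _,_ e e′)
        }
        where
        valid : ∀ i → Valid m (lookup (pairs m) i)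
        valid i = All.lookup (pairs-valid m) (∈-lookup i)

      p≤z : ∀ m i → proj₁ (lookup (pairs m) i) ≤ z
      p≤z m i = proj₂ (proj₂ (proj₁ (All.lookup (pairs-valid m) (∈-lookup i))))

      power-at : (ℕ → ℕ) → ℕ → ℕ
      power-at g q = pick (good? q) (g q ^ ρ q) 1

      -- The prime q occurs once for each of its ρ(q) roots, so grouping the pairs by prime produces
      -- the exponent ρ(q).
      ∏-pairs : ∀ (g : ℕ → ℕ) m → ∏ (λ i → g (proj₁ (lookup (pairs m) i))) ≡ ∏< (power-at g) m
      ∏-pairs g m = trans (∏-lookup (λ x → g (proj₁ x)) (pairs m)) (products m)
        where
        constant : ∀ q xs → ∏ₗ (λ x → g (proj₁ x)) (map (q ,_) xs) ≡ g q ^ length xs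
        constant q []       = refl
        constant q (x ∷ xs) = cong (g q *_) (constant q xs)
        go : ∀ m (g? : Dec (Good m)) → ∏ₗ (λ x → g (proj₁ x)) (fibre m g?) ≡ pick g? (g m ^ ρ m) 1
        go m (yes _) = constant m (rootList m)
        go m (no _)  = refl
        products : ∀ m → ∏ₗ (λ x → g (proj₁ x)) (pairs m) ≡ ∏< (power-at g) m
        products zero    = refl
        products (suc m) = trans (∏ₗ-++ (λ x → g (proj₁ x)) (pairs m) _) (cong₂ _*_ (products m) (go m (good? m)))

      pp pq : ℕ → ℕ
      pp = power-at suc
      pq = power-at (λ q → q)

      pq≥1 : ∀ q → 1 ≤ pq q
      pq≥1 q = go (good? q)
        where
        go : (g? : Dec (Good q)) → 1 ≤ pick g? (q ^ ρ q) 1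
        go (yes (pr , _)) = m^n>0 q {{prime⇒nonZero pr}} (ρ q)
        go (no _)         = ≤-refl

      pq≤pp : ∀ q → pq q ≤ pp q
      pq≤pp q = go (good? q)
        where
        go : (g? : Dec (Good q)) → pick g? (q ^ ρ q) 1 ≤ pick g? (suc q ^ ρ q) 1
        go (yes _) = ^-monoˡ-≤ (ρ q) (n≤1+n q)
        go (no _)  = ≤-refl

    pairProductConstant : ℕ
    pairProductConstant = productConstant (countConstant {P} {d′} {δ} irreducible deg gcdδ)

    -- The bound for the product of 1 + 1/p over pairs with z = 2^ℓ, now as a product over primes of
    -- (1 + 1/q)^ρ(q).
    pp≤pq : ∀ ℓ e m → 1 ≤ ℓ → ℓ ≤ 2 ^ e → ∏< (pp (2 ^ ℓ)) m ≤ pairProductConstant * (ℓ * suc e) * ∏< (pq (2 ^ ℓ)) m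
    pp≤pq ℓ e m 1≤ℓ ℓ≤2^e = subst₂ (λ x y → x ≤ pairProductConstant * (ℓ * suc e) * y)
      (∏-pairs (2 ^ ℓ) suc m) (∏-pairs (2 ^ ℓ) (λ q → q) m)
      (product≤ (Points.p (points (2 ^ ℓ) m))
        (λ i → >-nonZero⁻¹ _ {{prime⇒nonZero (Points.prime (points (2 ^ ℓ) m) i)}})
        (countConstant {P} {d′} {δ} irreducible deg gcdδ)
        (count≤ {P} {d′} {δ} irreducible deg gcdδ (points (2 ^ ℓ) m))
        {ℓ} (p≤z (2 ^ ℓ) m) e 1≤ℓ ℓ≤2^e)

    module _ (n : ℕ) .{{_ : NonZero n}} (coprime : gcd n δ ≡ 1) (z : ℕ) where
      open ≤-Reasoning
      open +-*-Solver

      factor∤δ : ∀ {q} → PrimeFactor P n q → ¬ q ∣ δ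
      factor∤δ (pr , q∣n) q∣δ = ¬prime[1] (subst Prime (ℕ∣.∣1⇒≡1 (subst (_ ∣_) coprime (gcd-greatest q∣n q∣δ))) pr)

      private
        -- At a prime q ≤ z dividing n the quotient of `T` by `B` is (1 - ρ(q)/q) (1 + 1/q)^ρ(q),
        -- which is close to 1. Bounding the product of `B` by a constant times that of `T`
        -- transfers the estimate for pairs to the sieve.
        b t B T : ℕ → ℕ
        b = bot P n
        t = top P n
        B q = b q * pq z q
        T q = t q * pp z q

      t≥1 : ∀ q → 1 ≤ t q
      t≥1 q = go (primeFactor? P n q)
        where
        go : (f? : Dec (PrimeFactor P n q)) → 1 ≤ pick f? (nonroots P q) 1
        go (yes f) = nonroots≥1 (proj₁ f) (factor∤δ f)
        go (no _)  = ≤-refl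

      -- q ≤ 2 D; 2 D < q ≤ z; and the remaining q
      low middle high : (ℕ → ℕ) → ℕ → ℕ
      low    f q = pick (q <? q₀) (f q) 1
      middle f q = pick (q <? q₀) 1 (pick (q ≤? z) (f q) 1)
      high   f q = pick (q <? q₀) 1 (pick (q ≤? z) 1 (f q))

      decompose : ∀ f m → ∏< f m ≡ ∏< (low f) m * ∏< (middle f) m * ∏< (high f) m
      decompose f m = trans (∏<-cong m (λ q _ → go (q <? q₀) (q ≤? z) (f q)))
        (trans (∏<-* (λ q → low f q * middle f q) (high f) m) (cong (_* ∏< (high f) m) (∏<-* (low f) (middle f) m)))
        where
        go : ∀ {A C : Set} (a? : Dec A) (c? : Dec C) x → x ≡ pick a? x 1 * pick a? 1 (pick c? x 1) * pick a? 1 (pick c? 1 x)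
        go (yes _) _       = solve 1 (λ x → x := x :* con 1 :* con 1) refl
        go (no _)  (yes _) = solve 1 (λ x → x := con 1 :* x :* con 1) refl
        go (no _)  (no _)  = solve 1 (λ x → x := con 1 :* con 1 :* x) refl

      -- Each of these factors loses at most `q₀`, because `t q` is at least 1, and there are at
      -- most `q₀` of them.
      low≤ : ∀ m → ∏< (low B) m ≤ q₀ ^ q₀ * ∏< (low T) m
      low≤ m = begin
        ∏< (low B) m                                              ≤⟨ ∏<-mono m (λ q → go q (q <? q₀)) ⟩
        ∏< (λ q → pick (q <? q₀) q₀ 1 * low T q) m                ≡⟨ ∏<-* (λ q → pick (q <? q₀) q₀ 1) (low T) m ⟩
        ∏< (λ q → pick (q <? q₀) q₀ 1) m * ∏< (low T) m           ≤⟨ *-monoˡ-≤ (∏< (low T) m) (capped-product q₀ q₀ m (s≤s z≤n)) ⟩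
        q₀ ^ q₀ * ∏< (low T) m                                    ∎
        where
        b≤ : ∀ q → q < q₀ → (f? : Dec (PrimeFactor P n q)) → pick f? q 1 ≤ q₀
        b≤ q q< (yes _) = <⇒≤ q<
        b≤ q q< (no _)  = s≤s z≤n
        go : ∀ q (c? : Dec (q < q₀)) → pick c? (B q) 1 ≤ pick c? q₀ 1 * pick c? (T q) 1
        go q (no _)   = ≤-refl
        go q (yes q<) = begin
          b q * pq z q          ≤⟨ *-mono-≤ (b≤ q q< (primeFactor? P n q)) (pq≤pp z q) ⟩
          q₀ * pp z q           ≤⟨ *-monoʳ-≤ q₀ (≤-trans (≤-reflexive (sym (+-identityʳ (pp z q)))) (*-monoˡ-≤ (pp z q) (t≥1 q))) ⟩
          q₀ * (t q * pp z q)   ∎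

      -- By Bernoulli, (1 - r/q) (1 + 1/q)^r is at least (1 - r/q) (1 + r/q) = 1 - r²/q², and r =
      -- ρ(q) is at most d.
      factor-middle : ∀ q → q ≤ z → B q * (q * q) ≤ T q * (q * q) + B q * D
      factor-middle q q≤z = go (primeFactor? P n q)
        where
        go : (f? : Dec (PrimeFactor P n q)) →
             pick f? q 1 * pq z q * (q * q) ≤ pick f? (nonroots P q) 1 * pp z q * (q * q) + pick f? q 1 * pq z q * D
        go (no _) = ≤-trans (*-monoˡ-≤ (q * q) (*-monoʳ-≤ 1 (pq≤pp z q))) (m≤m+n _ _)
        go (yes f@(pr , _)) = subst₂ (λ x y → q * x * (q * q) ≤ nonroots P q * y * (q * q) + q * x * D)
          (sym (pick-yes (good? z q) (pr , factor∤δ f , q≤z))) (sym (pick-yes (good? z q) (pr , factor∤δ f , q≤z))) (begin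
          q * q ^ r * (q * q)
            ≡⟨ cong (λ x → q * q ^ r * (x * x)) (nonroots+ρ q) ⟨
          q * q ^ r * ((c + r) * (c + r))
            ≡⟨ solve 4 (λ q x c r → q :* x :* ((c :+ r) :* (c :+ r)) := c :* q :* (x :* ((c :+ r) :+ r)) :+ q :* x :* (r :* r)) refl q (q ^ r) c r ⟩
          c * q * (q ^ r * ((c + r) + r)) + q * q ^ r * (r * r)
            ≡⟨ cong (λ x → c * q * (q ^ r * (x + r)) + q * q ^ r * (r * r)) (nonroots+ρ q) ⟩
          c * q * (q ^ r * (q + r)) + q * q ^ r * (r * r)
            ≤⟨ +-mono-≤ (*-monoʳ-≤ (c * q) (bernoulli q r)) (*-monoʳ-≤ (q * q ^ r) (*-mono-≤ (ρ≤d pr (factor∤δ f)) (ρ≤d pr (factor∤δ f)))) ⟩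
          c * q * (q * suc q ^ r) + q * q ^ r * D
            ≡⟨ cong (λ x → x + q * q ^ r * D) (solve 3 (λ c q y → c :* q :* (q :* y) := c :* y :* (q :* q)) refl c q (suc q ^ r)) ⟩
          c * suc q ^ r * (q * q) + q * q ^ r * D ∎)
          where
          c = nonroots P q
          r = ρ q

      -- The product of 1 - D/q² over 2D < q ≤ k is at least (k + 2D)/(2k), which starts at 1 for k
      -- = 2D. This minorant, unlike the constant 1/2 below it, survives the induction step.
      middle-bound : ∀ j → ∏< (middle B) (suc (2 * D + j)) * (2 * D + j + 2 * D) ≤ ∏< (middle T) (suc (2 * D + j)) * (2 * (2 * D + j))
      middle-bound zero = ≤-reflexive (cong₂ _*_ (trans (trivial B (suc (2 * D + 0)) bound) (sym (trivial T (suc (2 * D + 0)) bound)))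
        (solve 1 (λ x → x :+ con 0 :+ x := con 2 :* (x :+ con 0)) refl (2 * D)))
        where
        bound : suc (2 * D + 0) ≤ q₀
        bound = ≤-reflexive (cong suc (+-identityʳ (2 * D)))
        trivial : ∀ f m → m ≤ q₀ → ∏< (middle f) m ≡ 1
        trivial f zero    m≤ = refl
        trivial f (suc m) m< = trans (cong₂ _*_ (trivial f m (<⇒≤ m<)) (pick-yes (m <? q₀) m<)) refl
      middle-bound (suc j) = subst (λ k → ∏< (middle B) (suc k) * (k + 2 * D) ≤ ∏< (middle T) (suc k) * (2 * k)) (sym (+-suc (2 * D) j))
        (*-cancelʳ-≤ _ _ (q * k) {{>-nonZero (*-mono-≤ {1} {q} (s≤s z≤n) k≥1)}} (+-cancelʳ-≤ (Bs * x * (D * (k + 2 * D))) _ _ (begin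
          Bs * x * (q + 2 * D) * (q * k) + Bs * x * (D * (k + 2 * D))
            ≡⟨ solve 5 (λ B x q D k → B :* x :* (q :+ con 2 :* D) :* (q :* k) :+ B :* x :* (D :* (k :+ con 2 :* D))
                          := B :* x :* ((q :+ con 2 :* D) :* (q :* k) :+ D :* (k :+ con 2 :* D))) refl Bs x q D k ⟩
          Bs * x * ((q + 2 * D) * (q * k) + D * (k + 2 * D))
            ≤⟨ *-monoʳ-≤ (Bs * x) (begin
                 (q + 2 * D) * (q * k) + D * (k + 2 * D)
                   -- The surplus D (j + 2) is the exact difference of the two sides.
                   ≤⟨ m≤m+n _ (D * (j + 2)) ⟩
                 (q + 2 * D) * (q * k) + D * (k + 2 * D) + D * (j + 2)
                   ≡⟨ solve 2 (λ D j → let k = con 2 :* D :+ j ; q = con 1 :+ k in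
                        (q :+ con 2 :* D) :* (q :* k) :+ D :* (k :+ con 2 :* D) :+ D :* (j :+ con 2) := (q :* q) :* (k :+ con 2 :* D)) refl D j ⟩
                 (q * q) * (k + 2 * D) ∎) ⟩
          Bs * x * ((q * q) * (k + 2 * D))
            ≡⟨ solve 4 (λ B x s u → B :* x :* (s :* u) := B :* u :* (x :* s)) refl Bs x (q * q) (k + 2 * D) ⟩
          Bs * (k + 2 * D) * (x * (q * q))
            ≤⟨ *-monoʳ-≤ (Bs * (k + 2 * D)) (factor (q <? q₀) (q ≤? z)) ⟩
          Bs * (k + 2 * D) * (y * (q * q) + x * D)
            ≡⟨ solve 6 (λ B u y s x D → B :* u :* (y :* s :+ x :* D) := B :* u :* (y :* s) :+ B :* x :* (D :* u)) refl Bs (k + 2 * D) y (q * q) x D ⟩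
          Bs * (k + 2 * D) * (y * (q * q)) + Bs * x * (D * (k + 2 * D))
            ≤⟨ +-monoˡ-≤ (Bs * x * (D * (k + 2 * D))) (*-monoˡ-≤ (y * (q * q)) (middle-bound j)) ⟩
          Ts * (2 * k) * (y * (q * q)) + Bs * x * (D * (k + 2 * D))
            ≡⟨ cong (_+ Bs * x * (D * (k + 2 * D))) (solve 4 (λ T k y q → T :* (con 2 :* k) :* (y :* (q :* q)) := T :* y :* (con 2 :* q) :* (q :* k)) refl Ts k y q) ⟩
          Ts * y * (2 * q) * (q * k) + Bs * x * (D * (k + 2 * D)) ∎)))
        where
        k = 2 * D + j
        q = suc k
        Bs = ∏< (middle B) q
        Ts = ∏< (middle T) q
        x = middle B q
        y = middle T q
        k≥1 : 1 ≤ k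
        k≥1 = ≤-trans (*-mono-≤ {1} {2} {1} {D} (s≤s z≤n) (s≤s z≤n)) (m≤m+n (2 * D) j)
        factor : (a? : Dec (q < q₀)) (c? : Dec (q ≤ z)) →
                 pick a? 1 (pick c? (B q) 1) * (q * q) ≤ pick a? 1 (pick c? (T q) 1) * (q * q) + pick a? 1 (pick c? (B q) 1) * D
        factor (yes _) _         = m≤m+n _ _
        factor (no _)  (no _)    = m≤m+n _ _
        factor (no _)  (yes q≤z) = factor-middle q q≤z

      middle≤ : ∀ m → ∏< (middle B) m ≤ 2 * ∏< (middle T) m
      middle≤ m with ≤-total q₀ m
      ... | inj₁ q₀≤m = subst (λ m → ∏< (middle B) m ≤ 2 * ∏< (middle T) m) (m+[n∸m]≡n q₀≤m)
        (*-cancelʳ-≤ _ _ k {{>-nonZero (≤-trans (*-mono-≤ {1} {2} {1} {D} (s≤s z≤n) (s≤s z≤n)) (m≤m+n (2 * D) (m ∸ q₀)))}} (begin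
          ∏< (middle B) (suc k) * k             ≤⟨ *-monoʳ-≤ (∏< (middle B) (suc k)) (m≤m+n k (2 * D)) ⟩
          ∏< (middle B) (suc k) * (k + 2 * D)   ≤⟨ middle-bound (m ∸ q₀) ⟩
          ∏< (middle T) (suc k) * (2 * k)       ≡⟨ solve 2 (λ t k → t :* (con 2 :* k) := con 2 :* t :* k) refl (∏< (middle T) (suc k)) k ⟩
          2 * ∏< (middle T) (suc k) * k         ∎))
        where
        k = 2 * D + (m ∸ q₀)
      ... | inj₂ m≤q₀ = subst₂ (λ x y → x ≤ 2 * y) (sym (trivial B m m≤q₀)) (sym (trivial T m m≤q₀)) (s≤s z≤n)
        where
        trivial : ∀ f m → m ≤ q₀ → ∏< (middle f) m ≡ 1
        trivial f zero    m≤ = refl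
        trivial f (suc m) m< = trans (cong₂ _*_ (trivial f m (<⇒≤ m<)) (pick-yes (m <? q₀) m<)) refl

      ω : ℕ → ℕ
      ω = ∑< (λ q → pick (primeFactor? P n q) 1 0)

      2^ω≤n : ∀ m → 2 ^ ω m ≤ n
      2^ω≤n m = ≤-trans (go m) (ℕ∣.∣⇒≤ (bot∣n P n m))
        where
        step : ∀ q (f? : Dec (PrimeFactor P n q)) → 2 ^ pick f? 1 0 ≤ pick f? q 1
        step q (yes (pr , _)) = nonTrivial⇒n>1 q {{prime⇒nonTrivial pr}}
        step q (no _)         = ≤-refl
        go : ∀ m → 2 ^ ω m ≤ ∏< b m
        go zero    = ≤-refl
        go (suc m) = ≤-trans (≤-reflexive (^-distribˡ-+-* 2 (ω m) _)) (*-mono-≤ (go m) (step m (primeFactor? P n m)))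

      -- A prime q > z dividing n costs a factor 1 - ρ(q)/q ≥ 1 - d/z, and the losses add up to at
      -- most d ω/z. The second component lets the induction replace the product of `T` by that of
      -- `B` in the error term.
      high-bound : ∀ m → z * ∏< (high B) m ≤ z * ∏< (high T) m + d * ω m * ∏< (high B) m
                       × ∏< (high T) m ≤ ∏< (high B) m
      high-bound zero    = m≤m+n _ _ , ≤-refl
      high-bound (suc m) with high-bound m
      ... | IH , Ts≤Bs = go (m <? q₀) (m ≤? z) (primeFactor? P n m) (good? z m)
        where
        Bs = ∏< (high B) m
        Ts = ∏< (high T) m
        Goal : ℕ → ℕ → ℕ → Set
        Goal x y w = z * (Bs * x) ≤ z * (Ts * y) + d * (ω m + w) * (Bs * x) × Ts * y ≤ Bs * x
        same : ∀ w → Goal 1 1 w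
        same w = (begin
          z * (Bs * 1)                                   ≡⟨ cong (z *_) (*-identityʳ Bs) ⟩
          z * Bs                                         ≤⟨ IH ⟩
          z * Ts + d * ω m * Bs                          ≤⟨ +-monoʳ-≤ (z * Ts) (*-monoˡ-≤ Bs (*-monoʳ-≤ d (m≤m+n (ω m) w))) ⟩
          z * Ts + d * (ω m + w) * Bs                    ≡⟨ cong₂ (λ u v → z * u + d * (ω m + w) * v) (sym (*-identityʳ Ts)) (sym (*-identityʳ Bs)) ⟩
          z * (Ts * 1) + d * (ω m + w) * (Bs * 1)        ∎) , *-monoˡ-≤ 1 Ts≤Bs
        go : (a? : Dec (m < q₀)) (c? : Dec (m ≤ z)) (f? : Dec (PrimeFactor P n m)) (g? : Dec (Good z m)) →
             Goal (pick a? 1 (pick c? 1 (pick f? m 1 * pick g? (m ^ ρ m) 1)))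
                  (pick a? 1 (pick c? 1 (pick f? (nonroots P m) 1 * pick g? (suc m ^ ρ m) 1))) (pick f? 1 0)
        go (yes _) _       f?      g?      = same (pick f? 1 0)
        go (no _)  (yes _) f?      g?      = same (pick f? 1 0)
        go (no _)  (no m≰z) f?     (yes (_ , _ , m≤z)) = contradiction m≤z m≰z
        go (no _)  (no _)  (no _)  (no _)  = same 0
        go (no _)  (no m≰z) (yes f) (no _) = (begin
          z * (Bs * (m * 1))
            ≡⟨ solve 3 (λ z B m → z :* (B :* (m :* con 1)) := m :* (z :* B)) refl z Bs m ⟩
          m * (z * Bs)
            ≤⟨ *-monoʳ-≤ m IH ⟩
          m * (z * Ts + d * ω m * Bs)
            ≡⟨ solve 5 (λ m z T x B → m :* (z :* T :+ x :* B) := m :* (z :* T) :+ x :* (m :* B)) refl m z Ts (d * ω m) Bs ⟩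
          m * (z * Ts) + d * ω m * (m * Bs)
            ≤⟨ +-monoˡ-≤ (d * ω m * (m * Bs)) (begin
                 m * (z * Ts)                      ≡⟨ cong (_* (z * Ts)) (nonroots+ρ m) ⟨
                 (c + ρ m) * (z * Ts)              ≤⟨ *-monoˡ-≤ (z * Ts) (+-monoʳ-≤ c (ρ≤d (proj₁ f) (factor∤δ f))) ⟩
                 (c + d) * (z * Ts)                ≡⟨ *-distribʳ-+ (z * Ts) c d ⟩
                 c * (z * Ts) + d * (z * Ts)       ≤⟨ +-monoʳ-≤ (c * (z * Ts)) (*-monoʳ-≤ d (*-mono-≤ (<⇒≤ (≰⇒> m≰z)) Ts≤Bs)) ⟩
                 c * (z * Ts) + d * (m * Bs)       ∎) ⟩
          c * (z * Ts) + d * (m * Bs) + d * ω m * (m * Bs)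
            ≡⟨ solve 7 (λ c z T d m B w → c :* (z :* T) :+ d :* (m :* B) :+ d :* w :* (m :* B)
                 := z :* (T :* (c :* con 1)) :+ d :* (w :+ con 1) :* (B :* (m :* con 1))) refl c z Ts d m Bs (ω m) ⟩
          z * (Ts * (c * 1)) + d * (ω m + 1) * (Bs * (m * 1)) ∎) ,
          *-mono-≤ Ts≤Bs (*-monoˡ-≤ 1 (≤-trans (m≤m+n c (ρ m)) (≤-reflexive (nonroots+ρ m))))
          where
          c = nonroots P m

      -- Since 2^ω ≤ n, the hypothesis applies to ω and makes the accumulated loss d ω/z at most one
      -- half.
      high≤ : 1 ≤ z → (∀ w → 2 ^ w ≤ n → 2 * (d * w) ≤ z) → ∀ m → ∏< (high B) m ≤ 2 * ∏< (high T) m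
      high≤ 1≤z few m = *-cancelˡ-≤ z {{>-nonZero 1≤z}} (+-cancelʳ-≤ (z * Bs) _ _ (begin
        z * Bs + z * Bs                          ≡⟨ cong (λ u → z * Bs + u) (+-identityʳ (z * Bs)) ⟨
        2 * (z * Bs)                             ≤⟨ *-monoʳ-≤ 2 (proj₁ (high-bound m)) ⟩
        2 * (z * Ts + d * ω m * Bs)              ≡⟨ solve 4 (λ z T w B → con 2 :* (z :* T :+ w :* B) := z :* (con 2 :* T) :+ con 2 :* w :* B) refl z Ts (d * ω m) Bs ⟩
        z * (2 * Ts) + 2 * (d * ω m) * Bs        ≤⟨ +-monoʳ-≤ (z * (2 * Ts)) (*-monoˡ-≤ Bs (few (ω m) (2^ω≤n m))) ⟩
        z * (2 * Ts) + z * Bs                    ∎))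
        where
        Bs = ∏< (high B) m
        Ts = ∏< (high T) m

      bot*pq≤ : 1 ≤ z → (∀ w → 2 ^ w ≤ n → 2 * (d * w) ≤ z) → ∀ m →
                ∏< b m * ∏< (pq z) m ≤ q₀ ^ q₀ * 4 * (∏< t m * ∏< (pp z) m)
      bot*pq≤ 1≤z few m = begin
        ∏< b m * ∏< (pq z) m
          ≡⟨ trans (sym (∏<-* b (pq z) m)) (decompose B m) ⟩
        ∏< (low B) m * ∏< (middle B) m * ∏< (high B) m
          ≤⟨ *-mono-≤ (*-mono-≤ (low≤ m) (middle≤ m)) (high≤ 1≤z few m) ⟩
        q₀ ^ q₀ * ∏< (low T) m * (2 * ∏< (middle T) m) * (2 * ∏< (high T) m)
          ≡⟨ solve 4 (λ k x y w → k :* x :* (con 2 :* y) :* (con 2 :* w) := k :* con 4 :* (x :* y :* w)) refl (q₀ ^ q₀) (∏< (low T) m) (∏< (middle T) m) (∏< (high T) m) ⟩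
        q₀ ^ q₀ * 4 * (∏< (low T) m * ∏< (middle T) m * ∏< (high T) m)
          ≡⟨ cong (q₀ ^ q₀ * 4 *_) (trans (sym (decompose T m)) (∏<-* t (pp z) m)) ⟩
        q₀ ^ q₀ * 4 * (∏< t m * ∏< (pp z) m) ∎

    -- Kept opaque so that the type checker does not expand this large number.
    abstract
      sieveConstant : ℕ
      sieveConstant = q₀ ^ q₀ * 4 * pairProductConstant

      -- With z = 2^ℓ the product ℓ (e + 1) stands for log z log log z. The last hypothesis puts z
      -- beyond 2d times the number of prime factors of n.
      φ-lower : ∀ n .{{_ : NonZero n}} → gcd n δ ≡ 1 → ∀ ℓ e → 1 ≤ ℓ → ℓ ≤ 2 ^ e →
                (∀ w → 2 ^ w ≤ n → 2 * (d * w) ≤ 2 ^ ℓ) → n ≤ sieveConstant * (ℓ * suc e) * φ P n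
      φ-lower n coprime ℓ e 1≤ℓ ℓ≤2^e few =
        *-cancelʳ-≤ _ _ (∏< (top P n) m) {{>-nonZero (∏<-pos m (t≥1 n coprime z))}} (begin
          n * Top                                          ≤⟨ n*top≤φ*bot P n ⟩
          φ P n * Bot                                      ≤⟨ *-monoʳ-≤ (φ P n) Bot≤ ⟩
          φ P n * (sieveConstant * (ℓ * suc e) * Top)      ≡⟨ solve 3 (λ f k t → f :* (k :* t) := k :* f :* t) refl (φ P n) (sieveConstant * (ℓ * suc e)) Top ⟩
          sieveConstant * (ℓ * suc e) * φ P n * Top        ∎)
        where
        open ≤-Reasoning
        open +-*-Solver
        m z Top Bot PQ : ℕ
        m = suc n
        z = 2 ^ ℓ
        Top = ∏< (top P n) m
        Bot = ∏< (bot P n) m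
        PQ = ∏< (pq z) m
        Bot≤ : Bot ≤ sieveConstant * (ℓ * suc e) * Top
        Bot≤ = *-cancelʳ-≤ _ _ PQ {{>-nonZero (∏<-pos m (pq≥1 z))}} (begin
          Bot * PQ                                                 ≤⟨ bot*pq≤ n coprime z (m^n>0 2 ℓ) few m ⟩
          q₀ ^ q₀ * 4 * (Top * ∏< (pp z) m)                        ≤⟨ *-monoʳ-≤ (q₀ ^ q₀ * 4) (*-monoʳ-≤ Top (pp≤pq ℓ e m 1≤ℓ ℓ≤2^e)) ⟩
          q₀ ^ q₀ * 4 * (Top * (pairProductConstant * (ℓ * suc e) * PQ))
            ≡⟨ solve 5 (λ k t c l p → k :* (t :* (c :* l :* p)) := k :* c :* l :* t :* p) refl (q₀ ^ q₀ * 4) Top pairProductConstant (ℓ * suc e) PQ ⟩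
          sieveConstant * (ℓ * suc e) * Top * PQ                   ∎)

-- Truncated logarithm series over ℚ

module RationalLogarithm where

  open import Defs using (module CauchySequences)
  open CauchySequences
  open import Data.Nat.Base as ℕ using (ℕ; zero; suc)
  import Data.Nat.Properties as ℕₚ
  open import Data.Integer.Base using (+_)
  open import Data.Product.Base using (∃-syntax; _,_; proj₁; proj₂)
  open import Data.Rational.Base
  open import Data.Rational.Properties
  open import Data.Rational.Solver using (module +-*-Solver)
  open import Relation.Binary.PropositionalEquality
  open +-*-Solver

  ∑q : (ℕ → ℚ) → ℕ → ℚ
  ∑q t zero    = 0ℚ
  ∑q t (suc k) = ∑q t k + t k

  ∑q-mono : ∀ {s t} → (∀ k → s k ≤ t k) → ∀ n → ∑q s n ≤ ∑q t n
  ∑q-mono h zero    = ≤-refl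
  ∑q-mono h (suc n) = +-mono-≤ (∑q-mono h n) (h n)

  ∑q-nonNeg : ∀ {t} → (∀ k → 0ℚ ≤ t k) → ∀ n → 0ℚ ≤ ∑q t n
  ∑q-nonNeg h zero    = ≤-refl
  ∑q-nonNeg h (suc n) = +-mono-≤ (∑q-nonNeg h n) (h n)

  ≤-by : ∀ {p q} → 0ℚ ≤ q - p → p ≤ q
  ≤-by {p} {q} h = ≤-from-diff (q - p) (solve 2 (λ p q → q := p :+ (q :- p)) refl p q) h

  0≤- : ∀ {p q} → p ≤ q → 0ℚ ≤ q - p
  0≤- {p} {q} p≤q = subst (_≤ q - p) (+-inverseʳ p) (+-monoˡ-≤ (- p) p≤q)

  infixr 8 _^q_
  _^q_ : ℚ → ℕ → ℚ
  x ^q zero  = 1ℚ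
  x ^q suc k = x * x ^q k

  ^q-nonNeg : ∀ {x} → 0ℚ ≤ x → ∀ k → 0ℚ ≤ x ^q k
  ^q-nonNeg 0≤x zero    = 0≤1
  ^q-nonNeg 0≤x (suc k) = *-nonNeg 0≤x (^q-nonNeg 0≤x k)

  1≤^q : ∀ {x} → 1ℚ ≤ x → ∀ k → 1ℚ ≤ x ^q k
  1≤^q 1≤x zero    = ≤-refl
  1≤^q {x} 1≤x (suc k) = *-mono {1ℚ} {x} {1ℚ} {x ^q k} 0≤1 (≤-trans 0≤1 (1≤^q 1≤x k)) 1≤x (1≤^q 1≤x k)

  ^q-+ : ∀ x m n → x ^q (m ℕ.+ n) ≡ x ^q m * x ^q n
  ^q-+ x zero    n = sym (*-identityˡ (x ^q n))
  ^q-+ x (suc m) n = trans (cong (x *_) (^q-+ x m n)) (sym (*-assoc x (x ^q m) (x ^q n)))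

  -- Bernoulli's inequality in the form of a decay rate 1/(1 + M t), from which a truncation index
  -- can be computed in ℚ.
  geometric-decay : ∀ t → 0ℚ ≤ t → 0ℚ ≤ 1ℚ - t → ∀ M → (1ℚ - t) ^q M * (1ℚ + nat M * t) ≤ 1ℚ
  geometric-decay t 0≤t t≤1 zero    = ≤-reflexive (solve 1 (λ t → con 1ℚ :* (con 1ℚ :+ con 0ℚ :* t) := con 1ℚ) refl t)
  geometric-decay t 0≤t t≤1 (suc M) = ≤-trans
    (≤-from-diff ((1ℚ - t) ^q M * (t * t * (1ℚ + nat M))) (begin
      (1ℚ - t) ^q M * (1ℚ + nat M * t)
        ≡⟨ solve 3 (λ t m x → x :* (con 1ℚ :+ m :* t)
             := (con 1ℚ :- t) :* x :* (con 1ℚ :+ (con 1ℚ :+ m) :* t) :+ x :* (t :* t :* (con 1ℚ :+ m))) refl t (nat M) ((1ℚ - t) ^q M) ⟩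
      (1ℚ - t) * (1ℚ - t) ^q M * (1ℚ + (1ℚ + nat M) * t) + (1ℚ - t) ^q M * (t * t * (1ℚ + nat M))
        ≡⟨ cong (λ m → (1ℚ - t) * (1ℚ - t) ^q M * (1ℚ + m * t) + (1ℚ - t) ^q M * (t * t * (1ℚ + nat M))) (nat-suc M) ⟨
      (1ℚ - t) ^q suc M * (1ℚ + nat (suc M) * t) + (1ℚ - t) ^q M * (t * t * (1ℚ + nat M)) ∎)
      (*-nonNeg (^q-nonNeg t≤1 M) (*-nonNeg (*-nonNeg 0≤t 0≤t) (+-mono-≤ 0≤1 (nat-nonNeg M)))))
    (geometric-decay t 0≤t t≤1 M)
    where open ≡-Reasoning

  oddPow : ℚ → ℕ → ℚ
  oddPow z zero    = z
  oddPow z (suc k) = oddPow z k * (z * z)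

  arTerm : ℚ → ℕ → ℚ
  arTerm z k = oddPow z k * (+ 1 / suc (2 ℕ.* k))

  artanhq : ℕ → ℚ → ℚ
  artanhq N z = ∑q (arTerm z) N

  cayley : ℚ → ℚ
  cayley x = (x - 1ℚ) * inv (x + 1ℚ)

  -- At the N-th approximation of a real argument this is the N-th approximation of `log`, so
  -- inequalities of reals reduce to inequalities of these truncations for large N.
  logq : ℕ → ℚ → ℚ
  logq N x = + 2 / 1 * artanhq N (cayley x)

  evenPow : ℚ → ℕ → ℚ
  evenPow z zero    = 1ℚ
  evenPow z (suc k) = evenPow z k * (z * z)

  oddPow≡ : ∀ z k → oddPow z k ≡ z * evenPow z k
  oddPow≡ z zero    = sym (*-identityʳ z)
  oddPow≡ z (suc k) = trans (cong (_* (z * z)) (oddPow≡ z k)) (*-assoc z (evenPow z k) (z * z))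

  evenPow-nonNeg : ∀ z k → 0ℚ ≤ z → 0ℚ ≤ evenPow z k
  evenPow-nonNeg z zero    0≤z = 0≤1
  evenPow-nonNeg z (suc k) 0≤z = *-nonNeg (evenPow-nonNeg z k 0≤z) (*-nonNeg 0≤z 0≤z)

  -- The tangent of the convex function z^(2k+1) lies below it.
  oddPow-gap : ∀ z w k → 0ℚ ≤ z → z ≤ w → oddPow z k + nat (suc (2 ℕ.* k)) * (evenPow z k * (w - z)) ≤ oddPow w k
  oddPow-gap z w zero    0≤z z≤w = ≤-reflexive (solve 2 (λ z w → z :+ con 1ℚ :* (con 1ℚ :* (w :- z)) := w) refl z w)
  oddPow-gap z w (suc k) 0≤z z≤w = begin
    oddPow z k * (z * z) + nat (suc (2 ℕ.* suc k)) * (evenPow z k * (z * z) * g)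
      ≡⟨ cong₂ (λ o c → o * (z * z) + c * (evenPow z k * (z * z) * g)) (oddPow≡ z k) n+2 ⟩
    z * e * (z * z) + (1ℚ + (1ℚ + n)) * (e * (z * z) * g)
      ≤⟨ ≤-from-diff (e * (z * g * g) + n * (e * g) * ((z + w) * g))
           (subst (λ w → (z * e + n * (e * g)) * (w * w) ≡ z * e * (z * z) + (1ℚ + (1ℚ + n)) * (e * (z * z) * g) + (e * (z * g * g) + n * (e * g) * ((z + w) * g))) z+g≡w
             (solve 4 (λ z e n g → (z :* e :+ n :* (e :* g)) :* ((z :+ g) :* (z :+ g))
                := z :* e :* (z :* z) :+ (con 1ℚ :+ (con 1ℚ :+ n)) :* (e :* (z :* z) :* g)
                   :+ (e :* (z :* g :* g) :+ n :* (e :* g) :* ((z :+ (z :+ g)) :* g))) refl z e n g))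
           (+-mono-≤ (*-nonNeg e≥0 (*-nonNeg (*-nonNeg 0≤z g≥0) g≥0))
             (*-nonNeg (*-nonNeg (nat-nonNeg (suc (2 ℕ.* k))) (*-nonNeg e≥0 g≥0)) (*-nonNeg (+-mono-≤ 0≤z (≤-trans 0≤z z≤w)) g≥0))) ⟩
    (z * e + n * (e * g)) * (w * w)
      ≡⟨ cong (λ o → (o + n * (e * g)) * (w * w)) (oddPow≡ z k) ⟨
    (oddPow z k + n * (e * g)) * (w * w)
      ≤⟨ *-monoʳ-≤-nonNeg (w * w) {{nonNegative (*-nonNeg (≤-trans 0≤z z≤w) (≤-trans 0≤z z≤w))}} (oddPow-gap z w k 0≤z z≤w) ⟩
    oddPow w k * (w * w) ∎
    where
    open ≤-Reasoning
    e = evenPow z k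
    g = w - z
    n = nat (suc (2 ℕ.* k))
    g≥0 : 0ℚ ≤ g
    g≥0 = 0≤- z≤w
    e≥0 = evenPow-nonNeg z k 0≤z
    z+g≡w : z + g ≡ w
    z+g≡w = solve 2 (λ z w → z :+ (w :- z) := w) refl z w
    n+2 : nat (suc (2 ℕ.* suc k)) ≡ 1ℚ + (1ℚ + n)
    n+2 = trans (cong (λ m → nat (suc m)) (ℕₚ.*-suc 2 k)) (trans (nat-suc (suc (suc (2 ℕ.* k)))) (cong (λ z → 1ℚ + z) (nat-suc (suc (2 ℕ.* k)))))

  -- The tangent inequalities summed over the odd powers; `∑q (evenPow z) N` truncates 1/(1 - z²),
  -- the derivative of artanh.
  artanhq-gap : ∀ z w N → 0ℚ ≤ z → z ≤ w → artanhq N z + (w - z) * ∑q (evenPow z) N ≤ artanhq N w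
  artanhq-gap z w zero    0≤z z≤w = ≤-reflexive (solve 1 (λ g → con 0ℚ :+ g :* con 0ℚ := con 0ℚ) refl (w - z))
  artanhq-gap z w (suc N) 0≤z z≤w = begin
    artanhq N z + arTerm z N + (w - z) * (∑q (evenPow z) N + evenPow z N)
      ≡⟨ solve 5 (λ A t g s e → A :+ t :+ g :* (s :+ e) := A :+ g :* s :+ (t :+ e :* g)) refl
           (artanhq N z) (arTerm z N) (w - z) (∑q (evenPow z) N) (evenPow z N) ⟩
    artanhq N z + (w - z) * ∑q (evenPow z) N + (arTerm z N + evenPow z N * (w - z))
      ≤⟨ +-mono-≤ (artanhq-gap z w N 0≤z z≤w) term ⟩
    artanhq N w + arTerm w N ∎
    where
    open ≤-Reasoning
    c = + 1 / suc (2 ℕ.* N)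
    n = nat (suc (2 ℕ.* N))
    term : arTerm z N + evenPow z N * (w - z) ≤ arTerm w N
    term = begin
      oddPow z N * c + evenPow z N * (w - z)
        ≡⟨ cong (λ x → oddPow z N * c + x) (trans (sym (*-identityˡ (evenPow z N * (w - z)))) (cong (_* (evenPow z N * (w - z))) (sym (nat-inverse (2 ℕ.* N))))) ⟩
      oddPow z N * c + n * c * (evenPow z N * (w - z))
        ≡⟨ solve 4 (λ o c n x → o :* c :+ n :* c :* x := (o :+ n :* x) :* c) refl (oddPow z N) c n (evenPow z N * (w - z)) ⟩
      (oddPow z N + n * (evenPow z N * (w - z))) * c
        ≤⟨ *-monoʳ-≤-nonNeg c {{nonNegative (unit-nonNeg (2 ℕ.* N))}} (oddPow-gap z w N 0≤z z≤w) ⟩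
      oddPow w N * c ∎

  evenPow-sum : ∀ z N → (1ℚ - z * z) * ∑q (evenPow z) N ≡ 1ℚ - evenPow z N
  evenPow-sum z zero    = trans (*-zeroʳ (1ℚ - z * z)) (sym (+-inverseʳ 1ℚ))
  evenPow-sum z (suc N) = trans (*-distribˡ-+ (1ℚ - z * z) (∑q (evenPow z) N) (evenPow z N))
    (trans (cong (_+ (1ℚ - z * z) * evenPow z N) (evenPow-sum z N))
      (solve 2 (λ z e → con 1ℚ :- e :+ (con 1ℚ :- z :* z) :* e := con 1ℚ :- e :* (z :* z)) refl z (evenPow z N)))

  evenPow≡^q : ∀ z N → evenPow z N ≡ z ^q N * z ^q N
  evenPow≡^q z zero    = refl
  evenPow≡^q z (suc N) = trans (cong (_* (z * z)) (evenPow≡^q z N))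
    (solve 2 (λ z x → x :* x :* (z :* z) := z :* x :* (z :* x)) refl z (z ^q N))

  inv-pos : ∀ {x} → 0ℚ < x → 0ℚ < inv x
  inv-pos {x} 0<x = cancel-pos (inv x) 0<x (subst (0ℚ <_) (sym (inv-inverse 0<x)) 0<1)

  inv-antitone : ∀ {x y} → 0ℚ < x → x ≤ y → inv y ≤ inv x
  inv-antitone {x} {y} 0<x x≤y = *-cancelˡ-≤-pos x {{positive 0<x}} (begin
    x * inv y   ≤⟨ *-monoʳ-≤-nonNeg (inv y) {{nonNegative (<⇒≤ (inv-pos (<-≤-trans 0<x x≤y)))}} x≤y ⟩
    y * inv y   ≡⟨ trans (inv-inverse (<-≤-trans 0<x x≤y)) (sym (inv-inverse 0<x)) ⟩
    x * inv x   ∎)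
    where open ≤-Reasoning

  2ℚ : ℚ
  2ℚ = + 2 / 1

  0<x+1 : ∀ {x} → 0ℚ ≤ x → 0ℚ < x + 1ℚ
  0<x+1 0≤x = +-mono-≤-< 0≤x 0<1

  cayley≡ : ∀ {x} → 0ℚ ≤ x → cayley x ≡ 1ℚ - 2ℚ * inv (x + 1ℚ)
  cayley≡ {x} 0≤x = trans
    (solve 2 (λ x i → (x :- con 1ℚ) :* i := (x :+ con 1ℚ) :* i :- con 2ℚ :* i) refl x (inv (x + 1ℚ)))
    (cong (_- 2ℚ * inv (x + 1ℚ)) (inv-inverse (0<x+1 0≤x)))

  cayley-nonNeg : ∀ {x} → 1ℚ ≤ x → 0ℚ ≤ cayley x
  cayley-nonNeg {x} 1≤x = *-nonNeg (0≤- 1≤x) (<⇒≤ (inv-pos (0<x+1 (≤-trans 0≤1 1≤x))))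

  0≤2 : 0ℚ ≤ 2ℚ
  0≤2 = nat-nonNeg 2

  cayley-mono : ∀ {x y} → 0ℚ ≤ x → x ≤ y → cayley x ≤ cayley y
  cayley-mono {x} {y} 0≤x x≤y = subst₂ _≤_ (sym (cayley≡ 0≤x)) (sym (cayley≡ (≤-trans 0≤x x≤y)))
    (+-monoʳ-≤ 1ℚ (neg-antimono-≤ (*-monoˡ-≤-nonNeg 2ℚ {{nonNegative 0≤2}} (inv-antitone (0<x+1 0≤x) (+-monoˡ-≤ 1ℚ x≤y)))))

  artanhq-mono : ∀ {z w} N → 0ℚ ≤ z → z ≤ w → artanhq N z ≤ artanhq N w
  artanhq-mono {z} {w} N 0≤z z≤w = ≤-trans
    (≤-from-diff ((w - z) * ∑q (evenPow z) N) refl (*-nonNeg (0≤- z≤w) (∑q-nonNeg (λ k → evenPow-nonNeg z k 0≤z) N)))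
    (artanhq-gap z w N 0≤z z≤w)

  logq-mono : ∀ {x y} N → 1ℚ ≤ x → x ≤ y → logq N x ≤ logq N y
  logq-mono N 1≤x x≤y = *-monoˡ-≤-nonNeg 2ℚ {{nonNegative 0≤2}}
    (artanhq-mono N (cayley-nonNeg 1≤x) (cayley-mono (≤-trans 0≤1 1≤x) x≤y))

  logq-nonNeg : ∀ {x} N → 1ℚ ≤ x → 0ℚ ≤ logq N x
  logq-nonNeg {x} N 1≤x = *-nonNeg 0≤2 (∑q-nonNeg (λ k → *-nonNeg (odd k) (unit-nonNeg (2 ℕ.* k))) N)
    where
    odd : ∀ k → 0ℚ ≤ oddPow (cayley x) k
    odd k = subst (0ℚ ≤_) (sym (oddPow≡ (cayley x) k)) (*-nonNeg (cayley-nonNeg 1≤x) (evenPow-nonNeg (cayley x) k (cayley-nonNeg 1≤x)))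

  -- The derivative of log at x is 1/x, so log gains at least h/(1+h) from x to (1+h)x; here h = 1/n and c = 1/(n+2) < h/(1+h).
  logq-step : ∀ h n c x → 0ℚ ≤ h → 0ℚ ≤ n → 0ℚ ≤ c → n * h ≡ 1ℚ → (1ℚ + (1ℚ + n)) * c ≡ 1ℚ → 1ℚ ≤ x →
              ∃[ N₀ ] (∀ N → N₀ ℕ.≤ N → logq N x + c ≤ logq N ((1ℚ + h) * x))
  logq-step h n c x 0≤h 0≤n 0≤c nh 2+n*c 1≤x = N₀ , λ N N₀≤N → ≤-trans
    (+-monoʳ-≤ (logq N x) (Δ≥ N N₀≤N))
    (subst₂ _≤_ (solve 3 (λ t A g → t :* (A :+ g) := t :* A :+ t :* g) refl 2ℚ (artanhq N z) ((w - z) * ∑q (evenPow z) N)) refl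
      (*-monoˡ-≤-nonNeg 2ℚ {{nonNegative 0≤2}} (artanhq-gap z w N (cayley-nonNeg 1≤x) (cayley-mono 0≤x x≤y))))
    where
    open ≤-Reasoning
    y = (1ℚ + h) * x
    z = cayley x
    w = cayley y
    a = inv (x + 1ℚ)
    b = inv (y + 1ℚ)
    0≤x : 0ℚ ≤ x
    0≤x = ≤-trans 0≤1 1≤x
    x≤y : x ≤ y
    x≤y = ≤-from-diff (h * x) (solve 2 (λ h x → (con 1ℚ :+ h) :* x := x :+ h :* x) refl h x) (*-nonNeg 0≤h 0≤x)
    0≤y = ≤-trans 0≤x x≤y
    0<a : 0ℚ < a
    0<a = inv-pos (0<x+1 0≤x)
    0<b : 0ℚ < b
    0<b = inv-pos (0<x+1 0≤y)
    xa : (x + 1ℚ) * a ≡ 1ℚ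
    xa = inv-inverse (0<x+1 0≤x)
    yb : (y + 1ℚ) * b ≡ 1ℚ
    yb = inv-inverse (0<x+1 0≤y)
    -- Chosen so that z^N = (1 - 2a)^N is at most 1/(n + 2) from `N₀` on, by `geometric-decay`.
    archimedes = archimedean ((1ℚ + n) * inv a)
    N₀ = proj₁ archimedes
    Δ : ℕ → ℚ
    Δ N = 2ℚ * ((w - z) * ∑q (evenPow z) N)

    -- From z = 1 - 2a one has 1 - z² = 4a (1 - a), and w - z = 2 b h (1 - a), so the factor 1 - a
    -- is absorbed into the closed form of the geometric sum.
    gap : ∀ N → a * Δ N ≡ b * h * (1ℚ - evenPow z N)
    gap N = trans (cong (λ g → a * (2ℚ * (g * ∑q (evenPow z) N))) w-z)
      (trans (solve 5 (λ a b h t s → a :* (con 2ℚ :* (con 2ℚ :* (b :* h :* (con 1ℚ :- a)) :* s))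
                := b :* h :* ((con 1ℚ :- (con 1ℚ :- con 2ℚ :* a) :* (con 1ℚ :- con 2ℚ :* a)) :* s)) refl a b h 0ℚ (∑q (evenPow z) N))
        (trans (cong (λ z′ → b * h * ((1ℚ - z′ * z′) * ∑q (evenPow z) N)) (sym (cayley≡ 0≤x))) (cong (b * h *_) (evenPow-sum z N))))
      where
      a-b : a - b ≡ b * h * (1ℚ - a)
      a-b = begin-equality
        a - b                                                     ≡⟨ solve 2 (λ a b → a :- b := a :* con 1ℚ :- b :* con 1ℚ) refl a b ⟩
        a * 1ℚ - b * 1ℚ                                           ≡⟨ cong₂ (λ u v → a * u - b * v) (sym yb) (sym xa) ⟩
        a * ((y + 1ℚ) * b) - b * ((x + 1ℚ) * a)                   ≡⟨ solve 4 (λ a b h x → a :* (((con 1ℚ :+ h) :* x :+ con 1ℚ) :* b) :- b :* ((x :+ con 1ℚ) :* a)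
                                                                      := b :* h :* ((x :+ con 1ℚ) :* a :- a)) refl a b h x ⟩
        b * h * ((x + 1ℚ) * a - a)                                ≡⟨ cong (λ u → b * h * (u - a)) xa ⟩
        b * h * (1ℚ - a)                                          ∎
      w-z : w - z ≡ 2ℚ * (b * h * (1ℚ - a))
      w-z = trans (cong₂ _-_ (cayley≡ 0≤y) (cayley≡ 0≤x))
        (trans (solve 2 (λ a b → con 1ℚ :- con 2ℚ :* b :- (con 1ℚ :- con 2ℚ :* a) := con 2ℚ :* (a :- b)) refl a b) (cong (2ℚ *_) a-b))

    a≤ : a ≤ (1ℚ + h) * b
    a≤ = ≤-from-diff (h * (a * b)) (begin-equality
      (1ℚ + h) * b                                                 ≡⟨ *-identityʳ ((1ℚ + h) * b) ⟨
      (1ℚ + h) * b * 1ℚ                                            ≡⟨ cong ((1ℚ + h) * b *_) xa ⟨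
      (1ℚ + h) * b * ((x + 1ℚ) * a)                                ≡⟨ solve 4 (λ a b h x → (con 1ℚ :+ h) :* b :* ((x :+ con 1ℚ) :* a)
                                                                       := a :* (((con 1ℚ :+ h) :* x :+ con 1ℚ) :* b) :+ h :* (a :* b)) refl a b h x ⟩
      a * ((y + 1ℚ) * b) + h * (a * b)                             ≡⟨ cong (λ u → a * u + h * (a * b)) yb ⟩
      a * 1ℚ + h * (a * b)                                         ≡⟨ cong (_+ h * (a * b)) (*-identityʳ a) ⟩
      a + h * (a * b)                                              ∎) (*-nonNeg 0≤h (*-nonNeg (<⇒≤ 0<a) (<⇒≤ 0<b)))

    small : ∀ N → N₀ ℕ.≤ N → evenPow z N * (1ℚ + (1ℚ + n)) ≤ 1ℚ
    small N N₀≤N = begin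
      evenPow z N * (1ℚ + (1ℚ + n))               ≡⟨ cong (_* (1ℚ + (1ℚ + n))) (evenPow≡^q z N) ⟩
      z ^q N * z ^q N * (1ℚ + (1ℚ + n))           ≤⟨ *-monoʳ-≤-nonNeg (1ℚ + (1ℚ + n)) {{nonNegative (+-mono-≤ 0≤1 (+-mono-≤ 0≤1 0≤n))}}
                                                       (≤-trans (*-monoˡ-≤-nonNeg (z ^q N) {{nonNegative (^q-nonNeg 0≤z N)}} (^q≤1 N)) (≤-reflexive (*-identityʳ (z ^q N)))) ⟩
      z ^q N * (1ℚ + (1ℚ + n))                    ≤⟨ *-monoˡ-≤-nonNeg (z ^q N) {{nonNegative (^q-nonNeg 0≤z N)}} (+-monoʳ-≤ 1ℚ enough) ⟩
      z ^q N * (1ℚ + nat N * (2ℚ * a))            ≡⟨ cong (λ z → z ^q N * (1ℚ + nat N * (2ℚ * a))) (cayley≡ 0≤x) ⟩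
      (1ℚ - 2ℚ * a) ^q N * (1ℚ + nat N * (2ℚ * a)) ≤⟨ geometric-decay (2ℚ * a) (*-nonNeg 0≤2 (<⇒≤ 0<a)) (subst (0ℚ ≤_) (cayley≡ 0≤x) 0≤z) N ⟩
      1ℚ                                          ∎
      where
      0≤z : 0ℚ ≤ z
      0≤z = cayley-nonNeg 1≤x
      z≤1′ : z ≤ 1ℚ
      z≤1′ = subst (_≤ 1ℚ) (sym (cayley≡ 0≤x)) (≤-from-diff (2ℚ * a) (solve 1 (λ t → con 1ℚ := con 1ℚ :- t :+ t) refl (2ℚ * a)) (*-nonNeg 0≤2 (<⇒≤ 0<a)))
      ^q≤1 : ∀ N → z ^q N ≤ 1ℚ
      ^q≤1 zero    = ≤-refl
      ^q≤1 (suc N) = *-mono {z} {1ℚ} {z ^q N} {1ℚ} 0≤z 0≤1 z≤1′ (^q≤1 N)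
      enough : 1ℚ + n ≤ nat N * (2ℚ * a)
      enough = begin
        1ℚ + n                          ≡⟨ *-identityʳ (1ℚ + n) ⟨
        (1ℚ + n) * 1ℚ                   ≡⟨ cong ((1ℚ + n) *_) (inv-inverse 0<a) ⟨
        (1ℚ + n) * (a * inv a)          ≡⟨ solve 3 (λ n a i → n :* (a :* i) := n :* i :* a) refl (1ℚ + n) a (inv a) ⟩
        (1ℚ + n) * inv a * a            ≤⟨ *-monoʳ-≤-nonNeg a {{nonNegative (<⇒≤ 0<a)}} (≤-trans (proj₂ archimedes) (nat-mono N₀≤N)) ⟩
        nat N * a                       ≤⟨ *-monoˡ-≤-nonNeg (nat N) {{nonNegative (nat-nonNeg N)}} (≤-from-diff a (solve 1 (λ a → con 2ℚ :* a := a :+ a) refl a) (<⇒≤ 0<a)) ⟩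
        nat N * (2ℚ * a)                ∎

    -- The quotient b/a is at least 1/(1 + h), so the gain is at least h/(1 + h) = 1/(n + 1) up to
    -- truncation. Truncation costs a factor 1 - c, and (1 - 1/(n + 2))/(n + 1) is exactly c.
    Δ≥ : ∀ N → N₀ ℕ.≤ N → c ≤ Δ N
    Δ≥ N N₀≤N = *-cancelˡ-≤-pos a {{positive 0<a}} (*-cancelˡ-≤-pos (1ℚ + n) {{positive (+-mono-<-≤ 0<1 0≤n)}} (begin
      (1ℚ + n) * (a * c)
        ≤⟨ *-monoˡ-≤-nonNeg (1ℚ + n) {{nonNegative (+-mono-≤ 0≤1 0≤n)}}
             (*-monoʳ-≤-nonNeg c {{nonNegative 0≤c}} a≤) ⟩
      (1ℚ + n) * ((1ℚ + h) * b * c)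
        ≡⟨ cong (λ u → (1ℚ + n) * ((u + h) * b * c)) (sym nh) ⟩
      (1ℚ + n) * ((n * h + h) * b * c)
        ≡⟨ solve 4 (λ n h b c → (con 1ℚ :+ n) :* ((n :* h :+ h) :* b :* c) := (con 1ℚ :+ n) :* (b :* h) :* ((con 1ℚ :+ n) :* c)) refl n h b c ⟩
      (1ℚ + n) * (b * h) * ((1ℚ + n) * c)
        ≤⟨ *-monoˡ-≤-nonNeg ((1ℚ + n) * (b * h)) {{nonNegative (*-nonNeg (+-mono-≤ 0≤1 0≤n) (*-nonNeg (<⇒≤ 0<b) 0≤h))}} cN ⟩
      (1ℚ + n) * (b * h) * (1ℚ - evenPow z N)
        ≡⟨ *-assoc (1ℚ + n) (b * h) (1ℚ - evenPow z N) ⟩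
      (1ℚ + n) * (b * h * (1ℚ - evenPow z N))
        ≡⟨ cong ((1ℚ + n) *_) (gap N) ⟨
      (1ℚ + n) * (a * Δ N) ∎))
      where
      e≤c : evenPow z N ≤ c
      e≤c = *-cancelʳ-≤-pos (1ℚ + (1ℚ + n)) {{positive (+-mono-<-≤ 0<1 (+-mono-≤ 0≤1 0≤n))}}
        (≤-trans (small N N₀≤N) (≤-reflexive (trans (sym 2+n*c) (*-comm (1ℚ + (1ℚ + n)) c))))
      cN : (1ℚ + n) * c ≤ 1ℚ - evenPow z N
      cN = begin
        (1ℚ + n) * c                     ≡⟨ solve 2 (λ n c → (con 1ℚ :+ n) :* c := (con 1ℚ :+ (con 1ℚ :+ n)) :* c :- c) refl n c ⟩
        (1ℚ + (1ℚ + n)) * c - c          ≡⟨ cong (_- c) 2+n*c ⟩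
        1ℚ - c                           ≤⟨ +-monoʳ-≤ 1ℚ (neg-antimono-≤ e≤c) ⟩
        1ℚ - evenPow z N                 ∎

  -- `logq-step` iterated; c = 1/(n + 2) stands in for log(1 + 1/n).
  logq-power : ∀ h n c → 0ℚ ≤ h → 0ℚ ≤ n → 0ℚ ≤ c → n * h ≡ 1ℚ → (1ℚ + (1ℚ + n)) * c ≡ 1ℚ →
               ∀ m → ∃[ N₀ ] (∀ N → N₀ ℕ.≤ N → nat m * c ≤ logq N ((1ℚ + h) ^q m))
  logq-power h n c 0≤h 0≤n 0≤c nh nc zero    = 0 , λ N _ → ≤-trans (≤-reflexive (*-zeroˡ c)) (logq-nonNeg N ≤-refl)
  logq-power h n c 0≤h 0≤n 0≤c nh nc (suc m) =
    let N₁ , h₁ = logq-power h n c 0≤h 0≤n 0≤c nh nc m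
        N₂ , h₂ = logq-step h n c ((1ℚ + h) ^q m) 0≤h 0≤n 0≤c nh nc (1≤^q (≤-from-diff h refl 0≤h) m)
    in N₁ ℕ.⊔ N₂ , λ N N≥ → begin
    nat (suc m) * c                ≡⟨ trans (cong (_* c) (nat-suc m)) (solve 2 (λ m c → (con 1ℚ :+ m) :* c := m :* c :+ c) refl (nat m) c) ⟩
    nat m * c + c                  ≤⟨ +-monoˡ-≤ c (h₁ N (ℕₚ.m⊔n≤o⇒m≤o N₁ N₂ N≥)) ⟩
    logq N ((1ℚ + h) ^q m) + c     ≤⟨ h₂ N (ℕₚ.m⊔n≤o⇒n≤o N₁ N₂ N≥) ⟩
    logq N ((1ℚ + h) ^q suc m)     ∎
    where
    open ≤-Reasoning

-- Truncated exponential series over ℚ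

module RationalExponential where

  open import Defs using (module CauchySequences; const; exp; expTerm; approx; cauchy)
  open CauchySequences
  open RationalLogarithm
  open import Data.Nat.Base as ℕ using (ℕ; zero; suc)
  import Data.Nat.Properties as ℕₚ
  open import Data.Integer.Base using (+_)
  open import Data.Product.Base using (∃-syntax; _×_; _,_; proj₁)
  open import Data.Rational.Base
  open import Data.Rational.Properties
  open import Data.Rational.Solver using (module +-*-Solver)
  open import Data.Sum.Base using (inj₁; inj₂)
  open import Relation.Binary.PropositionalEquality
  open +-*-Solver

  eTerm : ℚ → ℕ → ℚ
  eTerm x zero    = 1ℚ
  eTerm x (suc k) = eTerm x k * x * (+ 1 / suc k)

  expq : ℕ → ℚ → ℚ
  expq N x = ∑q (eTerm x) N

  ∑q-cong : ∀ {s t} n → (∀ k → k ℕ.< n → s k ≡ t k) → ∑q s n ≡ ∑q t n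
  ∑q-cong zero    h = refl
  ∑q-cong (suc n) h = cong₂ _+_ (∑q-cong n (λ k k<n → h k (ℕₚ.m<n⇒m<1+n k<n))) (h n ℕₚ.≤-refl)

  ∑q-mono-< : ∀ {s t} n → (∀ k → k ℕ.< n → s k ≤ t k) → ∑q s n ≤ ∑q t n
  ∑q-mono-< zero    h = ≤-refl
  ∑q-mono-< (suc n) h = +-mono-≤ (∑q-mono-< n (λ k k<n → h k (ℕₚ.m<n⇒m<1+n k<n))) (h n ℕₚ.≤-refl)

  ∑q-distrib-+ : ∀ s t n → ∑q (λ k → s k + t k) n ≡ ∑q s n + ∑q t n
  ∑q-distrib-+ s t zero    = refl
  ∑q-distrib-+ s t (suc n) = trans (cong (_+ (s n + t n)) (∑q-distrib-+ s t n))
    (solve 4 (λ a b c d → a :+ b :+ (c :+ d) := a :+ c :+ (b :+ d)) refl (∑q s n) (∑q t n) (s n) (t n))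

  ∑q-*ˡ : ∀ c t n → ∑q (λ k → c * t k) n ≡ c * ∑q t n
  ∑q-*ˡ c t zero    = sym (*-zeroʳ c)
  ∑q-*ˡ c t (suc n) = trans (cong (_+ c * t n) (∑q-*ˡ c t n)) (sym (*-distribˡ-+ c (∑q t n) (t n)))

  ∑q-shift : ∀ t n → ∑q t (suc n) ≡ t 0 + ∑q (λ k → t (suc k)) n
  ∑q-shift t zero    = +-comm 0ℚ (t 0)
  ∑q-shift t (suc n) = trans (cong (_+ t (suc n)) (∑q-shift t n)) (+-assoc (t 0) _ (t (suc n)))

  ∑q-+ : ∀ t m n → ∑q t (m ℕ.+ n) ≡ ∑q t m + ∑q (λ k → t (m ℕ.+ k)) n
  ∑q-+ t m zero    = trans (cong (∑q t) (ℕₚ.+-identityʳ m)) (sym (+-identityʳ (∑q t m)))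
  ∑q-+ t m (suc n) = trans (cong (∑q t) (ℕₚ.+-suc m n))
    (trans (cong (_+ t (m ℕ.+ n)) (∑q-+ t m n)) (+-assoc (∑q t m) (∑q (λ k → t (m ℕ.+ k)) n) (t (m ℕ.+ n))))

  nat-+ : ∀ m n → nat (m ℕ.+ n) ≡ nat m + nat n
  nat-+ zero    n = sym (+-identityˡ (nat n))
  nat-+ (suc m) n = trans (nat-suc (m ℕ.+ n)) (trans (cong (λ z → 1ℚ + z) (nat-+ m n))
    (trans (sym (+-assoc 1ℚ (nat m) (nat n))) (cong (_+ nat n) (sym (nat-suc m)))))

  eTerm-step : ∀ x k → nat (suc k) * eTerm x (suc k) ≡ x * eTerm x k
  eTerm-step x k = trans
    (solve 4 (λ n t x c → n :* (t :* x :* c) := n :* c :* (x :* t)) refl (nat (suc k)) (eTerm x k) x (+ 1 / suc k))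
    (trans (cong (_* (x * eTerm x k)) (nat-inverse k)) (*-identityˡ (x * eTerm x k)))

  eTerm-nonNeg : ∀ {x} → 0ℚ ≤ x → ∀ k → 0ℚ ≤ eTerm x k
  eTerm-nonNeg 0≤x zero    = 0≤1
  eTerm-nonNeg 0≤x (suc k) = *-nonNeg (*-nonNeg (eTerm-nonNeg 0≤x k) 0≤x) (unit-nonNeg k)

  eTerm-mono : ∀ {x y} → 0ℚ ≤ x → x ≤ y → ∀ k → eTerm x k ≤ eTerm y k
  eTerm-mono 0≤x x≤y zero    = ≤-refl
  eTerm-mono {x} {y} 0≤x x≤y (suc k) = *-monoʳ-≤-nonNeg (+ 1 / suc k) {{nonNegative (unit-nonNeg k)}}
    (*-mono (eTerm-nonNeg 0≤x k) (≤-trans 0≤x x≤y) (eTerm-mono 0≤x x≤y k) x≤y)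

  -- Together the two inequalities say that the terms at `- x` are dominated in absolute value by
  -- those at `x`. Each step changes the sign of one side and so swaps them, which is why they are
  -- proved jointly.
  eTerm-neg : ∀ {x} → 0ℚ ≤ x → ∀ k → 0ℚ ≤ eTerm x k - eTerm (- x) k × 0ℚ ≤ eTerm x k + eTerm (- x) k
  eTerm-neg {x} 0≤x zero    = ≤-reflexive (sym (+-inverseʳ 1ℚ)) , +-mono-≤ 0≤1 0≤1
  eTerm-neg {x} 0≤x (suc k) =
    let d , s = eTerm-neg 0≤x k
        c = + 1 / suc k
    in subst (0ℚ ≤_) (solve 4 (λ a b x c → (a :+ b) :* x :* c := a :* x :* c :- b :* (:- x) :* c) refl (eTerm x k) (eTerm (- x) k) x c)
         (*-nonNeg (*-nonNeg s 0≤x) (unit-nonNeg k)) ,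
       subst (0ℚ ≤_) (solve 4 (λ a b x c → (a :- b) :* x :* c := a :* x :* c :+ b :* (:- x) :* c) refl (eTerm x k) (eTerm (- x) k) x c)
         (*-nonNeg (*-nonNeg d 0≤x) (unit-nonNeg k))

  eTerm-neg≤ : ∀ {x} → 0ℚ ≤ x → ∀ k → eTerm (- x) k ≤ eTerm x k
  eTerm-neg≤ 0≤x k = ≤-by (proj₁ (eTerm-neg 0≤x k))

  convolution : (ℕ → ℚ) → (ℕ → ℚ) → ℕ → ℚ
  convolution a b n = ∑q (λ i → a i * b (n ℕ.∸ i)) (suc n)

  -- (n+1) c_{n+1} = x c_n - x c_n, splitting n+1 as i + (n+1-i) in each summand.
  convolution-zero : ∀ x n → convolution (eTerm x) (eTerm (- x)) (suc n) ≡ 0ℚ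
  convolution-zero x n = trans (sym (*-identityˡ _)) (trans (cong (_* C (suc n)) (sym (trans (*-comm (+ 1 / suc n) (nat (suc n))) (nat-inverse n))))
    (trans (*-assoc (+ 1 / suc n) (nat (suc n)) (C (suc n))) (trans (cong (+ 1 / suc n *_) weighted) (*-zeroʳ (+ 1 / suc n)))))
    where
    open ≡-Reasoning
    a b : ℕ → ℚ
    a = eTerm x
    b = eTerm (- x)
    C = convolution a b
    left right : ℕ → ℚ
    left  i = nat i * a i * b (suc n ℕ.∸ i)
    right i = a i * (nat (suc n ℕ.∸ i) * b (suc n ℕ.∸ i))
    left-sum : ∑q left (suc (suc n)) ≡ x * C n
    left-sum = begin
      ∑q left (suc (suc n))                    ≡⟨ ∑q-shift left (suc n) ⟩
      left 0 + ∑q (λ i → left (suc i)) (suc n) ≡⟨ cong₂ _+_ (solve 2 (λ a b → con 0ℚ :* a :* b := con 0ℚ) refl (a 0) (b (suc n)))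
                                                    (∑q-cong (suc n) (λ i _ → trans (cong (_* b (n ℕ.∸ i)) (eTerm-step x i)) (*-assoc x (a i) (b (n ℕ.∸ i))))) ⟩
      0ℚ + ∑q (λ i → x * (a i * b (n ℕ.∸ i))) (suc n) ≡⟨ +-identityˡ _ ⟩
      ∑q (λ i → x * (a i * b (n ℕ.∸ i))) (suc n)      ≡⟨ ∑q-*ˡ x (λ i → a i * b (n ℕ.∸ i)) (suc n) ⟩
      x * C n                                  ∎
    right-term : ∀ i → i ℕ.< suc n → right i ≡ - x * (a i * b (n ℕ.∸ i))
    right-term i i<1+n = trans (cong (λ k → a i * (nat k * b k)) (ℕₚ.+-∸-assoc 1 (ℕₚ.≤-pred i<1+n)))
      (trans (cong (a i *_) (eTerm-step (- x) (n ℕ.∸ i))) (solve 3 (λ a x b → a :* (x :* b) := x :* (a :* b)) refl (a i) (- x) (b (n ℕ.∸ i))))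
    right-sum : ∑q right (suc (suc n)) ≡ - x * C n
    right-sum = begin
      ∑q right (suc n) + right (suc n)
        ≡⟨ cong₂ _+_ (∑q-cong (suc n) right-term) (trans (cong (λ k → a (suc n) * (nat k * b k)) (ℕₚ.n∸n≡0 (suc n)))
             (solve 1 (λ a → a :* (con 0ℚ :* con 1ℚ) := con 0ℚ) refl (a (suc n)))) ⟩
      ∑q (λ i → - x * (a i * b (n ℕ.∸ i))) (suc n) + 0ℚ
        ≡⟨ trans (+-identityʳ _) (∑q-*ˡ (- x) (λ i → a i * b (n ℕ.∸ i)) (suc n)) ⟩
      - x * C n ∎
    split : ∀ i → i ℕ.< suc (suc n) → nat (suc n) * (a i * b (suc n ℕ.∸ i)) ≡ left i + right i
    split i i<2+n = trans (cong (_* (a i * b (suc n ℕ.∸ i))) (trans (cong nat (sym (ℕₚ.m+[n∸m]≡n (ℕₚ.≤-pred i<2+n)))) (nat-+ i (suc n ℕ.∸ i))))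
      (solve 4 (λ m k a b → (m :+ k) :* (a :* b) := m :* a :* b :+ a :* (k :* b)) refl (nat i) (nat (suc n ℕ.∸ i)) (a i) (b (suc n ℕ.∸ i)))
    weighted : nat (suc n) * C (suc n) ≡ 0ℚ
    weighted = begin
      nat (suc n) * C (suc n)
        ≡⟨ ∑q-*ˡ (nat (suc n)) (λ i → a i * b (suc n ℕ.∸ i)) (suc (suc n)) ⟨
      ∑q (λ i → nat (suc n) * (a i * b (suc n ℕ.∸ i))) (suc (suc n))
        ≡⟨ ∑q-cong (suc (suc n)) split ⟩
      ∑q (λ i → left i + right i) (suc (suc n))
        ≡⟨ ∑q-distrib-+ left right (suc (suc n)) ⟩
      ∑q left (suc (suc n)) + ∑q right (suc (suc n))
        ≡⟨ cong₂ _+_ left-sum right-sum ⟩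
      x * C n + - x * C n
        ≡⟨ solve 2 (λ x c → x :* c :+ (:- x) :* c := con 0ℚ) refl x (C n) ⟩
      0ℚ ∎

  module _ (a b : ℕ → ℚ) where
    -- A partial sum of the Cauchy product: the sum of a i b j over i + j < n.
    triangle-sum : ℕ → ℚ
    triangle-sum n = ∑q (λ i → a i * ∑q b (n ℕ.∸ i)) n

    triangle-sum-suc : ∀ n → triangle-sum (suc n) ≡ triangle-sum n + convolution a b n
    triangle-sum-suc n = begin
      ∑q (λ i → a i * ∑q b (suc n ℕ.∸ i)) (suc n)
        ≡⟨ ∑q-cong (suc n) (λ i i<1+n → trans (cong (λ k → a i * ∑q b k) (ℕₚ.+-∸-assoc 1 (ℕₚ.≤-pred i<1+n))) (*-distribˡ-+ (a i) (∑q b (n ℕ.∸ i)) (b (n ℕ.∸ i)))) ⟩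
      ∑q (λ i → a i * ∑q b (n ℕ.∸ i) + a i * b (n ℕ.∸ i)) (suc n)
        ≡⟨ ∑q-distrib-+ (λ i → a i * ∑q b (n ℕ.∸ i)) (λ i → a i * b (n ℕ.∸ i)) (suc n) ⟩
      triangle-sum n + a n * ∑q b (n ℕ.∸ n) + convolution a b n
        ≡⟨ cong (λ k → triangle-sum n + a n * ∑q b k + convolution a b n) (ℕₚ.n∸n≡0 n) ⟩
      triangle-sum n + a n * 0ℚ + convolution a b n
        ≡⟨ cong (_+ convolution a b n) (solve 2 (λ t a → t :+ a :* con 0ℚ := t) refl (triangle-sum n) (a n)) ⟩
      triangle-sum n + convolution a b n ∎
      where open ≡-Reasoning

  triangle-one : ∀ x n → triangle-sum (eTerm x) (eTerm (- x)) (suc n) ≡ 1ℚ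
  triangle-one x zero    = refl
  triangle-one x (suc n) = trans (triangle-sum-suc (eTerm x) (eTerm (- x)) (suc n))
    (trans (cong₂ _+_ (triangle-one x n) (convolution-zero x n)) (+-identityʳ 1ℚ))

  ∑q-tail-mono : ∀ {s t} → (∀ k → s k ≤ t k) → ∀ {m n} → m ℕ.≤ n → ∑q s n - ∑q s m ≤ ∑q t n - ∑q t m
  ∑q-tail-mono {s} {t} h {m} {n} m≤n = subst (λ n → ∑q s n - ∑q s m ≤ ∑q t n - ∑q t m) (ℕₚ.m+[n∸m]≡n m≤n)
    (subst₂ _≤_ (tail s) (tail t) (∑q-mono (λ k → h (m ℕ.+ k)) (n ℕ.∸ m)))
    where
    tail : ∀ s → ∑q (λ k → s (m ℕ.+ k)) (n ℕ.∸ m) ≡ ∑q s (m ℕ.+ (n ℕ.∸ m)) - ∑q s m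
    tail s = trans (solve 2 (λ a b → b := a :+ b :- a) refl (∑q s m) (∑q (λ k → s (m ℕ.+ k)) (n ℕ.∸ m))) (cong (_- ∑q s m) (sym (∑q-+ s m (n ℕ.∸ m))))

  ∑q-increasing : ∀ {t} → (∀ k → 0ℚ ≤ t k) → ∀ {m n} → m ℕ.≤ n → ∑q t m ≤ ∑q t n
  ∑q-increasing {t} h {m} {n} m≤n = subst (λ n → ∑q t m ≤ ∑q t n) (ℕₚ.m+[n∸m]≡n m≤n)
    (≤-from-diff (∑q (λ k → t (m ℕ.+ k)) (n ℕ.∸ m)) (∑q-+ t m (n ℕ.∸ m)) (∑q-nonNeg (λ k → h (m ℕ.+ k)) (n ℕ.∸ m)))

  module _ (a b : ℕ → ℚ) (0≤a : ∀ k → 0ℚ ≤ a k) (b≤a : ∀ k → b k ≤ a k) (M K : ℕ) (M≤K : M ℕ.≤ K) where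
    private
      open ≤-Reasoning
      N = M ℕ.+ K
      A = ∑q a
      S = ∑q b
      η = A N - A M
      M≤N : M ℕ.≤ N
      M≤N = ℕₚ.m≤m+n M K

    -- The square exceeds the triangle by products with i + j ≥ N = M + K. As M ≤ K, one of the two
    -- indices is at least M, so one factor lies in the tail that η measures.
    product-triangle : A N * S N ≤ triangle-sum a b N + η * (A N + A N)
    product-triangle = begin
      A N * S N
        ≡⟨ trans (*-comm (A N) (S N)) (sym (∑q-*ˡ (S N) a N)) ⟩
      ∑q (λ i → S N * a i) N
        ≡⟨ ∑q-cong N (λ i _ → solve 3 (λ s a t → s :* a := a :* t :+ a :* (s :- t)) refl (S N) (a i) (S (N ℕ.∸ i))) ⟩
      ∑q (λ i → a i * S (N ℕ.∸ i) + a i * (S N - S (N ℕ.∸ i))) N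
        ≡⟨ ∑q-distrib-+ (λ i → a i * S (N ℕ.∸ i)) (λ i → a i * (S N - S (N ℕ.∸ i))) N ⟩
      triangle-sum a b N + ∑q (λ i → a i * (S N - S (N ℕ.∸ i))) N
        ≤⟨ +-monoʳ-≤ (triangle-sum a b N) (∑q-mono (λ i → *-monoˡ-≤-nonNeg (a i) {{nonNegative (0≤a i)}} (∑q-tail-mono b≤a (ℕₚ.m∸n≤m N i))) N) ⟩
      triangle-sum a b N + ∑q (λ i → a i * (A N - A (N ℕ.∸ i))) N
        ≡⟨ cong (λ z → triangle-sum a b N + z) (∑q-+ (λ i → a i * (A N - A (N ℕ.∸ i))) M K) ⟩
      triangle-sum a b N + (∑q (λ i → a i * (A N - A (N ℕ.∸ i))) M + ∑q (λ i → a (M ℕ.+ i) * (A N - A (N ℕ.∸ (M ℕ.+ i)))) K)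
        ≤⟨ +-monoʳ-≤ (triangle-sum a b N) (+-mono-≤ first second) ⟩
      triangle-sum a b N + (η * A N + A N * η)
        ≡⟨ cong (λ z → triangle-sum a b N + z) (solve 2 (λ e a → e :* a :+ a :* e := e :* (a :+ a)) refl η (A N)) ⟩
      triangle-sum a b N + η * (A N + A N) ∎
      where
      0≤η : 0ℚ ≤ η
      0≤η = 0≤- (∑q-increasing 0≤a M≤N)
      first : ∑q (λ i → a i * (A N - A (N ℕ.∸ i))) M ≤ η * A N
      first = begin
        ∑q (λ i → a i * (A N - A (N ℕ.∸ i))) M
          ≤⟨ ∑q-mono-< M (λ i i<M → *-monoˡ-≤-nonNeg (a i) {{nonNegative (0≤a i)}} (+-monoʳ-≤ (A N) (neg-antimono-≤
               (∑q-increasing 0≤a (ℕₚ.≤-trans (ℕₚ.≤-reflexive (sym (ℕₚ.m+n∸n≡m M i)))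
                 (ℕₚ.∸-monoˡ-≤ i (ℕₚ.+-monoʳ-≤ M (ℕₚ.≤-trans (ℕₚ.<⇒≤ i<M) M≤K)))))))) ⟩
        ∑q (λ i → a i * η) M
          ≡⟨ trans (∑q-cong M (λ i _ → *-comm (a i) η)) (∑q-*ˡ η a M) ⟩
        η * A M
          ≤⟨ *-monoˡ-≤-nonNeg η {{nonNegative 0≤η}} (∑q-increasing 0≤a M≤N) ⟩
        η * A N ∎
      second : ∑q (λ i → a (M ℕ.+ i) * (A N - A (N ℕ.∸ (M ℕ.+ i)))) K ≤ A N * η
      second = begin
        ∑q (λ i → a (M ℕ.+ i) * (A N - A (N ℕ.∸ (M ℕ.+ i)))) K
          ≤⟨ ∑q-mono (λ i → *-monoˡ-≤-nonNeg (a (M ℕ.+ i)) {{nonNegative (0≤a (M ℕ.+ i))}}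
               (≤-from-diff (A (N ℕ.∸ (M ℕ.+ i))) (solve 2 (λ x y → x := x :- y :+ y) refl (A N) (A (N ℕ.∸ (M ℕ.+ i)))) (∑q-nonNeg 0≤a (N ℕ.∸ (M ℕ.+ i))))) K ⟩
        ∑q (λ i → a (M ℕ.+ i) * A N) K
          ≡⟨ trans (∑q-cong K (λ i _ → *-comm (a (M ℕ.+ i)) (A N))) (∑q-*ˡ (A N) (λ i → a (M ℕ.+ i)) K) ⟩
        A N * ∑q (λ i → a (M ℕ.+ i)) K
          ≡⟨ cong (A N *_) (trans (solve 2 (λ a b → b := a :+ b :- a) refl (A M) (∑q (λ i → a (M ℕ.+ i)) K)) (cong (_- A M) (sym (∑q-+ a M K)))) ⟩
        A N * η ∎

  approx-exp : ∀ x n → approx (exp x) n ≡ expq n (approx x n)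
  approx-exp x n = sums n
    where
    terms : ∀ k → approx (expTerm x k) n ≡ eTerm (approx x n) k
    terms zero    = refl
    terms (suc k) = cong (λ t → t * approx x n * (+ 1 / suc k)) (terms k)
    sums : ∀ m → partial (λ k → approx (expTerm x k)) m n ≡ expq m (approx x n)
    sums zero    = refl
    sums (suc m) = cong₂ _+_ (sums m) (terms m)

  expq-cauchy : ∀ B → IsCauchy (λ n → expq n B)
  expq-cauchy B η 0<η = let N , h = cauchy (exp (const B)) η 0<η in
    N , λ m n N≤m N≤n → subst₂ (λ x y → ∣ x - y ∣ ≤ η) (approx-exp (const B) m) (approx-exp (const B) n) (h m n N≤m N≤n)

  ≤∣∣ : ∀ p → p ≤ ∣ p ∣
  ≤∣∣ p with ≤-total 0ℚ p
  ... | inj₁ 0≤p = ≤-reflexive (sym (0≤p⇒∣p∣≡p 0≤p))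
  ... | inj₂ p≤0 = ≤-trans p≤0 (0≤∣p∣ p)

  module _ {B η G θ} (0<η : 0ℚ < η) (0≤θ : 0ℚ ≤ θ) (2Gθ : (G + G) * θ ≡ η) {M K} (M≤K : M ℕ.≤ K)
           (bounded : expq (M ℕ.+ K) B ≤ G) (close : expq (M ℕ.+ K) B - expq M B ≤ θ) where
    exp-inverse-at : ∀ u → 0ℚ ≤ u → u ≤ B → 1 ℕ.≤ M → expq (M ℕ.+ K) u * expq (M ℕ.+ K) (- u) ≤ 1ℚ + η
    exp-inverse-at u 0≤u u≤B 1≤M = begin
      A N * expq N (- u)
        ≤⟨ product-triangle (eTerm u) (eTerm (- u)) (eTerm-nonNeg 0≤u) (eTerm-neg≤ 0≤u) M K M≤K ⟩
      triangle-sum (eTerm u) (eTerm (- u)) N + (A N - A M) * (A N + A N)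
        ≡⟨ cong (_+ (A N - A M) * (A N + A N)) (one 1≤M) ⟩
      1ℚ + (A N - A M) * (A N + A N)
        ≤⟨ +-monoʳ-≤ 1ℚ (*-mono (0≤- (∑q-increasing (eTerm-nonNeg 0≤u) (ℕₚ.m≤m+n M K))) (+-mono-≤ 0≤G 0≤G)
             (≤-trans (∑q-tail-mono (eTerm-mono 0≤u u≤B) (ℕₚ.m≤m+n M K)) close) (+-mono-≤ A≤G A≤G)) ⟩
      1ℚ + θ * (G + G)
        ≡⟨ cong (λ z → 1ℚ + z) (trans (*-comm θ (G + G)) 2Gθ) ⟩
      1ℚ + η ∎
      where
      open ≤-Reasoning
      N = M ℕ.+ K
      A = λ n → expq n u
      A≤G : A N ≤ G
      A≤G = ≤-trans (∑q-mono (eTerm-mono 0≤u u≤B) N) bounded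
      0≤G : 0ℚ ≤ G
      0≤G = ≤-trans (∑q-nonNeg (eTerm-nonNeg 0≤u) N) A≤G
      one : 1 ℕ.≤ M → triangle-sum (eTerm u) (eTerm (- u)) N ≡ 1ℚ
      one (ℕ.s≤s {n = m} _) = triangle-one u (m ℕ.+ K)

  -- Uniform in u, because u will be an approximation of a real exponent and varies together with N.
  -- The tail of the series at B dominates the tails at all u ≤ B.
  exp-inverse : ∀ B η → 0ℚ < η → ∃[ N₀ ] (∀ N → N₀ ℕ.≤ N → ∀ u → 0ℚ ≤ u → u ≤ B → expq N u * expq N (- u) ≤ 1ℚ + η)
  exp-inverse B η 0<η =
    let G , 0<G , N₁ , bounded = cauchy⇒bounded {λ n → expq n B} (expq-cauchy B)
        θ , 0<θ , 2Gθ = scale-down (+-pos 0<G 0<G) 0<η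
        N₂ , close = expq-cauchy B θ 0<θ
        -- Positive, since the empty triangle has sum 0 and not 1.
        M = suc (N₁ ℕ.⊔ N₂)
        N₁≤M : N₁ ℕ.≤ M
        N₁≤M = ℕₚ.≤-trans (ℕₚ.m≤m⊔n N₁ N₂) (ℕₚ.n≤1+n _)
        N₂≤M : N₂ ℕ.≤ M
        N₂≤M = ℕₚ.≤-trans (ℕₚ.m≤n⊔m N₁ N₂) (ℕₚ.n≤1+n _)
    in M ℕ.+ M , λ N N≥ u 0≤u u≤B →
       let K = N ℕ.∸ M
           M+K≡N : M ℕ.+ K ≡ N
           M+K≡N = ℕₚ.m+[n∸m]≡n (ℕₚ.≤-trans (ℕₚ.m≤m+n M M) N≥)
       in subst (λ N → expq N u * expq N (- u) ≤ 1ℚ + η) M+K≡N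
            (exp-inverse-at {B} {η} {G} {θ} 0<η (<⇒≤ 0<θ) 2Gθ {M} {K}
              (ℕₚ.+-cancelˡ-≤ M M K (subst (M ℕ.+ M ℕ.≤_) (sym M+K≡N) N≥))
              (≤-trans (≤∣∣ (expq (M ℕ.+ K) B)) (bounded (M ℕ.+ K) (ℕₚ.≤-trans N₁≤M (ℕₚ.m≤m+n M K))))
              (≤-trans (≤∣∣ (expq (M ℕ.+ K) B - expq M B)) (close (M ℕ.+ K) M (ℕₚ.≤-trans N₂≤M (ℕₚ.m≤m+n M K)) N₂≤M))
              u 0≤u u≤B (ℕ.s≤s ℕ.z≤n))

  -- The left side consists of the first two terms of the binomial expansion of (u +
  -- h)^(k+1)/(k+1)!; the others are nonnegative.
  eTerm-increment : ∀ u h → 0ℚ ≤ u → 0ℚ ≤ h → ∀ k → eTerm u (suc k) + h * eTerm u k ≤ eTerm (u + h) (suc k)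
  eTerm-increment u h 0≤u 0≤h zero    = ≤-reflexive
    (solve 2 (λ u h → con 1ℚ :* u :* con 1ℚ :+ h :* con 1ℚ := con 1ℚ :* (u :+ h) :* con 1ℚ) refl u h)
  eTerm-increment u h 0≤u 0≤h (suc k) = begin
    e₁ * u * c + h * e₁
      ≡⟨ cong (λ x → e₁ * u * c + h * x) (sym (trans (cong (_* e₁) nc) (*-identityˡ e₁))) ⟩
    e₁ * u * c + h * (n * c * e₁)
      ≡⟨ cong (λ n → e₁ * u * c + h * (n * c * e₁)) (nat-suc (suc k)) ⟩
    e₁ * u * c + h * ((1ℚ + m) * c * e₁)
      ≡⟨ solve 5 (λ e u c h m → e :* u :* c :+ h :* ((con 1ℚ :+ m) :* c :* e) := (e :* u :+ h :* e :+ h :* (m :* e)) :* c) refl e₁ u c h m ⟩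
    (e₁ * u + h * e₁ + h * (m * e₁)) * c
      ≡⟨ cong (λ x → (e₁ * u + h * e₁ + h * x) * c) (eTerm-step u k) ⟩
    (e₁ * u + h * e₁ + h * (u * e₀)) * c
      ≤⟨ *-monoʳ-≤-nonNeg c {{nonNegative (unit-nonNeg (suc k))}} (≤-from-diff {e₁ * u + h * e₁ + h * (u * e₀)} {(e₁ + h * e₀) * (u + h)} (h * h * e₀)
           (solve 4 (λ e₁ u h e₀ → (e₁ :+ h :* e₀) :* (u :+ h) := e₁ :* u :+ h :* e₁ :+ h :* (u :* e₀) :+ h :* h :* e₀) refl e₁ u h e₀)
           (*-nonNeg (*-nonNeg 0≤h 0≤h) (eTerm-nonNeg 0≤u k))) ⟩
    (e₁ + h * e₀) * (u + h) * c
      ≤⟨ *-monoʳ-≤-nonNeg c {{nonNegative (unit-nonNeg (suc k))}} (*-monoʳ-≤-nonNeg (u + h) {{nonNegative (+-mono-≤ 0≤u 0≤h)}} (eTerm-increment u h 0≤u 0≤h k)) ⟩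
    eTerm (u + h) (suc k) * (u + h) * c ∎
    where
    open ≤-Reasoning
    e₀ = eTerm u k
    e₁ = eTerm u (suc k)
    c = + 1 / suc (suc k)
    n = nat (suc (suc k))
    m = nat (suc k)
    nc : n * c ≡ 1ℚ
    nc = nat-inverse (suc k)

  -- Multiplication by h moves each term up by one order, hence the additional term of the
  -- truncation on the right.
  expq-increment : ∀ u h → 0ℚ ≤ u → 0ℚ ≤ h → ∀ N → (1ℚ + h) * expq N u ≤ expq (suc N) (u + h)
  expq-increment u h 0≤u 0≤h N = begin
    (1ℚ + h) * expq N u
      ≡⟨ solve 2 (λ h e → (con 1ℚ :+ h) :* e := e :+ h :* e) refl h (expq N u) ⟩
    expq N u + h * expq N u
      ≤⟨ +-monoˡ-≤ (h * expq N u) (∑q-increasing (eTerm-nonNeg 0≤u) (ℕₚ.n≤1+n N)) ⟩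
    expq (suc N) u + h * expq N u
      ≡⟨ cong₂ _+_ (∑q-shift (eTerm u) N) (sym (∑q-*ˡ h (eTerm u) N)) ⟩
    1ℚ + ∑q (λ k → eTerm u (suc k)) N + ∑q (λ k → h * eTerm u k) N
      ≡⟨ trans (+-assoc 1ℚ (∑q (λ k → eTerm u (suc k)) N) (∑q (λ k → h * eTerm u k) N)) (cong (λ z → 1ℚ + z) (sym (∑q-distrib-+ (λ k → eTerm u (suc k)) (λ k → h * eTerm u k) N))) ⟩
    1ℚ + ∑q (λ k → eTerm u (suc k) + h * eTerm u k) N
      ≤⟨ +-monoʳ-≤ 1ℚ (∑q-mono (eTerm-increment u h 0≤u 0≤h) N) ⟩
    1ℚ + ∑q (λ k → eTerm (u + h) (suc k)) N
      ≡⟨ ∑q-shift (eTerm (u + h)) N ⟨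
    expq (suc N) (u + h) ∎
    where open ≤-Reasoning

  expq-power : ∀ h → 0ℚ ≤ h → ∀ M → (1ℚ + h) ^q M ≤ expq (suc M) (nat M * h)
  expq-power h 0≤h zero    = ≤-reflexive (sym (+-identityˡ 1ℚ))
  expq-power h 0≤h (suc M) = begin
    (1ℚ + h) * (1ℚ + h) ^q M                   ≤⟨ *-monoˡ-≤-nonNeg (1ℚ + h) {{nonNegative (+-mono-≤ 0≤1 0≤h)}} (expq-power h 0≤h M) ⟩
    (1ℚ + h) * expq (suc M) (nat M * h)        ≤⟨ expq-increment (nat M * h) h (*-nonNeg (nat-nonNeg M) 0≤h) 0≤h (suc M) ⟩
    expq (suc (suc M)) (nat M * h + h)         ≡⟨ cong (expq (suc (suc M))) (trans
                                                    (solve 2 (λ m h → m :* h :+ h := (con 1ℚ :+ m) :* h) refl (nat M) h) (cong (_* h) (sym (nat-suc M)))) ⟩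
    expq (suc (suc M)) (nat (suc M) * h)       ∎
    where open ≤-Reasoning

  -- Combines exp(u) ≥ (1 + h)^M with the near inverse exp(- u).
  exp-decay : ∀ h M B η → 0ℚ ≤ h → 0ℚ < η → ∃[ N₀ ] (∀ N → N₀ ℕ.≤ N → ∀ u → nat M * h ≤ u → u ≤ B →
              expq N (- u) * (1ℚ + h) ^q M ≤ 1ℚ + η)
  exp-decay h M B η 0≤h 0<η =
    let N₁ , inverse = exp-inverse B η 0<η
    in suc M ℕ.⊔ N₁ , λ N N≥ u Mh≤u u≤B →
       let 0≤u = ≤-trans (*-nonNeg (nat-nonNeg M) 0≤h) Mh≤u
           large : (1ℚ + h) ^q M ≤ expq N u
           large = ≤-trans (expq-power h 0≤h M) (≤-trans (∑q-mono (eTerm-mono (*-nonNeg (nat-nonNeg M) 0≤h) Mh≤u) (suc M))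
                     (∑q-increasing (eTerm-nonNeg 0≤u) (ℕₚ.m⊔n≤o⇒m≤o (suc M) N₁ N≥)))
       in conclude (expq N (- u)) ((1ℚ + h) ^q M) (expq N u) large (^q-nonNeg (+-mono-≤ 0≤1 0≤h) M)
            (inverse N (ℕₚ.m⊔n≤o⇒n≤o (suc M) N₁ N≥) u 0≤u u≤B)
    where
    conclude : ∀ v p e → p ≤ e → 0ℚ ≤ p → e * v ≤ 1ℚ + η → v * p ≤ 1ℚ + η
    conclude v p e p≤e 0≤p ev≤ with ≤-total 0ℚ v
    ... | inj₁ 0≤v = ≤-trans (*-monoˡ-≤-nonNeg v {{nonNegative 0≤v}} p≤e) (≤-trans (≤-reflexive (*-comm v e)) ev≤)
    -- A truncation of exp(- u) can be negative.
    ... | inj₂ v≤0 = ≤-trans (≤-trans (*-monoʳ-≤-nonNeg p {{nonNegative 0≤p}} v≤0) (≤-reflexive (*-zeroˡ p)))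
                       (+-mono-≤ 0≤1 (<⇒≤ 0<η))

-- Integer logarithms and growth of powers of 1 + 1/J

module Growth where

  open import Defs using (module CauchySequences)
  open CauchySequences
  open RationalLogarithm
  open RationalExponential using (nat-+)
  open import Data.Integer.Base using (+_)
  import Data.Integer.Base as ℤ
  import Data.Integer.Properties as ℤₚ
  open import Data.Nat.Base as ℕ using (ℕ; zero; suc; ⌊_/2⌋; ⌈_/2⌉; z≤n; s≤s)
  import Data.Nat.Properties as ℕₚ
  import Data.Nat.Solver as ℕ-Solver
  open import Data.Product.Base using (∃-syntax; _×_; _,_)
  open import Data.Rational.Base
  open import Data.Rational.Properties
  open import Data.Rational.Solver using (module +-*-Solver)
  import Data.Rational.Unnormalised.Base as ℚᵘ
  import Data.Rational.Unnormalised.Properties as ℚᵘₚ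
  open import Relation.Binary.PropositionalEquality
  open import Relation.Nullary using (yes; no; contradiction)
  open ProductBound using (n<2^n)

  nat-* : ∀ m n → nat (m ℕ.* n) ≡ nat m * nat n
  nat-* zero    n = sym (*-zeroˡ (nat n))
  nat-* (suc m) n = trans (nat-+ n (m ℕ.* n)) (trans (cong (λ z → nat n + z) (nat-* m n))
    (trans (solve 2 (λ m n → n :+ m :* n := (con 1ℚ :+ m) :* n) refl (nat m) (nat n)) (cong (_* nat n) (sym (nat-suc m)))))
    where open +-*-Solver

  nat-^ : ∀ m k → nat (m ℕ.^ k) ≡ nat m ^q k
  nat-^ m zero    = refl
  nat-^ m (suc k) = trans (nat-* m (m ℕ.^ k)) (cong (nat m *_) (nat-^ m k))

  nat-cancel-≤ : ∀ {m n} → nat m ≤ nat n → m ℕ.≤ n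
  nat-cancel-≤ {m} {n} h = ℕₚ.≮⇒≥ λ n<m → <-irrefl refl (<-≤-trans
    (subst₂ _<_ (+-identityˡ (nat n)) (sym (nat-suc n)) (+-monoˡ-< (nat n) 0<1)) (≤-trans (nat-mono n<m) h))

  fraction : ∀ s m .{{_ : ℕ.NonZero m}} → (+ s / m) * nat m ≡ nat s
  fraction s (suc k) = toℚᵘ-injective (begin
    toℚᵘ ((+ s / suc k) * nat (suc k))
      ≈⟨ toℚᵘ-homo-* (+ s / suc k) (nat (suc k)) ⟩
    toℚᵘ (+ s / suc k) ℚᵘ.* toℚᵘ (nat (suc k))
      ≈⟨ ℚᵘₚ.*-cong (toℚᵘ-fromℚᵘ (ℚᵘ.mkℚᵘ (+ s) k)) (toℚᵘ-fromℚᵘ (ℚᵘ.mkℚᵘ (+ suc k) 0)) ⟩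
    ℚᵘ.mkℚᵘ (+ s) k ℚᵘ.* ℚᵘ.mkℚᵘ (+ suc k) 0
      ≈⟨ ℚᵘ.*≡* (trans (ℤₚ.*-identityʳ (+ s ℤ.* + suc k)) (cong (λ z → + s ℤ.* + z) (sym (ℕₚ.*-identityʳ (suc k))))) ⟩
    ℚᵘ.mkℚᵘ (+ s) 0
      ≈⟨ toℚᵘ-fromℚᵘ (ℚᵘ.mkℚᵘ (+ s) 0) ⟨
    toℚᵘ (nat s) ∎)
    where open ℚᵘₚ.≃-Reasoning

  proportion≥1 : ∀ q s m d .{{_ : ℕ.NonZero m}} → q ≡ + s / m → m ℕ.≤ s ℕ.* d → 1ℚ ≤ q * nat d
  proportion≥1 q s m@(suc k) d q≡s/m m≤sd = *-cancelˡ-≤-pos (nat m) {{positive (<-≤-trans 0<1 (nat-mono {1} {m} (s≤s z≤n)))}} (begin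
    nat m * 1ℚ                       ≡⟨ *-identityʳ (nat m) ⟩
    nat m                            ≤⟨ nat-mono m≤sd ⟩
    nat (s ℕ.* d)                    ≡⟨ nat-* s d ⟩
    nat s * nat d                    ≡⟨ cong (_* nat d) (trans (cong (_* nat m) q≡s/m) (fraction s m)) ⟨
    q * nat m * nat d                ≡⟨ solve 3 (λ q m d → q :* m :* d := m :* (q :* d)) refl q (nat m) (nat d) ⟩
    nat m * (q * nat d)              ∎)
    where
    open ≤-Reasoning
    open +-*-Solver

  floor-log : ∀ n → 1 ℕ.≤ n → ∃[ k ] (2 ℕ.^ k ℕ.≤ n × n ℕ.< 2 ℕ.^ suc k)
  floor-log (suc zero) _ = 0 , s≤s z≤n , s≤s (s≤s z≤n)
  floor-log (suc n@(suc _)) _ with floor-log n (s≤s z≤n)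
  ... | k , 2^k≤n , n<2^1+k with suc n ℕₚ.<? 2 ℕ.^ suc k
  ...   | yes lt = k , ℕₚ.≤-trans 2^k≤n (ℕₚ.n≤1+n n) , lt
  ...   | no  ge = suc k , ℕₚ.≮⇒≥ ge , ℕₚ.≤-<-trans n<2^1+k (ℕₚ.^-monoʳ-< 2 (s≤s (s≤s z≤n)) (ℕₚ.n<1+n (suc k)))

  floor-log-maximal : ∀ {n k t} → n ℕ.< 2 ℕ.^ suc k → 2 ℕ.^ t ℕ.≤ n → t ℕ.≤ k
  floor-log-maximal {n} {k} {t} n< ≤n = ℕₚ.≮⇒≥ λ k<t → ℕₚ.<⇒≱ n< (ℕₚ.≤-trans (ℕₚ.^-monoʳ-≤ 2 k<t) ≤n)

  module _ (h : ℚ) (J : ℕ) (0≤h : 0ℚ ≤ h) (Jh : nat J * h ≡ 1ℚ) where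
    open ≤-Reasoning
    open +-*-Solver
    private
      β : ℚ
      β = 1ℚ + h

    1≤β : 1ℚ ≤ β
    1≤β = ≤-from-diff h refl 0≤h

    bernoulli-q : ∀ k → 1ℚ + nat k * h ≤ β ^q k
    bernoulli-q zero    = ≤-reflexive (solve 1 (λ h → con 1ℚ :+ con 0ℚ :* h := con 1ℚ) refl h)
    bernoulli-q (suc k) = begin
      1ℚ + nat (suc k) * h           ≡⟨ cong (λ m → 1ℚ + m * h) (nat-suc k) ⟩
      1ℚ + (1ℚ + nat k) * h          ≤⟨ ≤-from-diff (nat k * h * h) (solve 2 (λ k h → (con 1ℚ :+ h) :* (con 1ℚ :+ k :* h)
                                          := con 1ℚ :+ (con 1ℚ :+ k) :* h :+ k :* h :* h) refl (nat k) h) (*-nonNeg (*-nonNeg (nat-nonNeg k) 0≤h) 0≤h) ⟩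
      β * (1ℚ + nat k * h)           ≤⟨ *-monoˡ-≤-nonNeg β {{nonNegative (≤-trans 0≤1 1≤β)}} (bernoulli-q k) ⟩
      β * β ^q k                     ∎

    nat*h≤ : ∀ k → nat k * h ≤ β ^q k
    nat*h≤ k = ≤-trans (≤-from-diff 1ℚ (+-comm 1ℚ (nat k * h)) 0≤1) (bernoulli-q k)

    -- Splitting β^i into two powers with exponents about i/2 and applying Bernoulli to each gives a
    -- quadratic lower bound, which overtakes the linear function.
    linear≤exponential : ∀ A C → ∃[ i₀ ] (∀ i → i₀ ℕ.≤ i → nat (A ℕ.+ C ℕ.* i) ≤ β ^q i)
    linear≤exponential A C = t ℕ.+ t , bound
      where
      t = suc (J ℕ.* J ℕ.* (A ℕ.+ 2 ℕ.* C))
      bound : ∀ i → t ℕ.+ t ℕ.≤ i → nat (A ℕ.+ C ℕ.* i) ≤ β ^q i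
      bound i 2t≤i = begin
        nat (A ℕ.+ C ℕ.* i)
          ≡⟨ *-identityʳ (nat (A ℕ.+ C ℕ.* i)) ⟨
        nat (A ℕ.+ C ℕ.* i) * 1ℚ
          ≡⟨ cong (nat (A ℕ.+ C ℕ.* i) *_) (cong₂ _*_ Jh Jh) ⟨
        nat (A ℕ.+ C ℕ.* i) * (nat J * h * (nat J * h))
          ≡⟨ solve 3 (λ a j h → a :* (j :* h :* (j :* h)) := j :* j :* a :* (h :* h)) refl (nat (A ℕ.+ C ℕ.* i)) (nat J) h ⟩
        nat J * nat J * nat (A ℕ.+ C ℕ.* i) * (h * h)
          ≡⟨ cong (_* (h * h)) (trans (nat-* (J ℕ.* J) (A ℕ.+ C ℕ.* i)) (cong (_* nat (A ℕ.+ C ℕ.* i)) (nat-* J J))) ⟨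
        nat (J ℕ.* J ℕ.* (A ℕ.+ C ℕ.* i)) * (h * h)
          ≤⟨ *-monoʳ-≤-nonNeg (h * h) {{nonNegative (*-nonNeg 0≤h 0≤h)}} (nat-mono naturals) ⟩
        nat (k ℕ.* k′) * (h * h)
          ≡⟨ trans (cong (_* (h * h)) (nat-* k k′)) (solve 3 (λ a b h → a :* b :* (h :* h) := a :* h :* (b :* h)) refl (nat k) (nat k′) h) ⟩
        nat k * h * (nat k′ * h)
          ≤⟨ *-mono (*-nonNeg (nat-nonNeg k) 0≤h) (^q-nonNeg (≤-trans 0≤1 1≤β) k′) (nat*h≤ k) (nat*h≤ k′) ⟩
        β ^q k * β ^q k′
          ≡⟨ trans (sym (^q-+ β k k′)) (cong (β ^q_) (ℕₚ.⌊n/2⌋+⌈n/2⌉≡n i)) ⟩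
        β ^q i ∎
        where
        k  = ⌊ i /2⌋
        k′ = ⌈ i /2⌉
        t≤k : t ℕ.≤ k
        t≤k = subst (ℕ._≤ k) (sym (ℕₚ.n≡⌊n+n/2⌋ t)) (ℕₚ.⌊n/2⌋-mono 2t≤i)
        k≤k′ : k ℕ.≤ k′
        k≤k′ = ℕₚ.⌊n/2⌋≤⌈n/2⌉ i
        1≤k′ : 1 ℕ.≤ k′
        1≤k′ = ℕₚ.≤-trans (s≤s z≤n) (ℕₚ.≤-trans t≤k k≤k′)
        naturals : J ℕ.* J ℕ.* (A ℕ.+ C ℕ.* i) ℕ.≤ k ℕ.* k′
        naturals = ℕₚ.≤-trans (ℕₚ.*-monoʳ-≤ (J ℕ.* J) (ℕₚ.≤-trans
            (ℕₚ.+-mono-≤ (ℕₚ.≤-trans (ℕₚ.≤-reflexive (sym (ℕₚ.*-identityʳ A))) (ℕₚ.*-monoʳ-≤ A 1≤k′))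
              (ℕₚ.*-monoʳ-≤ C (subst (ℕ._≤ k′ ℕ.+ k′) (ℕₚ.⌊n/2⌋+⌈n/2⌉≡n i) (ℕₚ.+-monoˡ-≤ k′ k≤k′))))
            (ℕₚ.≤-reflexive (N.solve 3 (λ a c k → a N.:* k N.:+ c N.:* (k N.:+ k) N.:= (a N.:+ N.con 2 N.:* c) N.:* k) refl A C k′))))
          (ℕₚ.≤-trans (ℕₚ.≤-reflexive (sym (ℕₚ.*-assoc (J ℕ.* J) (A ℕ.+ 2 ℕ.* C) k′)))
            (ℕₚ.*-monoˡ-≤ k′ (ℕₚ.≤-trans (ℕₚ.n≤1+n (J ℕ.* J ℕ.* (A ℕ.+ 2 ℕ.* C))) t≤k)))
          where module N = ℕ-Solver.+-*-Solver

    nat<block-power : ∀ k → nat k < β ^q (J ℕ.* k)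
    nat<block-power k = <-≤-trans
      (subst (_< 1ℚ + nat k) (+-identityˡ (nat k)) (+-monoˡ-< (nat k) 0<1))
      (subst (λ z → 1ℚ + z ≤ β ^q (J ℕ.* k))
        (trans (cong (_* h) (nat-* J k)) (trans (solve 3 (λ j k h → j :* k :* h := j :* h :* k) refl (nat J) (nat k) h) (trans (cong (_* nat k) Jh) (*-identityˡ (nat k)))))
        (bernoulli-q (J ℕ.* k)))

    bracket : ∀ X i k → β ^q (J ℕ.* i) ≤ X → X < β ^q (J ℕ.* (i ℕ.+ k)) →
              ∃[ i′ ] (i ℕ.≤ i′ × β ^q (J ℕ.* i′) ≤ X × X < β ^q (J ℕ.* suc i′))
    bracket X i zero    lo hi = contradiction (<-≤-trans (subst (λ m → X < β ^q (J ℕ.* m)) (ℕₚ.+-identityʳ i) hi) lo) (<-irrefl refl)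
    bracket X i (suc k) lo hi with X <? β ^q (J ℕ.* suc i)
    ... | yes lt = i , ℕₚ.≤-refl , lo , lt
    ... | no  ge = let i′ , i<i′ , bounds = bracket X (suc i) k (≮⇒≥ ge) (subst (λ m → X < β ^q (J ℕ.* m)) (ℕₚ.+-suc i k) hi)
                   in i′ , ℕₚ.≤-trans (ℕₚ.n≤1+n i) i<i′ , bounds

    h≤1 : h ≤ 1ℚ
    h≤1 = go J Jh
      where
      go : ∀ J → nat J * h ≡ 1ℚ → h ≤ 1ℚ
      go zero     eq = contradiction (trans (sym (*-zeroˡ h)) eq) (λ ())
      go (suc J′) eq = ≤-trans (≤-trans (≤-reflexive (sym (*-identityˡ h))) (*-monoʳ-≤-nonNeg h {{nonNegative 0≤h}} (nat-mono {1} {suc J′} (s≤s z≤n))))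
                         (≤-reflexive eq)

    β^≤ : ∀ k → β ^q k ≤ nat (2 ℕ.^ k)
    β^≤ zero    = ≤-refl
    β^≤ (suc k) = subst (β * β ^q k ≤_) (sym (nat-* 2 (2 ℕ.^ k)))
      (*-mono (≤-trans 0≤1 1≤β) (nat-nonNeg (2 ℕ.^ k)) (+-monoʳ-≤ 1ℚ h≤1) (β^≤ k))

    -- X = m/3 lies between the i-th and (i+1)-st powers of βᴶ, and ℓ = m + g is of the same order of magnitude.
    module _ (K g i m : ℕ) (⅓ : ℚ) (3⅓ : nat 3 * ⅓ ≡ 1ℚ) (upper : nat m * ⅓ < β ^q (J ℕ.* suc i)) where
      private
        c₁ ℓ e : ℕ
        -- From m < 3 β^(J (i + 1)) ≤ 3 · 2^J β^(J i), as β ≤ 2; the summand `g` covers ℓ - m.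
        c₁ = 3 ℕ.* 2 ℕ.^ J ℕ.+ g
        ℓ = m ℕ.+ g
        e = c₁ ℕ.+ J ℕ.* i
        Bⁱ = β ^q (J ℕ.* i)
        1≤Bⁱ : 1ℚ ≤ Bⁱ
        1≤Bⁱ = 1≤^q 1≤β (J ℕ.* i)

      ℓ≤block : nat ℓ ≤ nat c₁ * Bⁱ
      ℓ≤block = begin
        nat (m ℕ.+ g)
          ≡⟨ nat-+ m g ⟩
        nat m + nat g
          ≤⟨ +-mono-≤ m≤ (≤-trans (≤-reflexive (sym (*-identityʳ (nat g)))) (*-monoˡ-≤-nonNeg (nat g) {{nonNegative (nat-nonNeg g)}} 1≤Bⁱ)) ⟩
        nat (3 ℕ.* 2 ℕ.^ J) * Bⁱ + nat g * Bⁱ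
          ≡⟨ trans (sym (*-distribʳ-+ Bⁱ (nat (3 ℕ.* 2 ℕ.^ J)) (nat g))) (cong (_* Bⁱ) (sym (nat-+ (3 ℕ.* 2 ℕ.^ J) g))) ⟩
        nat c₁ * Bⁱ ∎
        where
        m≤ : nat m ≤ nat (3 ℕ.* 2 ℕ.^ J) * Bⁱ
        m≤ = begin
          nat m                                      ≡⟨ *-identityʳ (nat m) ⟨
          nat m * 1ℚ                                 ≡⟨ cong (nat m *_) 3⅓ ⟨
          nat m * (nat 3 * ⅓)                        ≡⟨ solve 3 (λ m t u → m :* (t :* u) := t :* (m :* u)) refl (nat m) (nat 3) ⅓ ⟩
          nat 3 * (nat m * ⅓)                        ≤⟨ *-monoˡ-≤-nonNeg (nat 3) {{nonNegative (nat-nonNeg 3)}} (<⇒≤ upper) ⟩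
          nat 3 * β ^q (J ℕ.* suc i)                 ≡⟨ cong (nat 3 *_) (trans (cong (β ^q_) (ℕₚ.*-suc J i)) (^q-+ β J (J ℕ.* i))) ⟩
          nat 3 * (β ^q J * Bⁱ)                      ≤⟨ *-monoˡ-≤-nonNeg (nat 3) {{nonNegative (nat-nonNeg 3)}}
                                                          (*-monoʳ-≤-nonNeg Bⁱ {{nonNegative (≤-trans 0≤1 1≤Bⁱ)}} (β^≤ J)) ⟩
          nat 3 * (nat (2 ℕ.^ J) * Bⁱ)               ≡⟨ sym (*-assoc (nat 3) (nat (2 ℕ.^ J)) Bⁱ) ⟩
          nat 3 * nat (2 ℕ.^ J) * Bⁱ                 ≡⟨ cong (_* Bⁱ) (nat-* 3 (2 ℕ.^ J)) ⟨
          nat (3 ℕ.* 2 ℕ.^ J) * Bⁱ                   ∎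

      ℓ≤2^e : ℓ ℕ.≤ 2 ℕ.^ e
      ℓ≤2^e = ℕₚ.≤-trans (nat-cancel-≤ (begin
        nat ℓ                                ≤⟨ ℓ≤block ⟩
        nat c₁ * Bⁱ                          ≤⟨ *-monoˡ-≤-nonNeg (nat c₁) {{nonNegative (nat-nonNeg c₁)}} (β^≤ (J ℕ.* i)) ⟩
        nat c₁ * nat (2 ℕ.^ (J ℕ.* i))       ≡⟨ nat-* c₁ (2 ℕ.^ (J ℕ.* i)) ⟨
        nat (c₁ ℕ.* 2 ℕ.^ (J ℕ.* i))         ∎))
        (ℕₚ.≤-trans (ℕₚ.*-monoˡ-≤ (2 ℕ.^ (J ℕ.* i)) (ℕₚ.<⇒≤ (n<2^n c₁))) (ℕₚ.≤-reflexive (sym (ℕₚ.^-distribˡ-+-* 2 c₁ (J ℕ.* i)))))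

      -- ℓ is at most a multiple of β^(J i), while K (e + 1) and the implied constant are linear in
      -- i and fit into β^i. The exponent J + 1 in place of J is what ε will pay for.
      growth : nat (K ℕ.* c₁ ℕ.* suc c₁ ℕ.+ K ℕ.* c₁ ℕ.* J ℕ.* i) ≤ β ^q i → nat (K ℕ.* (ℓ ℕ.* suc e)) ≤ β ^q (suc J ℕ.* i)
      growth enough = begin
        nat (K ℕ.* (ℓ ℕ.* suc e))
          ≡⟨ trans (nat-* K (ℓ ℕ.* suc e)) (cong (nat K *_) (nat-* ℓ (suc e))) ⟩
        nat K * (nat ℓ * nat (suc e))
          ≤⟨ *-monoˡ-≤-nonNeg (nat K) {{nonNegative (nat-nonNeg K)}} (*-monoʳ-≤-nonNeg (nat (suc e)) {{nonNegative (nat-nonNeg (suc e))}} ℓ≤block) ⟩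
        nat K * (nat c₁ * Bⁱ * nat (suc e))
          ≡⟨ solve 4 (λ k c b e → k :* (c :* b :* e) := k :* c :* e :* b) refl (nat K) (nat c₁) Bⁱ (nat (suc e)) ⟩
        nat K * nat c₁ * nat (suc e) * Bⁱ
          ≡⟨ cong (_* Bⁱ) (trans (cong (_* nat (suc e)) (sym (nat-* K c₁))) (sym (nat-* (K ℕ.* c₁) (suc e)))) ⟩
        nat (K ℕ.* c₁ ℕ.* suc e) * Bⁱ
          ≡⟨ cong (λ z → nat z * Bⁱ) (N.solve 3 (λ k c x → k N.:* c N.:* (N.con 1 N.:+ (c N.:+ x)) N.:= k N.:* c N.:* (N.con 1 N.:+ c) N.:+ k N.:* c N.:* x) refl K c₁ (J ℕ.* i)) ⟩
        nat (K ℕ.* c₁ ℕ.* suc c₁ ℕ.+ K ℕ.* c₁ ℕ.* (J ℕ.* i)) * Bⁱ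
          ≡⟨ cong (λ z → nat (K ℕ.* c₁ ℕ.* suc c₁ ℕ.+ z) * Bⁱ) (sym (ℕₚ.*-assoc (K ℕ.* c₁) J i)) ⟩
        nat (K ℕ.* c₁ ℕ.* suc c₁ ℕ.+ K ℕ.* c₁ ℕ.* J ℕ.* i) * Bⁱ
          ≤⟨ *-monoʳ-≤-nonNeg Bⁱ {{nonNegative (≤-trans 0≤1 1≤Bⁱ)}} enough ⟩
        β ^q i * Bⁱ
          ≡⟨ ^q-+ β i (J ℕ.* i) ⟨
        β ^q (suc J ℕ.* i) ∎
        where module N = ℕ-Solver.+-*-Solver

-- Orbit-stabiliser inequality for the Galois group

module Orbit where

  open import Defs
  open PolynomialRoots using (Regular; roots⇒zero)
  open IntegerPolynomials using (leading-term; coeff; eval-injective)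
  open SubsetCount using (lookup-injective)
  open import Data.List.Membership.Propositional.Properties using (∈-lookup)
  import Data.Rational.Base as Rat
  import Data.Rational.Properties as Ratₚ
  import Data.Integer.Properties as ℤₚ
  import Data.Rational.Unnormalised.Base as ℚᵘ
  import Data.Rational.Unnormalised.Properties as ℚᵘₚ
  open import Algebra.Bundles using (CommutativeRing)
  open import Algebra.Apartness.Bundles using (HeytingField; HeytingCommutativeRing)
  open import Algebra.Morphism.Structures using (module RingMorphisms)
  import Algebra.Morphism.Construct.Composition as Composition
  open import Data.Empty using (⊥-elim)
  open import Data.Fin.Base using (Fin)
  import Data.Fin.Properties as Finₚ
  open import Data.Integer.Base as ℤ using (ℤ; +_; 0ℤ)
  open import Data.List.Base using (List; []; _∷_; length; map; filter; allFin; _∷ʳ_; lookup)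
  import Data.List.Properties as List
  open import Data.List.Relation.Unary.All as All using (All; []; _∷_)
  import Data.List.Relation.Unary.All.Properties as All
  open import Data.List.Relation.Unary.AllPairs as AllPairs using (AllPairs; []; _∷_)
  import Data.List.Relation.Unary.AllPairs.Properties as AllPairs
  open import Data.List.Relation.Unary.Unique.Propositional using (Unique)
  import Data.List.Relation.Unary.Unique.Propositional.Properties as Unique
  open import Data.Nat.Base as ℕ using (ℕ; suc)
  import Data.Nat.Properties as ℕₚ
  open import Data.Nat.Induction using (<-wellFounded)
  open import Induction.WellFounded using (Acc; acc)
  open import Data.Product.Base using (∃-syntax; _×_; _,_; proj₁; proj₂)
  open import Function.Base using (_∘_)
  open import Function.Bundles using (Inverse)
  open import Relation.Binary.Bundles using (Setoid)
  open import Relation.Binary.PropositionalEquality as ≡ using (_≡_; _≢_; refl; cong; subst)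
  open import Relation.Nullary using (¬_; yes; no; Dec; ¬?)
  open import Relation.Unary using (Decidable)

  length-filter-split : ∀ {a p} {A : Set a} {Q : A → Set p} (Q? : Decidable Q) xs →
                        length xs ≡ length (filter Q? xs) ℕ.+ length (filter (¬? ∘ Q?) xs)
  length-filter-split Q? [] = refl
  length-filter-split Q? (x ∷ xs) with Q? x
  ... | yes _ = cong suc (length-filter-split Q? xs)
  ... | no  _ = ≡.trans (cong suc (length-filter-split Q? xs)) (≡.sym (ℕₚ.+-suc _ _))

  module _ {m : ℕ} {ℓ} {_~_ : Fin m → Fin m → Set ℓ} (_~?_ : ∀ i j → Dec (i ~ j)) (~-refl : ∀ i → i ~ i) (s : ℕ)
           (class≤ : ∀ i xs → Unique xs → All (i ~_) xs → length xs ℕ.≤ s) where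

    -- A greedy choice in which each representative accounts for at most `s` elements. The last
    -- component passes properties of a list on to its representatives, so that `x` stays apart from
    -- those found later.
    representatives : ∀ xs → Acc ℕ._<_ (length xs) → Unique xs →
      ∃[ rs ] (AllPairs (λ i j → ¬ i ~ j) rs × length xs ℕ.≤ s ℕ.* length rs × (∀ {Q : Fin m → Set ℓ} → All Q xs → All Q rs))
    representatives []       _         _        = [] , [] , ℕ.z≤n , λ h → h
    representatives (x ∷ xs) (acc rec) (x∉ ∷ u) =
      let others = filter (¬? ∘ (x ~?_)) xs
          rs , apart , bound , sub = representatives others (rec (ℕ.s≤s (List.length-filter (¬? ∘ (x ~?_)) xs))) (Unique.filter⁺ _ u)
      in x ∷ rs , sub (All.all-filter (¬? ∘ (x ~?_)) xs) ∷ apart ,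
         (begin
           length (x ∷ xs)
             ≡⟨ cong suc (length-filter-split (x ~?_) xs) ⟩
           length (x ∷ filter (x ~?_) xs) ℕ.+ length others
             ≤⟨ ℕₚ.+-mono-≤ (class≤ x (x ∷ filter (x ~?_) xs) (All.filter⁺ _ x∉ ∷ Unique.filter⁺ _ u) (~-refl x ∷ All.all-filter (x ~?_) xs)) bound ⟩
           s ℕ.+ s ℕ.* length rs
             ≡⟨ ℕₚ.*-suc s (length rs) ⟨
           s ℕ.* length (x ∷ rs) ∎) ,
         λ { (q ∷ qs) → q ∷ sub (All.filter⁺ _ qs) }
      where open ℕₚ.≤-Reasoning

  module _ {a ℓ₁ ℓ₂} {P : ℤ[X]} {d : ℕ} (deg : HasDegree P d) (S : SplittingField a ℓ₁ ℓ₂ P) where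
    open SplittingField S hiding (K)
    open SplittingField S using (K)
    open GaloisGroup S
    private
      commRing : CommutativeRing a ℓ₁
      commRing = HeytingCommutativeRing.commutativeRing (HeytingField.heytingCommutativeRing K)
      module R = CommutativeRing commRing
      module ι = RingMorphisms.IsRingHomomorphism isHom
    open import Relation.Binary.Reasoning.Setoid R.setoid

    1≉0 : ¬ 1# ≈ 0#
    1≉0 1≈0 = proj₂ (tight 1# 0#) 1≈0 (invertible⇒# (1# , R.trans (R.*-identityˡ (1# - 0#)) 1-0≈1 , R.trans (R.*-identityʳ (1# - 0#)) 1-0≈1))
      where
      1-0≈1 : 1# - 0# ≈ 1#
      1-0≈1 = R.trans (R.+-congˡ (R.trans (R.sym (R.+-identityˡ (- 0#))) (R.-‿inverseʳ 0#))) (R.+-identityʳ 1#)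

    -- In a Heyting field `¬ x ≈ y` does not make `y - x` invertible. Tightness helps: if z were
    -- apart from 0, it would be invertible, and x ≈ y would follow.
    ≉⇒regular : ∀ {x y} → ¬ x ≈ y → Regular commRing (y - x)
    ≉⇒regular {x} {y} x≉y z dz≈0 = proj₁ (tight z 0#) λ z#0 →
      let i , _ , z-0*i≈1 = #⇒invertible z#0
          z-0≈z = R.trans (R.+-congˡ (R.trans (R.sym (R.+-identityˡ (- 0#))) (R.-‿inverseʳ 0#))) (R.+-identityʳ z)
      in x≉y (begin
        x                             ≈⟨ R.+-identityˡ x ⟨
        0# + x                        ≈⟨ R.+-congʳ (R.trans (R.sym (R.zeroˡ i)) (R.*-congʳ (R.sym dz≈0))) ⟩
        (y - x) * z * i + x           ≈⟨ R.+-congʳ (R.trans (R.*-assoc (y - x) z i) (R.*-congˡ (R.*-congʳ (R.sym z-0≈z)))) ⟩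
        (y - x) * ((z - 0#) * i) + x  ≈⟨ R.+-congʳ (R.trans (R.*-congˡ z-0*i≈1) (R.*-identityʳ (y - x))) ⟩
        y - x + x                     ≈⟨ R.+-assoc y (- x) x ⟩
        y + (- x + x)                 ≈⟨ R.trans (R.+-congˡ (R.-‿inverseˡ x)) (R.+-identityʳ y) ⟩
        y                             ∎)

    ι-integer : ℤ → Carrier
    ι-integer z = ι (z Rat./ 1)

    ι-integer-zero : ι-integer 0ℤ ≈ 0#
    ι-integer-zero = ι.0#-homo

    -- A nonzero integer is already invertible in ℚ, and ι preserves this.
    ι-integer-nonzero : ∀ c → c ≢ 0ℤ → ¬ ι-integer c ≈ 0#
    ι-integer-nonzero c c≢0 ιc≈0 = 1≉0 (begin
      1#                             ≈⟨ ι.1#-homo ⟨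
      ι Rat.1ℚ                       ≡⟨ cong ι (Ratₚ.*-inverseʳ q) ⟨
      ι (q Rat.* Rat.1/ q)           ≈⟨ ι.*-homo q (Rat.1/ q) ⟩
      ι q * ι (Rat.1/ q)             ≈⟨ R.*-congʳ ιc≈0 ⟩
      0# * ι (Rat.1/ q)              ≈⟨ R.zeroˡ (ι (Rat.1/ q)) ⟩
      0#                             ∎)
      where
      q = c Rat./ 1
      q≢0 : q ≢ Rat.0ℚ
      q≢0 q≡0 = c≢0 (integer-zero c q≡0)
        where
        integer-zero : ∀ c → c Rat./ 1 ≡ Rat.0ℚ → c ≡ 0ℤ
        integer-zero c eq with ℚᵘ.*≡* h ← ℚᵘₚ.≃-trans (ℚᵘₚ.≃-sym (Ratₚ.toℚᵘ-fromℚᵘ (ℚᵘ.mkℚᵘ c 0))) (ℚᵘₚ.≃-reflexive (cong Rat.toℚᵘ eq)) =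
          ≡.trans (≡.sym (ℤₚ.*-identityʳ c)) h
      instance _ = Rat.≢-nonZero q≢0

    eval-embed-zero : ∀ p x → (∀ i → coeff p i ≡ 0ℤ) → evalₚ (embed ι p) x ≈ 0#
    eval-embed-zero []      x h = R.refl
    eval-embed-zero (b ∷ p) x h = begin
      ι-integer b + x * evalₚ (embed ι p) x  ≈⟨ R.+-cong (R.trans (R.reflexive (cong ι-integer (h 0))) ι-integer-zero)
                                                  (R.*-congˡ (eval-embed-zero p x (λ i → h (suc i)))) ⟩
      0# + x * 0#                            ≈⟨ R.trans (R.+-identityˡ (x * 0#)) (R.zeroʳ x) ⟩
      0#                                     ∎

    eval-embed-cong : ∀ p q x → (∀ i → coeff p i ≡ coeff q i) → evalₚ (embed ι p) x ≈ evalₚ (embed ι q) x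
    eval-embed-cong []      q       x h = R.sym (eval-embed-zero q x (λ i → ≡.sym (h i)))
    eval-embed-cong (a ∷ p) []      x h = eval-embed-zero (a ∷ p) x h
    eval-embed-cong (a ∷ p) (b ∷ q) x h = R.+-cong (R.reflexive (cong ι-integer (h 0)))
      (R.*-congˡ (eval-embed-cong p q x (λ i → h (suc i))))

    coeff-embed-∷ʳ : ∀ q c → Polynomials.coeff rawRing (embed ι (q ∷ʳ c)) (length q) ≈ ι-integer c
    coeff-embed-∷ʳ []      c = R.refl
    coeff-embed-∷ʳ (b ∷ q) c = coeff-embed-∷ʳ q c

    -- The general root count, applied to d + 1 coefficients the last of which is nonzero in the
    -- field.
    roots≤d : ∀ ys → AllPairs (λ x y → ¬ x ≈ y) ys → All IsRoot ys → length ys ℕ.≤ d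
    roots≤d ys distinct isRoots with length ys ℕₚ.≤? d
    ... | yes ys≤d = ys≤d
    ... | no  ys≰d with q , c , c≢0 , |q| , P≡ ← leading-term P deg =
      ⊥-elim (ι-integer-nonzero c c≢0 (R.trans (R.sym (coeff-embed-∷ʳ q c))
        (roots⇒zero commRing (embed ι (q ∷ʳ c)) ys
          (subst (ℕ._≤ length ys) (≡.sym (≡.trans (List.length-map ι-integer (q ∷ʳ c))
            (≡.trans (List.length-++ q) (≡.trans (ℕₚ.+-comm (length q) 1) (cong suc |q|))))) (ℕₚ.≰⇒> ys≰d))
          (AllPairs.map ≉⇒regular distinct)
          (All.map (λ {y} Py → R.trans (eval-embed-cong (q ∷ʳ c) P y (λ i → ≡.sym (eval-injective P (q ∷ʳ c) P≡ i))) Py) isRoots)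
          (length q))))

    module _ (f : Automorphism) where
      private module f = RingMorphisms.IsRingIsomorphism (isRingIsomorphism f)

      image-root : ∀ y → IsRoot y → IsRoot (σ f y)
      image-root y Py = R.trans (evals P) (R.trans (f.⟦⟧-cong Py) f.0#-homo)
        where
        evals : ∀ p → evalₚ (embed ι p) (σ f y) ≈ σ f (evalₚ (embed ι p) y)
        evals []      = R.sym f.0#-homo
        evals (c ∷ p) = begin
          ι-integer c + σ f y * evalₚ (embed ι p) (σ f y)         ≈⟨ R.+-cong (R.sym (fixesℚ f (c Rat./ 1))) (R.*-congˡ (evals p)) ⟩
          σ f (ι-integer c) + σ f y * σ f (evalₚ (embed ι p) y)   ≈⟨ R.+-congˡ (f.*-homo y (evalₚ (embed ι p) y)) ⟨
          σ f (ι-integer c) + σ f (y * evalₚ (embed ι p) y)       ≈⟨ f.+-homo (ι-integer c) (y * evalₚ (embed ι p) y) ⟨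
          σ f (ι-integer c + y * evalₚ (embed ι p) y)             ∎

      private
        σ⁻¹ : Carrier → Carrier
        σ⁻¹ y = proj₁ (f.surjective y)

        σσ⁻¹ : ∀ y → σ f (σ⁻¹ y) ≈ y
        σσ⁻¹ y = proj₂ (f.surjective y) R.refl

        solve-σ : ∀ {x y} → σ f x ≈ y → σ⁻¹ y ≈ x
        solve-σ h = f.injective (R.trans (σσ⁻¹ _) (R.sym h))

      inverse-automorphism : Automorphism
      inverse-automorphism = record
        { σ = σ⁻¹
        ; isRingIsomorphism = record
          { isRingMonomorphism = record
            { isRingHomomorphism = record
              { isSemiringHomomorphism = record
                { isNearSemiringHomomorphism = record
                  { +-isMonoidHomomorphism = record
                    { isMagmaHomomorphism = record
                      { isRelHomomorphism = record { cong = λ x≈y → solve-σ (R.trans (σσ⁻¹ _) (R.sym x≈y)) }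
                      ; homo = λ x y → solve-σ (R.trans (f.+-homo (σ⁻¹ x) (σ⁻¹ y)) (R.+-cong (σσ⁻¹ x) (σσ⁻¹ y)))
                      }
                    ; ε-homo = solve-σ f.0#-homo
                    }
                  ; *-homo = λ x y → solve-σ (R.trans (f.*-homo (σ⁻¹ x) (σ⁻¹ y)) (R.*-cong (σσ⁻¹ x) (σσ⁻¹ y)))
                  }
                ; 1#-homo = solve-σ f.1#-homo
                }
              ; -‿homo = λ x → solve-σ (R.trans (f.-‿homo (σ⁻¹ x)) (R.-‿cong (σσ⁻¹ x)))
              }
            ; injective = λ {x} {y} h → R.trans (R.sym (σσ⁻¹ x)) (R.trans (f.⟦⟧-cong h) (σσ⁻¹ y))
            }
          ; surjective = λ y → σ f y , λ z≈ → solve-σ (R.sym z≈)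
          }
        ; fixesℚ = λ q → solve-σ (fixesℚ f q)
        }

      inverse-≈ : ∀ {x y} → σ f x ≈ y → σ inverse-automorphism y ≈ x
      inverse-≈ = solve-σ

      ≈-inverse : ∀ {x y} → σ inverse-automorphism y ≈ x → σ f x ≈ y
      ≈-inverse h = R.trans (f.⟦⟧-cong (R.sym h)) (σσ⁻¹ _)

    compose : Automorphism → Automorphism → Automorphism
    compose f g = record
      { σ = σ g ∘ σ f
      ; isRingIsomorphism = Composition.isRingIsomorphism R.trans (isRingIsomorphism f) (isRingIsomorphism g)
      ; fixesℚ = λ q → R.trans (RingMorphisms.IsRingIsomorphism.⟦⟧-cong (isRingIsomorphism g) (fixesℚ f q)) (fixesℚ g q)
      }

    module _ (y : Carrier) (Py : IsRoot y) {m s : ℕ} (|G| : HasCardinality Gal m) (|G-fixing-y| : HasCardinality (Fixing y) s) where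
      private
        module G = Inverse |G|
        module F = Inverse |G-fixing-y|
        g : Fin m → Automorphism
        g = G.from

      _~_ : Fin m → Fin m → Set ℓ₁
      i ~ j = σ (g j) y ≈ σ (g i) y

      quotient : Fin m → Fin m → Automorphism
      quotient i j = compose (g j) (inverse-automorphism (g i))

      -- Equality in the field need not be decidable. Membership in the stabiliser is: the index of
      -- h in the enumerated group is compared with the indices of the enumerated stabiliser.
      fixing? : ∀ h → Dec (σ h y ≈ y)
      fixing? h with Finₚ.any? (λ k → G.to h Finₚ.≟ G.to (proj₁ (F.from k)))
      ... | yes (k , eq) = yes (R.trans (to-injective h (proj₁ (F.from k)) eq y) (proj₂ (F.from k)))
        where
        to-injective : ∀ f h → G.to f ≡ G.to h → Setoid._≈_ Gal f h
        to-injective f h eq x = R.trans (R.sym (G.inverseʳ {f} ≡.refl x)) (G.inverseʳ {h} eq x)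
      ... | no  none = no λ hy≈y → none (F.to (h , hy≈y) , G.to-cong (λ x → R.sym (F.inverseʳ {h , hy≈y} ≡.refl x)))

      _~?_ : ∀ i j → Dec (i ~ j)
      i ~? j with fixing? (quotient i j)
      ... | yes e  = yes (R.sym (≈-inverse (g i) e))
      ... | no  ne = no (λ i~j → ne (inverse-≈ (g i) (R.sym i~j)))

      -- Elements sending y to the same root lie in one coset of the stabiliser; composing with the
      -- inverse of `g i` maps them injectively into it.
      class≤s : ∀ i xs → Unique xs → All (i ~_) xs → length xs ℕ.≤ s
      class≤s i xs unique i~xs = Finₚ.injective⇒≤ {f = code} (λ {k} {l} → code-injective k l)
        where
        fixes : ∀ k → σ (quotient i (lookup xs k)) y ≈ y
        fixes k = inverse-≈ (g i) (R.sym (All.lookup i~xs (∈-lookup k)))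
        code : Fin (length xs) → Fin s
        code k = F.to (quotient i (lookup xs k) , fixes k)
        code-injective : ∀ k l → code k ≡ code l → k ≡ l
        code-injective k l eq = lookup-injective unique k l
          (≡.trans (≡.sym (G.inverseˡ {lookup xs k} {g (lookup xs k)} (λ _ → R.refl))) (≡.trans (G.to-cong same) (G.inverseˡ {lookup xs l} {g (lookup xs l)} (λ _ → R.refl))))
          where
          quotients : ∀ x → σ (quotient i (lookup xs k)) x ≈ σ (quotient i (lookup xs l)) x
          quotients x = R.trans (R.sym (F.inverseʳ {quotient i (lookup xs k) , fixes k} ≡.refl x))
                                (F.inverseʳ {quotient i (lookup xs l) , fixes l} eq x)
          same : ∀ x → σ (g (lookup xs k)) x ≈ σ (g (lookup xs l)) x
          same x = R.trans (R.sym (≈-inverse (g i) R.refl)) (R.trans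
            (RingMorphisms.IsRingIsomorphism.⟦⟧-cong (isRingIsomorphism (g i)) (quotients x)) (≈-inverse (g i) R.refl))

      -- Representatives of different classes send y to different roots of P, so there are at most d
      -- classes.
      order≤ : m ℕ.≤ s ℕ.* d
      order≤ = let rs , apart , bound , _ = representatives _~?_ (λ _ → R.refl) s class≤s (allFin m) (<-wellFounded _) (Unique.allFin⁺ m) in
        ℕₚ.≤-trans (ℕₚ.≤-reflexive (≡.sym (List.length-tabulate (λ i → i)))) (ℕₚ.≤-trans bound (ℕₚ.*-monoʳ-≤ s
          (subst (ℕ._≤ d) (List.length-map (λ i → σ (g i) y) rs)
            (roots≤d (map (λ i → σ (g i) y) rs) (AllPairs.map⁺ (AllPairs.map (λ i≁j e → i≁j (R.sym e)) apart))
              (All.map⁺ (All.universal (λ i → image-root (g i) y Py) rs))))))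

-- From the sieve bound to the iterated logarithm

module LowerBound where

  open import Defs
  open CauchySequences
  open RationalLogarithm
  open RationalExponential
  open Growth
  open ProductBound using (n<2^n)
  open import Data.Integer.Base using (+_)
  open import Data.Nat.Base as ℕ using (ℕ; zero; suc; z≤n; s≤s)
  import Data.Nat.Properties as ℕₚ
  import Data.Nat.Solver as ℕ-Solver
  open import Data.Product.Base using (Σ-syntax; ∃-syntax; _,_; proj₁; proj₂)
  open import Data.Rational.Base
  open import Data.Rational.Properties
  open import Data.Rational.Solver using (module +-*-Solver)
  open import Data.Sum.Base using (inj₁; inj₂)
  open import Relation.Binary.PropositionalEquality hiding (J)

  artanh-sums : ∀ z n m → partial (λ k j → approx (oddPower z k) j * (+ 1 / suc (2 ℕ.* k))) m n ≡ artanhq m (approx z n)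
  artanh-sums z n = sums
    where
    powers : ∀ k → approx (oddPower z k) n ≡ oddPow (approx z n) k
    powers zero    = refl
    powers (suc k) = cong (_* (approx z n * approx z n)) (powers k)
    sums : ∀ m → partial (λ k j → approx (oddPower z k) j * (+ 1 / suc (2 ℕ.* k))) m n ≡ artanhq m (approx z n)
    sums zero    = refl
    sums (suc m) = cong₂ (λ s t → s + t * (+ 1 / suc (2 ℕ.* m))) (sums m) (powers m)

  approx-log : ∀ x 0<x n → approx (log x 0<x) n ≡ logq n (approx x n)
  approx-log x (δ , 0<δ , N , h) n = cong (2ℚ *_) (artanh-sums _ n n)

  ⅓ : ℚ
  ⅓ = + 1 / 3

  0≤⅓ : 0ℚ ≤ ⅓
  0≤⅓ = unit-nonNeg 2

  -- ⅓ is the constant 1/(n + 2) of `logq-step` at n = h = 1, a lower bound for log 2.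
  log-lower : ∀ m → ∃[ N₀ ] (∀ N → N₀ ℕ.≤ N → ∀ x → nat (2 ℕ.^ m) ≤ x → nat m * ⅓ ≤ logq N x)
  log-lower m =
    let N₀ , lower = logq-power 1ℚ 1ℚ ⅓ 0≤1 0≤1 0≤⅓ refl refl m
    in N₀ , λ N N≥ x 2^m≤x → ≤-trans (lower N N≥)
         (logq-mono N (1≤^q 1≤2 m) (subst (_≤ x) (trans (nat-^ 2 m) (cong (_^q m) (nat-suc 1))) 2^m≤x))
    where
    1≤2 : 1ℚ ≤ 1ℚ + 1ℚ
    1≤2 = +-mono-≤ {1ℚ} {1ℚ} {0ℚ} {1ℚ} ≤-refl 0≤1

  -- Here `q` stands for the product q d, and `Λ` for an approximation of the logarithm in the
  -- exponent. Apart from the factor i the claim amounts to (J + 1) (J + 2) ≤ (1 + ε₀) J², which J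
  -- ε₀ ≥ 5 yields because 3J + 2 ≤ 5J.
  exponent-lower : ∀ J i h c ε₀ q ε Λ → 0ℚ ≤ h → 0ℚ ≤ c → nat J * h ≡ 1ℚ → (1ℚ + (1ℚ + nat J)) * c ≡ 1ℚ → 1 ℕ.≤ J →
                   + 5 / 1 ≤ nat J * ε₀ → 0ℚ ≤ ε₀ → 1ℚ ≤ q → ε₀ ≤ ε → nat (J ℕ.* i) * c ≤ Λ → nat (suc J ℕ.* i) * h ≤ (q + ε) * Λ
  exponent-lower J i h c ε₀ q ε Λ 0≤h 0≤c jh jc 1≤J 5≤jε 0≤ε₀ 1≤q ε₀≤ε Λ≥ = begin
    nat (suc J ℕ.* i) * h
      ≡⟨ cong (_* h) (trans (nat-* (suc J) i) (cong (_* nat i) (nat-suc J))) ⟩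
    (1ℚ + j) * nat i * h
      ≡⟨ solve 3 (λ j i h → (con 1ℚ :+ j) :* i :* h := (con 1ℚ :+ j) :* h :* i) refl j (nat i) h ⟩
    (1ℚ + j) * h * nat i
      ≤⟨ *-monoʳ-≤-nonNeg (nat i) {{nonNegative (nat-nonNeg i)}} ratio ⟩
    (1ℚ + ε₀) * (j * c) * nat i
      ≡⟨ trans (solve 4 (λ e j c i → (con 1ℚ :+ e) :* (j :* c) :* i := (con 1ℚ :+ e) :* (j :* i :* c)) refl ε₀ j c (nat i))
           (cong (λ z → (1ℚ + ε₀) * (z * c)) (sym (nat-* J i))) ⟩
    (1ℚ + ε₀) * (nat (J ℕ.* i) * c)
      ≤⟨ *-mono (+-mono-≤ 0≤1 0≤ε₀) (≤-trans (*-nonNeg (nat-nonNeg (J ℕ.* i)) 0≤c) Λ≥) (+-mono-≤ 1≤q ε₀≤ε) Λ≥ ⟩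
    (q + ε) * Λ ∎
    where
    open ≤-Reasoning
    open +-*-Solver
    j = nat J
    1≤j : 1ℚ ≤ j
    1≤j = nat-mono {1} {J} 1≤J
    0<j : 0ℚ < j
    0<j = <-≤-trans 0<1 1≤j
    5ℚ = + 5 / 1
    0<j+2 : 0ℚ < 1ℚ + (1ℚ + j)
    0<j+2 = +-mono-<-≤ 0<1 (+-mono-≤ 0≤1 (nat-nonNeg J))
    ratio : (1ℚ + j) * h ≤ (1ℚ + ε₀) * (j * c)
    ratio = *-cancelˡ-≤-pos j {{positive 0<j}} (*-cancelˡ-≤-pos (1ℚ + (1ℚ + j)) {{positive 0<j+2}} (begin
      (1ℚ + (1ℚ + j)) * (j * ((1ℚ + j) * h))
        ≡⟨ solve 2 (λ j h → (con 1ℚ :+ (con 1ℚ :+ j)) :* (j :* ((con 1ℚ :+ j) :* h)) := (con 1ℚ :+ (con 1ℚ :+ j)) :* (con 1ℚ :+ j) :* (j :* h)) refl j h ⟩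
      (1ℚ + (1ℚ + j)) * (1ℚ + j) * (j * h)
        ≡⟨ trans (cong ((1ℚ + (1ℚ + j)) * (1ℚ + j) *_) jh) (*-identityʳ _) ⟩
      (1ℚ + (1ℚ + j)) * (1ℚ + j)
        ≤⟨ ≤-from-diff ((j * ε₀ - 5ℚ) * j + (1ℚ + 1ℚ) * (j - 1ℚ))
             (solve 2 (λ j e → (con 1ℚ :+ e) :* (j :* j) := (con 1ℚ :+ (con 1ℚ :+ j)) :* (con 1ℚ :+ j)
                :+ ((j :* e :- con 5ℚ) :* j :+ (con 1ℚ :+ con 1ℚ) :* (j :- con 1ℚ))) refl j ε₀)
             (+-mono-≤ (*-nonNeg (0≤- 5≤jε) (<⇒≤ 0<j)) (*-nonNeg (+-mono-≤ 0≤1 0≤1) (0≤- 1≤j))) ⟩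
      (1ℚ + ε₀) * (j * j)
        ≡⟨ trans (sym (*-identityʳ _)) (cong ((1ℚ + ε₀) * (j * j) *_) (sym jc)) ⟩
      (1ℚ + ε₀) * (j * j) * ((1ℚ + (1ℚ + j)) * c)
        ≡⟨ solve 3 (λ j e c → (con 1ℚ :+ e) :* (j :* j) :* ((con 1ℚ :+ (con 1ℚ :+ j)) :* c)
             := (con 1ℚ :+ (con 1ℚ :+ j)) :* (j :* ((con 1ℚ :+ e) :* (j :* c)))) refl j ε₀ c ⟩
      (1ℚ + (1ℚ + j)) * (j * ((1ℚ + ε₀) * (j * c))) ∎))

  -- `θ` is η divided by 1 + f, so that the error f θ stays within η. The factor `E` will be a
  -- truncation of exp, hence the case of a negative value.
  trade : ∀ E p n f η θ → n ≤ p * f → 0ℚ ≤ n → 0ℚ ≤ f → 0ℚ < θ → E * p ≤ 1ℚ + θ → (1ℚ + f) * θ ≡ η → n * E ≤ f + η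
  trade E p n f η θ n≤pf 0≤n 0≤f 0<θ Ep≤ eq with ≤-total 0ℚ E
  ... | inj₁ 0≤E = begin
    n * E              ≤⟨ *-monoʳ-≤-nonNeg E {{nonNegative 0≤E}} n≤pf ⟩
    p * f * E          ≡⟨ solve 3 (λ p f e → p :* f :* e := f :* (e :* p)) refl p f E ⟩
    f * (E * p)        ≤⟨ *-monoˡ-≤-nonNeg f {{nonNegative 0≤f}} Ep≤ ⟩
    f * (1ℚ + θ)       ≤⟨ ≤-from-diff θ (solve 2 (λ f t → f :+ (con 1ℚ :+ f) :* t := f :* (con 1ℚ :+ t) :+ t) refl f θ) (<⇒≤ 0<θ) ⟩
    f + (1ℚ + f) * θ   ≡⟨ cong (λ z → f + z) eq ⟩
    f + η              ∎
    where
    open ≤-Reasoning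
    open +-*-Solver
  ... | inj₂ E≤0 = ≤-trans (≤-trans (*-monoˡ-≤-nonNeg n {{nonNegative 0≤n}} E≤0) (≤-reflexive (*-zeroʳ n)))
    (+-mono-≤ 0≤f (subst (0ℚ ≤_) eq (*-nonNeg (+-mono-≤ 0≤1 0≤f) (<⇒≤ 0<θ))))

  -- h = 1/J with J ε₀ ≥ 5
  module Parameters (K d : ℕ) (ε₀ : ℚ) (0<ε₀ : 0ℚ < ε₀) where
    private
      large = archimedean (+ 5 / 1 * inv ε₀)
    J₀ J g c₁ i₀ m₀ n₀ : ℕ
    J₀ = proj₁ large
    J = suc J₀
    -- For w ≤ b < 2^(m + 3) one has 2 d w ≤ 2 · 2^d · 2^(m + 3), which is 2^(m + g).
    g = 4 ℕ.+ d
    c₁ = 3 ℕ.* 2 ℕ.^ J ℕ.+ g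
    h c : ℚ
    h = + 1 / suc J₀
    c = + 1 / suc (suc (suc J₀))

    0≤h : 0ℚ ≤ h
    0≤h = unit-nonNeg J₀
    0≤c : 0ℚ ≤ c
    0≤c = unit-nonNeg (suc (suc J₀))
    Jh : nat J * h ≡ 1ℚ
    Jh = nat-inverse J₀
    Jc : (1ℚ + (1ℚ + nat J)) * c ≡ 1ℚ
    Jc = trans (cong (_* c) (sym (trans (nat-suc (suc J)) (cong (λ z → 1ℚ + z) (nat-suc J))))) (nat-inverse (suc J))

    5≤Jε₀ : + 5 / 1 ≤ nat J * ε₀
    5≤Jε₀ = begin
      + 5 / 1                       ≡⟨ trans (sym (*-identityʳ (+ 5 / 1))) (cong (+ 5 / 1 *_) (sym (trans (*-comm (inv ε₀) ε₀) (inv-inverse 0<ε₀)))) ⟩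
      + 5 / 1 * (inv ε₀ * ε₀)       ≡⟨ sym (*-assoc (+ 5 / 1) (inv ε₀) ε₀) ⟩
      + 5 / 1 * inv ε₀ * ε₀         ≤⟨ *-monoʳ-≤-nonNeg ε₀ {{nonNegative (<⇒≤ 0<ε₀)}} (≤-trans (proj₂ large) (nat-mono {J₀} {J} (ℕₚ.n≤1+n J₀))) ⟩
      nat J * ε₀                    ∎
      where open ≤-Reasoning

    private
      exponential = linear≤exponential h J 0≤h Jh (K ℕ.* c₁ ℕ.* suc c₁) (K ℕ.* c₁ ℕ.* J)
    i₀ = proj₁ exponential
    -- Makes m/3 at least 2^(J i₀) ≥ (1 + h)^(J i₀), so that the bracketing index `i` is at least
    -- `i₀`.
    m₀ = 3 ℕ.* 2 ℕ.^ (J ℕ.* i₀)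
    n₀ = 2 ℕ.^ (2 ℕ.^ (m₀ ℕ.+ 2))

    -- 2ᵇ ≤ n < 2ᵇ⁺¹ and 2ᵐ⁺² ≤ b < 2ᵐ⁺³, and (1+h)^(Ji) ≤ m/3 < (1+h)^(J(i+1))
    module _ (n : ℕ) (n₀<n : n₀ ℕ.< n) where
      private
        1≤n : 1 ℕ.≤ n
        1≤n = ℕₚ.≤-trans (s≤s z≤n) n₀<n
        log-n = floor-log n 1≤n
      b : ℕ
      b = proj₁ log-n
      private
        n<2^1+b : n ℕ.< 2 ℕ.^ suc b
        n<2^1+b = proj₂ (proj₂ log-n)
        b-large : 2 ℕ.^ (m₀ ℕ.+ 2) ℕ.≤ b
        b-large = floor-log-maximal n<2^1+b (ℕₚ.<⇒≤ n₀<n)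
        log-b = floor-log b (ℕₚ.≤-trans (ℕₚ.m^n>0 2 (m₀ ℕ.+ 2)) b-large)
        l : ℕ
        l = proj₁ log-b
        l-large : m₀ ℕ.+ 2 ℕ.≤ l
        l-large = floor-log-maximal (proj₂ (proj₂ log-b)) b-large
      m : ℕ
      m = l ℕ.∸ 2
      private
        m+2≡l : m ℕ.+ 2 ≡ l
        m+2≡l = ℕₚ.m∸n+n≡m (ℕₚ.≤-trans (ℕₚ.m≤n+m 2 m₀) l-large)
        m₀≤m : m₀ ℕ.≤ m
        m₀≤m = ℕₚ.+-cancelʳ-≤ 2 m₀ m (subst (m₀ ℕ.+ 2 ℕ.≤_) (sym m+2≡l) l-large)
        b<2^m+3 : b ℕ.< 2 ℕ.^ suc (m ℕ.+ 2)
        b<2^m+3 = subst (λ l → b ℕ.< 2 ℕ.^ suc l) (sym m+2≡l) (proj₂ (proj₂ log-b))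

      2^b≤n : 2 ℕ.^ b ℕ.≤ n
      2^b≤n = proj₁ (proj₂ log-n)

      1≤b : 1 ℕ.≤ b
      1≤b = ℕₚ.≤-trans (ℕₚ.m^n>0 2 (m₀ ℕ.+ 2)) b-large

      1≤m : 1 ℕ.≤ m
      1≤m = ℕₚ.≤-trans (ℕₚ.*-mono-≤ {1} {3} (s≤s z≤n) (ℕₚ.m^n>0 2 (J ℕ.* i₀))) m₀≤m

      -- The factor 3 pays for the estimate log 2 ≥ 1/3: from log n ≥ b/3 it yields log n ≥ 2^m.
      3*2^m≤b : 3 ℕ.* 2 ℕ.^ m ℕ.≤ b
      3*2^m≤b = ℕₚ.≤-trans (ℕₚ.*-monoˡ-≤ (2 ℕ.^ m) {3} {4} (s≤s (s≤s (s≤s z≤n))))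
        (ℕₚ.≤-trans (ℕₚ.≤-reflexive (trans (ℕₚ.*-comm 4 (2 ℕ.^ m)) (trans (sym (ℕₚ.^-distribˡ-+-* 2 m 2)) (cong (2 ℕ.^_) m+2≡l)))) (proj₁ (proj₂ log-b)))

      3⅓ : ∀ k → nat (3 ℕ.* k) * ⅓ ≡ nat k
      3⅓ k = trans (cong (_* ⅓) (nat-* 3 k)) (trans (solve 3 (λ t k u → t :* k :* u := t :* u :* k) refl (nat 3) (nat k) ⅓)
        (trans (cong (_* nat k) (nat-inverse 2)) (*-identityˡ (nat k))))
        where open +-*-Solver

      few : ∀ w → 2 ℕ.^ w ℕ.≤ n → 2 ℕ.* (d ℕ.* w) ℕ.≤ 2 ℕ.^ (m ℕ.+ g)
      few w 2^w≤n = begin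
        2 ℕ.* (d ℕ.* w)
          ≤⟨ ℕₚ.*-monoʳ-≤ 2 (ℕₚ.*-mono-≤ (ℕₚ.<⇒≤ (n<2^n d)) (ℕₚ.≤-trans (floor-log-maximal n<2^1+b 2^w≤n) (ℕₚ.<⇒≤ b<2^m+3))) ⟩
        2 ℕ.* (2 ℕ.^ d ℕ.* 2 ℕ.^ suc (m ℕ.+ 2))
          ≡⟨ cong (2 ℕ.*_) (ℕₚ.^-distribˡ-+-* 2 d (suc (m ℕ.+ 2))) ⟨
        2 ℕ.^ suc (d ℕ.+ suc (m ℕ.+ 2))
          ≡⟨ cong (2 ℕ.^_) (solve 2 (λ d m → con 1 :+ (d :+ (con 1 :+ (m :+ con 2))) := m :+ (con 4 :+ d)) refl d m) ⟩
        2 ℕ.^ (m ℕ.+ g) ∎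
        where
        open ℕₚ.≤-Reasoning
        open ℕ-Solver.+-*-Solver

      private
        X : ℚ
        X = nat m * ⅓
        lo : (1ℚ + h) ^q (J ℕ.* i₀) ≤ X
        lo = ≤-trans (β^≤ h J 0≤h Jh (J ℕ.* i₀)) (≤-trans (≤-reflexive (sym (3⅓ (2 ℕ.^ (J ℕ.* i₀)))))
          (*-monoʳ-≤-nonNeg ⅓ {{nonNegative 0≤⅓}} (nat-mono m₀≤m)))
        hi : X < (1ℚ + h) ^q (J ℕ.* (i₀ ℕ.+ m))
        hi = ≤-<-trans (≤-trans (*-monoʳ-≤-nonNeg ⅓ {{nonNegative 0≤⅓}} (nat-mono {m} {3 ℕ.* (i₀ ℕ.+ m)} (ℕₚ.≤-trans (ℕₚ.m≤n+m m i₀) (ℕₚ.m≤m+n (i₀ ℕ.+ m) _))))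
          (≤-reflexive (3⅓ (i₀ ℕ.+ m)))) (nat<block-power h J 0≤h Jh (i₀ ℕ.+ m))
        bracketed = bracket h J 0≤h Jh X i₀ m lo hi
      i : ℕ
      i = proj₁ bracketed

      power≤m/3 : (1ℚ + h) ^q (J ℕ.* i) ≤ nat m * ⅓
      power≤m/3 = proj₁ (proj₂ (proj₂ bracketed))

      ℓ e : ℕ
      ℓ = m ℕ.+ g
      e = c₁ ℕ.+ J ℕ.* i

      private
        upper : nat m * ⅓ < (1ℚ + h) ^q (J ℕ.* suc i)
        upper = proj₂ (proj₂ (proj₂ bracketed))

      1≤ℓ : 1 ℕ.≤ ℓ
      1≤ℓ = ℕₚ.≤-trans 1≤m (ℕₚ.m≤m+n m g)

      ℓ≤ : ℓ ℕ.≤ 2 ℕ.^ e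
      ℓ≤ = ℓ≤2^e h J 0≤h Jh K g i m ⅓ (nat-inverse 2) upper

      Kℓe≤ : nat (K ℕ.* (ℓ ℕ.* suc e)) ≤ (1ℚ + h) ^q (suc J ℕ.* i)
      Kℓe≤ = growth h J 0≤h Jh K g i m ⅓ (nat-inverse 2) upper (proj₂ exponential i (proj₁ (proj₂ bracketed)))

  log-eventually : ∀ m x 0<x N₁ → (∀ N → N₁ ℕ.≤ N → nat (2 ℕ.^ m) ≤ approx x N) →
                   ∃[ N₂ ] (∀ N → N₂ ℕ.≤ N → nat m * ⅓ ≤ approx (log x 0<x) N)
  log-eventually m x 0<x N₁ x≥ =
    let N₂ , lower = log-lower m
    in N₁ ℕ.⊔ N₂ , λ N N≥ → subst (nat m * ⅓ ≤_) (sym (approx-log x 0<x N))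
         (lower N (ℕₚ.m⊔n≤o⇒n≤o N₁ N₂ N≥) (approx x N) (x≥ N (ℕₚ.m⊔n≤o⇒m≤o N₁ N₂ N≥)))

  -- Conversion checking of terms log x 0<x is costly when 0<x unfolds.
  abstract
    eventually-positive : ∀ x k → 1 ℕ.≤ k → ∃[ N₁ ] (∀ N → N₁ ℕ.≤ N → nat k * ⅓ ≤ approx x N) → 0ℝ <ℝ x
    eventually-positive x k 1≤k (N₁ , x≥) =
      nat k * ⅓ , *-pos (<-≤-trans 0<1 (nat-mono {1} {k} 1≤k)) (positive⁻¹ ⅓) , N₁ ,
      λ N N≥ → ≤-trans (≤-reflexive (+-identityˡ (nat k * ⅓))) (x≥ N N≥)

  module _ (K d : ℕ) (ε₀ : ℚ) (0<ε₀ : 0ℚ < ε₀) (q : ℚ) (1≤qd : 1ℚ ≤ q * nat d)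
           (ε : ℝ) (Nε : ℕ) (ε≥ : ∀ N → Nε ℕ.≤ N → ε₀ ≤ approx ε N) where
    open Parameters K d ε₀ 0<ε₀

    module _ (n f : ℕ) (n₀<n : n₀ ℕ.< n) (n≤ : n ℕ.≤ K ℕ.* (ℓ n n₀<n ℕ.* suc (e n n₀<n)) ℕ.* f)
             (L : ℝ) (0<L : 0ℝ <ℝ L) (N₁ : ℕ) (L≥ : ∀ N → N₁ ℕ.≤ N → nat (m n n₀<n) * ⅓ ≤ approx L N) where
      private
        i′ = i n n₀<n
        log-bound = logq-power h (nat J) c 0≤h (nat-nonNeg J) 0≤c Jh Jc (J ℕ.* i′)
        N₂ = proj₁ log-bound

        log-L≥ : ∀ N → N₁ ℕ.≤ N → N₂ ℕ.≤ N → nat (J ℕ.* i′) * c ≤ approx (log L 0<L) N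
        log-L≥ N N≥N₁ N≥N₂ = subst (nat (J ℕ.* i′) * c ≤_) (sym (approx-log L 0<L N))
          (≤-trans (proj₂ log-bound N N≥N₂)
            (logq-mono N (1≤^q (1≤β h J 0≤h Jh) (J ℕ.* i′)) (≤-trans (power≤m/3 n n₀<n) (L≥ N N≥N₁))))

        exponent : ℝ
        exponent = ((-ℝ (const q *ℝ fromℕ d)) -ℝ ε) *ℝ log L 0<L

        u : ℕ → ℚ
        u N = (q * nat d + approx ε N) * approx (log L 0<L) N

        -u≡ : ∀ N → - u N ≡ approx exponent N
        -u≡ N = solve 3 (λ x e l → :- ((x :+ e) :* l) := (:- x :+ :- e) :* l) refl (q * nat d) (approx ε N) (approx (log L 0<L) N)
          where open +-*-Solver

        M : ℕ
        M = suc J ℕ.* i′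

        u≥ : ∀ N → N₁ ℕ.≤ N → N₂ ℕ.≤ N → Nε ℕ.≤ N → nat M * h ≤ u N
        u≥ N N≥N₁ N≥N₂ N≥Nε = exponent-lower J i′ h c ε₀ (q * nat d) (approx ε N) (approx (log L 0<L) N) 0≤h 0≤c Jh Jc (s≤s z≤n)
          5≤Jε₀ (<⇒≤ 0<ε₀) 1≤qd (ε≥ N N≥Nε) (log-L≥ N N≥N₁ N≥N₂)

        n≤power*f : nat n ≤ (1ℚ + h) ^q M * nat f
        n≤power*f = ≤-trans (nat-mono n≤)
          (≤-trans (≤-reflexive (nat-* (K ℕ.* (ℓ n n₀<n ℕ.* suc (e n n₀<n))) f))
            (*-monoʳ-≤-nonNeg (nat f) {{nonNegative (nat-nonNeg f)}} (Kℓe≤ n n₀<n)))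

        -- `exp-decay` is uniform only over bounded exponents; the bound comes from the exponent
        -- being a Cauchy sequence.
        u-bounded : ∃[ B ] ∃[ N₃ ] (∀ N → N₃ ℕ.≤ N → u N ≤ B)
        u-bounded = let B , _ , N₃ , bounded = cauchy⇒bounded {approx exponent} (cauchy exponent) in
          B , N₃ , λ N N≥ → ≤-trans (≤∣∣ (u N)) (≤-trans (≤-reflexive (trans (sym (∣-p∣≡∣p∣ (u N))) (cong ∣_∣ (-u≡ N)))) (bounded N N≥))

      -- The power is exp(- u) with u eventually at least M h, so it is close to or below (1 + h)^(-
      -- M), while the sieve and the choice of parameters give n ≤ (1 + h)^M f.
      power-bound : 1ℝ *ℝ fromℕ n *ℝ power L 0<L ((-ℝ (const q *ℝ fromℕ d)) -ℝ ε) ≤ℝ fromℕ f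
      power-bound η 0<η =
        let θ , 0<θ , eq = scale-down {1ℚ + nat f} (+-mono-<-≤ 0<1 (nat-nonNeg f)) 0<η
            B , N₃ , u≤B = u-bounded
            N₄ , decay = exp-decay h M B θ 0≤h 0<θ
            N₅ = N₁ ℕ.⊔ (N₂ ℕ.⊔ Nε)
        in N₅ ℕ.⊔ (N₃ ℕ.⊔ N₄) , λ N N≥ →
           let N≥₅ = ℕₚ.m⊔n≤o⇒m≤o N₅ (N₃ ℕ.⊔ N₄) N≥
               N≥₃₄ = ℕₚ.m⊔n≤o⇒n≤o N₅ (N₃ ℕ.⊔ N₄) N≥
               N≥₂ε = ℕₚ.m⊔n≤o⇒n≤o N₁ (N₂ ℕ.⊔ Nε) N≥₅
               E≡ : expq N (- u N) ≡ approx (exp exponent) N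
               E≡ = trans (cong (expq N) (-u≡ N)) (sym (approx-exp exponent N))
           in subst (_≤ nat f + η) (cong₂ _*_ (sym (*-identityˡ (nat n))) E≡)
                (trade (expq N (- u N)) ((1ℚ + h) ^q M) (nat n) (nat f) η θ n≤power*f (nat-nonNeg n) (nat-nonNeg f) 0<θ
                  (decay N (ℕₚ.m⊔n≤o⇒n≤o N₃ N₄ N≥₃₄) (u N)
                    (u≥ N (ℕₚ.m⊔n≤o⇒m≤o N₁ (N₂ ℕ.⊔ Nε) N≥₅) (ℕₚ.m⊔n≤o⇒m≤o N₂ Nε N≥₂ε) (ℕₚ.m⊔n≤o⇒n≤o N₂ Nε N≥₂ε))
                    (u≤B N (ℕₚ.m⊔n≤o⇒m≤o N₃ N₄ N≥₃₄))) eq)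

    iterated-logarithm-bound : ∀ n f 1≤n (n₀<n : n₀ ℕ.< n) → n ℕ.≤ K ℕ.* (ℓ n n₀<n ℕ.* suc (e n n₀<n)) ℕ.* f →
      Σ[ 0<log-n ∈ 0ℝ <ℝ log (fromℕ n) (fromℕ-positive n 1≤n) ]
      Σ[ 0<loglog-n ∈ 0ℝ <ℝ log (log (fromℕ n) (fromℕ-positive n 1≤n)) 0<log-n ]
      1ℝ *ℝ fromℕ n *ℝ power (log (log (fromℕ n) (fromℕ-positive n 1≤n)) 0<log-n) 0<loglog-n ((-ℝ (const q *ℝ fromℕ d)) -ℝ ε) ≤ℝ fromℕ f
    iterated-logarithm-bound n f 1≤n n₀<n n≤ = 0<log-n , 0<loglog-n ,
      power-bound n f n₀<n n≤ (log (log (fromℕ n) (fromℕ-positive n 1≤n)) 0<log-n) 0<loglog-n (proj₁ loglog-n≥) (proj₂ loglog-n≥)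
      where
      log-n≥ : ∃[ N₁ ] (∀ N → N₁ ℕ.≤ N → nat (b n n₀<n) * ⅓ ≤ approx (log (fromℕ n) (fromℕ-positive n 1≤n)) N)
      log-n≥ = log-eventually (b n n₀<n) (fromℕ n) (fromℕ-positive n 1≤n) 0 (λ _ _ → nat-mono (2^b≤n n n₀<n))
      0<log-n : 0ℝ <ℝ log (fromℕ n) (fromℕ-positive n 1≤n)
      0<log-n = eventually-positive (log (fromℕ n) (fromℕ-positive n 1≤n)) (b n n₀<n) (1≤b n n₀<n) log-n≥
      loglog-n≥ : ∃[ N₁ ] (∀ N → N₁ ℕ.≤ N → nat (m n n₀<n) * ⅓ ≤ approx (log (log (fromℕ n) (fromℕ-positive n 1≤n)) 0<log-n) N)
      loglog-n≥ = log-eventually (m n n₀<n) (log (fromℕ n) (fromℕ-positive n 1≤n)) 0<log-n (proj₁ log-n≥)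
        (λ N N≥ → ≤-trans
          (≤-trans (≤-reflexive (sym (3⅓ n n₀<n (2 ℕ.^ m n n₀<n)))) (*-monoʳ-≤-nonNeg ⅓ {{nonNegative 0≤⅓}} (nat-mono (3*2^m≤b n n₀<n))))
          (proj₂ log-n≥ N N≥))
      0<loglog-n : 0ℝ <ℝ log (log (fromℕ n) (fromℕ-positive n 1≤n)) 0<log-n
      0<loglog-n = eventually-positive (log (log (fromℕ n) (fromℕ-positive n 1≤n)) 0<log-n) (m n n₀<n) (1≤m n n₀<n) loglog-n≥

  -- Stated for arbitrary `F` and `Sievable`, which keeps the polynomial and its constants out of
  -- the analytic argument.
  sieve⇒lower-bound : ∀ (K d : ℕ) (q : ℚ) → 1ℚ ≤ q * nat d → (F : ℕ → ℕ) (Sievable : ℕ → Set) →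
    (∀ n .{{_ : ℕ.NonZero n}} → Sievable n → ∀ ℓ e → 1 ℕ.≤ ℓ → ℓ ℕ.≤ 2 ℕ.^ e →
      (∀ w → 2 ℕ.^ w ℕ.≤ n → 2 ℕ.* (d ℕ.* w) ℕ.≤ 2 ℕ.^ ℓ) → n ℕ.≤ K ℕ.* (ℓ ℕ.* suc e) ℕ.* F n) →
    ∀ (ε : ℝ) → 0ℝ <ℝ ε → ∃[ n₀ ] (∀ (n : ℕ) (2≤n : 2 ℕ.≤ n) → n₀ ℕ.< n → Sievable n →
      let log-n = log (fromℕ n) (fromℕ-positive n (ℕₚ.<⇒≤ 2≤n)) in
      Σ[ 0<log-n ∈ 0ℝ <ℝ log-n ]
      Σ[ 0<loglog-n ∈ 0ℝ <ℝ log log-n 0<log-n ]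
      1ℝ *ℝ fromℕ n *ℝ power (log log-n 0<log-n) 0<loglog-n ((-ℝ (const q *ℝ fromℕ d)) -ℝ ε) ≤ℝ fromℕ (F n))
  sieve⇒lower-bound K d q 1≤qd F Sievable sieve ε (ε₀ , 0<ε₀ , Nε , ε≥) = n₀ , λ n 2≤n n₀<n sievable →
    iterated-logarithm-bound K d ε₀ 0<ε₀ q 1≤qd ε Nε (λ N N≥ → ≤-trans (≤-reflexive (sym (+-identityˡ ε₀))) (ε≥ N N≥))
      n (F n) (ℕₚ.<⇒≤ 2≤n) n₀<n
      (sieve n {{ℕ.>-nonZero (ℕₚ.<⇒≤ 2≤n)}} sievable (ℓ n n₀<n) (e n n₀<n) (1≤ℓ n n₀<n) (ℓ≤ n n₀<n) (few n n₀<n))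
    where open Parameters K d ε₀ 0<ε₀

-- Combining the sieve bound with q d ≥ 1

open import Defs
open import Data.Nat.Base using (ℕ; _≤_; _<_)
open import Data.Nat.Properties using (<⇒≤)
open import Data.Nat.GCD using (gcd)
open import Data.Product.Base using (Σ-syntax; ∃-syntax; _×_)
open import Relation.Binary.PropositionalEquality using (_≡_; refl)

open import Data.Nat.Base using (suc; s≤s)
open import Data.Product.Base using (_,_)
open import Data.Rational.Base using (1ℚ)
open import Data.Rational.Properties using (≤-reflexive; +-identityˡ)
open SieveEstimate using (sieveConstant; φ-lower)
open Growth using (proportion≥1)
open Orbit using (order≤)
open LowerBound using (sieve⇒lower-bound)

theorem2p1 : ∀ {a ℓ₁ ℓ₂} (P : ℤ[X]) (d δ : ℕ) →
    Irreducible P → HasDegree P d → 1 ≤ d → IsGCDOfValues P δ →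
    (S : SplittingField a ℓ₁ ℓ₂ P)
    (y : SplittingField.Carrier S) → SplittingField.IsRoot S y →
    ∀ {m s} (|G| : HasCardinality (GaloisGroup.Gal S) m) (|G-fixing-y| : HasCardinality (GaloisGroup.Fixing S y) s) →
    let q = const (GaloisGroup.fixingProportion S y |G| |G-fixing-y|) in
    ∃[ c ] (0ℝ <ℝ c × (∀ (ε : ℝ) → 0ℝ <ℝ ε → ∃[ n₀ ] (∀ (n : ℕ) (2≤n : 2 ≤ n) → n₀ < n → gcd n δ ≡ 1 →
    let log-n = log (fromℕ n) (fromℕ-positive n (<⇒≤ 2≤n)) in
    Σ[ 0<log-n ∈ 0ℝ <ℝ log-n ]
    Σ[ 0<loglog-n ∈ 0ℝ <ℝ log log-n 0<log-n ]
    c *ℝ fromℕ n *ℝ power (log log-n 0<log-n) 0<loglog-n ((-ℝ (q *ℝ fromℕ d)) -ℝ ε) ≤ℝ fromℕ (φ P n))))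
theorem2p1 P (suc d′) δ irreducible deg (s≤s _) gcdδ S y Py {m} {s} |G| |G-fixing-y| =
  -- For large n a fixed constant, that of the sieve included, is absorbed by ε, so 1 can be taken
  -- for c.
  1ℝ , (1ℚ , CauchySequences.0<1 , 0 , λ _ _ → ≤-reflexive (+-identityˡ 1ℚ)) ,
  sieve⇒lower-bound (sieveConstant {P} {d′} {δ} irreducible deg gcdδ) (suc d′) (GaloisGroup.fixingProportion S y |G| |G-fixing-y|)
    (proportion≥1 (GaloisGroup.fixingProportion S y |G| |G-fixing-y|) s m (suc d′) {{GaloisGroup.order-nonZero S |G|}} refl (order≤ {P = P} {suc d′} deg S y Py |G| |G-fixing-y|))
    (φ P) (λ n → gcd n δ ≡ 1) (φ-lower {P} {d′} {δ} irreducible deg gcdδ)
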